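{- As $k\to\infty$, \[ R(3,k)\geq \Big(\frac{1}{3}+o(1)\Big)\frac{k^2}{\log k}. \] That is, for every $\varepsilon>0$ there is $k_0$ such that for all $k\ge k_0$ there exists a triangle-free graph on at least $(\frac13-\varepsilon)\frac{k^2}{\log k}$ vertices with no independent set of size $k$.
   Context: The Ramsey number $R(3,k)$ is the minimum $n$ such that every graph on $n$ vertices contains either a triangle or an independent set of size $k$ (equivalently, every red/blue colouring of the edges of $K_n$ contains a blue $K_3$ or a red $K_k$). $\log$ denotes the natural logarithm. -}

module Defs where

open import Data.Nat as ℕ using (ℕ; zero; suc)
open import Data.Integer using (+_)
open import Data.Rational using (ℚ; _/_; _+_; _*_; _≤_; 0ℚ)
open import Data.Fin using (Fin)
open import Data.Bool using (Bool; true; false)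
open import Data.Product using (Σ; _×_; ∃)
open import Data.Sum using (_⊎_)
open import Data.Empty using (⊥)
open import Relation.Binary.PropositionalEquality using (_≡_; _≢_)
open import Function.Definitions using (Injective)

record Graph (n : ℕ) : Set where
  field
    adj   : Fin n → Fin n → Bool
    sym   : ∀ x y → adj x y ≡ adj y x
    irrfl : ∀ x → adj x x ≡ false
open Graph public

-- no three pairwise adjacent vertices (distinctness is automatic by irreflexivity)
TriangleFree : ∀ {n} → Graph n → Set
TriangleFree G = ∀ x y z → adj G x y ≡ true → adj G y z ≡ true → adj G x z ≡ true → ⊥

IndependentSetOfSize : ∀ {n} → Graph n → ℕ → Set
IndependentSetOfSize {n} G k =
  Σ (Fin k → Fin n) λ f → Injective _≡_ _≡_ f × (∀ i j → i ≢ j → adj G (f i) (f j) ≡ false)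

ℕ→ℚ : ℕ → ℚ
ℕ→ℚ m = + m / 1

expTerm : ℚ → ℕ → ℚ
expTerm q zero    = + 1 / 1
expTerm q (suc j) = expTerm q j * q * (+ 1 / suc j)

expPartial : ℚ → ℕ → ℚ
expPartial q zero    = expTerm q zero
expPartial q (suc N) = expPartial q N + expTerm q (suc N)

-- For q ≥ 0:  exp q ≤ x   (exp q is the supremum of its Taylor partial sums)
ExpLe : ℚ → ℚ → Set
ExpLe q x = ∀ N → expPartial q N ≤ x

-- "c · k² / log k ≤ n"  (natural log; intended for k ≥ 2, so log k > 0):
--   if c ≤ 0 this holds trivially;
--   if c > 0 it is equivalent to n > 0 and c·k²/n ≤ log k, i.e. exp(c·k²/n) ≤ k.
LowerBoundOverLog : ℚ → ℕ → ℕ → Set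
LowerBoundOverLog c k n =
  c ≤ 0ℚ ⊎ Σ (ℕ.NonZero n) λ nz →
    ExpLe (c * ℕ→ℚ (k ℕ.* k) * ((+ 1 / n) {{nz}})) (ℕ→ℚ k)

-- Take two independent random graphs H₀, H₁ of edge density 1/d on m = k D points and two random maps
-- b₀, b₁ from n = r m vertices to these points.  Join u and v when bᵢ u and bᵢ v are adjacent in Hᵢ for
-- some i, unless for some i the points bᵢ u and bᵢ v have a common neighbour in Hᵢ (the pair is closed).
-- Two sides of a triangle would have the same colour and close the third, so the graph is triangle-free.
--
-- For a k-set I put Aᵢ = bᵢ(I) and uᵢ = k − |Aᵢ|.  Points outside Aᵢ close at most about
-- ½ uᵢ min(uᵢ, T) of the pairs, T being the maximum degree of Hᵢ times the largest fibre of a bᵢ, so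
-- that about M = ½ Σ (|Aᵢ|² − uᵢ min(uᵢ, T)) pairs inside A₀ and A₁ stay open.  When I is independent,
-- all of them are non-edges, except those closed by few edges inside the Aᵢ, which a union bound over
-- maximal disjoint families of such edges absorbs.  Hence I is independent with probability about
-- (1 − 1/d)^M, while exp(O(k log log k)) D^(|A₀| + |A₁| − k) of the k-sets have images of these sizes.  With
-- d ≈ 4k / (3 log₂ k) and n ≈ 20 k² / (39 log₂ k) the union bound over I succeeds, and
-- (20/39) log 2 > 1/3.
module Submission where

-- A random graph on all n vertices would give a pair of order n/d², that is log k, common
-- neighbours, and nearly every pair would be closed. With fibres of polylogarithmic size r this
-- becomes m/d², of order (log k)/r, which tends to 0; only points with many neighbours in an image
-- of I still close many of its pairs. Two requirements fix the constants. If the images do not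
-- collapse, M is about k² against about k^k sets, so k²/d must exceed k log k; and (4/3) k / log₂ k
-- is 0.92 k / log k. If u₀ + u₁ is near k, exp(O(k log log k)) sets remain and M must still be of
-- order k², which for u₀ = u₁ = k/2 means T < k/2. The mean behind T is n/d = (5/13) k; the two
-- maxima cost a factor 1.1 each, and T stays below 0.47 k. The edges inside the Aᵢ decide both
-- whether a pair is open and whether it is an edge. So a certificate, the union of the disjoint
-- families, is fixed first: it and the outside edges tell which pairs must be non-edges, and
-- weights of equal mean on the inside edges give the probability without conditioning on the number
-- of open pairs.

-- Finite sums, and the number of sublists of bounded length

module Sums where

  open import Data.Nat
  open import Data.Nat.Properties
  open import Data.Nat.Tactic.RingSolver using (solve-∀)
  open import Data.Bool using (Bool; true; false; if_then_else_; _∧_; _∨_)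
  open import Data.Fin using (Fin; zero; suc)
  import Data.Fin.Properties as FP
  open import Data.List using (List; []; _∷_; length; map; _++_; concatMap; allFin; tabulate)
  import Data.List.Properties as LP
  open import Data.List.Membership.Propositional using (_∈_; _∉_)
  open import Data.List.Membership.Propositional.Properties using (∈-allFin; ∈-++⁺ˡ; ∈-++⁺ʳ; ∈-map⁺; ∈-map⁻; ∈-++⁻)
  open import Data.List.Relation.Unary.Any using (here; there)
  open import Data.List.Relation.Unary.All using (All; []; _∷_)
  import Data.List.Relation.Unary.All as All
  open import Data.List.Relation.Unary.AllPairs using ([]; _∷_)
  open import Data.List.Relation.Unary.Unique.Propositional using (Unique)
  open import Data.List.Relation.Unary.Unique.Propositional.Properties using (allFin⁺)
  open import Data.List.Relation.Binary.Sublist.Propositional using (_⊆_; []; _∷_; _∷ʳ_; minimum)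
  open import Data.Product using (∃; _×_; _,_)
  open import Data.Sum using (_⊎_; inj₁; inj₂)
  open import Data.Empty using (⊥-elim)
  open import Relation.Nullary using (Dec; yes; no)
  open import Relation.Binary.PropositionalEquality
  open import Function using (_∘_; id)

  private
    variable
      A B : Set

  𝟙 : Bool → ℕ
  𝟙 true  = 1
  𝟙 false = 0

  𝟙≤1 : ∀ b → 𝟙 b ≤ 1
  𝟙≤1 true  = ≤-refl
  𝟙≤1 false = z≤n

  𝟙-∧ : ∀ a b → 𝟙 (a ∧ b) ≡ 𝟙 a * 𝟙 b
  𝟙-∧ true  b = sym (+-identityʳ (𝟙 b))
  𝟙-∧ false b = refl

  𝟙-∨ : ∀ a b → 𝟙 (a ∨ b) ≤ 𝟙 a + 𝟙 b
  𝟙-∨ true  b = s≤s z≤n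
  𝟙-∨ false b = ≤-refl

  ∑ : List A → (A → ℕ) → ℕ
  ∑ []       f = 0
  ∑ (x ∷ xs) f = f x + ∑ xs f

  infix 10 ∑
  syntax ∑ xs (λ x → e) = ∑[ x ∈ xs ] e

  ∑-cong : (xs : List A) {f g : A → ℕ} → (∀ x → f x ≡ g x) → ∑ xs f ≡ ∑ xs g
  ∑-cong []       e = refl
  ∑-cong (x ∷ xs) e = cong₂ _+_ (e x) (∑-cong xs e)

  ∑-mono∈ : (xs : List A) {f g : A → ℕ} → (∀ {x} → x ∈ xs → f x ≤ g x) → ∑ xs f ≤ ∑ xs g
  ∑-mono∈ []       h = z≤n
  ∑-mono∈ (x ∷ xs) h = +-mono-≤ (h (here refl)) (∑-mono∈ xs (λ i → h (there i)))

  ∑-mono : (xs : List A) {f g : A → ℕ} → (∀ x → f x ≤ g x) → ∑ xs f ≤ ∑ xs g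
  ∑-mono xs h = ∑-mono∈ xs (λ {x} _ → h x)

  ∑-+ : (xs : List A) (f g : A → ℕ) → ∑[ x ∈ xs ] (f x + g x) ≡ ∑ xs f + ∑ xs g
  ∑-+ []       f g = refl
  ∑-+ (x ∷ xs) f g rewrite ∑-+ xs f g = p (f x) (g x) (∑ xs f) (∑ xs g)
    where p : ∀ a b c d → a + b + (c + d) ≡ a + c + (b + d)
          p = solve-∀

  ∑-*ˡ : (xs : List A) (c : ℕ) (f : A → ℕ) → ∑[ x ∈ xs ] (c * f x) ≡ c * ∑ xs f
  ∑-*ˡ []       c f = sym (*-zeroʳ c)
  ∑-*ˡ (x ∷ xs) c f rewrite ∑-*ˡ xs c f = sym (*-distribˡ-+ c (f x) (∑ xs f))

  ∑-*ʳ : (xs : List A) (c : ℕ) (f : A → ℕ) → ∑[ x ∈ xs ] (f x * c) ≡ ∑ xs f * c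
  ∑-*ʳ xs c f = trans (∑-cong xs (λ x → *-comm (f x) c)) (trans (∑-*ˡ xs c f) (*-comm c _))

  ∑-const : (xs : List A) (c : ℕ) → ∑[ x ∈ xs ] c ≡ length xs * c
  ∑-const []       c = refl
  ∑-const (x ∷ xs) c = cong (c +_) (∑-const xs c)

  ∑-1 : (xs : List A) → ∑[ x ∈ xs ] 1 ≡ length xs
  ∑-1 xs = trans (∑-const xs 1) (*-identityʳ _)

  ∑-≤const : (xs : List A) {f : A → ℕ} (c : ℕ) → (∀ {x} → x ∈ xs → f x ≤ c) → ∑ xs f ≤ length xs * c
  ∑-≤const xs c h = ≤-trans (∑-mono∈ xs h) (≤-reflexive (∑-const xs c))

  ∑-zero : (xs : List A) → ∑[ x ∈ xs ] 0 ≡ 0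
  ∑-zero xs = trans (∑-const xs 0) (*-zeroʳ (length xs))

  ∑-swap : (xs : List A) (ys : List B) (f : A → B → ℕ) →
           ∑[ x ∈ xs ] (∑[ y ∈ ys ] (f x y)) ≡ ∑[ y ∈ ys ] (∑[ x ∈ xs ] (f x y))
  ∑-swap []       ys f = sym (∑-zero ys)
  ∑-swap (x ∷ xs) ys f = trans (cong (∑ ys (f x) +_) (∑-swap xs ys f)) (sym (∑-+ ys (f x) _))

  ∑-++ : (xs ys : List A) (f : A → ℕ) → ∑ (xs ++ ys) f ≡ ∑ xs f + ∑ ys f
  ∑-++ []       ys f = refl
  ∑-++ (x ∷ xs) ys f = trans (cong (f x +_) (∑-++ xs ys f)) (sym (+-assoc (f x) _ _))

  ∑-map : (g : A → B) (xs : List A) (f : B → ℕ) → ∑ (map g xs) f ≡ ∑ xs (f ∘ g)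
  ∑-map g []       f = refl
  ∑-map g (x ∷ xs) f = cong (f (g x) +_) (∑-map g xs f)

  ∑-concatMap : (g : A → List B) (xs : List A) (f : B → ℕ) → ∑ (concatMap g xs) f ≡ ∑[ x ∈ xs ] (∑ (g x) f)
  ∑-concatMap g []       f = refl
  ∑-concatMap g (x ∷ xs) f = trans (∑-++ (g x) _ f) (cong (∑ (g x) f +_) (∑-concatMap g xs f))

  ∈⇒≤∑ : {xs : List A} (f : A → ℕ) {x : A} → x ∈ xs → f x ≤ ∑ xs f
  ∈⇒≤∑ f (here refl) = m≤m+n _ _
  ∈⇒≤∑ f (there i)   = ≤-trans (∈⇒≤∑ f i) (m≤n+m _ _)

  ∑≡0⇒ : {xs : List A} {f : A → ℕ} → ∑ xs f ≡ 0 → ∀ {x} → x ∈ xs → f x ≡ 0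
  ∑≡0⇒ {f = f} e i = n≤0⇒n≡0 (≤-trans (∈⇒≤∑ f i) (≤-reflexive e))

  filt : (A → Bool) → List A → List A
  filt p []       = []
  filt p (x ∷ xs) = if p x then x ∷ filt p xs else filt p xs

  ∑-filt : (p : A → Bool) (xs : List A) (f : A → ℕ) → ∑ (filt p xs) f ≡ ∑[ x ∈ xs ] (𝟙 (p x) * f x)
  ∑-filt p []       f = refl
  ∑-filt p (x ∷ xs) f with p x
  ... | true  = cong₂ _+_ (sym (+-identityʳ (f x))) (∑-filt p xs f)
  ... | false = ∑-filt p xs f

  length-filt : (p : A → Bool) (xs : List A) → length (filt p xs) ≡ ∑[ x ∈ xs ] (𝟙 (p x))
  length-filt p xs = trans (sym (∑-1 (filt p xs)))
    (trans (∑-filt p xs (λ _ → 1)) (∑-cong xs (λ x → *-identityʳ (𝟙 (p x)))))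

  filt-⊆ : (p : A → Bool) (xs : List A) → filt p xs ⊆ xs
  filt-⊆ p []       = []
  filt-⊆ p (x ∷ xs) with p x
  ... | true  = refl ∷ filt-⊆ p xs
  ... | false = x ∷ʳ filt-⊆ p xs

  ∈-filt⁺ : (p : A → Bool) {xs : List A} {x : A} → x ∈ xs → p x ≡ true → x ∈ filt p xs
  ∈-filt⁺ p {x ∷ xs} (here refl) e rewrite e = here refl
  ∈-filt⁺ p {y ∷ xs} (there i)   e with p y
  ... | true  = there (∈-filt⁺ p i e)
  ... | false = ∈-filt⁺ p i e

  ∈-filt⁻ : (p : A → Bool) (xs : List A) {x : A} → x ∈ filt p xs → x ∈ xs × p x ≡ true
  ∈-filt⁻ p (y ∷ xs) i with p y in eq
  ∈-filt⁻ p (y ∷ xs) (here refl) | true = here refl , eq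
  ∈-filt⁻ p (y ∷ xs) (there i)   | true = let (a , b) = ∈-filt⁻ p xs i in there a , b
  ∈-filt⁻ p (y ∷ xs) i           | false = let (a , b) = ∈-filt⁻ p xs i in there a , b

  ⊆⇒∈ : {xs ys : List A} → xs ⊆ ys → ∀ {x} → x ∈ xs → x ∈ ys
  ⊆⇒∈ (y ∷ʳ s)   i           = there (⊆⇒∈ s i)
  ⊆⇒∈ (refl ∷ s) (here refl) = here refl
  ⊆⇒∈ (refl ∷ s) (there i)   = there (⊆⇒∈ s i)

  ⊆⇒Unique : {xs ys : List A} → xs ⊆ ys → Unique ys → Unique xs
  ⊆⇒Unique []         u       = []
  ⊆⇒Unique (y ∷ʳ s)   (_ ∷ u) = ⊆⇒Unique s u
  ⊆⇒Unique (refl ∷ s) (a ∷ u) = All.tabulate (λ i → All.lookup a (⊆⇒∈ s i)) ∷ ⊆⇒Unique s u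

  ⊆⇒length : {xs ys : List A} → xs ⊆ ys → length xs ≤ length ys
  ⊆⇒length []         = z≤n
  ⊆⇒length (y ∷ʳ s)   = m≤n⇒m≤1+n (⊆⇒length s)
  ⊆⇒length (refl ∷ s) = s≤s (⊆⇒length s)

  Unique-head : {x : A} {xs : List A} → Unique (x ∷ xs) → x ∉ xs
  Unique-head (a ∷ _) i = All.lookup a i refl

  abstract
    -- Opaque on purpose: sums over `fins` are handled through length, membership and uniqueness
    -- only, and even those over `fins 2` do not compute.
    fins : (n : ℕ) → List (Fin n)
    fins = allFin

    length-fins : ∀ n → length (fins n) ≡ n
    length-fins n = LP.length-tabulate {n = n} id

    ∈-fins : ∀ {n} (i : Fin n) → i ∈ fins n
    ∈-fins = ∈-allFin

    fins-Unique : ∀ n → Unique (fins n)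
    fins-Unique n = allFin⁺ n

  _==_ : ∀ {n} → Fin n → Fin n → Bool
  i == j = Relation.Nullary.Dec.does (i FP.≟ j)

  ==-refl : ∀ {n} (i : Fin n) → (i == i) ≡ true
  ==-refl i with i FP.≟ i
  ... | yes _ = refl
  ... | no ¬p = ⊥-elim (¬p refl)

  ==⇒≡ : ∀ {n} {i j : Fin n} → (i == j) ≡ true → i ≡ j
  ==⇒≡ {i = i} {j} e with i FP.≟ j
  ... | yes p = p
  ==⇒≡ () | no _

  ≢⇒== : ∀ {n} {i j : Fin n} → i ≢ j → (i == j) ≡ false
  ≢⇒== {i = i} {j} ne with i FP.≟ j
  ... | yes p = ⊥-elim (ne p)
  ... | no _  = refl

  ==-sym : ∀ {n} (i j : Fin n) → (i == j) ≡ (j == i)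
  ==-sym i j with i FP.≟ j | j FP.≟ i
  ... | yes _ | yes _ = refl
  ... | no _  | no _  = refl
  ... | yes p | no q  = ⊥-elim (q (sym p))
  ... | no p  | yes q = ⊥-elim (p (sym q))

  ∑-δ≤ : ∀ {n} {xs : List (Fin n)} → Unique xs → (j : Fin n) (f : Fin n → ℕ) →
         ∑[ i ∈ xs ] (𝟙 (i == j) * f i) ≤ f j
  ∑-δ≤ {xs = []}     u       j f = z≤n
  ∑-δ≤ {xs = x ∷ xs} (a ∷ u) j f with x FP.≟ j
  ... | no  _    = ∑-δ≤ u j f
  ... | yes refl = begin
      1 * f x + ∑[ i ∈ xs ] (𝟙 (i == x) * f i) ≤⟨ +-mono-≤ (≤-reflexive (*-identityˡ (f x))) (∑-mono∈ xs z) ⟩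
      f x + ∑[ i ∈ xs ] 0                      ≡⟨ cong (f x +_) (∑-zero xs) ⟩
      f x + 0                                  ≡⟨ +-identityʳ (f x) ⟩
      f x ∎
    where open ≤-Reasoning
          z : ∀ {i} → i ∈ xs → 𝟙 (i == x) * f i ≤ 0
          z i∈ rewrite ≢⇒== (λ e → All.lookup a i∈ (sym e)) = z≤n

  ∑-δ : ∀ {n} {xs : List (Fin n)} → Unique xs → {j : Fin n} → j ∈ xs → (f : Fin n → ℕ) →
        ∑[ i ∈ xs ] (𝟙 (i == j) * f i) ≡ f j
  ∑-δ u {j} j∈ f = ≤-antisym (∑-δ≤ u j f)
    (≤-trans (≤-reflexive (trans (sym (*-identityˡ (f j))) (cong (λ t → 𝟙 t * f j) (sym (==-refl j)))))
             (∈⇒≤∑ (λ i → 𝟙 (i == _) * f i) j∈))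

  -- Sublists of length at most `j`, not exactly `j`: the two base clauses yield the short ones, and
  -- the counting bounds then need no side condition on `j`.
  subs : ℕ → List A → List (List A)
  subs zero    xs       = [] ∷ []
  subs (suc j) []       = [] ∷ []
  subs (suc j) (x ∷ xs) = map (x ∷_) (subs j xs) ++ subs (suc j) xs

  length-subs-suc : (j : ℕ) (x : A) (xs : List A) →
    length (subs (suc j) (x ∷ xs)) ≡ length (subs j xs) + length (subs (suc j) xs)
  length-subs-suc j x xs = trans (LP.length-++ (map (x ∷_) (subs j xs)))
    (cong (_+ length (subs (suc j) xs)) (LP.length-map (x ∷_) (subs j xs)))

  length-subs≤pow : (j : ℕ) (xs : List A) → length (subs j xs) ≤ suc (length xs) ^ j
  length-subs≤pow zero    xs       = ≤-refl
  length-subs≤pow (suc j) []       = ≤-reflexive (sym (^-zeroˡ (suc j)))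
  length-subs≤pow (suc j) (x ∷ xs) = begin
    length (subs (suc j) (x ∷ xs))                      ≡⟨ length-subs-suc j x xs ⟩
    length (subs j xs) + length (subs (suc j) xs)       ≤⟨ +-mono-≤ (length-subs≤pow j xs) (length-subs≤pow (suc j) xs) ⟩
    N ^ j + N * N ^ j                                   ≡⟨⟩
    suc N * N ^ j                                       ≤⟨ *-monoʳ-≤ (suc N) (^-monoˡ-≤ j (n≤1+n N)) ⟩
    suc N * suc N ^ j ∎
    where open ≤-Reasoning
          N = suc (length xs)

  -- A generating function in place of binomial coefficients: with n = `length xs`, a sublist S gets
  -- the weight D^(n - |S|). All weights add up to (D + 1)^n, and for |S| ≤ j the weight times D^j
  -- is at least D^n.
  length-subs-weighted : (D : ℕ) .{{_ : NonZero D}} (j : ℕ) (xs : List A) →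
    length (subs j xs) * D ^ length xs ≤ suc D ^ length xs * D ^ j
  length-subs-weighted D zero    xs       = begin
    1 * D ^ length xs     ≡⟨ *-identityˡ _ ⟩
    D ^ length xs         ≤⟨ ^-monoˡ-≤ (length xs) (n≤1+n D) ⟩
    suc D ^ length xs     ≡⟨ *-identityʳ _ ⟨
    suc D ^ length xs * 1 ∎
    where open ≤-Reasoning
  length-subs-weighted D (suc j) []       = begin
    1                     ≤⟨ m^n>0 D (suc j) ⟩
    D ^ suc j             ≡⟨ *-identityˡ _ ⟨
    1 * D ^ suc j ∎
    where open ≤-Reasoning
  length-subs-weighted D (suc j) (x ∷ xs) = begin
    length (subs (suc j) (x ∷ xs)) * (D * D ^ n)  ≡⟨ cong (_* (D * D ^ n)) (length-subs-suc j x xs) ⟩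
    (a + b) * (D * D ^ n)                         ≡⟨ p a b D (D ^ n) ⟩
    D * (a * D ^ n) + D * (b * D ^ n)             ≤⟨ +-mono-≤ (*-monoʳ-≤ D (length-subs-weighted D j xs)) (*-monoʳ-≤ D (length-subs-weighted D (suc j) xs)) ⟩
    D * (suc D ^ n * D ^ j) + D * (suc D ^ n * (D * D ^ j)) ≡⟨ q D (suc D ^ n) (D ^ j) ⟩
    suc D * suc D ^ n * (D * D ^ j) ∎
    where open ≤-Reasoning
          n = length xs
          a = length (subs j xs)
          b = length (subs (suc j) xs)
          p : ∀ a b D E → (a + b) * (D * E) ≡ D * (a * E) + D * (b * E)
          p = solve-∀
          q : ∀ D S E → D * (S * E) + D * (S * (D * E)) ≡ (S + D * S) * (D * E)
          q = solve-∀

  ∈-subs : {j : ℕ} {ys xs : List A} → ys ⊆ xs → length ys ≤ j → ys ∈ subs j xs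
  ∈-subs {j = zero}  {[]}     s le = here refl
  ∈-subs {j = suc j} []         le = here refl
  ∈-subs {j = suc j} (x ∷ʳ s)   le = ∈-++⁺ʳ (map (x ∷_) _) (∈-subs {j = suc j} s le)
  ∈-subs {j = suc j} (refl ∷ s) (s≤s le) = ∈-++⁺ˡ (∈-map⁺ (_ ∷_) (∈-subs {j = j} s le))

  subs⇒⊆ : (j : ℕ) {ys : List A} (xs : List A) → ys ∈ subs j xs → ys ⊆ xs × length ys ≤ j
  subs⇒⊆ zero    xs       (here refl) = minimum xs , z≤n
  subs⇒⊆ (suc j) []       (here refl) = [] , z≤n
  subs⇒⊆ (suc j) (x ∷ xs) i with ∈-++⁻ (map (x ∷_) (subs j xs)) i
  ... | inj₂ k = let (s , l) = subs⇒⊆ (suc j) xs k in x ∷ʳ s , l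
  ... | inj₁ k with ∈-map⁻ (x ∷_) k
  ...   | zs , z∈ , refl = let (s , l) = subs⇒⊆ j xs z∈ in refl ∷ s , s≤s l

  ≤-by : ∀ {a b : ℕ} (c : ℕ) → b ≡ a + c → a ≤ b
  ≤-by c refl = m≤m+n _ c

  -- (1 + 1/X)^y (1 − y/X) ≤ 1 with X = y + z.
  pow-bernoulli : (y z : ℕ) → suc (y + z) ^ y * z ≤ (y + z) ^ y * (y + z)
  pow-bernoulli y z = go y z
    where
    open ≤-Reasoning
    go' : (X i z : ℕ) → X ≡ i + z → suc X ^ i * z ≤ X ^ i * X
    go' X zero    z e = *-monoʳ-≤ 1 (≤-reflexive (sym e))
    go' X (suc i) z e = begin
      suc X * suc X ^ i * z       ≡⟨ p (suc X) (suc X ^ i) z ⟩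
      suc X ^ i * (suc X * z)     ≤⟨ *-monoʳ-≤ (suc X ^ i) (≤-by (suc i) (q X z i e)) ⟩
      suc X ^ i * (suc z * X)     ≡⟨ *-assoc (suc X ^ i) (suc z) X ⟨
      suc X ^ i * suc z * X       ≤⟨ *-monoˡ-≤ X (go' X i (suc z) (trans e (sym (+-suc i z)))) ⟩
      X ^ i * X * X               ≡⟨ cong (_* X) (*-comm (X ^ i) X) ⟩
      X * X ^ i * X ∎
      where p : ∀ a b c → a * b * c ≡ b * (a * c)
            p = solve-∀
            q : ∀ X z i → X ≡ suc i + z → suc z * X ≡ suc X * z + suc i
            q X z i refl = q' i z
              where q' : ∀ i z → suc z * suc (i + z) ≡ suc (suc (i + z)) * z + suc i
                    q' = solve-∀
    go : (y z : ℕ) → suc (y + z) ^ y * z ≤ (y + z) ^ y * (y + z)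
    go y z = go' (y + z) y z refl

  ^-distribʳ-* : ∀ a b n → (a * b) ^ n ≡ a ^ n * b ^ n
  ^-distribʳ-* a b zero    = refl
  ^-distribʳ-* a b (suc n) rewrite ^-distribʳ-* a b n = p a b (a ^ n) (b ^ n)
    where p : ∀ a b c d → a * b * (c * d) ≡ a * c * (b * d)
          p = solve-∀

  half-split : ∀ D → ∃ λ y → (D ≡ y + y) ⊎ (D ≡ y + suc y)
  half-split zero = 0 , inj₁ refl
  half-split (suc D) with half-split D
  ... | y , inj₁ refl = y , inj₂ (sym (+-suc y y))
  ... | y , inj₂ refl = suc y , inj₁ refl

  -- `pow-bernoulli` with y about D/2 bounds either half of the power by 2, and an odd D costs one
  -- more factor 2. The constant 8 stands in for e; as a power of 2 it merges with the later
  -- exponents.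
  [1+1/D]^D≤8 : ∀ D .{{_ : NonZero D}} → suc D ^ D ≤ 8 * D ^ D
  [1+1/D]^D≤8 D with half-split D
  ... | zero , inj₁ refl = s≤s z≤n
  ... | y@(suc y₁) , inj₁ refl = begin
      suc (y + y) ^ (y + y)               ≡⟨ ^-distribˡ-+-* (suc (y + y)) y y ⟩
      suc (y + y) ^ y * suc (y + y) ^ y   ≤⟨ *-mono-≤ b b ⟩
      2 * (y + y) ^ y * (2 * (y + y) ^ y) ≡⟨ p ((y + y) ^ y) ⟩
      4 * ((y + y) ^ y * (y + y) ^ y)     ≡⟨ cong (4 *_) (^-distribˡ-+-* (y + y) y y) ⟨
      4 * (y + y) ^ (y + y)               ≤⟨ *-monoˡ-≤ ((y + y) ^ (y + y)) (m≤m+n 4 4) ⟩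
      8 * (y + y) ^ (y + y) ∎
    where open ≤-Reasoning
          p : ∀ a → 2 * a * (2 * a) ≡ 4 * (a * a)
          p = solve-∀
          q : ∀ a y → a * (y + y) ≡ 2 * a * y
          q = solve-∀
          b : suc (y + y) ^ y ≤ 2 * (y + y) ^ y
          b = *-cancelʳ-≤ _ _ y (≤-trans (pow-bernoulli y y) (≤-reflexive (q ((y + y) ^ y) y)))
  ... | y , inj₂ refl = begin
      suc X ^ (y + suc y)                 ≡⟨ ^-distribˡ-+-* (suc X) y (suc y) ⟩
      suc X ^ y * (suc X * suc X ^ y)     ≤⟨ *-mono-≤ b (*-mono-≤ c b) ⟩
      2 * X ^ y * (2 * X * (2 * X ^ y))   ≡⟨ p (X ^ y) X ⟩
      8 * (X ^ y * (X * X ^ y))           ≡⟨ cong (8 *_) (^-distribˡ-+-* X y (suc y)) ⟨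
      8 * X ^ (y + suc y) ∎
    where open ≤-Reasoning
          X = y + suc y
          p : ∀ a X → 2 * a * (2 * X * (2 * a)) ≡ 8 * (a * (X * a))
          p = solve-∀
          q : ∀ a y → 2 * a * suc y ≡ a * (y + suc y) + a
          q = solve-∀
          b : suc X ^ y ≤ 2 * X ^ y
          b = *-cancelʳ-≤ _ _ (suc y) (≤-trans (pow-bernoulli y (suc y)) (≤-by (X ^ y) (q (X ^ y) y)))
          r : ∀ y → 2 * (y + suc y) ≡ suc (y + suc y) + (y + y)
          r = solve-∀
          c : suc X ≤ 2 * X
          c = ≤-by (y + y) (r y)

  [1+1/D]^n≤8^c : ∀ D .{{_ : NonZero D}} n c → n ≤ c * D → suc D ^ n ≤ 8 ^ c * D ^ n
  [1+1/D]^n≤8^c D n c le = *-cancelʳ-≤ _ _ (D ^ e) {{m^n≢0 D e}} (begin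
      suc D ^ n * D ^ e       ≤⟨ *-monoʳ-≤ (suc D ^ n) (^-monoˡ-≤ e (n≤1+n D)) ⟩
      suc D ^ n * suc D ^ e   ≡⟨ ^-distribˡ-+-* (suc D) n e ⟨
      suc D ^ (n + e)         ≡⟨ cong (suc D ^_) (m+[n∸m]≡n le) ⟩
      suc D ^ (c * D)         ≤⟨ go c ⟩
      8 ^ c * D ^ (c * D)     ≡⟨ cong (λ t → 8 ^ c * D ^ t) (m+[n∸m]≡n le) ⟨
      8 ^ c * D ^ (n + e)     ≡⟨ cong (8 ^ c *_) (^-distribˡ-+-* D n e) ⟩
      8 ^ c * (D ^ n * D ^ e) ≡⟨ *-assoc (8 ^ c) _ _ ⟨
      8 ^ c * D ^ n * D ^ e ∎)
    where
    open ≤-Reasoning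
    e = c * D ∸ n
    p : ∀ a b c d → a * b * (c * d) ≡ a * c * (b * d)
    p = solve-∀
    go : ∀ c → suc D ^ (c * D) ≤ 8 ^ c * D ^ (c * D)
    go zero    = ≤-refl
    go (suc c) = begin
      suc D ^ (D + c * D)                 ≡⟨ ^-distribˡ-+-* (suc D) D (c * D) ⟩
      suc D ^ D * suc D ^ (c * D)         ≤⟨ *-mono-≤ ([1+1/D]^D≤8 D) (go c) ⟩
      8 * D ^ D * (8 ^ c * D ^ (c * D))   ≡⟨ p 8 (D ^ D) (8 ^ c) (D ^ (c * D)) ⟩
      8 * 8 ^ c * (D ^ D * D ^ (c * D))   ≡⟨ cong (8 * 8 ^ c *_) (^-distribˡ-+-* D D (c * D)) ⟨
      8 * 8 ^ c * D ^ (D + c * D) ∎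

  -- Cancelling D^n in the weighted count leaves (1 + 1/D)^n ≤ 8^c. In the union bounds below D^j is
  -- matched by the probability of j blocks, so that only 8^c is lost, uniformly in `j`.
  length-subs≤ : (D : ℕ) .{{_ : NonZero D}} (c j : ℕ) (xs : List A) → length xs ≤ c * D →
                 length (subs j xs) ≤ 8 ^ c * D ^ j
  length-subs≤ D c j xs le = *-cancelʳ-≤ _ _ (D ^ length xs) {{m^n≢0 D (length xs)}} (begin
      length (subs j xs) * D ^ length xs      ≤⟨ length-subs-weighted D j xs ⟩
      suc D ^ length xs * D ^ j               ≤⟨ *-monoˡ-≤ (D ^ j) ([1+1/D]^n≤8^c D (length xs) c le) ⟩
      8 ^ c * D ^ length xs * D ^ j           ≡⟨ p (8 ^ c) (D ^ length xs) (D ^ j) ⟩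
      8 ^ c * D ^ j * D ^ length xs ∎)
    where
    open ≤-Reasoning
    p : ∀ a b c → a * b * c ≡ a * c * b
    p = solve-∀

-- Unnormalised expectations and products of independent coordinates

module Expectation where

  open import Data.Nat
  open import Data.Nat.Properties
  open import Data.Nat.Tactic.RingSolver using (solve-∀)
  open import Data.Bool using (Bool; true; false; if_then_else_; _∨_)
  open import Data.Fin using (Fin; zero; suc)
  import Data.Fin.Properties as FP
  open import Data.Vec using (Vec; []; _∷_; lookup; _[_]≔_)
  import Data.Vec.Properties as VP
  open import Data.List using (List; []; _∷_; length; replicate)
  open import Data.List.Membership.Propositional using (_∈_; _∉_)
  open import Data.List.Relation.Unary.Any using (here; there)
  open import Data.List.Relation.Unary.AllPairs using ([]; _∷_)
  open import Data.List.Relation.Unary.Unique.Propositional using (Unique)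
  open import Data.Product using (∃; _×_; _,_; proj₁; proj₂)
  open import Data.Sum using (_⊎_; inj₁; inj₂)
  open import Data.Empty using (⊥-elim)
  open import Relation.Nullary using (yes; no)
  open import Relation.Binary.PropositionalEquality
  open import Function using (_∘_)
  open Sums

  private
    variable
      A V : Set

  ∏ : ∀ {K} → (Fin K → ℕ) → ℕ
  ∏ {zero}  f = 1
  ∏ {suc K} f = f zero * ∏ (f ∘ suc)

  ∏-cong : ∀ {K} {f g : Fin K → ℕ} → (∀ i → f i ≡ g i) → ∏ f ≡ ∏ g
  ∏-cong {zero}  e = refl
  ∏-cong {suc K} e = cong₂ _*_ (e zero) (∏-cong (e ∘ suc))

  ∏-* : ∀ {K} (f g : Fin K → ℕ) → ∏ (λ i → f i * g i) ≡ ∏ f * ∏ g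
  ∏-* {zero}  f g = refl
  ∏-* {suc K} f g rewrite ∏-* (f ∘ suc) (g ∘ suc) = p (f zero) (g zero) (∏ (f ∘ suc)) (∏ (g ∘ suc))
    where p : ∀ a b c d → a * b * (c * d) ≡ a * c * (b * d)
          p = solve-∀

  ∏-const : ∀ K (c : ℕ) → ∏ {K} (λ _ → c) ≡ c ^ K
  ∏-const zero    c = refl
  ∏-const (suc K) c = cong (c *_) (∏-const K c)

  ∏ₗ : List A → (A → ℕ) → ℕ
  ∏ₗ []       f = 1
  ∏ₗ (x ∷ xs) f = f x * ∏ₗ xs f

  ∏ₗ-mono∈ : (xs : List A) {f g : A → ℕ} → (∀ {x} → x ∈ xs → f x ≤ g x) → ∏ₗ xs f ≤ ∏ₗ xs g
  ∏ₗ-mono∈ []       h = ≤-refl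
  ∏ₗ-mono∈ (x ∷ xs) h = *-mono-≤ (h (here refl)) (∏ₗ-mono∈ xs (λ i → h (there i)))

  ∏ₗ-* : (xs : List A) (f g : A → ℕ) → ∏ₗ xs (λ i → f i * g i) ≡ ∏ₗ xs f * ∏ₗ xs g
  ∏ₗ-* []       f g = refl
  ∏ₗ-* (x ∷ xs) f g rewrite ∏ₗ-* xs f g = p (f x) (g x) (∏ₗ xs f) (∏ₗ xs g)
    where p : ∀ a b c d → a * b * (c * d) ≡ a * c * (b * d)
          p = solve-∀

  ∏ₗ-const : (xs : List A) (c : ℕ) → ∏ₗ xs (λ _ → c) ≡ c ^ length xs
  ∏ₗ-const []       c = refl
  ∏ₗ-const (x ∷ xs) c = cong (c *_) (∏ₗ-const xs c)

  mem : ∀ {K} → Fin K → List (Fin K) → Bool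
  mem i []       = false
  mem i (x ∷ xs) = (i == x) ∨ mem i xs

  ∈⇒mem : ∀ {K} {i : Fin K} {xs} → i ∈ xs → mem i xs ≡ true
  ∈⇒mem {i = i} (here refl) rewrite ==-refl i = refl
  ∈⇒mem {i = i} {x ∷ xs} (there p) with i == x
  ... | true  = refl
  ... | false = ∈⇒mem p

  mem⇒∈ : ∀ {K} {i : Fin K} xs → mem i xs ≡ true → i ∈ xs
  mem⇒∈ {i = i} (x ∷ xs) e with i FP.≟ x
  ... | yes refl = here refl
  ... | no _     = there (mem⇒∈ xs e)

  ∉⇒mem : ∀ {K} {i : Fin K} {xs} → i ∉ xs → mem i xs ≡ false
  ∉⇒mem {i = i} {xs} n with mem i xs in eq
  ... | true  = ⊥-elim (n (mem⇒∈ xs eq))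
  ... | false = refl

  ∏-δ : ∀ {K} (c : Fin K) (x : Fin K → ℕ) → ∏ (λ i → if i == c then x i else 1) ≡ x c
  ∏-δ {suc K} zero    x = trans (cong (x zero *_) (trans (∏-const K 1) (^-zeroˡ K))) (*-identityʳ (x zero))
  ∏-δ {suc K} (suc c) x = trans (*-identityˡ _) (trans (∏-cong e) (∏-δ c (x ∘ suc)))
    where e : ∀ i → (if suc i == suc c then x (suc i) else 1) ≡ (if i == c then x (suc i) else 1)
          e i with i FP.≟ c
          ... | yes _ = refl
          ... | no _  = refl

  -- Turns a product over a duplicate-free list of coordinates into one over all coordinates, with
  -- factor 1 elsewhere; this is the form that `E-∏≤` integrates.
  ∏-mem : ∀ {K} {cs : List (Fin K)} → Unique cs → (x : Fin K → ℕ) →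
          ∏ (λ i → if mem i cs then x i else 1) ≡ ∏ₗ cs x
  ∏-mem {K} {[]}     u x = trans (∏-const K 1) (^-zeroˡ K)
  ∏-mem {K} {c ∷ cs} u@(_ ∷ u′) x =
    trans (∏-cong e) (trans (∏-* (λ i → if i == c then x i else 1) (λ i → if mem i cs then x i else 1))
          (cong₂ _*_ (∏-δ c x) (∏-mem u′ x)))
    where e : ∀ i → (if (i == c) ∨ mem i cs then x i else 1) ≡
                    (if i == c then x i else 1) * (if mem i cs then x i else 1)
          e i with i FP.≟ c
          ... | no _     = sym (+-identityʳ _)
          ... | yes refl rewrite ∉⇒mem (Unique-head u) = sym (*-identityʳ (x c))

  -- The expectation over K independent uniform draws from `vs`, multiplied by `length vs ^ K`, so
  -- that everything stays in ℕ. Repetitions in `vs` carry the probabilities: one `true` among d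
  -- entries is a coin of bias 1/d.
  E : List V → ∀ {K} → (Vec V K → ℕ) → ℕ
  E vs {zero}  φ = φ []
  E vs {suc K} φ = ∑[ v ∈ vs ] (E vs (λ ω → φ (v ∷ ω)))

  module _ (vs : List V) where

    E-cong : ∀ {K} {φ ψ : Vec V K → ℕ} → (∀ ω → φ ω ≡ ψ ω) → E vs φ ≡ E vs ψ
    E-cong {zero}  e = e []
    E-cong {suc K} e = ∑-cong vs (λ v → E-cong (λ ω → e (v ∷ ω)))

    E-mono : ∀ {K} {φ ψ : Vec V K → ℕ} → (∀ ω → φ ω ≤ ψ ω) → E vs φ ≤ E vs ψ
    E-mono {zero}  e = e []
    E-mono {suc K} e = ∑-mono vs (λ v → E-mono (λ ω → e (v ∷ ω)))

    E-∑ : ∀ {K} (xs : List A) (φ : A → Vec V K → ℕ) → E vs (λ ω → ∑[ x ∈ xs ] (φ x ω)) ≡ ∑[ x ∈ xs ] (E vs (φ x))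
    E-∑ {K = zero}  xs φ = refl
    E-∑ {K = suc K} xs φ = trans (∑-cong vs (λ v → E-∑ xs (λ x ω → φ x (v ∷ ω)))) (∑-swap vs xs _)

    E-+ : ∀ {K} (φ ψ : Vec V K → ℕ) → E vs (λ ω → φ ω + ψ ω) ≡ E vs φ + E vs ψ
    E-+ {zero}  φ ψ = refl
    E-+ {suc K} φ ψ = trans (∑-cong vs (λ v → E-+ (λ ω → φ (v ∷ ω)) (λ ω → ψ (v ∷ ω)))) (∑-+ vs _ _)

    E-*ʳ : ∀ {K} (φ : Vec V K → ℕ) c → E vs (λ ω → φ ω * c) ≡ E vs φ * c
    E-*ʳ {zero}  φ c = refl
    E-*ʳ {suc K} φ c = trans (∑-cong vs (λ v → E-*ʳ (λ ω → φ (v ∷ ω)) c)) (∑-*ʳ vs c _)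

    E-*ˡ : ∀ {K} c (φ : Vec V K → ℕ) → E vs (λ ω → c * φ ω) ≡ c * E vs φ
    E-*ˡ {zero}  c φ = refl
    E-*ˡ {suc K} c φ = trans (∑-cong vs (λ v → E-*ˡ c (λ ω → φ (v ∷ ω)))) (∑-*ˡ vs c _)

    total : ℕ → ℕ
    total K = length vs ^ K

    private
      pigeon : (xs : List V) (f : V → ℕ) (c : ℕ) → ∑ xs f < length xs * c → ∃ λ x → f x < c
      pigeon (x ∷ xs) f c lt with f x <? c
      ... | yes p = x , p
      ... | no ¬p = pigeon xs f c (+-cancelˡ-< c _ _ (≤-<-trans (+-monoˡ-≤ (∑ xs f) (≮⇒≥ ¬p)) lt))

    -- The method of conditional expectations: if the mean is below 1, some value of the first
    -- coordinate keeps the conditional mean below 1, and at the end a natural number below 1 is 0.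
    E-witness : ∀ {K} (φ : Vec V K → ℕ) → E vs φ < total K → ∃ λ ω → φ ω ≡ 0
    E-witness {zero}  φ lt = [] , n<1⇒n≡0 lt
    E-witness {suc K} φ lt =
      let (v , lt′) = pigeon vs (λ v → E vs (λ ω → φ (v ∷ ω))) (total K) lt
          (ω , e)   = E-witness (λ ω → φ (v ∷ ω)) lt′
      in v ∷ ω , e

    -- The coordinates in S are independent given the others, so a product of factors, each
    -- reading one S-coordinate and non-S-coordinates only, is integrated factor by factor.
    E-∏≤ : ∀ {K} (S : Fin K → Bool) (h : Fin K → Vec V K → ℕ) (B : Fin K → ℕ) →
           (∀ i j v ω → S i ≡ true → i ≢ j → h j (ω [ i ]≔ v) ≡ h j ω) →
           (∀ i ω → S i ≡ true → ∑[ v ∈ vs ] (h i (ω [ i ]≔ v)) ≤ B i) →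
           (∀ i ω → S i ≡ false → h i ω ≤ 1 × length vs ≤ B i) →
           E vs (λ ω → ∏ (λ i → h i ω)) ≤ ∏ B
    E-∏≤ {zero}  S h B inv mean out = ≤-refl
    E-∏≤ {suc K} S h B inv mean out = go (S zero) refl
      where
      open ≤-Reasoning
      IH : ∀ v → E vs (λ ω → ∏ (λ i → h (suc i) (v ∷ ω))) ≤ ∏ (B ∘ suc)
      IH v = E-∏≤ (S ∘ suc) (λ i ω → h (suc i) (v ∷ ω)) (B ∘ suc)
               (λ i j v′ ω s ne → inv (suc i) (suc j) v′ (v ∷ ω) s (λ e → ne (FP.suc-injective e)))
               (λ i ω s → mean (suc i) (v ∷ ω) s)
               (λ i ω s → out (suc i) (v ∷ ω) s)
      head? : (xs : List V) → (xs ≡ []) ⊎ V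
      head? []      = inj₁ refl
      head? (x ∷ _) = inj₂ x
      go : (b : Bool) → S zero ≡ b → ∑[ v ∈ vs ] (E vs (λ ω → h zero (v ∷ ω) * ∏ (λ i → h (suc i) (v ∷ ω)))) ≤ B zero * ∏ (B ∘ suc)
      go false s = begin
        ∑[ v ∈ vs ] (E vs (λ ω → h zero (v ∷ ω) * ∏ (λ i → h (suc i) (v ∷ ω))))
          ≤⟨ ∑-mono vs (λ v → ≤-trans (E-mono (λ ω → ≤-trans (*-monoˡ-≤ _ (proj₁ (out zero (v ∷ ω) s))) (≤-reflexive (*-identityˡ _)))) (IH v)) ⟩
        ∑[ v ∈ vs ] (∏ (B ∘ suc))  ≡⟨ ∑-const vs _ ⟩
        length vs * ∏ (B ∘ suc)    ≤⟨ len (head? vs) ⟩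
        B zero * ∏ (B ∘ suc) ∎
        -- `out` speaks about a full vector, so an arbitrary one is built to read off
        -- `length vs ≤ B zero`; this needs some value, hence the split on whether `vs` is empty.
        where dummy : V → Vec V (suc K)
              dummy v = v ∷ Data.Vec.replicate K v
              len : (vs ≡ []) ⊎ V → length vs * ∏ (B ∘ suc) ≤ B zero * ∏ (B ∘ suc)
              len (inj₁ e) rewrite e = z≤n
              len (inj₂ v) = *-monoˡ-≤ _ (proj₂ (out zero (dummy v) s))
      go true s with head? vs
      ... | inj₁ e = subst (λ xs → ∑[ v ∈ xs ] (E vs (λ ω → h zero (v ∷ ω) * ∏ (λ i → h (suc i) (v ∷ ω)))) ≤ B zero * ∏ (B ∘ suc)) (sym e) z≤n
      -- The later factors do not read coordinate zero, so there it may be frozen at `v₀`; they then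
      -- leave the sum over v.
      ... | inj₂ v₀ = begin
        ∑[ v ∈ vs ] (E vs (λ ω → h zero (v ∷ ω) * ∏ (λ i → h (suc i) (v ∷ ω))))
          ≡⟨ ∑-cong vs (λ v → E-cong (λ ω → cong (h zero (v ∷ ω) *_) (∏-cong (λ i → inv zero (suc i) v (v₀ ∷ ω) s (λ ()))))) ⟩
        ∑[ v ∈ vs ] (E vs (λ ω → h zero (v ∷ ω) * R ω))
          ≡⟨ E-∑ vs (λ v ω → h zero (v ∷ ω) * R ω) ⟨
        E vs (λ ω → ∑[ v ∈ vs ] (h zero (v ∷ ω) * R ω))
          ≤⟨ E-mono (λ ω → ≤-trans (≤-reflexive (∑-*ʳ vs (R ω) _)) (*-monoˡ-≤ (R ω) (mean zero (v₀ ∷ ω) s))) ⟩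
        E vs (λ ω → B zero * R ω)   ≡⟨ E-*ˡ (B zero) R ⟩
        B zero * E vs R             ≤⟨ *-monoʳ-≤ (B zero) (IH v₀) ⟩
        B zero * ∏ (B ∘ suc) ∎
        where R : Vec V K → ℕ
              R ω = ∏ (λ i → h (suc i) (v₀ ∷ ω))

    -- All coordinates are integrated. One outside `cs` has the factor 1 and contributes
    -- `length vs`, which is why only `length cs` powers of `length vs` appear on the left.
    E-∏ₗ≤ : ∀ {K} {cs : List (Fin K)} → Unique cs → (g : Fin K → V → ℕ) (β : Fin K → ℕ) →
            (∀ i → ∑ vs (g i) ≤ β i) →
            E vs (λ ω → ∏ₗ cs (λ i → g i (lookup ω i))) * length vs ^ length cs ≤ ∏ₗ cs β * total K
    E-∏ₗ≤ {K} {cs} u g β le = begin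
      E vs (λ ω → ∏ₗ cs (λ i → g i (lookup ω i))) * D ^ length cs
        ≡⟨ cong₂ _*_ (E-cong (λ ω → sym (∏-mem u (λ i → g i (lookup ω i))))) (sym (trans (∏-mem u (λ _ → D)) (∏ₗ-const cs D))) ⟩
      E vs (λ ω → ∏ (λ i → h i ω)) * ∏ (λ i → if mem i cs then D else 1)
        ≤⟨ *-monoˡ-≤ _ (E-∏≤ (λ _ → true) h B inv mean (λ i ω ())) ⟩
      ∏ B * ∏ (λ i → if mem i cs then D else 1)
        ≡⟨ ∏-* B _ ⟨
      ∏ (λ i → B i * (if mem i cs then D else 1))
        ≡⟨ ∏-cong e ⟩
      ∏ (λ i → (if mem i cs then β i else 1) * D)
        ≡⟨ ∏-* (λ i → if mem i cs then β i else 1) (λ _ → D) ⟩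
      ∏ (λ i → if mem i cs then β i else 1) * ∏ {K} (λ _ → D)
        ≡⟨ cong₂ _*_ (∏-mem u β) (∏-const K D) ⟩
      ∏ₗ cs β * D ^ K ∎
      where
      open ≤-Reasoning
      D = length vs
      h : Fin K → Vec V K → ℕ
      h i ω = if mem i cs then g i (lookup ω i) else 1
      B : Fin K → ℕ
      B i = if mem i cs then β i else D
      e : ∀ i → B i * (if mem i cs then D else 1) ≡ (if mem i cs then β i else 1) * D
      e i with mem i cs
      ... | true  = refl
      ... | false = trans (*-identityʳ D) (sym (*-identityˡ D))
      inv : ∀ i j v ω → true ≡ true → i ≢ j → h j (ω [ i ]≔ v) ≡ h j ω
      inv i j v ω _ ne with mem j cs
      ... | true  = cong (g j) (VP.lookup∘updateAt′ j i (λ e → ne (sym e)) ω)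
      ... | false = refl
      mean : ∀ i ω → true ≡ true → ∑[ v ∈ vs ] (h i (ω [ i ]≔ v)) ≤ B i
      mean i ω _ with mem i cs
      ... | true  = ≤-trans (≤-reflexive (∑-cong vs (λ v → cong (g i) (VP.lookup∘updateAt i ω)))) (le i)
      ... | false = ≤-reflexive (∑-1 vs)

-- Many hits, and disjoint blocks that are hit entirely

module Events where

  open import Data.Nat
  open import Data.Nat.Properties
  open import Data.Nat.Tactic.RingSolver using (solve-∀)
  open import Data.Bool using (Bool; true; false; _∧_; not)
  open import Data.Fin using (Fin; zero; suc)
  import Data.Fin.Properties as FP
  open import Data.Vec using (Vec; []; _∷_; lookup)
  open import Data.List using (List; []; _∷_; length; map; _++_; concat; concatMap; take)
  import Data.List.Properties as LP
  open import Data.List.Membership.Propositional using (_∈_; _∉_)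
  open import Data.List.Membership.Propositional.Properties using (∈-++⁻; ∈-++⁺ˡ; ∈-++⁺ʳ)
  open import Data.List.Relation.Unary.Any using (here; there)
  open import Data.List.Relation.Unary.All using (All; []; _∷_)
  import Data.List.Relation.Unary.All as All
  open import Data.List.Relation.Unary.AllPairs using ([]; _∷_)
  open import Data.List.Relation.Unary.Unique.Propositional using (Unique)
  open import Data.List.Relation.Unary.Unique.DecPropositional using (unique?)
  open import Data.List.Relation.Binary.Sublist.Propositional using (_⊆_; []; _∷_; _∷ʳ_; minimum)
  open import Data.Product using (∃; _×_; _,_)
  open import Data.Sum using (_⊎_; inj₁; inj₂)
  open import Data.Empty using (⊥; ⊥-elim)
  open import Data.Unit using (tt)
  open import Relation.Nullary using (¬_; Dec; yes; no; does)
  open import Relation.Binary.PropositionalEquality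
  open import Function using (_∘_)
  open Sums
  open Expectation

  private
    variable
      A B V : Set

  ∧-true : ∀ {a b} → (a ∧ b) ≡ true → a ≡ true × b ≡ true
  ∧-true {true}  {true} refl = refl , refl

  ∧-intro : ∀ {a b} → a ≡ true → b ≡ true → (a ∧ b) ≡ true
  ∧-intro refl refl = refl

  not-true : ∀ {a} → not a ≡ true → a ≡ false
  not-true {false} _ = refl

  true≢false : ∀ {b} → b ≡ true → b ≡ false → ⊥
  true≢false refl ()

  ≤ᵇ-true : ∀ a b → (a ≤ᵇ b) ≡ true → a ≤ b
  ≤ᵇ-true a b e = ≤ᵇ⇒≤ a b (subst Data.Bool.T (sym e) tt)

  ≤ᵇ-intro : ∀ {a b} → a ≤ b → (a ≤ᵇ b) ≡ true
  ≤ᵇ-intro {a} {b} le with a ≤ᵇ b | ≤⇒≤ᵇ le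
  ... | true | _ = refl

  does-true : {P : Set} (d : Dec P) → does d ≡ true → P
  does-true (yes p) _ = p

  does-intro : {P : Set} (d : Dec P) → P → does d ≡ true
  does-intro (yes _) _ = refl
  does-intro (no ¬p) p = ⊥-elim (¬p p)

  module _ (vs : List V) (hit : V → Bool) (hit≤1 : ∑ vs (𝟙 ∘ hit) ≤ 1) where

    hits : ∀ {K} → List (Fin K) → Vec V K → ℕ
    hits cs ω = ∑[ i ∈ cs ] (𝟙 (hit (lookup ω i)))

    present : ∀ {K} → List (Fin K) → Vec V K → ℕ
    present cs ω = ∏ₗ cs (λ i → 𝟙 (hit (lookup ω i)))

    E-present : ∀ {K} {cs : List (Fin K)} → Unique cs →
                E vs (present cs) * length vs ^ length cs ≤ total vs K
    E-present {K} {cs} u = ≤-trans (E-∏ₗ≤ vs u (λ _ v → 𝟙 (hit v)) (λ _ → 1) (λ _ → hit≤1))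
      (≤-reflexive (trans (cong (_* total vs K) (trans (∏ₗ-const cs 1) (^-zeroˡ (length cs)))) (*-identityˡ _)))

    many : ∀ {K} → List (Fin K) → ℕ → Vec V K → ℕ
    many cs j ω = 𝟙 (j ≤ᵇ hits cs ω)

    -- Markov's inequality for the exponential moment, with the rational base 1 + e/q in place of an
    -- exponential: a hit multiplies the weight by q + e, a miss by q, and a coordinate has mean at
    -- most q + e/D.
    E-many : ∀ {K} {cs : List (Fin K)} → Unique cs → (q e j : ℕ) .{{_ : NonZero q}} →
             E vs (many cs j) * ((q + e) ^ j * q ^ length cs * length vs ^ length cs)
             ≤ q ^ j * ((q * length vs + e) ^ length cs * total vs K)
    E-many {K} {cs} u q e j = begin
      E vs (many cs j) * ((q + e) ^ j * q ^ N * D ^ N)      ≡⟨ *-assoc (E vs (many cs j)) _ _ ⟨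
      E vs (many cs j) * ((q + e) ^ j * q ^ N) * D ^ N      ≡⟨ cong (_* D ^ N) (E-*ʳ vs (many cs j) _) ⟨
      E vs (λ ω → many cs j ω * ((q + e) ^ j * q ^ N)) * D ^ N ≤⟨ *-monoˡ-≤ (D ^ N) (E-mono vs pt) ⟩
      E vs (λ ω → q ^ j * ∏ₗ cs (λ i → g (lookup ω i))) * D ^ N ≡⟨ cong (_* D ^ N) (E-*ˡ vs {K} (q ^ j) _) ⟩
      q ^ j * E vs (λ ω → ∏ₗ cs (λ i → g (lookup ω i))) * D ^ N ≡⟨ *-assoc (q ^ j) _ _ ⟩
      q ^ j * (E vs (λ ω → ∏ₗ cs (λ i → g (lookup ω i))) * D ^ N) ≤⟨ *-monoʳ-≤ (q ^ j) (E-∏ₗ≤ vs u (λ _ → g) (λ _ → q * D + e) (λ _ → mean)) ⟩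
      q ^ j * (∏ₗ cs (λ _ → q * D + e) * total vs K)            ≡⟨ cong (λ t → q ^ j * (t * total vs K)) (∏ₗ-const cs (q * D + e)) ⟩
      q ^ j * ((q * D + e) ^ N * total vs K) ∎
      where
      open ≤-Reasoning
      D = length vs
      N = length cs
      g : V → ℕ
      g v = q + e * 𝟙 (hit v)
      mean : ∑ vs g ≤ q * D + e
      mean = begin
        ∑ vs g                                ≡⟨ ∑-+ vs (λ _ → q) _ ⟩
        ∑[ v ∈ vs ] q + ∑[ v ∈ vs ] (e * 𝟙 (hit v)) ≡⟨ cong₂ _+_ (trans (∑-const vs q) (*-comm D q)) (∑-*ˡ vs e _) ⟩
        q * D + e * ∑ vs (𝟙 ∘ hit)            ≤⟨ +-monoʳ-≤ (q * D) (*-monoʳ-≤ e hit≤1) ⟩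
        q * D + e * 1                         ≡⟨ cong (q * D +_) (*-identityʳ e) ⟩
        q * D + e ∎
      weight : ∀ (cs : List (Fin K)) ω → (q + e) ^ hits cs ω * q ^ length cs ≤ q ^ hits cs ω * ∏ₗ cs (λ i → g (lookup ω i))
      weight []       ω = ≤-refl
      weight (c ∷ cs) ω with hit (lookup ω c)
      ... | false = begin
          (q + e) ^ hits cs ω * (q * q ^ length cs)     ≡⟨ p ((q + e) ^ hits cs ω) q (q ^ length cs) ⟩
          q * ((q + e) ^ hits cs ω * q ^ length cs)     ≤⟨ *-monoʳ-≤ q (weight cs ω) ⟩
          q * (q ^ hits cs ω * P)                       ≡⟨ p′ q (q ^ hits cs ω) P e ⟩
          q ^ hits cs ω * ((q + e * 0) * P) ∎
        where P = ∏ₗ cs (λ i → g (lookup ω i))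
              p : ∀ a b c → a * (b * c) ≡ b * (a * c)
              p = solve-∀
              p′ : ∀ q a b e → q * (a * b) ≡ a * ((q + e * 0) * b)
              p′ = solve-∀
      ... | true = begin
          (q + e) * (q + e) ^ hits cs ω * (q * q ^ length cs) ≡⟨ p (q + e) ((q + e) ^ hits cs ω) q (q ^ length cs) ⟩
          q * (q + e) * ((q + e) ^ hits cs ω * q ^ length cs) ≤⟨ *-monoʳ-≤ (q * (q + e)) (weight cs ω) ⟩
          q * (q + e) * (q ^ hits cs ω * P)                   ≡⟨ p′ q (q ^ hits cs ω) P e ⟩
          q * q ^ hits cs ω * ((q + e * 1) * P) ∎
        where P = ∏ₗ cs (λ i → g (lookup ω i))
              p : ∀ a b c d → a * b * (c * d) ≡ c * a * (b * d)
              p = solve-∀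
              p′ : ∀ q a b e → q * (q + e) * (a * b) ≡ q * a * ((q + e * 1) * b)
              p′ = solve-∀
      pt : ∀ ω → many cs j ω * ((q + e) ^ j * q ^ N) ≤ q ^ j * ∏ₗ cs (λ i → g (lookup ω i))
      pt ω with j ≤ᵇ hits cs ω in eq
      ... | false = z≤n
      -- More than `j` hits only help, as q + e ≥ q; the surplus δ is multiplied in on both sides.
      ... | true = *-cancelʳ-≤ _ _ (q ^ δ) {{m^n≢0 q δ}} (begin
          1 * (Q ^ j * q ^ N) * q ^ δ  ≤⟨ *-monoʳ-≤ (1 * (Q ^ j * q ^ N)) (^-monoˡ-≤ δ (m≤m+n q e)) ⟩
          1 * (Q ^ j * q ^ N) * Q ^ δ  ≡⟨ p (Q ^ j) (q ^ N) (Q ^ δ) ⟩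
          Q ^ j * Q ^ δ * q ^ N        ≡⟨ cong (_* q ^ N) (sym (^-distribˡ-+-* Q j δ)) ⟩
          Q ^ (j + δ) * q ^ N          ≡⟨ cong (λ t → Q ^ t * q ^ N) (m+[n∸m]≡n (≤ᵇ-true j (hits cs ω) eq)) ⟩
          Q ^ hits cs ω * q ^ N        ≤⟨ weight cs ω ⟩
          q ^ hits cs ω * P            ≡⟨ cong (λ t → q ^ t * P) (m+[n∸m]≡n (≤ᵇ-true j (hits cs ω) eq)) ⟨
          q ^ (j + δ) * P              ≡⟨ cong (_* P) (^-distribˡ-+-* q j δ) ⟩
          q ^ j * q ^ δ * P            ≡⟨ p″ (q ^ j) (q ^ δ) P ⟩
          q ^ j * P * q ^ δ ∎)
        where δ = hits cs ω ∸ j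
              Q = q + e
              P = ∏ₗ cs (λ i → g (lookup ω i))
              p : ∀ a b c → 1 * (a * b) * c ≡ a * c * b
              p = solve-∀
              p″ : ∀ a b c → a * b * c ≡ a * c * b
              p″ = solve-∀

    -- Counts the families of `j` pairwise disjoint blocks of size `t` from 𝒯 that are hit entirely.
    -- Disjointness is encoded as uniqueness of the concatenation; it makes the blocks independent,
    -- so a plain union bound over families suffices.
    family : ∀ {K} → (t j : ℕ) → List (List (Fin K)) → Vec V K → ℕ
    family t j 𝒯 ω = ∑[ 𝓕 ∈ subs j 𝒯 ]
      (𝟙 (does (unique? FP._≟_ (concat 𝓕)) ∧ (length (concat 𝓕) ≡ᵇ t * j)) * present (concat 𝓕) ω)

    E-family : ∀ {K} (t j : ℕ) (𝒯 : List (List (Fin K))) →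
               E vs (family t j 𝒯) * length vs ^ (t * j) ≤ length (subs j 𝒯) * total vs K
    E-family {K} t j 𝒯 = begin
      E vs (family t j 𝒯) * D ^ (t * j)                     ≡⟨ cong (_* D ^ (t * j)) (E-∑ vs {K = K} (subs j 𝒯) f) ⟩
      ∑[ 𝓕 ∈ subs j 𝒯 ] (E vs (f 𝓕)) * D ^ (t * j)        ≡⟨ ∑-*ʳ (subs j 𝒯) (D ^ (t * j)) _ ⟨
      ∑[ 𝓕 ∈ subs j 𝒯 ] (E vs (f 𝓕) * D ^ (t * j))        ≤⟨ ∑-≤const (subs j 𝒯) (total vs K) (λ {𝓕} _ → each 𝓕) ⟩
      length (subs j 𝒯) * total vs K ∎
      where
      open ≤-Reasoning
      D = length vs
      f : List (List (Fin K)) → Vec V K → ℕ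
      f 𝓕 ω = 𝟙 (does (unique? FP._≟_ (concat 𝓕)) ∧ (length (concat 𝓕) ≡ᵇ t * j)) * present (concat 𝓕) ω
      each : ∀ 𝓕 → E vs (f 𝓕) * D ^ (t * j) ≤ total vs K
      each 𝓕 with unique? FP._≟_ (concat 𝓕) | length (concat 𝓕) ≡ᵇ t * j in eq
      ... | no _  | _     = ≤-trans (≤-reflexive (cong (_* D ^ (t * j)) (E-*ˡ vs 0 (present (concat 𝓕))))) z≤n
      ... | yes u | false = ≤-trans (≤-reflexive (cong (_* D ^ (t * j)) (E-*ˡ vs 0 (present (concat 𝓕))))) z≤n
      ... | yes u | true  = begin
          E vs (λ ω → 1 * present (concat 𝓕) ω) * D ^ (t * j)
            ≡⟨ cong₂ _*_ (trans (E-*ˡ vs 1 (present (concat 𝓕))) (*-identityˡ _))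
                 (cong (D ^_) (sym (≡ᵇ⇒≡ (length (concat 𝓕)) (t * j) (subst Data.Bool.T (sym eq) tt)))) ⟩
          E vs (present (concat 𝓕)) * D ^ length (concat 𝓕) ≤⟨ E-present u ⟩
          total vs K ∎

    present≡1 : ∀ {K} (cs : List (Fin K)) (ω : Vec V K) → (∀ {i} → i ∈ cs → hit (lookup ω i) ≡ true) → present cs ω ≡ 1
    present≡1 []       ω h = refl
    present≡1 (c ∷ cs) ω h rewrite h (here refl) | present≡1 cs ω (λ i → h (there i)) = refl

    family-hit : ∀ {K} (t j : ℕ) (𝒯 𝓕 : List (List (Fin K))) (ω : Vec V K) →
                 𝓕 ⊆ 𝒯 → length 𝓕 ≡ j → Unique (concat 𝓕) → length (concat 𝓕) ≡ t * j →
                 (∀ {i} → i ∈ concat 𝓕 → hit (lookup ω i) ≡ true) → family t j 𝒯 ω ≢ 0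
    family-hit t j 𝒯 𝓕 ω s l u l′ h z = bad (≤-trans (≤-reflexive (sym one)) (≤-trans (∈⇒≤∑ {xs = subs j 𝒯} F 𝓕∈) (≤-reflexive z)))
      where
      F = λ 𝓕 → 𝟙 (does (unique? FP._≟_ (concat 𝓕)) ∧ (length (concat 𝓕) ≡ᵇ t * j)) * present (concat 𝓕) ω
      𝓕∈ = ∈-subs {j = j} s (≤-reflexive l)
      bad : ¬ (1 ≤ 0)
      bad ()
      one : F 𝓕 ≡ 1
      one with unique? FP._≟_ (concat 𝓕) | length (concat 𝓕) ≡ᵇ t * j | ≡⇒≡ᵇ (length (concat 𝓕)) (t * j) l′
      ... | no ¬u | _    | _ = ⊥-elim (¬u u)
      ... | yes _ | true | _ = trans (*-identityˡ _) (present≡1 (concat 𝓕) ω h)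

  take-⊆ : (j : ℕ) (xs : List A) → take j xs ⊆ xs
  take-⊆ zero    xs       = minimum xs
  take-⊆ (suc j) []       = []
  take-⊆ (suc j) (x ∷ xs) = refl ∷ take-⊆ j xs

  Unique-++ : {xs ys : List A} → Unique xs → Unique ys → (∀ {x} → x ∈ xs → x ∉ ys) → Unique (xs ++ ys)
  Unique-++ {xs = []}     ux       uy dj = uy
  Unique-++ {xs = x ∷ xs} {ys} (a ∷ ux) uy dj =
    All.tabulate (λ {z} z∈ e → case z (∈-++⁻ xs z∈) e) ∷ Unique-++ ux uy (λ i → dj (there i))
    where case : ∀ z → z ∈ xs ⊎ z ∈ ys → x ≡ z → ⊥
          case z (inj₁ i) e    = All.lookup a i e
          case z (inj₂ i) refl = dj (here refl) i

  ∈-concatMap⁻ : (g : A → List B) {xs : List A} {y : B} → y ∈ concatMap g xs → ∃ λ x → x ∈ xs × y ∈ g x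
  ∈-concatMap⁻ g {x ∷ xs} i with ∈-++⁻ (g x) i
  ... | inj₁ j = x , here refl , j
  ... | inj₂ j = let (z , z∈ , k) = ∈-concatMap⁻ g j in z , there z∈ , k

  ∈-concatMap⁺ : (g : A → List B) {xs : List A} {x : A} {y : B} → x ∈ xs → y ∈ g x → y ∈ concatMap g xs
  ∈-concatMap⁺ g (here refl) j = ∈-++⁺ˡ j
  ∈-concatMap⁺ g {x ∷ xs} (there i) j = ∈-++⁺ʳ (g x) (∈-concatMap⁺ g i j)

  Unique-concatMap : (g : A → List B) {xs : List A} → Unique xs → (∀ {x} → x ∈ xs → Unique (g x)) →
                     (∀ {x x′ y} → x ∈ xs → x′ ∈ xs → y ∈ g x → y ∈ g x′ → x ≡ x′) → Unique (concatMap g xs)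
  Unique-concatMap g {[]}     u ug dj = []
  Unique-concatMap g {x ∷ xs} u@(_ ∷ u′) ug dj =
    Unique-++ (ug (here refl)) (Unique-concatMap g u′ (λ i → ug (there i)) (λ i j → dj (there i) (there j)))
      (λ y∈ y∈′ → let (z , z∈ , y∈z) = ∈-concatMap⁻ g y∈′ in
         Unique-head u (subst (_∈ xs) (sym (dj (here refl) (there z∈) y∈ y∈z)) z∈))

  length-concatMap-const : (g : A → List B) (t : ℕ) (xs : List A) → (∀ {x} → x ∈ xs → length (g x) ≡ t) →
                           length (concatMap g xs) ≡ t * length xs
  length-concatMap-const g t []       h = sym (*-zeroʳ t)
  length-concatMap-const g t (x ∷ xs) h = trans (LP.length-++ (g x))
    (trans (cong₂ _+_ (h (here refl)) (length-concatMap-const g t xs (λ i → h (there i)))) (sym (*-suc t (length xs))))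

  -- One block per selected index, taken in the order of the indices, forms a sublist of all blocks
  -- and hence one of the families that `subs` enumerates.
  choice-⊆ : (p : A → Bool) (c : A → B) (g : A → List B) (xs : List A) →
             (∀ {x} → p x ≡ true → c x ∈ g x) → map c (filt p xs) ⊆ concatMap g xs
  choice-⊆ p c g []       h = []
  choice-⊆ p c g (x ∷ xs) h with p x in eq
  ... | false = skip (g x)
    where skip : ∀ ys → map c (filt p xs) ⊆ (ys ++ concatMap g xs)
          skip []       = choice-⊆ p c g xs h
          skip (y ∷ ys) = y ∷ʳ skip ys
  ... | true = at (h eq)
    where skip : ∀ ys → map c (filt p xs) ⊆ (ys ++ concatMap g xs)
          skip []       = choice-⊆ p c g xs h
          skip (y ∷ ys) = y ∷ʳ skip ys
          at : ∀ {ys} → c x ∈ ys → (c x ∷ map c (filt p xs)) ⊆ (ys ++ concatMap g xs)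
          at {y ∷ ys} (here e)  = e ∷ skip ys
          at {y ∷ ys} (there i) = y ∷ʳ at i

-- Weighted pairs of points with a common neighbour

module WeightedPairs where

  open import Data.Nat
  open import Data.Nat.Properties
  open import Data.Nat.Tactic.RingSolver using (solve-∀)
  open import Data.Bool using (Bool; true; false; _∧_; not)
  open import Data.Fin using (Fin; zero; suc)
  open import Data.List using (List; []; _∷_; length; take)
  import Data.List.Properties as LP
  open import Data.List.Membership.Propositional using (_∈_)
  open import Data.List.Relation.Binary.Sublist.Propositional using (⊆-trans)
  open import Data.List.Relation.Unary.AllPairs using ([]; _∷_)
  open import Data.List.Relation.Unary.Unique.Propositional using (Unique)
  open import Data.Product using (proj₁; proj₂)
  open import Data.Empty using (⊥-elim)
  open import Relation.Nullary using (yes; no)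
  open import Relation.Binary.PropositionalEquality
  open Sums
  open Events

  private
    variable
      A B : Set

  ∑-filt≤ : (p : A → Bool) (xs : List A) (f : A → ℕ) → ∑ (filt p xs) f ≤ ∑ xs f
  ∑-filt≤ p xs f = ≤-trans (≤-reflexive (∑-filt p xs f)) (∑-mono xs (λ x → ≤-trans (*-monoˡ-≤ (f x) (𝟙≤1 (p x))) (≤-reflexive (*-identityˡ (f x)))))

  ∑-*∑ : (xs : List A) (ys : List B) (f : A → ℕ) (g : B → ℕ) →
         ∑[ x ∈ xs ] (∑[ y ∈ ys ] (f x * g y)) ≡ ∑ xs f * ∑ ys g
  ∑-*∑ xs ys f g = trans (∑-cong xs (λ x → ∑-*ˡ ys (f x) g)) (∑-*ʳ xs (∑ ys g) f)

  levels : ℕ → List ℕ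
  levels zero    = []
  levels (suc n) = n ∷ levels n

  length-levels : ∀ n → length (levels n) ≡ n
  length-levels zero    = refl
  length-levels (suc n) = cong suc (length-levels n)

  <ᵇ-intro : ∀ {a b} → a < b → (a <ᵇ b) ≡ true
  <ᵇ-intro = ≤ᵇ-intro

  <ᵇ-false : ∀ {a b} → b ≤ a → (a <ᵇ b) ≡ false
  <ᵇ-false {a} {b} le with a <ᵇ b in eq
  ... | false = refl
  ... | true  = ⊥-elim (<⇒≱ (≤ᵇ-true (suc a) b eq) le)

  <ᵇ-true : ∀ a b → (a <ᵇ b) ≡ true → a < b
  <ᵇ-true a b e = ≤ᵇ-true (suc a) b e

  layers-full : ∀ ρ μ → ρ ≤ μ → ∑[ i ∈ levels ρ ] (𝟙 (i <ᵇ μ)) ≡ ρ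
  layers-full zero    μ le = refl
  layers-full (suc ρ) μ le rewrite <ᵇ-intro le = cong suc (layers-full ρ μ (≤-trans (n≤1+n ρ) le))

  layer-cake : ∀ ρ μ → μ ≤ ρ → ∑[ i ∈ levels ρ ] (𝟙 (i <ᵇ μ)) ≡ μ
  layer-cake zero    zero z≤n = refl
  layer-cake (suc ρ) μ le with μ ≟ suc ρ
  ... | yes refl = layers-full (suc ρ) (suc ρ) ≤-refl
  ... | no ne rewrite <ᵇ-false {ρ} {μ} (≤-pred (≤∧≢⇒< le ne)) = layer-cake ρ μ (≤-pred (≤∧≢⇒< le ne))

  -- Bounds the μ-weighted number of pairs x ≠ y with a common neighbour w by sorting the w. The few
  -- w of weighted degree at least t₁ give the main term. Those with at least t₀ neighbours in the
  -- support are controlled by `sparse`. The others close at most t₀² pairs between two level sets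
  -- of μ, and `joint` bounds how many of them close any pair at all.
  module Closers
    {m : ℕ} (H : Fin m → Fin m → Bool) (k Δ L₁ cd α β γ : ℕ)
    (deg : ∀ w → ∑[ x ∈ fins m ] (𝟙 (H w x)) ≤ Δ)
    (sparse : ∀ {W X} → W ∈ subs k (fins m) → X ∈ subs k (fins m) → ∑[ w ∈ W ] (∑[ x ∈ X ] (𝟙 (H w x))) ≤ L₁)
    (codeg : ∀ {w w′} → w ≢ w′ → ∑[ x ∈ fins m ] (𝟙 (H w x) * 𝟙 (H w′ x)) ≤ cd)
    (joint : ∀ {X Y} → X ∈ subs k (fins m) → Y ∈ subs k (fins m) →
             β * ∑[ w ∈ fins m ] (𝟙 (1 ≤ᵇ ∑[ x ∈ X ] (∑[ y ∈ Y ] (𝟙 (not (x == y)) * (𝟙 (H w x) * 𝟙 (H w y)))))) ≤ α * (length X * length Y) + γ)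
    (t₀ t₁ j : ℕ) (L₁<kt₀ : L₁ < k * t₀)
    (ρ : ℕ) (few : k + j * j * (cd * ρ) < j * t₁)
    (μ : Fin m → ℕ) (μ≤ρ : ∀ x → μ x ≤ ρ) (∑μ≤k : ∑ (fins m) μ ≤ k)
    where

    N : List (Fin m)
    N = fins m

    hitsBoth : List (Fin m) → List (Fin m) → Fin m → ℕ
    hitsBoth X Y w = ∑[ x ∈ X ] (∑[ y ∈ Y ] (𝟙 (not (x == y)) * (𝟙 (H w x) * 𝟙 (H w y))))

    open ≤-Reasoning

    ovl = j * j * (cd * ρ)
    S = filt (λ x → 1 ≤ᵇ μ x) N
    D ex dS : Fin m → ℕ
    D  w = ∑[ x ∈ N ] (𝟙 (H w x) * μ x)
    ex w = ∑[ x ∈ N ] (𝟙 (H w x) * (μ x ∸ 1))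
    dS w = ∑[ x ∈ S ] (𝟙 (H w x))
    exc = ∑[ x ∈ N ] (μ x ∸ 1)
    Q : Fin m → ℕ
    Q w = ∑[ x ∈ N ] (∑[ y ∈ N ] (𝟙 (not (x == y)) * ((𝟙 (H w x) * μ x) * (𝟙 (H w y) * μ y))))

    drop𝟙 : ∀ b n → 𝟙 b * n ≤ n
    drop𝟙 true  n = ≤-reflexive (*-identityˡ n)
    drop𝟙 false n = z≤n

    -- Neighbourhoods of distinct points of W share at most `cd` points, so up to |W|² `cd`
    -- repetitions, each of weight at most ρ, they are disjoint and weigh together no more than
    -- everything.
    overlaps : (W : List (Fin m)) → Unique W → (ν : Fin m → ℕ) → (∀ x → ν x ≤ ρ) →
               ∑[ w ∈ W ] (∑[ x ∈ N ] (𝟙 (H w x) * ν x)) ≤ ∑ N ν + length W * length W * (cd * ρ)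
    overlaps W u ν ν≤ρ = ≤-trans (≤-trans (≤-reflexive (∑-swap W N _)) (∑-mono N step)) (begin
        ∑[ x ∈ N ] (ν x + ν x * C W x)         ≡⟨ ∑-+ N ν _ ⟩
        ∑ N ν + ∑[ x ∈ N ] (ν x * C W x)       ≤⟨ +-monoʳ-≤ (∑ N ν) (∑-mono N (λ x → *-monoˡ-≤ (C W x) (ν≤ρ x))) ⟩
        ∑ N ν + ∑[ x ∈ N ] (ρ * C W x)         ≡⟨ cong (∑ N ν +_) (∑-*ˡ N ρ _) ⟩
        ∑ N ν + ρ * ∑[ x ∈ N ] (C W x)         ≤⟨ +-monoʳ-≤ (∑ N ν) (*-monoʳ-≤ ρ (count W u)) ⟩
        ∑ N ν + ρ * (length W * length W * cd) ≡⟨ cong (∑ N ν +_) (p ρ (length W * length W) cd) ⟩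
        ∑ N ν + length W * length W * (cd * ρ) ∎)
      where
      p : ∀ a b c → a * (b * c) ≡ b * (c * a)
      p = solve-∀
      -- Counts the pairs in the list that are both adjacent to x; by Bonferroni the degree of x
      -- into the list exceeds 1 by no more than this.
      C : List (Fin m) → Fin m → ℕ
      C []      x = 0
      C (w ∷ W) x = ∑[ w′ ∈ W ] (𝟙 (H w x) * 𝟙 (H w′ x)) + C W x
      bonferroni : ∀ W x → ∑[ w ∈ W ] (𝟙 (H w x)) ≤ 1 + C W x
      bonferroni []      x = z≤n
      bonferroni (w ∷ W) x with H w x
      ... | false = ≤-trans (bonferroni W x) (s≤s (m≤n+m _ _))
      ... | true  = s≤s (≤-trans (≤-reflexive (∑-cong W (λ w′ → sym (+-identityʳ _)))) (m≤m+n _ _))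
      step : ∀ x → ∑[ w ∈ W ] (𝟙 (H w x) * ν x) ≤ ν x + ν x * C W x
      step x = begin
        ∑[ w ∈ W ] (𝟙 (H w x) * ν x)  ≡⟨ ∑-*ʳ W (ν x) _ ⟩
        ∑[ w ∈ W ] (𝟙 (H w x)) * ν x  ≤⟨ *-monoˡ-≤ (ν x) (bonferroni W x) ⟩
        (1 + C W x) * ν x             ≡⟨ cong (ν x +_) (*-comm (C W x) (ν x)) ⟩
        ν x + ν x * C W x ∎
      count : ∀ W → Unique W → ∑[ x ∈ N ] (C W x) ≤ length W * length W * cd
      count []      u = ≤-reflexive (∑-zero N)
      count (w ∷ W) u@(_ ∷ u′) = begin
        ∑[ x ∈ N ] (∑[ w′ ∈ W ] (𝟙 (H w x) * 𝟙 (H w′ x)) + C W x)  ≡⟨ ∑-+ N _ _ ⟩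
        ∑[ x ∈ N ] (∑[ w′ ∈ W ] (𝟙 (H w x) * 𝟙 (H w′ x))) + ∑ N (C W) ≡⟨ cong (_+ ∑ N (C W)) (∑-swap N W _) ⟩
        ∑[ w′ ∈ W ] (∑[ x ∈ N ] (𝟙 (H w x) * 𝟙 (H w′ x))) + ∑ N (C W)
          ≤⟨ +-mono-≤ (∑-≤const W cd (λ w′∈ → codeg (λ e → Unique-head u (subst (_∈ W) (sym e) w′∈)))) (count W u′) ⟩
        length W * cd + length W * length W * cd  ≤⟨ ≤-by (suc (length W) * cd) (q (length W) cd) ⟩
        suc (length W) * suc (length W) * cd ∎
        where q : ∀ l c → suc l * suc l * c ≡ l * c + l * l * c + suc l * c
              q = solve-∀

    big mid : Fin m → Bool
    big w = t₁ ≤ᵇ D w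
    mid w = t₀ ≤ᵇ dS w

    Wbig = filt big N
    Wmid = filt (λ w → not (big w) ∧ mid w) N

    ∑-threshold : (W : List (Fin m)) (f : Fin m → ℕ) (t : ℕ) → (∀ {w} → w ∈ W → t ≤ f w) → length W * t ≤ ∑ W f
    ∑-threshold W f t h = ≤-trans (≤-reflexive (sym (∑-const W t))) (∑-mono∈ W h)

    length-take : ∀ i (xs : List A) → i ≤ length xs → length (take i xs) ≡ i
    length-take i xs le = trans (LP.length-take i xs) (m≤n⇒m⊓n≡m le)

    -- With more of them, `j` of them would weigh at least j t₁, which by `few` is more than nearly
    -- disjoint neighbourhoods can weigh.
    length-Wbig : length Wbig ≤ j
    length-Wbig with length Wbig ≤? j
    ... | yes le = le
    ... | no ¬le = ⊥-elim (<⇒≱ few (begin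
        j * t₁                 ≡⟨ cong (_* t₁) (length-take j Wbig j≤) ⟨
        length T * t₁          ≤⟨ ∑-threshold T D t₁ (λ {w} i → ≤ᵇ-true t₁ (D w) (proj₂ (∈-filt⁻ big N (⊆⇒∈ (take-⊆ j Wbig) i)))) ⟩
        ∑ T D                  ≤⟨ overlaps T (⊆⇒Unique (take-⊆ j Wbig) (⊆⇒Unique (filt-⊆ big N) (fins-Unique m))) μ μ≤ρ ⟩
        ∑ N μ + length T * length T * (cd * ρ) ≡⟨ cong (λ t → ∑ N μ + t * t * (cd * ρ)) (length-take j Wbig j≤) ⟩
        ∑ N μ + ovl        ≤⟨ +-monoˡ-≤ ovl ∑μ≤k ⟩
        k + ovl ∎))
      where T = take j Wbig
            j≤ = <⇒≤ (≰⇒> ¬le)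

    overlaps-big : (ν : Fin m → ℕ) → (∀ x → ν x ≤ ρ) → ∑[ w ∈ Wbig ] (∑[ x ∈ N ] (𝟙 (H w x) * ν x)) ≤ ∑ N ν + ovl
    overlaps-big ν ν≤ = ≤-trans (overlaps Wbig (⊆⇒Unique (filt-⊆ big N) (fins-Unique m)) ν ν≤)
      (+-monoʳ-≤ (∑ N ν) (*-monoˡ-≤ (cd * ρ) (*-mono-≤ length-Wbig length-Wbig)))

    ex≤D : ∀ w → ex w ≤ D w
    ex≤D w = ∑-mono N (λ x → *-monoʳ-≤ (𝟙 (H w x)) (m∸n≤m (μ x) 1))

    D≤ex+Δ : ∀ w → D w ≤ ex w + Δ
    D≤ex+Δ w = begin
      D w                                              ≤⟨ ∑-mono N (λ x → ≤-trans (*-monoʳ-≤ (𝟙 (H w x)) (le (μ x))) (≤-reflexive (trans (*-distribˡ-+ (𝟙 (H w x)) (μ x ∸ 1) 1) (cong (𝟙 (H w x) * (μ x ∸ 1) +_) (*-identityʳ _))))) ⟩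
      ∑[ x ∈ N ] (𝟙 (H w x) * (μ x ∸ 1) + 𝟙 (H w x))   ≡⟨ ∑-+ N _ _ ⟩
      ex w + ∑[ x ∈ N ] (𝟙 (H w x))                    ≤⟨ +-monoʳ-≤ (ex w) (deg w) ⟩
      ex w + Δ ∎
      where le : ∀ a → a ≤ (a ∸ 1) + 1
            le zero    = z≤n
            le (suc a) = ≤-reflexive (+-comm 1 a)

    ex≤exc : ∀ w → ex w ≤ exc
    ex≤exc w = ∑-mono N (λ x → drop𝟙 (H w x) (μ x ∸ 1))

    ex≤ρΔ : ∀ w → ex w ≤ ρ * Δ
    ex≤ρΔ w = begin
      ex w                           ≤⟨ ∑-mono N (λ x → *-monoʳ-≤ (𝟙 (H w x)) (≤-trans (m∸n≤m (μ x) 1) (μ≤ρ x))) ⟩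
      ∑[ x ∈ N ] (𝟙 (H w x) * ρ)     ≡⟨ ∑-*ʳ N ρ _ ⟩
      ∑[ x ∈ N ] (𝟙 (H w x)) * ρ     ≤⟨ *-monoˡ-≤ ρ (deg w) ⟩
      Δ * ρ                          ≡⟨ *-comm Δ ρ ⟩
      ρ * Δ ∎

    Q≤D² : ∀ w → Q w ≤ D w * D w
    Q≤D² w = ≤-trans (∑-mono N (λ x → ∑-mono N (λ y → drop𝟙 (not (x == y)) _))) (≤-reflexive (∑-*∑ N N _ _))

    -- D ≤ ex + Δ splits the square into ex² + 2ΔD. In ex² one factor is bounded by τ and the other
    -- is summed; with τ = min(u, ρΔ) this becomes the term u min(u, T), while 2ΔD is an error since
    -- plain degrees are small.
    bigPart : ∀ τ → (∀ w → ex w ≤ τ) → ∑[ w ∈ Wbig ] (Q w) ≤ τ * (exc + ovl) + 2 * Δ * (k + ovl)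
    bigPart τ ex≤τ = begin
      ∑ Wbig Q                                            ≤⟨ ∑-mono Wbig pt ⟩
      ∑[ w ∈ Wbig ] (τ * ex w + 2 * Δ * D w)              ≡⟨ ∑-+ Wbig _ _ ⟩
      ∑[ w ∈ Wbig ] (τ * ex w) + ∑[ w ∈ Wbig ] (2 * Δ * D w) ≡⟨ cong₂ _+_ (∑-*ˡ Wbig τ ex) (∑-*ˡ Wbig (2 * Δ) D) ⟩
      τ * ∑ Wbig ex + 2 * Δ * ∑ Wbig D                    ≤⟨ +-mono-≤ (*-monoʳ-≤ τ (overlaps-big (λ x → μ x ∸ 1) (λ x → ≤-trans (m∸n≤m (μ x) 1) (μ≤ρ x))))
                                                              (*-monoʳ-≤ (2 * Δ) (≤-trans (overlaps-big μ μ≤ρ) (+-monoˡ-≤ ovl ∑μ≤k))) ⟩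
      τ * (exc + ovl) + 2 * Δ * (k + ovl) ∎
      where
      p : ∀ e D → (e + D) * D ≡ e * D + D * D
      p = solve-∀
      pt : ∀ w → Q w ≤ τ * ex w + 2 * Δ * D w
      pt w = begin
        Q w                              ≤⟨ Q≤D² w ⟩
        D w * D w                        ≤⟨ *-monoˡ-≤ (D w) (D≤ex+Δ w) ⟩
        (ex w + Δ) * D w                 ≡⟨ *-distribʳ-+ (D w) (ex w) Δ ⟩
        ex w * D w + Δ * D w             ≤⟨ +-monoˡ-≤ (Δ * D w) (*-monoʳ-≤ (ex w) (D≤ex+Δ w)) ⟩
        ex w * (ex w + Δ) + Δ * D w      ≡⟨ cong (_+ Δ * D w) (*-distribˡ-+ (ex w) (ex w) Δ) ⟩
        ex w * ex w + ex w * Δ + Δ * D w ≤⟨ +-monoˡ-≤ (Δ * D w) (+-mono-≤ (*-monoˡ-≤ (ex w) (ex≤τ w)) (*-monoˡ-≤ Δ (ex≤D w))) ⟩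
        τ * ex w + D w * Δ + Δ * D w     ≡⟨ q (τ * ex w) (D w) Δ ⟩
        τ * ex w + 2 * Δ * D w ∎
        where q : ∀ a b c → a + b * c + c * b ≡ a + 2 * c * b
              q = solve-∀

    length-S : length S ≤ k
    length-S = ≤-trans (≤-reflexive (length-filt _ N)) (≤-trans (∑-mono N (λ x → le (μ x))) ∑μ≤k)
      where le : ∀ a → 𝟙 (1 ≤ᵇ a) ≤ a
            le zero    = z≤n
            le (suc a) = s≤s z≤n

    S∈subs : S ∈ subs k N
    S∈subs = ∈-subs (filt-⊆ _ N) length-S

    D≤ρdS : ∀ w → D w ≤ ρ * dS w
    D≤ρdS w = begin
      D w                                                ≤⟨ ∑-mono N pt ⟩
      ∑[ x ∈ N ] (ρ * (𝟙 (1 ≤ᵇ μ x) * 𝟙 (H w x)))        ≡⟨ ∑-*ˡ N ρ _ ⟩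
      ρ * ∑[ x ∈ N ] (𝟙 (1 ≤ᵇ μ x) * 𝟙 (H w x))          ≡⟨ cong (ρ *_) (∑-filt _ N _) ⟨
      ρ * dS w ∎
      where pt : ∀ x → 𝟙 (H w x) * μ x ≤ ρ * (𝟙 (1 ≤ᵇ μ x) * 𝟙 (H w x))
            pt x with μ x in eq
            ... | zero  = ≤-trans (≤-reflexive (*-zeroʳ (𝟙 (H w x)))) z≤n
            ... | suc a = ≤-trans (≤-reflexive (*-comm (𝟙 (H w x)) (suc a)))
                            (*-mono-≤ (subst (_≤ ρ) eq (μ≤ρ x)) (≤-reflexive (sym (*-identityˡ _))))

    -- `sparse` speaks about at most `k` points. More than `k` cannot occur, since `k` of them would
    -- already send k t₀ > L₁ edges into `S`.
    sparse-mid : ∑ Wmid dS ≤ L₁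
    sparse-mid with length Wmid ≤? k
    ... | yes le = sparse (∈-subs (filt-⊆ _ N) le) S∈subs
    ... | no ¬le = ⊥-elim (<⇒≱ L₁<kt₀ (begin
        k * t₀         ≡⟨ cong (_* t₀) (length-take k Wmid (<⇒≤ (≰⇒> ¬le))) ⟨
        length T * t₀  ≤⟨ ∑-threshold T dS t₀ (λ {w} i → ≤ᵇ-true t₀ (dS w) (proj₂ (∧-true {not (big w)} (proj₂ (∈-filt⁻ (λ w → not (big w) ∧ mid w) N (⊆⇒∈ (take-⊆ k Wmid) i)))))) ⟩
        ∑ T dS         ≤⟨ sparse (∈-subs (⊆-trans (take-⊆ k Wmid) (filt-⊆ _ N)) (≤-reflexive (length-take k Wmid (<⇒≤ (≰⇒> ¬le))))) S∈subs ⟩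
        L₁ ∎))
      where T = take k Wmid

    midPart : ∑ Wmid Q ≤ t₁ * (ρ * L₁)
    midPart = begin
      ∑ Wmid Q                            ≤⟨ ∑-mono∈ Wmid pt ⟩
      ∑[ w ∈ Wmid ] (t₁ * (ρ * dS w))     ≡⟨ ∑-*ˡ Wmid t₁ _ ⟩
      t₁ * ∑[ w ∈ Wmid ] (ρ * dS w)       ≡⟨ cong (t₁ *_) (∑-*ˡ Wmid ρ dS) ⟩
      t₁ * (ρ * ∑ Wmid dS)                ≤⟨ *-monoʳ-≤ t₁ (*-monoʳ-≤ ρ sparse-mid) ⟩
      t₁ * (ρ * L₁) ∎
      where
      pt : ∀ {w} → w ∈ Wmid → Q w ≤ t₁ * (ρ * dS w)
      pt {w} i = ≤-trans (Q≤D² w) (*-mono-≤ le (D≤ρdS w))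
        where nb : big w ≡ false
              nb = not-true (proj₁ (∧-true (proj₂ (∈-filt⁻ (λ w → not (big w) ∧ mid w) N i))))
              le : D w ≤ t₁
              le with t₁ ≤? D w
              ... | yes l = ⊥-elim (true≢false (≤ᵇ-intro l) nb)
              ... | no ¬l = <⇒≤ (≰⇒> ¬l)

    X : ℕ → List (Fin m)
    X i = filt (λ x → i <ᵇ μ x) N

    ∑X≤∑S : ∀ i (f : Fin m → ℕ) → ∑ (X i) f ≤ ∑ S f
    ∑X≤∑S i f = ≤-trans (≤-reflexive (∑-filt _ N f)) (≤-trans (∑-mono N (λ x → *-monoˡ-≤ (f x) (le (μ x)))) (≤-reflexive (sym (∑-filt _ N f))))
      where le : ∀ a → 𝟙 (i <ᵇ a) ≤ 𝟙 (1 ≤ᵇ a)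
            le zero    = z≤n
            le (suc a) = 𝟙≤1 _

    length-X : ∀ i → length (X i) ≤ k
    length-X i = ≤-trans (≤-reflexive (sym (∑-1 (X i)))) (≤-trans (∑X≤∑S i (λ _ → 1)) (≤-trans (≤-reflexive (∑-1 S)) length-S))

    X∈subs : ∀ i → X i ∈ subs k N
    X∈subs i = ∈-subs (filt-⊆ _ N) (length-X i)

    ∑-length-X : ∑[ i ∈ levels ρ ] (length (X i)) ≤ k
    ∑-length-X = begin
      ∑[ i ∈ levels ρ ] (length (X i))                    ≡⟨ ∑-cong (levels ρ) (λ i → length-filt _ N) ⟩
      ∑[ i ∈ levels ρ ] (∑[ x ∈ N ] (𝟙 (i <ᵇ μ x)))       ≡⟨ ∑-swap (levels ρ) N _ ⟩
      ∑[ x ∈ N ] (∑[ i ∈ levels ρ ] (𝟙 (i <ᵇ μ x)))       ≡⟨ ∑-cong N (λ x → layer-cake ρ (μ x) (μ≤ρ x)) ⟩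
      ∑ N μ                                               ≤⟨ ∑μ≤k ⟩
      k ∎

    -- Layer cake: μ is the sum of the indicators of its level sets, so weighted pairs become pairs
    -- between two sets, which is what `joint` is about.
    Q-layers : ∀ w → Q w ≡ ∑[ i ∈ levels ρ ] (∑[ l ∈ levels ρ ] (hitsBoth (X i) (X l) w))
    Q-layers w = sym (trans (∑-cong (levels ρ) (λ i → ∑-cong (levels ρ) (λ l → unf i l)))
      (trans (∑-cong (levels ρ) (λ i → trans (∑-swap (levels ρ) N _) (∑-cong N (λ x → ∑-swap (levels ρ) N _))))
      (trans (∑-swap (levels ρ) N _) (∑-cong N (λ x → trans (∑-swap (levels ρ) N _) (∑-cong N (λ y → fold x y)))))))
      where
      T : Fin m → Fin m → ℕ
      T x y = 𝟙 (not (x == y)) * (𝟙 (H w x) * 𝟙 (H w y))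
      unf : ∀ i l → hitsBoth (X i) (X l) w ≡ ∑[ x ∈ N ] (∑[ y ∈ N ] (T x y * (𝟙 (i <ᵇ μ x) * 𝟙 (l <ᵇ μ y))))
      unf i l = trans (∑-filt _ N _) (∑-cong N (λ x → trans (cong (𝟙 (i <ᵇ μ x) *_) (∑-filt _ N _))
        (trans (sym (∑-*ˡ N (𝟙 (i <ᵇ μ x)) _)) (∑-cong N (λ y → p (𝟙 (i <ᵇ μ x)) (𝟙 (l <ᵇ μ y)) (T x y))))))
        where p : ∀ a b c → a * (b * c) ≡ c * (a * b)
              p = solve-∀
      fold : ∀ x y → ∑[ i ∈ levels ρ ] (∑[ l ∈ levels ρ ] (T x y * (𝟙 (i <ᵇ μ x) * 𝟙 (l <ᵇ μ y)))) ≡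
             𝟙 (not (x == y)) * ((𝟙 (H w x) * μ x) * (𝟙 (H w y) * μ y))
      fold x y = trans (∑-cong (levels ρ) (λ i → ∑-*ˡ (levels ρ) (T x y) _)) (trans (∑-*ˡ (levels ρ) (T x y) _)
        (trans (cong (T x y *_) (trans (∑-*∑ (levels ρ) (levels ρ) _ _) (cong₂ _*_ (layer-cake ρ (μ x) (μ≤ρ x)) (layer-cake ρ (μ y) (μ≤ρ y)))))
          (p (𝟙 (not (x == y))) (𝟙 (H w x)) (𝟙 (H w y)) (μ x) (μ y))))
        where p : ∀ a b c d e → a * (b * c) * (d * e) ≡ a * ((b * d) * (c * e))
              p = solve-∀

    hitsBoth≤ : ∀ i l w → dS w < t₀ → hitsBoth (X i) (X l) w ≤ t₀ * t₀ * 𝟙 (1 ≤ᵇ hitsBoth (X i) (X l) w)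
    hitsBoth≤ i l w lt = cut (hitsBoth (X i) (X l) w) (begin
        hitsBoth (X i) (X l) w
          ≤⟨ ∑-mono (X i) (λ x → ∑-mono (X l) (λ y → drop𝟙 (not (x == y)) _)) ⟩
        ∑[ x ∈ X i ] (∑[ y ∈ X l ] (𝟙 (H w x) * 𝟙 (H w y))) ≡⟨ ∑-*∑ (X i) (X l) _ _ ⟩
        ∑[ x ∈ X i ] (𝟙 (H w x)) * ∑[ y ∈ X l ] (𝟙 (H w y)) ≤⟨ *-mono-≤ (∑X≤∑S i _) (∑X≤∑S l _) ⟩
        dS w * dS w                                          ≤⟨ *-mono-≤ (<⇒≤ lt) (<⇒≤ lt) ⟩
        t₀ * t₀ ∎)
      where cut : ∀ n → n ≤ t₀ * t₀ → n ≤ t₀ * t₀ * 𝟙 (1 ≤ᵇ n)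
            cut zero    le = z≤n
            cut (suc n) le = ≤-trans le (≤-reflexive (sym (*-identityʳ _)))

    -- Such a w closes at most t₀² pairs between two level sets, so only the number of w touching
    -- both matters. The level sets have total size at most k, which turns the sum of |Xᵢ| |Xₗ| into
    -- k².
    lowPart : β * ∑[ w ∈ N ] (𝟙 (not (mid w)) * Q w) ≤ t₀ * t₀ * (α * (k * k) + ρ * ρ * γ)
    lowPart = begin
      β * ∑[ w ∈ N ] (𝟙 (not (mid w)) * Q w)
        ≤⟨ *-monoʳ-≤ β (∑-mono N pt) ⟩
      β * ∑[ w ∈ N ] (∑[ i ∈ levels ρ ] (∑[ l ∈ levels ρ ] (t₀ * t₀ * b i l w)))
        ≡⟨ cong (β *_) (trans (∑-swap N (levels ρ) _) (∑-cong (levels ρ) (λ i → ∑-swap N (levels ρ) _))) ⟩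
      β * ∑[ i ∈ levels ρ ] (∑[ l ∈ levels ρ ] (∑[ w ∈ N ] (t₀ * t₀ * b i l w)))
        ≡⟨ trans (sym (∑-*ˡ (levels ρ) β _)) (∑-cong (levels ρ) (λ i → sym (∑-*ˡ (levels ρ) β _))) ⟩
      ∑[ i ∈ levels ρ ] (∑[ l ∈ levels ρ ] (β * ∑[ w ∈ N ] (t₀ * t₀ * b i l w)))
        ≤⟨ ∑-mono (levels ρ) (λ i → ∑-mono (levels ρ) (λ l → each i l)) ⟩
      ∑[ i ∈ levels ρ ] (∑[ l ∈ levels ρ ] (t₀ * t₀ * (α * (length (X i) * length (X l)) + γ)))
        ≡⟨ ∑-cong (levels ρ) (λ i → trans (∑-*ˡ (levels ρ) (t₀ * t₀) _) (cong (t₀ * t₀ *_) (trans (∑-+ (levels ρ) _ _) (cong₂ _+_ (∑-*ˡ (levels ρ) α _) (∑-const (levels ρ) γ))))) ⟩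
      ∑[ i ∈ levels ρ ] (t₀ * t₀ * (α * ∑[ l ∈ levels ρ ] (length (X i) * length (X l)) + length (levels ρ) * γ))
        ≡⟨ trans (∑-*ˡ (levels ρ) (t₀ * t₀) _) (cong (t₀ * t₀ *_) (trans (∑-+ (levels ρ) _ _) (cong₂ _+_ (∑-*ˡ (levels ρ) α _) (∑-const (levels ρ) _)))) ⟩
      t₀ * t₀ * (α * ∑[ i ∈ levels ρ ] (∑[ l ∈ levels ρ ] (length (X i) * length (X l))) + length (levels ρ) * (length (levels ρ) * γ))
        ≡⟨ cong₂ (λ s t → t₀ * t₀ * (α * s + t)) (∑-*∑ (levels ρ) (levels ρ) _ _) (trans (cong (λ t → t * (t * γ)) (length-levels ρ)) (sym (*-assoc ρ ρ γ))) ⟩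
      t₀ * t₀ * (α * (Σx * Σx) + ρ * ρ * γ)
        ≤⟨ *-monoʳ-≤ (t₀ * t₀) (+-monoˡ-≤ (ρ * ρ * γ) (*-monoʳ-≤ α (*-mono-≤ ∑-length-X ∑-length-X))) ⟩
      t₀ * t₀ * (α * (k * k) + ρ * ρ * γ) ∎
      where
      Σx = ∑[ i ∈ levels ρ ] (length (X i))
      b : ℕ → ℕ → Fin m → ℕ
      b i l w = 𝟙 (1 ≤ᵇ hitsBoth (X i) (X l) w)
      pt : ∀ w → 𝟙 (not (mid w)) * Q w ≤ ∑[ i ∈ levels ρ ] (∑[ l ∈ levels ρ ] (t₀ * t₀ * b i l w))
      pt w with mid w in eq
      ... | true  = z≤n
      ... | false = ≤-trans (≤-reflexive (trans (*-identityˡ (Q w)) (Q-layers w)))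
                      (∑-mono (levels ρ) (λ i → ∑-mono (levels ρ) (λ l → hitsBoth≤ i l w lt)))
        where lt : dS w < t₀
              lt with t₀ ≤? dS w
              ... | yes l = ⊥-elim (true≢false (≤ᵇ-intro l) eq)
              ... | no ¬l = ≰⇒> ¬l
      each : ∀ i l → β * ∑[ w ∈ N ] (t₀ * t₀ * b i l w) ≤ t₀ * t₀ * (α * (length (X i) * length (X l)) + γ)
      each i l = begin
        β * ∑[ w ∈ N ] (t₀ * t₀ * b i l w)   ≡⟨ cong (β *_) (∑-*ˡ N (t₀ * t₀) _) ⟩
        β * (t₀ * t₀ * ∑[ w ∈ N ] (b i l w)) ≡⟨ p β (t₀ * t₀) _ ⟩
        t₀ * t₀ * (β * ∑[ w ∈ N ] (b i l w)) ≤⟨ *-monoʳ-≤ (t₀ * t₀) (joint (X∈subs i) (X∈subs l)) ⟩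
        t₀ * t₀ * (α * (length (X i) * length (X l)) + γ) ∎
        where p : ∀ a b c → a * (b * c) ≡ b * (a * c)
              p = solve-∀

    Q-split : ∑ N Q ≤ ∑ Wbig Q + ∑ Wmid Q + ∑[ w ∈ N ] (𝟙 (not (mid w)) * Q w)
    Q-split = ≤-trans (∑-mono N pt) (≤-reflexive (trans (∑-+ N _ _) (cong (_+ ∑[ w ∈ N ] (𝟙 (not (mid w)) * Q w)) (trans (∑-+ N _ _) (cong₂ _+_ (sym (∑-filt _ N Q)) (sym (∑-filt _ N Q)))))))
      where pt : ∀ w → Q w ≤ 𝟙 (big w) * Q w + 𝟙 (not (big w) ∧ mid w) * Q w + 𝟙 (not (mid w)) * Q w
            pt w with big w | mid w
            ... | true  | _     = ≤-trans (≤-reflexive (sym (*-identityˡ (Q w)))) (≤-trans (m≤m+n _ _) (m≤m+n _ _))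
            ... | false | true  = ≤-trans (≤-reflexive (sym (*-identityˡ (Q w)))) (m≤m+n _ _)
            ... | false | false = ≤-reflexive (sym (*-identityˡ (Q w)))

    closers-bound : ∀ τ → (∀ w → ex w ≤ τ) →
      β * ∑ N Q ≤ β * (τ * (exc + ovl) + 2 * Δ * (k + ovl) + t₁ * (ρ * L₁)) + t₀ * t₀ * (α * (k * k) + ρ * ρ * γ)
    closers-bound τ ex≤τ = begin
      β * ∑ N Q                                                   ≤⟨ *-monoʳ-≤ β Q-split ⟩
      β * (∑ Wbig Q + ∑ Wmid Q + ∑[ w ∈ N ] (𝟙 (not (mid w)) * Q w)) ≡⟨ *-distribˡ-+ β (∑ Wbig Q + ∑ Wmid Q) _ ⟩
      β * (∑ Wbig Q + ∑ Wmid Q) + β * ∑[ w ∈ N ] (𝟙 (not (mid w)) * Q w)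
        ≤⟨ +-mono-≤ (*-monoʳ-≤ β (+-mono-≤ (bigPart τ ex≤τ) midPart)) lowPart ⟩
      β * (τ * (exc + ovl) + 2 * Δ * (k + ovl) + t₁ * (ρ * L₁)) + t₀ * t₀ * (α * (k * k) + ρ * ρ * γ) ∎

-- Tail bounds with explicit constants

module LargeDeviations where

  open import Data.Nat
  open import Data.Nat.Properties
  open import Data.Nat.Tactic.RingSolver using (solve-∀)
  open import Data.Bool using (Bool; true)
  open import Data.Fin using (Fin; zero; suc)
  open import Data.List using (List; _∷_; length)
  open import Data.List.Membership.Propositional using (_∈_)
  open import Data.List.Relation.Unary.Any using (here; there)
  open import Data.List.Relation.Unary.All using (_∷_)
  open import Data.List.Relation.Unary.AllPairs using (_∷_)
  open import Data.List.Relation.Unary.Unique.Propositional using (Unique)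
  open import Data.Product using (∃; _×_; _,_)
  open import Data.Empty using (⊥-elim)
  open import Data.Unit using (tt)
  open import Relation.Binary.PropositionalEquality
  open import Function using (_∘_)
  open Sums
  open Expectation
  open Events

  private
    variable
      A B V : Set

  ∑-pos : (xs : List A) (f : A → ℕ) → 1 ≤ ∑ xs f → ∃ λ x → x ∈ xs × 1 ≤ f x
  ∑-pos (x ∷ xs) f le with f x in eq
  ... | suc n = x , here refl , ≤-trans (s≤s z≤n) (≤-reflexive (sym eq))
  ... | zero  = let (y , y∈ , l) = ∑-pos xs f le in y , there y∈ , l

  𝟙-pos : ∀ {b} → 1 ≤ 𝟙 b → b ≡ true
  𝟙-pos {true} _ = refl

  *-pos : ∀ a b → 1 ≤ a * b → 1 ≤ a × 1 ≤ b
  *-pos (suc a) (suc b) _ = s≤s z≤n , s≤s z≤n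
  *-pos (suc a) zero le = ⊥-elim (<⇒≱ le (≤-reflexive (*-zeroʳ a)))

  -- By `pow-bernoulli` D₁ factors 1 + 1/(100 D₁) amount to at most 100/99, and there are at most M
  -- such blocks of factors.
  bernoulli-steps : (D₁ M N : ℕ) .{{_ : NonZero D₁}} → N ≤ D₁ * M → suc (100 * D₁) ^ N * 99 ^ M ≤ 100 ^ M * (100 * D₁) ^ N
  bernoulli-steps D₁ M N le = *-cancelʳ-≤ _ _ (X ^ e) {{m^n≢0 X e}} (begin
      suc X ^ N * 99 ^ M * X ^ e        ≤⟨ *-monoʳ-≤ (suc X ^ N * 99 ^ M) (^-monoˡ-≤ e (n≤1+n X)) ⟩
      suc X ^ N * 99 ^ M * suc X ^ e    ≡⟨ p (suc X ^ N) (99 ^ M) (suc X ^ e) ⟩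
      suc X ^ N * suc X ^ e * 99 ^ M    ≡⟨ cong (_* 99 ^ M) (^-distribˡ-+-* (suc X) N e) ⟨
      suc X ^ (N + e) * 99 ^ M          ≡⟨ cong (λ t → suc X ^ t * 99 ^ M) (m+[n∸m]≡n le) ⟩
      suc X ^ (D₁ * M) * 99 ^ M         ≡⟨ cong (_* 99 ^ M) (^-*-assoc (suc X) D₁ M) ⟨
      (suc X ^ D₁) ^ M * 99 ^ M         ≡⟨ ^-distribʳ-* (suc X ^ D₁) 99 M ⟨
      (suc X ^ D₁ * 99) ^ M             ≤⟨ ^-monoˡ-≤ M one ⟩
      (100 * X ^ D₁) ^ M                ≡⟨ ^-distribʳ-* 100 (X ^ D₁) M ⟩
      100 ^ M * (X ^ D₁) ^ M            ≡⟨ cong (100 ^ M *_) (^-*-assoc X D₁ M) ⟩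
      100 ^ M * X ^ (D₁ * M)            ≡⟨ cong (λ t → 100 ^ M * X ^ t) (m+[n∸m]≡n le) ⟨
      100 ^ M * X ^ (N + e)             ≡⟨ cong (100 ^ M *_) (^-distribˡ-+-* X N e) ⟩
      100 ^ M * (X ^ N * X ^ e)         ≡⟨ *-assoc (100 ^ M) _ _ ⟨
      100 ^ M * X ^ N * X ^ e ∎)
    where
    open ≤-Reasoning
    e = D₁ * M ∸ N
    X = 100 * D₁
    instance
      nzX : NonZero X
      nzX = m*n≢0 100 D₁
    p : ∀ a b c → a * b * c ≡ a * c * b
    p = solve-∀
    one : suc X ^ D₁ * 99 ≤ 100 * X ^ D₁
    one = *-cancelʳ-≤ _ _ D₁ (begin
      suc X ^ D₁ * 99 * D₁    ≡⟨ *-assoc (suc X ^ D₁) 99 D₁ ⟩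
      suc X ^ D₁ * (99 * D₁)  ≤⟨ pow-bernoulli D₁ (99 * D₁) ⟩
      X ^ D₁ * X              ≡⟨ q (X ^ D₁) D₁ ⟩
      100 * X ^ D₁ * D₁ ∎)
      where q : ∀ a b → a * (100 * b) ≡ 100 * a * b
            q = solve-∀

  abstract
    -- Mean 170, threshold 187 and tilt 11/10 gain 187 log (11/10) - 1700 log (100/99), which is
    -- about 0.737 and exceeds log 2 = 0.693.
    chernoff-base : 2 * (10 ^ 187 * 100 ^ 1700) ≤ 11 ^ 187 * 99 ^ 1700
    chernoff-base = ≤ᵇ⇒≤ _ _ tt

  module _ (vs : List V) (hit : V → Bool) (hit≤1 : ∑ vs (𝟙 ∘ hit) ≤ 1) where

    -- P (hits ≥ 11/10 of the mean) is exponentially small: (100/99)^1700 (10/11)^187 ≤ 1/2.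
    chernoff : ∀ {K} {cs : List (Fin K)} → Unique cs → (D₁ s : ℕ) .{{_ : NonZero D₁}} → length vs ≡ 10 * D₁ →
               length cs ≤ 170 * length vs * s →
               E vs (many vs hit hit≤1 cs (187 * s)) * 2 ^ s ≤ total vs K
    chernoff {K} {cs} u D₁ s D≡ le = *-cancelʳ-≤ _ _ (Q ^ s) {{m^n≢0 Q s {{nzQ}}}} (begin
        e * 2 ^ s * Q ^ s                      ≡⟨ *-assoc e (2 ^ s) (Q ^ s) ⟩
        e * (2 ^ s * Q ^ s)                    ≡⟨ cong (e *_) (^-distribʳ-* 2 Q s) ⟨
        e * (2 * Q) ^ s                        ≤⟨ *-monoʳ-≤ e (^-monoˡ-≤ s chernoff-base) ⟩
        e * P ^ s                              ≤⟨ *-cancelʳ-≤ _ _ (X ^ N) {{m^n≢0 X N}} main ⟩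
        tot * Q ^ s ∎)
      where
      open ≤-Reasoning
      e = E vs (many vs hit hit≤1 cs (187 * s))
      tot = total vs K
      N = length cs
      P = 11 ^ 187 * 99 ^ 1700
      Q = 10 ^ 187 * 100 ^ 1700
      nzQ : NonZero Q
      nzQ = m*n≢0 (10 ^ 187) (100 ^ 1700) {{m^n≢0 10 187}} {{m^n≢0 100 1700}}
      X = 100 * D₁
      instance
        nzX : NonZero X
        nzX = m*n≢0 100 D₁
      N≤ : N ≤ D₁ * (1700 * s)
      N≤ = ≤-trans le (≤-reflexive (trans (cong (λ t → 170 * t * s) D≡) (q D₁ s)))
        where q : ∀ a s → 170 * (10 * a) * s ≡ a * (1700 * s)
              q = solve-∀
      pw : ∀ a b c d → (a ^ b * c ^ d) ^ s ≡ a ^ (b * s) * c ^ (d * s)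
      pw a b c d = trans (^-distribʳ-* (a ^ b) (c ^ d) s) (cong₂ _*_ (^-*-assoc a b s) (^-*-assoc c d s))
      10D : 10 * length vs + 1 ≡ suc X
      10D = trans (cong (λ t → 10 * t + 1) D≡) (q D₁)
        where q : ∀ a → 10 * (10 * a) + 1 ≡ suc (100 * a)
              q = solve-∀
      XN : 10 ^ N * length vs ^ N ≡ X ^ N
      XN = trans (sym (^-distribʳ-* 10 (length vs) N)) (cong (_^ N) (trans (cong (10 *_) D≡) (sym (*-assoc 10 10 D₁))))
      main : e * P ^ s * X ^ N ≤ tot * Q ^ s * X ^ N
      main = begin
        e * P ^ s * X ^ N                                        ≡⟨ cong (λ t → e * t * X ^ N) (pw 11 187 99 1700) ⟩
        e * (11 ^ (187 * s) * 99 ^ (1700 * s)) * X ^ N           ≡⟨ q₁ e (11 ^ (187 * s)) (99 ^ (1700 * s)) (X ^ N) ⟩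
        e * (11 ^ (187 * s) * X ^ N) * 99 ^ (1700 * s)           ≡⟨ cong (λ t → e * (11 ^ (187 * s) * t) * 99 ^ (1700 * s)) XN ⟨
        e * (11 ^ (187 * s) * (10 ^ N * length vs ^ N)) * 99 ^ (1700 * s) ≡⟨ cong (λ t → e * t * 99 ^ (1700 * s)) (sym (*-assoc (11 ^ (187 * s)) _ _)) ⟩
        e * (11 ^ (187 * s) * 10 ^ N * length vs ^ N) * 99 ^ (1700 * s) ≤⟨ *-monoˡ-≤ (99 ^ (1700 * s)) (E-many vs hit hit≤1 u 10 1 (187 * s)) ⟩
        10 ^ (187 * s) * ((10 * length vs + 1) ^ N * tot) * 99 ^ (1700 * s) ≡⟨ cong (λ t → 10 ^ (187 * s) * (t ^ N * tot) * 99 ^ (1700 * s)) 10D ⟩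
        10 ^ (187 * s) * (suc X ^ N * tot) * 99 ^ (1700 * s)     ≡⟨ q₂ (10 ^ (187 * s)) (suc X ^ N) tot (99 ^ (1700 * s)) ⟩
        10 ^ (187 * s) * tot * (suc X ^ N * 99 ^ (1700 * s))     ≤⟨ *-monoʳ-≤ (10 ^ (187 * s) * tot) (bernoulli-steps D₁ (1700 * s) N N≤) ⟩
        10 ^ (187 * s) * tot * (100 ^ (1700 * s) * X ^ N)        ≡⟨ q₃ (10 ^ (187 * s)) tot (100 ^ (1700 * s)) (X ^ N) ⟩
        tot * (10 ^ (187 * s) * 100 ^ (1700 * s)) * X ^ N        ≡⟨ cong (λ t → tot * t * X ^ N) (pw 10 187 100 1700) ⟨
        tot * Q ^ s * X ^ N ∎
        where q₁ : ∀ a b c d → a * (b * c) * d ≡ a * (b * d) * c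
              q₁ = solve-∀
              q₂ : ∀ a b c d → a * (b * c) * d ≡ a * c * (b * d)
              q₂ = solve-∀
              q₃ : ∀ a b c d → a * b * (c * d) ≡ b * (a * c) * d
              q₃ = solve-∀

    -- The tilt is 5 = 1 + 4: as `length vs` is 4 D, each coordinate contributes 1 + 1/D, in total
    -- at most 8^c. Weakening 5^j to 4^j keeps the bound among powers of 2.
    many-5^j : ∀ {K} {cs : List (Fin K)} → Unique cs → (D c j : ℕ) .{{_ : NonZero D}} → length vs ≡ 4 * D →
               length cs ≤ c * D → E vs (many vs hit hit≤1 cs j) * 4 ^ j ≤ 8 ^ c * total vs K
    many-5^j {K} {cs} u D c j D≡ le = *-cancelʳ-≤ _ _ (length vs ^ N) {{m^n≢0 (length vs) N {{nz}}}} (begin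
        e * 4 ^ j * length vs ^ N        ≤⟨ *-monoˡ-≤ (length vs ^ N) (*-monoʳ-≤ e (^-monoˡ-≤ j (n≤1+n 4))) ⟩
        e * 5 ^ j * length vs ^ N        ≡⟨ q₁ e (5 ^ j) (length vs ^ N) ⟩
        e * (5 ^ j * 1 * length vs ^ N)  ≡⟨ cong (λ t → e * (5 ^ j * t * length vs ^ N)) (^-zeroˡ N) ⟨
        e * (5 ^ j * 1 ^ N * length vs ^ N) ≤⟨ E-many vs hit hit≤1 u 1 4 j ⟩
        1 ^ j * ((1 * length vs + 4) ^ N * total vs K) ≡⟨ trans (cong (_* ((1 * length vs + 4) ^ N * total vs K)) (^-zeroˡ j)) (*-identityˡ _) ⟩
        (1 * length vs + 4) ^ N * total vs K ≡⟨ cong (λ t → t ^ N * total vs K) (trans (cong (λ t → 1 * t + 4) D≡) (q₂ D)) ⟩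
        (4 * suc D) ^ N * total vs K     ≡⟨ cong (_* total vs K) (^-distribʳ-* 4 (suc D) N) ⟩
        4 ^ N * suc D ^ N * total vs K   ≤⟨ *-monoˡ-≤ (total vs K) (*-monoʳ-≤ (4 ^ N) ([1+1/D]^n≤8^c D N c le)) ⟩
        4 ^ N * (8 ^ c * D ^ N) * total vs K ≡⟨ q₃ (4 ^ N) (8 ^ c) (D ^ N) (total vs K) ⟩
        8 ^ c * total vs K * (4 ^ N * D ^ N) ≡⟨ cong (8 ^ c * total vs K *_) (trans (sym (^-distribʳ-* 4 D N)) (cong (_^ N) (sym D≡))) ⟩
        8 ^ c * total vs K * length vs ^ N ∎)
      where
      open ≤-Reasoning
      e = E vs (many vs hit hit≤1 cs j)
      N = length cs
      nz : NonZero (length vs)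
      nz = subst NonZero (sym D≡) (m*n≢0 4 D)
      q₁ : ∀ a b c → a * b * c ≡ a * (b * 1 * c)
      q₁ = solve-∀
      q₂ : ∀ D → 1 * (4 * D) + 4 ≡ 4 * suc D
      q₂ = solve-∀
      q₃ : ∀ a b c d → a * (b * c) * d ≡ b * d * (a * c)
      q₃ = solve-∀

    -- There are at most 8^c D^(2j) families of j pairs, and each is present with probability at
    -- most (4 D)^(-2j).
    family-16^j : ∀ {K} (𝒯 : List (List (Fin K))) (D c j : ℕ) .{{_ : NonZero D}} → length vs ≡ 4 * D →
                  length 𝒯 ≤ c * (D * D) → E vs (family vs hit hit≤1 2 j 𝒯) * 16 ^ j ≤ 8 ^ c * total vs K
    family-16^j {K} 𝒯 D c j D≡ le = *-cancelʳ-≤ _ _ ((D * D) ^ j) {{m^n≢0 (D * D) j}} (begin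
        e * 16 ^ j * (D * D) ^ j         ≡⟨ *-assoc e (16 ^ j) _ ⟩
        e * (16 ^ j * (D * D) ^ j)       ≡⟨ cong (e *_) (trans (sym (^-distribʳ-* 16 (D * D) j)) (trans (cong (_^ j) (trans (q₁ D) (cong (_^ 2) (sym D≡)))) (^-*-assoc (length vs) 2 j))) ⟩
        e * length vs ^ (2 * j)          ≤⟨ E-family vs hit hit≤1 2 j 𝒯 ⟩
        length (subs j 𝒯) * total vs K   ≤⟨ *-monoˡ-≤ (total vs K) (length-subs≤ (D * D) c j 𝒯 le) ⟩
        8 ^ c * (D * D) ^ j * total vs K ≡⟨ q₂ (8 ^ c) ((D * D) ^ j) (total vs K) ⟩
        8 ^ c * total vs K * (D * D) ^ j ∎)
      where
      open ≤-Reasoning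
      e = E vs (family vs hit hit≤1 2 j 𝒯)
      instance
        nzDD : NonZero (D * D)
        nzDD = m*n≢0 D D
      q₁ : ∀ D → 16 * (D * D) ≡ (4 * D) ^ 2
      q₁ D = q D
        where q : ∀ D → 16 * (D * D) ≡ 4 * D * (4 * D * 1)
              q = solve-∀
      q₂ : ∀ a b c → a * b * c ≡ a * c * b
      q₂ = solve-∀

-- The random graphs: degrees, sparsity, codegrees, joint neighbourhoods

module RandomHost where

  open import Data.Nat
  open import Data.Nat.Properties
  open import Data.Nat.Tactic.RingSolver using (solve-∀)
  open import Data.Bool using (Bool; true; false; if_then_else_; _∧_; _∨_; not)
  open import Data.Fin using (Fin; zero; suc; combine; remQuot; toℕ)
  import Data.Fin.Properties as FP
  open import Data.Vec using (Vec; lookup)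
  open import Data.List using (List; []; _∷_; length; map; _++_; concat; concatMap; take; replicate; cartesianProduct)
  import Data.List.Properties as LP
  open import Data.List.Membership.Propositional using (_∈_; _∉_)
  open import Data.List.Membership.Propositional.Properties using (∈-map⁺; ∈-cartesianProduct⁺)
  open import Data.List.Relation.Unary.Any using (here; there)
  open import Data.List.Relation.Unary.All using ([]; _∷_)
  open import Data.List.Relation.Unary.AllPairs using ([]; _∷_)
  open import Data.List.Relation.Unary.Unique.Propositional using (Unique)
  import Data.List.Relation.Unary.Unique.Propositional.Properties as UP
  open import Data.List.Relation.Binary.Sublist.Propositional using (⊆-trans)
  import Data.List.Relation.Binary.Sublist.Propositional.Properties as SP
  open import Data.Product using (Σ; ∃; _×_; _,_; proj₁; proj₂)
  open import Data.Sum using (_⊎_; inj₁; inj₂)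
  open import Data.Empty using (⊥; ⊥-elim)
  open import Relation.Nullary using (yes; no)
  open import Relation.Binary.PropositionalEquality
  open import Function using (_∘_; id)
  open Sums
  open Expectation
  open Events
  open LargeDeviations

  private
    variable
      A B V : Set

  bits : ℕ → List Bool
  bits d₁ = true ∷ replicate d₁ false

  bits-hit : ∀ d₁ → ∑ (bits d₁) (𝟙 ∘ id) ≤ 1
  bits-hit d₁ = s≤s (≤-reflexive (z d₁))
    where z : ∀ n → ∑ (replicate n false) (𝟙 ∘ id) ≡ 0
          z zero    = refl
          z (suc n) = z n

  length-bits : ∀ d₁ → length (bits d₁) ≡ suc d₁
  length-bits d₁ = cong suc (LP.length-replicate d₁)

  length-cartesianProduct : (xs : List A) (ys : List B) → length (cartesianProduct xs ys) ≡ length xs * length ys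
  length-cartesianProduct []       ys = refl
  length-cartesianProduct (x ∷ xs) ys = trans (LP.length-++ (map (x ,_) ys)) (cong₂ _+_ (LP.length-map (x ,_) ys) (length-cartesianProduct xs ys))

  ∑-cartesianProduct : (xs : List A) (ys : List B) (f : A × B → ℕ) → ∑ (cartesianProduct xs ys) f ≡ ∑[ x ∈ xs ] (∑[ y ∈ ys ] (f (x , y)))
  ∑-cartesianProduct []       ys f = refl
  ∑-cartesianProduct (x ∷ xs) ys f = trans (∑-++ (map (x ,_) ys) _ f) (cong₂ _+_ (∑-map (x ,_) ys f) (∑-cartesianProduct xs ys f))

  ∑-fins-const : ∀ n c → ∑[ x ∈ fins n ] c ≡ n * c
  ∑-fins-const n c = trans (∑-const (fins n) c) (cong (_* c) (length-fins n))

  concat-map : (g : A → List B) (xs : List A) → concat (map g xs) ≡ concatMap g xs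
  concat-map g []       = refl
  concat-map g (x ∷ xs) = cong (g x ++_) (concat-map g xs)

  module Keys (m : ℕ) where

    KK = 2 * (m * m)

    abstract
      okey : Fin 2 → Fin m → Fin m → Fin KK
      okey c x y = combine c (combine x y)

      key : Fin 2 → Fin m → Fin m → Fin KK
      key c x y = if toℕ x <ᵇ toℕ y then okey c x y else okey c y x

      key-< : ∀ {c x y} → (toℕ x <ᵇ toℕ y) ≡ true → key c x y ≡ okey c x y
      key-< e rewrite e = refl

      key-≥ : ∀ {c x y} → (toℕ x <ᵇ toℕ y) ≡ false → key c x y ≡ okey c y x
      key-≥ e rewrite e = refl

      okey-inj : ∀ {c c′ x x′ y y′} → okey c x y ≡ okey c′ x′ y′ → c ≡ c′ × x ≡ x′ × y ≡ y′
      okey-inj {c} {c′} {x} {x′} {y} {y′} e =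
        let (a , b) = FP.combine-injective c (combine x y) c′ (combine x′ y′) e
            (p , q) = FP.combine-injective x y x′ y′ b
        in a , p , q

      key-inj : ∀ {c c′ x x′ y y′} → key c x y ≡ key c′ x′ y′ → c ≡ c′ × ((x ≡ x′ × y ≡ y′) ⊎ (x ≡ y′ × y ≡ x′))
      key-inj {c} {c′} {x} {x′} {y} {y′} e with toℕ x <ᵇ toℕ y | toℕ x′ <ᵇ toℕ y′
      ... | true  | true  = let (a , p , q) = okey-inj {c} {c′} {x} {x′} {y} {y′} e in a , inj₁ (p , q)
      ... | true  | false = let (a , p , q) = okey-inj {c} {c′} {x} {y′} {y} {x′} e in a , inj₂ (p , q)
      ... | false | true  = let (a , p , q) = okey-inj {c} {c′} {y} {x′} {x} {y′} e in a , inj₂ (q , p)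
      ... | false | false = let (a , p , q) = okey-inj {c} {c′} {y} {y′} {x} {x′} e in a , inj₁ (q , p)

      ends : Fin KK → Fin m × Fin m
      ends i = remQuot m (proj₂ (remQuot {2} (m * m) i))

      ends-okey : ∀ c z t → ends (okey c z t) ≡ (z , t)
      ends-okey c z t = trans (cong (λ p → remQuot m (proj₂ p)) (FP.remQuot-combine {2} c (combine z t))) (FP.remQuot-combine z t)

      ends-key : ∀ c z t → (z ≡ proj₁ (ends (key c z t)) × t ≡ proj₂ (ends (key c z t))) ⊎
                           (z ≡ proj₂ (ends (key c z t)) × t ≡ proj₁ (ends (key c z t)))
      ends-key c z t with toℕ z <ᵇ toℕ t
      ... | true  = inj₁ (sym (cong proj₁ (ends-okey c z t)) , sym (cong proj₂ (ends-okey c z t)))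
      ... | false = inj₂ (sym (cong proj₂ (ends-okey c t z)) , sym (cong proj₁ (ends-okey c t z)))

      key-sym : ∀ c x y → key c x y ≡ key c y x
      key-sym c x y with toℕ x <ᵇ toℕ y in e₁ | toℕ y <ᵇ toℕ x in e₂
      ... | true  | false = refl
      ... | false | true  = refl
      ... | true  | true  = ⊥-elim (<-asym (≤ᵇ-true (suc (toℕ x)) (toℕ y) e₁) (≤ᵇ-true (suc (toℕ y)) (toℕ x) e₂))
      ... | false | false = cong₂ (okey c) (sym x≡y) x≡y
        where
        ge : ∀ {a b} → (a <ᵇ b) ≡ false → b ≤ a
        ge {a} {b} f with a <? b
        ... | yes l = ⊥-elim (true≢false (≤ᵇ-intro l) f)
        ... | no ¬l = ≮⇒≥ ¬l
        x≡y : x ≡ y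
        x≡y = FP.toℕ-injective (≤-antisym (ge {toℕ y} {toℕ x} e₂) (ge {toℕ x} {toℕ y} e₁))

      key-injʳ : ∀ {c w y y′} → key c w y ≡ key c w y′ → y ≡ y′
      key-injʳ {c} {w} {y} {y′} e with key-inj {c} {c} {w} {w} {y} {y′} e
      ... | _ , inj₁ (_ , q)  = q
      ... | _ , inj₂ (p , q)  = trans q p

    edge : Vec Bool KK → Fin 2 → Fin m → Fin m → Bool
    edge ω c x y = not (x == y) ∧ lookup ω (key c x y)

    edge-sym : ∀ ω c x y → edge ω c x y ≡ edge ω c y x
    edge-sym ω c x y = cong₂ (λ a b → not a ∧ lookup ω b) (==-sym x y) (key-sym c x y)

    edge≤bit : ∀ ω c x y → 𝟙 (edge ω c x y) ≤ 𝟙 (lookup ω (key c x y))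
    edge≤bit ω c x y with x == y
    ... | true  = z≤n
    ... | false = ≤-refl

    edge⇒≢ : ∀ ω c {x y} → edge ω c x y ≡ true → x ≢ y
    edge⇒≢ ω c {x} e refl with x == x | ==-refl x
    edge⇒≢ ω c {x} () refl | true | _

    edge⇒bit : ∀ ω c {x y} → edge ω c x y ≡ true → lookup ω (key c x y) ≡ true
    edge⇒bit ω c {x} {y} e = proj₂ (∧-true {not (x == y)} e)

  module RandomGraph (m D : ℕ) (d₁ : ℕ) .{{_ : NonZero D}} (d≡ : suc d₁ ≡ 4 * D) where

    open Keys m
    open ≤-Reasoning

    vs = bits d₁
    N = fins m
    Ω = Vec Bool KK
    hit≤1 = bits-hit d₁
    tot = total vs KK

    len : length vs ≡ 4 * D
    len = trans (length-bits d₁) d≡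

    colours = fins 2

    star : Fin 2 → Fin m → List (Fin KK)
    star c w = map (key c w) N

    degBad : ℕ → Ω → ℕ
    degBad Δ ω = ∑[ c ∈ colours ] (∑[ w ∈ N ] (many vs id hit≤1 (star c w) Δ ω))

    degBad-small : (D₁ s : ℕ) .{{_ : NonZero D₁}} → length vs ≡ 10 * D₁ → m ≤ 170 * length vs * s →
                   E vs (degBad (187 * s)) * 2 ^ s ≤ 2 * m * tot
    degBad-small D₁ s D≡ le = begin
      E vs (degBad T) * 2 ^ s
        ≡⟨ cong (_* 2 ^ s) (trans (E-∑ vs {K = KK} colours _) (∑-cong colours (λ c → E-∑ vs {K = KK} N _))) ⟩
      ∑[ c ∈ colours ] (∑[ w ∈ N ] (E vs (f c w))) * 2 ^ s
        ≡⟨ trans (sym (∑-*ʳ colours (2 ^ s) _)) (∑-cong colours (λ c → sym (∑-*ʳ N (2 ^ s) _))) ⟩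
      ∑[ c ∈ colours ] (∑[ w ∈ N ] (E vs (f c w) * 2 ^ s))
        ≤⟨ ∑-mono colours (λ c → ∑-≤const N tot (λ {w} _ → one c w)) ⟩
      ∑[ c ∈ colours ] (length N * tot)    ≡⟨ ∑-fins-const 2 _ ⟩
      2 * (length N * tot)                 ≡⟨ cong (λ t → 2 * (t * tot)) (length-fins m) ⟩
      2 * (m * tot)                        ≡⟨ *-assoc 2 m tot ⟨
      2 * m * tot ∎
      where
      T = 187 * s
      f : Fin 2 → Fin m → Ω → ℕ
      f c w = many vs id hit≤1 (star c w) T
      one : ∀ c w → E vs (f c w) * 2 ^ s ≤ tot
      one c w = chernoff vs id hit≤1 (UP.map⁺ key-injʳ (fins-Unique m)) D₁ s D≡
        (≤-trans (≤-reflexive (trans (LP.length-map (key c w) N) (length-fins m))) le)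

    degBad≡0 : ∀ Δ ω → degBad (suc Δ) ω ≡ 0 → ∀ c w → ∑[ x ∈ N ] (𝟙 (edge ω c w x)) ≤ Δ
    degBad≡0 Δ ω z c w with ∑[ x ∈ N ] (𝟙 (edge ω c w x)) ≤? Δ
    ... | yes le = le
    ... | no ¬le = ⊥-elim (absurd (trans (sym one) (∑≡0⇒ (∑≡0⇒ z (∈-fins c)) (∈-fins w))))
      where
      absurd : 1 ≢ 0
      absurd ()
      one : many vs id hit≤1 (star c w) (suc Δ) ω ≡ 1
      one = cong 𝟙 (≤ᵇ-intro (≤-trans (≰⇒> ¬le) (≤-trans (∑-mono N (λ x → edge≤bit ω c w x)) (≤-reflexive (sym (∑-map (key c w) N _))))))

    -- Restricted to increasing pairs, so that distinct entries read distinct coordinates even if W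
    -- and X overlap. The decreasing pairs are the increasing ones of X and W, which explains
    -- `j + j` in `sparseBad≡0`.
    rect : Fin 2 → List (Fin m) → List (Fin m) → List (Fin KK)
    rect c W X = map (λ (w , x) → okey c w x) (filt (λ (w , x) → toℕ w <ᵇ toℕ x) (cartesianProduct W X))

    sparseBad : ℕ → ℕ → Ω → ℕ
    sparseBad k j ω = ∑[ c ∈ colours ] (∑[ W ∈ subs k N ] (∑[ X ∈ subs k N ] (many vs id hit≤1 (rect c W X) j ω)))

    ∈-subs⇒Unique : ∀ {k W} → W ∈ subs k N → Unique W
    ∈-subs⇒Unique {k} W∈ = ⊆⇒Unique (proj₁ (subs⇒⊆ k N W∈)) (fins-Unique m)

    length-subs-N : ∀ k → length (subs k N) ≤ suc m ^ k
    length-subs-N k = ≤-trans (length-subs≤pow k N) (≤-reflexive (cong (λ t → suc t ^ k) (length-fins m)))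

    ∑-subs² : ∀ k (f : Fin 2 → List (Fin m) → List (Fin m) → ℕ) (b : ℕ) →
              (∀ c {W X} → W ∈ subs k N → X ∈ subs k N → f c W X ≤ b) →
              ∑[ c ∈ colours ] (∑[ W ∈ subs k N ] (∑[ X ∈ subs k N ] (f c W X))) ≤ 2 * (suc m ^ k * (suc m ^ k * b))
    ∑-subs² k f b h = begin
      ∑[ c ∈ colours ] (∑[ W ∈ subs k N ] (∑[ X ∈ subs k N ] (f c W X)))
        ≤⟨ ∑-mono colours (λ c → ∑-≤const (subs k N) _ (λ W∈ → ∑-≤const (subs k N) b (λ X∈ → h c W∈ X∈))) ⟩
      ∑[ c ∈ colours ] (length (subs k N) * (length (subs k N) * b)) ≡⟨ ∑-fins-const 2 _ ⟩
      2 * (length (subs k N) * (length (subs k N) * b))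
        ≤⟨ *-monoʳ-≤ 2 (*-mono-≤ (length-subs-N k) (*-monoˡ-≤ b (length-subs-N k))) ⟩
      2 * (suc m ^ k * (suc m ^ k * b)) ∎

    E-∑³ : ∀ k (f : Fin 2 → List (Fin m) → List (Fin m) → Ω → ℕ) (b : ℕ) →
           E vs (λ ω → ∑[ c ∈ colours ] (∑[ W ∈ subs k N ] (∑[ X ∈ subs k N ] (f c W X ω)))) * b ≡
           ∑[ c ∈ colours ] (∑[ W ∈ subs k N ] (∑[ X ∈ subs k N ] (E vs (f c W X) * b)))
    E-∑³ k f b = trans (cong (_* b) (trans (E-∑ vs {K = KK} colours _) (∑-cong colours (λ c → trans (E-∑ vs {K = KK} (subs k N) _) (∑-cong (subs k N) (λ W → E-∑ vs {K = KK} (subs k N) _))))))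
      (trans (sym (∑-*ʳ colours b _)) (∑-cong colours (λ c → trans (sym (∑-*ʳ (subs k N) b _)) (∑-cong (subs k N) (λ W → sym (∑-*ʳ (subs k N) b _))))))

    sparseBad-small : ∀ k c₀ j → k * k ≤ c₀ * D →
                      E vs (sparseBad k j) * 4 ^ j ≤ 2 * (suc m ^ k * (suc m ^ k * (8 ^ c₀ * tot)))
    sparseBad-small k c₀ j le = ≤-trans (≤-reflexive (E-∑³ k (λ c W X → many vs id hit≤1 (rect c W X) j) (4 ^ j))) (∑-subs² k _ _ one)
      where
      one : ∀ c {W X} → W ∈ subs k N → X ∈ subs k N → E vs (many vs id hit≤1 (rect c W X) j) * 4 ^ j ≤ 8 ^ c₀ * tot
      one c {W} {X} W∈ X∈ = many-5^j vs id hit≤1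
        (UP.map⁺ (λ {(w , x)} {(w′ , x′)} e → let (_ , p , q) = okey-inj {c} {c} {w} {w′} {x} {x′} e in cong₂ _,_ p q)
          (⊆⇒Unique (filt-⊆ _ (cartesianProduct W X)) (UP.cartesianProduct⁺ (∈-subs⇒Unique {k} W∈) (∈-subs⇒Unique {k} X∈))))
        D c₀ j len (begin
          length (rect c W X)             ≡⟨ LP.length-map _ (filt _ (cartesianProduct W X)) ⟩
          length (filt (λ (w , x) → toℕ w <ᵇ toℕ x) (cartesianProduct W X)) ≤⟨ ⊆⇒length (filt-⊆ _ (cartesianProduct W X)) ⟩
          length (cartesianProduct W X)   ≡⟨ length-cartesianProduct W X ⟩
          length W * length X             ≤⟨ *-mono-≤ (proj₂ (subs⇒⊆ k N W∈)) (proj₂ (subs⇒⊆ k N X∈)) ⟩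
          k * k                           ≤⟨ le ⟩
          c₀ * D ∎)

    sparseBad≡0 : ∀ k j ω → sparseBad k (suc j) ω ≡ 0 → ∀ c {W X} → W ∈ subs k N → X ∈ subs k N →
                  ∑[ w ∈ W ] (∑[ x ∈ X ] (𝟙 (edge ω c w x))) ≤ j + j
    sparseBad≡0 k j ω z c {W} {X} W∈ X∈ = begin
      ∑[ w ∈ W ] (∑[ x ∈ X ] (𝟙 (edge ω c w x)))       ≤⟨ ∑-mono W (λ w → ∑-mono X (λ x → split w x)) ⟩
      ∑[ w ∈ W ] (∑[ x ∈ X ] (o w x + o x w))          ≡⟨ ∑-cong W (λ w → ∑-+ X _ _) ⟩
      ∑[ w ∈ W ] (∑[ x ∈ X ] (o w x) + ∑[ x ∈ X ] (o x w)) ≡⟨ ∑-+ W _ _ ⟩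
      ∑[ w ∈ W ] (∑[ x ∈ X ] (o w x)) + ∑[ w ∈ W ] (∑[ x ∈ X ] (o x w)) ≡⟨ cong (∑[ w ∈ W ] (∑[ x ∈ X ] (o w x)) +_) (∑-swap W X _) ⟩
      ∑[ w ∈ W ] (∑[ x ∈ X ] (o w x)) + ∑[ x ∈ X ] (∑[ w ∈ W ] (o x w)) ≡⟨ cong₂ _+_ (h≡ W X) (h≡ X W) ⟨
      hits vs id hit≤1 (rect c W X) ω + hits vs id hit≤1 (rect c X W) ω ≤⟨ +-mono-≤ (few W∈ X∈) (few X∈ W∈) ⟩
      j + j ∎
      where
      o : Fin m → Fin m → ℕ
      o w x = 𝟙 (toℕ w <ᵇ toℕ x) * 𝟙 (lookup ω (okey c w x))
      split : ∀ w x → 𝟙 (edge ω c w x) ≤ o w x + o x w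
      split w x with toℕ w <ᵇ toℕ x in e₁ | toℕ x <ᵇ toℕ w in e₂
      ... | true  | _     = ≤-trans (≤-trans (edge≤bit ω c w x) (≤-reflexive (trans (cong (λ t → 𝟙 (lookup ω t)) (key-< {c} {w} {x} e₁)) (sym (*-identityˡ _))))) (m≤m+n _ _)
      ... | false | true  = ≤-trans (edge≤bit ω c w x) (≤-reflexive (trans (cong (λ t → 𝟙 (lookup ω t)) (key-≥ {c} {w} {x} e₁)) (sym (*-identityˡ _))))
      ... | false | false = ≤-trans (≤-reflexive (cong (λ t → 𝟙 (not t ∧ lookup ω (key c w x))) (trans (cong (w ==_) (sym w≡x)) (==-refl w)))) z≤n
        where
        ge : ∀ {a b} → (a <ᵇ b) ≡ false → b ≤ a
        ge {a} {b} f with a <? b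
        ... | yes l = ⊥-elim (true≢false (≤ᵇ-intro l) f)
        ... | no ¬l = ≮⇒≥ ¬l
        w≡x : w ≡ x
        w≡x = FP.toℕ-injective (≤-antisym (ge {toℕ x} {toℕ w} e₂) (ge {toℕ w} {toℕ x} e₁))
      h≡ : ∀ W X → hits vs id hit≤1 (rect c W X) ω ≡ ∑[ w ∈ W ] (∑[ x ∈ X ] (o w x))
      h≡ W X = trans (∑-map _ (filt _ (cartesianProduct W X)) _) (trans (∑-filt _ (cartesianProduct W X) _) (∑-cartesianProduct W X _))
      few : ∀ {W X} → W ∈ subs k N → X ∈ subs k N → hits vs id hit≤1 (rect c W X) ω ≤ j
      few {W} {X} W∈ X∈ with hits vs id hit≤1 (rect c W X) ω ≤? j
      ... | yes l = l
      ... | no ¬l = ⊥-elim (absurd (trans (sym (cong 𝟙 (≤ᵇ-intro (≰⇒> ¬l)))) (∑≡0⇒ (∑≡0⇒ (∑≡0⇒ z (∈-fins c)) W∈) X∈)))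
        where absurd : 1 ≢ 0
              absurd ()

    cherries : Fin 2 → Fin m → Fin m → Fin m → List (Fin KK)
    cherries c w w′ x = key c w x ∷ key c w′ x ∷ []

    codegBad : ℕ → Ω → ℕ
    codegBad j ω = ∑[ c ∈ colours ] (∑[ w ∈ N ] (∑[ w′ ∈ N ] (family vs id hit≤1 2 j (map (cherries c w w′) N) ω)))

    codegBad-small : ∀ j → m ≤ D * D → E vs (codegBad j) * 16 ^ j ≤ 2 * (m * (m * (8 * tot)))
    codegBad-small j le = begin
      E vs (codegBad j) * 16 ^ j
        ≡⟨ trans (cong (_* 16 ^ j) (trans (E-∑ vs {K = KK} colours _) (∑-cong colours (λ c → trans (E-∑ vs {K = KK} N _) (∑-cong N (λ w → E-∑ vs {K = KK} N _))))))
             (trans (sym (∑-*ʳ colours (16 ^ j) _)) (∑-cong colours (λ c → trans (sym (∑-*ʳ N (16 ^ j) _)) (∑-cong N (λ w → sym (∑-*ʳ N (16 ^ j) _)))))) ⟩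
      ∑[ c ∈ colours ] (∑[ w ∈ N ] (∑[ w′ ∈ N ] (E vs (f c w w′) * 16 ^ j)))
        ≤⟨ ∑-mono colours (λ c → ∑-≤const N _ (λ {w} _ → ∑-≤const N _ (λ {w′} _ → one c w w′))) ⟩
      ∑[ c ∈ colours ] (length N * (length N * (8 * tot)))   ≡⟨ ∑-fins-const 2 _ ⟩
      2 * (length N * (length N * (8 * tot)))                ≡⟨ cong (λ t → 2 * (t * (t * (8 * tot)))) (length-fins m) ⟩
      2 * (m * (m * (8 * tot))) ∎
      where
      f : Fin 2 → Fin m → Fin m → Ω → ℕ
      f c w w′ = family vs id hit≤1 2 j (map (cherries c w w′) N)
      one : ∀ c w w′ → E vs (f c w w′) * 16 ^ j ≤ 8 * tot
      one c w w′ = family-16^j vs id hit≤1 (map (cherries c w w′) N) D 1 j len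
        (≤-trans (≤-reflexive (trans (LP.length-map _ N) (length-fins m))) (≤-trans le (≤-reflexive (sym (*-identityˡ (D * D))))))

    -- Too many common neighbours would give as many cherries. They are disjoint: a coordinate in
    -- the cherries of x and x′ with its ends exchanged would make x′ equal to w or w′, but x′ is
    -- adjacent to both.
    codegBad≡0 : ∀ j ω → codegBad (suc j) ω ≡ 0 → ∀ c {w w′} → w ≢ w′ → ∑[ x ∈ N ] (𝟙 (edge ω c w x) * 𝟙 (edge ω c w′ x)) ≤ j
    codegBad≡0 j ω z c {w} {w′} ne with ∑[ x ∈ N ] (𝟙 (edge ω c w x) * 𝟙 (edge ω c w′ x)) ≤? j
    ... | yes le = le
    ... | no ¬le = ⊥-elim (family-hit vs id hit≤1 2 (suc j) (map g N) (map g xs) ω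
          (SP.map⁺ g (⊆-trans (take-⊆ (suc j) ys) (filt-⊆ both N)))
          (trans (LP.length-map g xs) len-xs)
          (subst Unique (sym (concat-map g xs)) (Unique-concatMap g u-xs (λ x∈ → (k≢ x∈ ∷ []) ∷ [] ∷ []) dj))
          (trans (cong length (concat-map g xs)) (trans (length-concatMap-const g 2 xs (λ _ → refl)) (cong (2 *_) len-xs)))
          (λ i∈ → let (x , x∈ , i∈′) = ∈-concatMap⁻ g (subst (_ ∈_) (concat-map g xs) i∈) in pres x∈ i∈′)
          (∑≡0⇒ (∑≡0⇒ (∑≡0⇒ z (∈-fins c)) (∈-fins w)) (∈-fins w′)))
      where
      g = cherries c w w′
      both : Fin m → Bool
      both x = edge ω c w x ∧ edge ω c w′ x
      ys = filt both N
      xs = take (suc j) ys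
      len-xs : length xs ≡ suc j
      len-xs = trans (LP.length-take (suc j) ys) (m≤n⇒m⊓n≡m (≤-trans (≰⇒> ¬le)
        (≤-reflexive (sym (trans (length-filt both N) (∑-cong N (λ x → 𝟙-∧ (edge ω c w x) _)))))))
      u-xs : Unique xs
      u-xs = ⊆⇒Unique (⊆-trans (take-⊆ (suc j) ys) (filt-⊆ both N)) (fins-Unique m)
      prop : ∀ {x} → x ∈ xs → edge ω c w x ≡ true × edge ω c w′ x ≡ true
      prop x∈ = ∧-true (proj₂ (∈-filt⁻ both N (⊆⇒∈ (take-⊆ (suc j) ys) x∈)))
      k≢ : ∀ {x} → x ∈ xs → key c w x ≢ key c w′ x
      k≢ x∈ e with key-inj e
      ... | _ , inj₁ (p , _) = ne p
      ... | _ , inj₂ (p , q) = ne (trans p q)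
      pres : ∀ {x i} → x ∈ xs → i ∈ g x → lookup ω i ≡ true
      pres x∈ (here refl)         = edge⇒bit ω c (proj₁ (prop x∈))
      pres x∈ (there (here refl)) = edge⇒bit ω c (proj₂ (prop x∈))
      aux : ∀ {x x′ a b} → x ∈ xs → x′ ∈ xs → a ≡ w ⊎ a ≡ w′ → b ≡ w ⊎ b ≡ w′ → key c a x ≡ key c b x′ → x ≡ x′
      aux x∈ x∈′ a? b? e with key-inj e
      ... | _ , inj₁ (_ , q) = q
      aux x∈ x∈′ (inj₁ refl) b? e | _ , inj₂ (p , q) = ⊥-elim (edge⇒≢ ω c (proj₁ (prop x∈′)) p)
      aux x∈ x∈′ (inj₂ refl) b? e | _ , inj₂ (p , q) = ⊥-elim (edge⇒≢ ω c (proj₂ (prop x∈′)) p)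
      dj : ∀ {x x′ y} → x ∈ xs → x′ ∈ xs → y ∈ g x → y ∈ g x′ → x ≡ x′
      dj x∈ x∈′ (here e)         (here e′)         = aux x∈ x∈′ (inj₁ refl) (inj₁ refl) (trans (sym e) e′)
      dj x∈ x∈′ (here e)         (there (here e′)) = aux x∈ x∈′ (inj₁ refl) (inj₂ refl) (trans (sym e) e′)
      dj x∈ x∈′ (there (here e)) (here e′)         = aux x∈ x∈′ (inj₂ refl) (inj₁ refl) (trans (sym e) e′)
      dj x∈ x∈′ (there (here e)) (there (here e′)) = aux x∈ x∈′ (inj₂ refl) (inj₂ refl) (trans (sym e) e′)

    hitsBoth : Ω → Fin 2 → List (Fin m) → List (Fin m) → Fin m → ℕ
    hitsBoth ω c X Y w = ∑[ x ∈ X ] (∑[ y ∈ Y ] (𝟙 (not (x == y)) * (𝟙 (edge ω c w x) * 𝟙 (edge ω c w y))))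

    pairs : Fin 2 → List (Fin m) → List (Fin m) → Fin m → List (List (Fin KK))
    pairs c X Y w = map (λ (x , y) → key c w x ∷ key c w y ∷ []) (cartesianProduct X Y)

    -- With d = 4 D this is sixteen times the expected number of pairs of edges from one point to X
    -- and to Y, and one more after rounding. Allowing that many pays for the factor 8^`cnt` in the
    -- number of families.
    cnt : List (Fin m) → List (Fin m) → ℕ
    cnt X Y = suc (m * (length X * length Y) / (D * D))
      where instance nz : NonZero (D * D)
                     nz = m*n≢0 D D

    D*D*cnt : ∀ X Y → m * (length X * length Y) ≤ cnt X Y * (D * D) × D * D * cnt X Y ≤ m * (length X * length Y) + D * D
    D*D*cnt X Y = ≤-trans (≤-reflexive (m≡m%n+[m/n]*n M DD)) (+-monoˡ-≤ (M / DD * DD) (<⇒≤ (m%n<n M DD)))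
                , ≤-trans (≤-reflexive (q DD (M / DD))) (+-monoˡ-≤ DD (≤-trans (m≤n+m _ (M % DD)) (≤-reflexive (sym (m≡m%n+[m/n]*n M DD)))))
      where
      open import Data.Nat.DivMod
      M = m * (length X * length Y)
      DD = D * D
      instance
        nz : NonZero DD
        nz = m*n≢0 D D
      q : ∀ a b → a * suc b ≡ b * a + a
      q = solve-∀

    jointBad : ℕ → ℕ → Ω → ℕ
    jointBad k J ω = ∑[ c ∈ colours ] (∑[ X ∈ subs k N ] (∑[ Y ∈ subs k N ]
      (family vs id hit≤1 2 (cnt X Y + J) (concatMap (pairs c X Y) N) ω)))

    jointBad-small : ∀ k J → E vs (jointBad k J) * 16 ^ J ≤ 2 * (suc m ^ k * (suc m ^ k * tot))
    jointBad-small k J = ≤-trans (≤-reflexive (E-∑³ k f (16 ^ J))) (∑-subs² k _ _ (λ c {X} {Y} _ _ → one c X Y))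
      where
      f : Fin 2 → List (Fin m) → List (Fin m) → Ω → ℕ
      f c X Y = family vs id hit≤1 2 (cnt X Y + J) (concatMap (pairs c X Y) N)
      one : ∀ c X Y → E vs (f c X Y) * 16 ^ J ≤ tot
      one c X Y = *-cancelʳ-≤ _ _ (8 ^ q) {{m^n≢0 8 q}} (begin
        E vs (f c X Y) * 16 ^ J * 8 ^ q      ≤⟨ *-monoʳ-≤ (E vs (f c X Y) * 16 ^ J) (^-monoˡ-≤ q (m≤m+n 8 8)) ⟩
        E vs (f c X Y) * 16 ^ J * 16 ^ q     ≡⟨ trans (*-assoc (E vs (f c X Y)) (16 ^ J) (16 ^ q)) (cong (E vs (f c X Y) *_) (trans (*-comm (16 ^ J) (16 ^ q)) (sym (^-distribˡ-+-* 16 q J)))) ⟩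
        E vs (f c X Y) * 16 ^ (q + J)        ≤⟨ family-16^j vs id hit≤1 (concatMap (pairs c X Y) N) D q (q + J) len lenT ⟩
        8 ^ q * tot                          ≡⟨ *-comm (8 ^ q) tot ⟩
        tot * 8 ^ q ∎)
        where
        q = cnt X Y
        lenT : length (concatMap (pairs c X Y) N) ≤ q * (D * D)
        lenT = begin
          length (concatMap (pairs c X Y) N)  ≡⟨ length-concatMap-const (pairs c X Y) (length X * length Y) N (λ _ → trans (LP.length-map _ (cartesianProduct X Y)) (length-cartesianProduct X Y)) ⟩
          length X * length Y * length N      ≡⟨ trans (cong (length X * length Y *_) (length-fins m)) (*-comm _ m) ⟩
          m * (length X * length Y)           ≤⟨ proj₁ (D*D*cnt X Y) ⟩
          q * (D * D) ∎

    -- The points of X and Y themselves, at most 2k, are set aside. For every other w one pair of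
    -- edges to X and Y is chosen; pairs chosen for different w share no coordinate, because the far
    -- ends lie in X or Y and the w do not.
    jointBad≡0 : ∀ k J ω → jointBad k (suc J) ω ≡ 0 → ∀ c {X Y} → X ∈ subs k N → Y ∈ subs k N →
                 D * D * ∑[ w ∈ N ] (𝟙 (1 ≤ᵇ hitsBoth ω c X Y w)) ≤ m * (length X * length Y) + D * D * suc (J + (k + k))
    jointBad≡0 k J ω z c {X} {Y} X∈ Y∈ = begin
      D * D * ∑[ w ∈ N ] (𝟙 (1 ≤ᵇ hitsBoth ω c X Y w))       ≤⟨ *-monoʳ-≤ (D * D) (≤-trans (∑-mono N split) (≤-reflexive (trans (∑-+ N _ _) (cong (∑[ w ∈ N ] (𝟙 (b w)) +_) (∑-+ N _ _))))) ⟩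
      D * D * (∑[ w ∈ N ] (𝟙 (b w)) + (∑[ w ∈ N ] (𝟙 (mem w X)) + ∑[ w ∈ N ] (𝟙 (mem w Y))))
        ≤⟨ *-monoʳ-≤ (D * D) (+-mono-≤ few (+-mono-≤ (≤-trans (∑-mem X) (proj₂ (subs⇒⊆ k N X∈))) (≤-trans (∑-mem Y) (proj₂ (subs⇒⊆ k N Y∈))))) ⟩
      D * D * (cnt X Y + J + (k + k))                       ≡⟨ q₁ (D * D) (cnt X Y) J (k + k) ⟩
      D * D * cnt X Y + D * D * (J + (k + k))               ≤⟨ +-monoˡ-≤ _ (proj₂ (D*D*cnt X Y)) ⟩
      m * (length X * length Y) + D * D + D * D * (J + (k + k)) ≡⟨ q₂ (m * (length X * length Y)) (D * D) (J + (k + k)) ⟩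
      m * (length X * length Y) + D * D * suc (J + (k + k)) ∎
      where
      q₁ : ∀ a b c d → a * (b + c + d) ≡ a * b + a * (c + d)
      q₁ = solve-∀
      q₂ : ∀ a b c → a + b + b * c ≡ a + b * suc c
      q₂ = solve-∀
      hb = hitsBoth ω c X Y
      b : Fin m → Bool
      b w = (not (mem w X) ∧ not (mem w Y)) ∧ (1 ≤ᵇ hb w)
      split : ∀ w → 𝟙 (1 ≤ᵇ hb w) ≤ 𝟙 (b w) + (𝟙 (mem w X) + 𝟙 (mem w Y))
      split w with mem w X | mem w Y
      ... | true  | _     = ≤-trans (𝟙≤1 (1 ≤ᵇ hb w)) (s≤s z≤n)
      ... | false | true  = ≤-trans (𝟙≤1 (1 ≤ᵇ hb w)) (s≤s z≤n)
      ... | false | false = ≤-reflexive (sym (+-identityʳ _))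
      ∑-mem : ∀ X → ∑[ w ∈ N ] (𝟙 (mem w X)) ≤ length X
      ∑-mem []      = ≤-reflexive (∑-zero N)
      ∑-mem (x ∷ X) = begin
        ∑[ w ∈ N ] (𝟙 ((w == x) ∨ mem w X))           ≤⟨ ∑-mono N (λ w → 𝟙-∨ (w == x) (mem w X)) ⟩
        ∑[ w ∈ N ] (𝟙 (w == x) + 𝟙 (mem w X))         ≡⟨ ∑-+ N _ _ ⟩
        ∑[ w ∈ N ] (𝟙 (w == x)) + ∑[ w ∈ N ] (𝟙 (mem w X)) ≤⟨ +-mono-≤ (≤-trans (≤-reflexive (∑-cong N (λ w → sym (*-identityʳ _)))) (∑-δ≤ (fins-Unique m) x (λ _ → 1))) (∑-mem X) ⟩
        suc (length X) ∎
      Sel : Fin m → Set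
      Sel w = Σ (Fin m × Fin m) λ (x , y) → (x ∈ X × y ∈ Y) × (x ≢ y × edge ω c w x ≡ true × edge ω c w y ≡ true) × (w ∉ X × w ∉ Y)
      sel : ∀ w → b w ≡ true → Sel w
      sel w e =
        let (e₁ , e₂) = ∧-true {not (mem w X) ∧ not (mem w Y)} e
            (e₃ , e₄) = ∧-true {not (mem w X)} e₁
            (x , x∈ , px) = ∑-pos X _ (≤ᵇ-true 1 (hb w) e₂)
            (y , y∈ , py) = ∑-pos Y _ px
            (p₁ , p₂) = *-pos (𝟙 (not (x == y))) _ py
            (p₃ , p₄) = *-pos (𝟙 (edge ω c w x)) _ p₂
        in (x , y) , (x∈ , y∈) ,
           ((λ x≡y → true≢false (trans (cong (_== y) x≡y) (==-refl y)) (not-true (𝟙-pos p₁))) , 𝟙-pos p₃ , 𝟙-pos p₄) ,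
           ((λ i → true≢false (∈⇒mem i) (not-true e₃)) , (λ i → true≢false (∈⇒mem i) (not-true e₄)))
      bitsOf : ∀ w → Sel w → List (Fin KK)
      bitsOf w ((x , y) , _) = key c w x ∷ key c w y ∷ []
      -- The value of the test is passed together with its equation, since a pair of edges can be
      -- selected only in the `true` case.
      choose : ∀ w bb → b w ≡ bb → List (Fin KK)
      choose w true  e = bitsOf w (sel w e)
      choose w false e = []
      ch : Fin m → List (Fin KK)
      ch w = choose w (b w) refl
      ch-true : ∀ {w} → b w ≡ true → Σ (Sel w) λ s → ch w ≡ bitsOf w s
      ch-true {w} e = go (b w) refl e
        where go : ∀ bb (q : b w ≡ bb) → bb ≡ true → Σ (Sel w) λ s → choose w bb q ≡ bitsOf w s
              go true q _ = sel w q , refl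
      ch∈ : ∀ {w} → b w ≡ true → ch w ∈ pairs c X Y w
      ch∈ {w} e with ch-true {w} e
      ... | s@((x , y) , (x∈ , y∈) , _) , eq rewrite eq = ∈-map⁺ (λ (x , y) → key c w x ∷ key c w y ∷ []) (∈-cartesianProduct⁺ x∈ y∈)
      j = cnt X Y + J
      few : ∑[ w ∈ N ] (𝟙 (b w)) ≤ j
      few with ∑[ w ∈ N ] (𝟙 (b w)) ≤? j
      ... | yes l = l
      ... | no ¬l = ⊥-elim (family-hit vs id hit≤1 2 (cnt X Y + suc J) (concatMap (pairs c X Y) N) (map ch xs) ω
            (⊆-trans (SP.map⁺ ch (take-⊆ (cnt X Y + suc J) ys)) (choice-⊆ b ch (pairs c X Y) N ch∈))
            (trans (LP.length-map ch xs) len-xs)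
            (subst Unique (sym (concat-map ch xs)) (Unique-concatMap ch u-xs uch dj))
            (trans (cong length (concat-map ch xs)) (trans (length-concatMap-const ch 2 xs (λ x∈ → cong length (proj₂ (ch-true (bt x∈))))) (cong (2 *_) len-xs)))
            (λ i∈ → let (x , x∈ , i∈′) = ∈-concatMap⁻ ch (subst (_ ∈_) (concat-map ch xs) i∈) in pres x∈ i∈′)
            (∑≡0⇒ (∑≡0⇒ (∑≡0⇒ z (∈-fins c)) X∈) Y∈))
        where
        ys = filt b N
        xs = take (cnt X Y + suc J) ys
        len-xs : length xs ≡ cnt X Y + suc J
        len-xs = trans (LP.length-take (cnt X Y + suc J) ys) (m≤n⇒m⊓n≡m (≤-trans (≤-reflexive (+-suc (cnt X Y) J)) (≤-trans (≰⇒> ¬l) (≤-reflexive (sym (length-filt b N))))))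
        u-xs : Unique xs
        u-xs = ⊆⇒Unique (⊆-trans (take-⊆ (cnt X Y + suc J) ys) (filt-⊆ b N)) (fins-Unique m)
        bt : ∀ {w} → w ∈ xs → b w ≡ true
        bt w∈ = proj₂ (∈-filt⁻ b N (⊆⇒∈ (take-⊆ (cnt X Y + suc J) ys) w∈))
        uch : ∀ {w} → w ∈ xs → Unique (ch w)
        uch {w} w∈ with ch-true {w} (bt w∈)
        ... | s@((x , y) , _ , (ne , _) , _) , eq rewrite eq = ((λ e → ne (key-injʳ e)) ∷ []) ∷ [] ∷ []
        pres : ∀ {w i} → w ∈ xs → i ∈ ch w → lookup ω i ≡ true
        pres {w} w∈ i∈ with ch-true {w} (bt w∈)
        ... | s@((x , y) , _ , (ne , ex , ey) , _) , eq with subst (_ ∈_) eq i∈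
        ...   | here refl         = edge⇒bit ω c ex
        ...   | there (here refl) = edge⇒bit ω c ey
        inXY : ∀ {w i} (s : Sel w) → i ∈ bitsOf w s → ∃ λ x → i ≡ key c w x × (x ∈ X ⊎ x ∈ Y)
        inXY ((x , y) , (x∈ , y∈) , _) (here e)         = x , e , inj₁ x∈
        inXY ((x , y) , (x∈ , y∈) , _) (there (here e)) = y , e , inj₂ y∈
        out : ∀ {w x} → Sel w → w ≡ x → x ∈ X ⊎ x ∈ Y → ⊥
        out (_ , _ , _ , (nX , _)) refl (inj₁ i) = nX i
        out (_ , _ , _ , (_ , nY)) refl (inj₂ i) = nY i
        dj : ∀ {w w′ i} → w ∈ xs → w′ ∈ xs → i ∈ ch w → i ∈ ch w′ → w ≡ w′
        dj {w} {w′} w∈ w∈′ i∈ i∈′ with ch-true {w} (bt w∈) | ch-true {w′} (bt w∈′)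
        ... | s , eq | s′ , eq′ with inXY s (subst (_ ∈_) eq i∈) | inXY s′ (subst (_ ∈_) eq′ i∈′)
        ...   | x , e , _ | x′ , e′ , x∈′ with key-inj {c} {c} {w} {w′} {x} {x′} (trans (sym e) e′)
        ...     | _ , inj₁ (p , _) = p
        ...     | _ , inj₂ (p , _) = ⊥-elim (out s p x∈′)

-- Certificates: two levels of maximal disjoint families

module TwoLevels where

  open import Data.Nat
  open import Data.Nat.Properties
  open import Data.Bool using (Bool; true; false; _∧_; not)
  open import Data.Fin using (Fin; suc)
  open import Data.List using (List; []; _∷_; length; map; _++_; concat)
  import Data.List.Properties as LP
  open import Data.List.Membership.Propositional using (_∈_; _∉_)
  open import Data.List.Membership.Propositional.Properties using (∈-map⁺; ∈-map⁻; ∈-++⁻; ∈-++⁺ˡ; ∈-++⁺ʳ; ∈-concat⁻′)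
  open import Data.List.Relation.Unary.Any using (here; there)
  open import Data.List.Relation.Unary.All using ([]; _∷_)
  open import Data.List.Relation.Unary.AllPairs using ([]; _∷_)
  open import Data.List.Relation.Unary.Unique.Propositional using (Unique)
  open import Data.List.Relation.Binary.Sublist.Propositional using (_⊆_; []; _∷_; _∷ʳ_; ⊆-trans)
  open import Data.Product using (∃; _×_; _,_; proj₁; proj₂)
  open import Data.Sum using (_⊎_; inj₁; inj₂)
  open import Data.Empty using (⊥; ⊥-elim)
  open import Relation.Binary.PropositionalEquality
  open Sums
  open Expectation
  open Events

  private
    variable
      A B : Set

  allᵇ : (A → Bool) → List A → Bool
  allᵇ p []       = true
  allᵇ p (x ∷ xs) = p x ∧ allᵇ p xs

  allᵇ-true : (p : A → Bool) (xs : List A) → allᵇ p xs ≡ true → ∀ {x} → x ∈ xs → p x ≡ true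
  allᵇ-true p (x ∷ xs) e (here refl) = proj₁ (∧-true {p x} e)
  allᵇ-true p (x ∷ xs) e (there i)   = allᵇ-true p xs (proj₂ (∧-true {p x} e)) i

  allᵇ-intro : (p : A → Bool) (xs : List A) → (∀ {x} → x ∈ xs → p x ≡ true) → allᵇ p xs ≡ true
  allᵇ-intro p []       h = refl
  allᵇ-intro p (x ∷ xs) h = ∧-intro (h (here refl)) (allᵇ-intro p xs (λ i → h (there i)))

  module TwoLevel {K : ℕ} where

    Bits = List (Fin K)

    meets? : (t E : Bits) → (∃ λ b → b ∈ t × b ∈ E) ⊎ (∀ {b} → b ∈ t → b ∉ E)
    meets? []      E = inj₂ (λ ())
    meets? (x ∷ t) E with mem x E in eq
    ... | true  = inj₁ (x , here refl , mem⇒∈ E eq)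
    ... | false with meets? t E
    ...   | inj₁ (b , i , j) = inj₁ (b , there i , j)
    ...   | inj₂ dj = inj₂ λ { (here refl) j → true≢false (∈⇒mem j) eq ; (there i) j → dj i j }

    -- Greedy: a set disjoint from all chosen so far is added, and then, being nonempty, meets the
    -- union itself.
    maximal : (T : List Bits) → (∀ {t} → t ∈ T → Unique t × ∃ λ b → b ∈ t) →
              ∃ λ 𝓕 → 𝓕 ⊆ T × Unique (concat 𝓕) × (∀ {t} → t ∈ T → ∃ λ b → b ∈ t × b ∈ concat 𝓕)
    maximal []      h = [] , [] , [] , λ ()
    maximal (t ∷ T) h with maximal T (λ i → h (there i))
    ... | 𝓕 , s , u , hit with meets? t (concat 𝓕)
    ...   | inj₁ m  = 𝓕 , t ∷ʳ s , u , λ { (here refl) → m ; (there i) → hit i }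
    ...   | inj₂ dj = t ∷ 𝓕 , refl ∷ s , Unique-++ (proj₁ (h (here refl))) u dj ,
        λ { (here refl) → let (b , b∈) = proj₂ (h (here refl)) in b , b∈ , ∈-++⁺ˡ b∈
          ; (there i) → let (b , b∈ , b∈′) = hit i in b , b∈ , ∈-++⁺ʳ t b∈′ }

    rest : Bits → Bits → Bits
    rest E t = filt (λ i → not (mem i E)) t

    -- The pairs left over from those triples that meet `E` in one element.
    𝒫 : Bits → List Bits → List Bits
    𝒫 E 𝒯 = filt (λ t → length t ≡ᵇ 2) (map (rest E) 𝒯)

    length-concat : (t : ℕ) (𝓕 : List Bits) → (∀ {x} → x ∈ 𝓕 → length x ≡ t) → length (concat 𝓕) ≡ t * length 𝓕
    length-concat t []      h = sym (*-zeroʳ t)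
    length-concat t (x ∷ 𝓕) h = trans (LP.length-++ x) (trans (cong₂ _+_ (h (here refl)) (length-concat t 𝓕 (λ i → h (there i)))) (sym (*-suc t (length 𝓕))))

    𝒫⇒length : ∀ E 𝒯 {t} → t ∈ 𝒫 E 𝒯 → length t ≡ 2
    𝒫⇒length E 𝒯 {t} i = ≡ᵇ⇒≡ (length t) 2 (subst Data.Bool.T (sym (proj₂ (∈-filt⁻ (λ t → length t ≡ᵇ 2) (map (rest E) 𝒯) i))) _)

    𝒫⇒rest : ∀ E 𝒯 {t} → t ∈ 𝒫 E 𝒯 → ∃ λ t′ → t′ ∈ 𝒯 × t ≡ rest E t′
    𝒫⇒rest E 𝒯 i = let (t′ , i′ , e) = ∈-map⁻ (rest E) (proj₁ (∈-filt⁻ (λ t → length t ≡ᵇ 2) (map (rest E) 𝒯) i)) in t′ , i′ , e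

    -- The first level is a maximal disjoint family of present triples, the second one of present
    -- leftover pairs. One level would only say that a present triple is touched; the second level
    -- yields the last clause, by which a present triple whose first entry is not covered has both
    -- others covered.
    Cover : List Bits → (Fin K → Bool) → Set
    Cover 𝒯 pr =
      ∃ λ 𝓕₀ → ∃ λ 𝓕₁ → 𝓕₀ ⊆ 𝒯 × 𝓕₁ ⊆ 𝒫 (concat 𝓕₀) 𝒯 ×
      Unique (concat 𝓕₀ ++ concat 𝓕₁) ×
      length (concat 𝓕₀ ++ concat 𝓕₁) ≡ 3 * length 𝓕₀ + 2 * length 𝓕₁ ×
      (∀ {i} → i ∈ concat 𝓕₀ ++ concat 𝓕₁ → pr i ≡ true × ∃ λ t → t ∈ 𝒯 × i ∈ t) ×
      (∀ {e f g} → (e ∷ f ∷ g ∷ []) ∈ 𝒯 → pr e ≡ true → pr f ≡ true → pr g ≡ true →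
         e ∉ concat 𝓕₀ ++ concat 𝓕₁ → f ∈ concat 𝓕₀ ++ concat 𝓕₁ × g ∈ concat 𝓕₀ ++ concat 𝓕₁)

    cover : (𝒯 : List Bits) (pr : Fin K → Bool) → (∀ {t} → t ∈ 𝒯 → Unique t × length t ≡ 3) → Cover 𝒯 pr
    cover 𝒯 pr h = 𝓕₀ , 𝓕₁ , ⊆-trans s₀ (filt-⊆ _ 𝒯) , ⊆-trans s₁ (filt-⊆ _ (𝒫 E₀ 𝒯)) , uE , lE , inE , two
      where
      present? = allᵇ pr
      lvl₀ = maximal (filt present? 𝒯) (λ {t} i → let (u , l) = h (proj₁ (∈-filt⁻ present? 𝒯 i)) in u , nonempty t 2 l)
        where nonempty : ∀ t n → length t ≡ suc n → ∃ λ b → b ∈ t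
              nonempty (x ∷ _) n _ = x , here refl
      𝓕₀ = proj₁ lvl₀
      s₀ = proj₁ (proj₂ lvl₀)
      u₀ = proj₁ (proj₂ (proj₂ lvl₀))
      hit₀ = proj₂ (proj₂ (proj₂ lvl₀))
      E₀ = concat 𝓕₀
      lvl₁ = maximal (filt present? (𝒫 E₀ 𝒯)) (λ {t} i → uniq (proj₁ (∈-filt⁻ present? (𝒫 E₀ 𝒯) i)) , nonempty t (𝒫⇒length E₀ 𝒯 (proj₁ (∈-filt⁻ present? (𝒫 E₀ 𝒯) i))))
        where nonempty : ∀ t → length t ≡ 2 → ∃ λ b → b ∈ t
              nonempty (x ∷ _) _ = x , here refl
              uniq : ∀ {t} → t ∈ 𝒫 E₀ 𝒯 → Unique t
              uniq i with 𝒫⇒rest E₀ 𝒯 i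
              ... | t′ , i′ , refl = ⊆⇒Unique (filt-⊆ _ t′) (proj₁ (h i′))
      𝓕₁ = proj₁ lvl₁
      s₁ = proj₁ (proj₂ lvl₁)
      u₁ = proj₁ (proj₂ (proj₂ lvl₁))
      hit₁ = proj₂ (proj₂ (proj₂ lvl₁))
      in₀ : ∀ {t} → t ∈ 𝓕₀ → t ∈ 𝒯 × present? t ≡ true
      in₀ i = ∈-filt⁻ present? 𝒯 (⊆⇒∈ s₀ i)
      in₁ : ∀ {t} → t ∈ 𝓕₁ → t ∈ 𝒫 E₀ 𝒯 × present? t ≡ true
      in₁ i = ∈-filt⁻ present? (𝒫 E₀ 𝒯) (⊆⇒∈ s₁ i)
      dj : ∀ {i} → i ∈ E₀ → i ∉ concat 𝓕₁
      dj {i} i∈ i∈′ with ∈-concat⁻′ 𝓕₁ i∈′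
      ... | t , i∈t , t∈ with 𝒫⇒rest E₀ 𝒯 (proj₁ (in₁ t∈))
      ...   | t′ , _ , refl = true≢false (∈⇒mem i∈) (not-true (proj₂ (∈-filt⁻ (λ i → not (mem i E₀)) t′ i∈t)))
      uE = Unique-++ u₀ u₁ dj
      lE = trans (LP.length-++ E₀) (cong₂ _+_ (length-concat 3 𝓕₀ (λ i → proj₂ (h (proj₁ (in₀ i))))) (length-concat 2 𝓕₁ (λ i → 𝒫⇒length E₀ 𝒯 (proj₁ (in₁ i)))))
      inE : ∀ {i} → i ∈ E₀ ++ concat 𝓕₁ → pr i ≡ true × ∃ λ t → t ∈ 𝒯 × i ∈ t
      inE i∈ with ∈-++⁻ E₀ i∈
      ... | inj₁ j = let (t , i∈t , t∈) = ∈-concat⁻′ 𝓕₀ j in allᵇ-true pr t (proj₂ (in₀ t∈)) i∈t , t , proj₁ (in₀ t∈) , i∈t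
      ... | inj₂ j with ∈-concat⁻′ 𝓕₁ j
      ...   | t , i∈t , t∈ with 𝒫⇒rest E₀ 𝒯 (proj₁ (in₁ t∈))
      ...     | t′ , t′∈ , refl = allᵇ-true pr (rest E₀ t′) (proj₂ (in₁ t∈)) i∈t , t′ , t′∈ , proj₁ (∈-filt⁻ _ t′ i∈t)
      E₁ = E₀ ++ concat 𝓕₁
      level₂ : ∀ {t} → t ∈ 𝒯 → (∀ {i} → i ∈ t → pr i ≡ true) → length (rest E₀ t) ≡ 2 → ∃ λ b → b ∈ rest E₀ t × b ∈ concat 𝓕₁
      level₂ {t} t∈ p l = hit₁ (∈-filt⁺ present? (∈-filt⁺ (λ t → length t ≡ᵇ 2) (∈-map⁺ (rest E₀) t∈) (cong (_≡ᵇ 2) l))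
                            (allᵇ-intro pr (rest E₀ t) (λ i → p (proj₁ (∈-filt⁻ _ t i)))))
      -- As e is not covered, the first level meets the triple in f or g. If it contains just one of
      -- them, the other forms a leftover pair with e, which the second level meets, and not in e.
      two : ∀ {e f g} → (e ∷ f ∷ g ∷ []) ∈ 𝒯 → pr e ≡ true → pr f ≡ true → pr g ≡ true → e ∉ E₁ → f ∈ E₁ × g ∈ E₁
      two {e} {f} {g} t∈ pe pf pg e∉ with mem f E₀ in ef | mem g E₀ in eg
      ... | true  | true  = ∈-++⁺ˡ (mem⇒∈ E₀ ef) , ∈-++⁺ˡ (mem⇒∈ E₀ eg)
      ... | false | false = ⊥-elim (case (hit₀ (∈-filt⁺ present? t∈ (∧-intro pe (∧-intro pf (∧-intro pg refl))))))
        where case : (∃ λ b → b ∈ e ∷ f ∷ g ∷ [] × b ∈ E₀) → ⊥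
              case (_ , here refl , j)                 = e∉ (∈-++⁺ˡ j)
              case (_ , there (here refl) , j)         = true≢false (∈⇒mem j) ef
              case (_ , there (there (here refl)) , j) = true≢false (∈⇒mem j) eg
      ... | true  | false = ∈-++⁺ˡ (mem⇒∈ E₀ ef) , case (level₂ t∈ prs (cong length r))
        where
        prs : ∀ {i} → i ∈ e ∷ f ∷ g ∷ [] → pr i ≡ true
        prs (here refl) = pe
        prs (there (here refl)) = pf
        prs (there (there (here refl))) = pg
        r : rest E₀ (e ∷ f ∷ g ∷ []) ≡ e ∷ g ∷ []
        r rewrite ∉⇒mem {i = e} {E₀} (λ j → e∉ (∈-++⁺ˡ j)) | ef | eg = refl
        case : (∃ λ b → b ∈ rest E₀ (e ∷ f ∷ g ∷ []) × b ∈ concat 𝓕₁) → g ∈ E₁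
        case (b , i , j) with subst (b ∈_) r i
        ... | here refl         = ⊥-elim (e∉ (∈-++⁺ʳ E₀ j))
        ... | there (here refl) = ∈-++⁺ʳ E₀ j
      ... | false | true  = case (level₂ t∈ prs (cong length r)) , ∈-++⁺ˡ (mem⇒∈ E₀ eg)
        where
        prs : ∀ {i} → i ∈ e ∷ f ∷ g ∷ [] → pr i ≡ true
        prs (here refl) = pe
        prs (there (here refl)) = pf
        prs (there (there (here refl))) = pg
        r : rest E₀ (e ∷ f ∷ g ∷ []) ≡ e ∷ f ∷ []
        r rewrite ∉⇒mem {i = e} {E₀} (λ j → e∉ (∈-++⁺ˡ j)) | ef | eg = refl
        case : (∃ λ b → b ∈ rest E₀ (e ∷ f ∷ g ∷ []) × b ∈ concat 𝓕₁) → f ∈ E₁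
        case (b , i , j) with subst (b ∈_) r i
        ... | here refl         = ⊥-elim (e∉ (∈-++⁺ʳ E₀ j))
        ... | there (here refl) = ∈-++⁺ʳ E₀ j

    abstract
      two-level : (𝒯 : List Bits) (pr : Fin K → Bool) → (∀ {t} → t ∈ 𝒯 → Unique t × length t ≡ 3) → Cover 𝒯 pr
      two-level = cover

    -- Only triples meeting `E` leave a pair, and an element lies in at most `R` triples. So the
    -- second level is drawn from far fewer pairs than there are in all.
    length-𝒫 : (E : Bits) (𝒯 : List Bits) (R : ℕ) → (∀ {t} → t ∈ 𝒯 → length t ≡ 3) →
               (∀ b → ∑[ t ∈ 𝒯 ] (𝟙 (mem b t)) ≤ R) → length (𝒫 E 𝒯) ≤ length E * R
    length-𝒫 E 𝒯 R h₃ hR = begin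
      length (𝒫 E 𝒯)                                              ≡⟨ length-filt (λ t → length t ≡ᵇ 2) (map (rest E) 𝒯) ⟩
      ∑[ t ∈ map (rest E) 𝒯 ] (𝟙 (length t ≡ᵇ 2))                 ≡⟨ ∑-map (rest E) 𝒯 _ ⟩
      ∑[ t ∈ 𝒯 ] (𝟙 (length (rest E t) ≡ᵇ 2))                     ≤⟨ ∑-mono∈ 𝒯 pt ⟩
      ∑[ t ∈ 𝒯 ] (∑[ b ∈ E ] (𝟙 (mem b t)))                       ≡⟨ ∑-swap 𝒯 E _ ⟩
      ∑[ b ∈ E ] (∑[ t ∈ 𝒯 ] (𝟙 (mem b t)))                       ≤⟨ ∑-≤const E R (λ {b} _ → hR b) ⟩
      length E * R ∎
      where
      open ≤-Reasoning
      full : ∀ t → (∀ {b} → b ∈ t → b ∉ E) → rest E t ≡ t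
      full []      dj = refl
      full (x ∷ t) dj rewrite ∉⇒mem {i = x} {E} (dj (here refl)) = cong (x ∷_) (full t (λ i → dj (there i)))
      pt : ∀ {t} → t ∈ 𝒯 → 𝟙 (length (rest E t) ≡ᵇ 2) ≤ ∑[ b ∈ E ] (𝟙 (mem b t))
      pt {t} t∈ with meets? t E
      ... | inj₁ (b , i , j) = ≤-trans (𝟙≤1 (length (rest E t) ≡ᵇ 2)) (≤-trans (≤-reflexive (sym (cong 𝟙 (∈⇒mem i)))) (∈⇒≤∑ (λ b → 𝟙 (mem b t)) j))
      ... | inj₂ dj rewrite full t dj | h₃ t∈ = z≤n

  ∑-Unique≤ : ∀ {n} {xs : List (Fin n)} → Unique xs → (f : Fin n → ℕ) → ∑ xs f ≤ ∑ (fins n) f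
  ∑-Unique≤ {n} {xs} u f = begin
    ∑ xs f                                                ≡⟨ ∑-cong xs (λ x → sym (∑-δ (fins-Unique n) (∈-fins x) f)) ⟩
    ∑[ x ∈ xs ] (∑[ v ∈ fins n ] (𝟙 (v == x) * f v))      ≡⟨ ∑-swap xs (fins n) _ ⟩
    ∑[ v ∈ fins n ] (∑[ x ∈ xs ] (𝟙 (v == x) * f v))      ≤⟨ ∑-mono (fins n) (λ v → ≤-trans (≤-reflexive (∑-cong xs (λ x → cong (λ t → 𝟙 t * f v) (==-sym v x)))) (∑-δ≤ u v (λ _ → f v))) ⟩
    ∑ (fins n) f ∎
    where open ≤-Reasoning

-- The construction, and the probability of a certificate

module Colours where

  open import Data.Nat
  open import Data.Nat.Properties
  open import Data.Nat.Tactic.RingSolver using (solve-∀)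
  open import Data.Bool using (Bool; true; false; if_then_else_; _∧_; _∨_; not)
  open import Data.Fin using (Fin; zero; suc; toℕ)
  import Data.Fin.Properties as FP
  open import Data.Vec using (Vec; lookup; _[_]≔_)
  import Data.Vec.Properties as VP
  open import Data.List using (List; []; _∷_; length; map; concatMap; cartesianProduct; replicate)
  import Data.List.Properties as LP
  open import Data.List.Membership.Propositional using (_∈_)
  open import Data.List.Membership.Propositional.Properties using (∈-map⁺; ∈-map⁻; ∈-cartesianProduct⁺; ∈-cartesianProduct⁻)
  open import Data.List.Relation.Unary.Any using (here; there)
  open import Data.List.Relation.Unary.All using (All; []; _∷_)
  import Data.List.Relation.Unary.All as All
  open import Data.List.Relation.Unary.AllPairs using ([]; _∷_)
  open import Data.List.Relation.Unary.Unique.Propositional using (Unique)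
  import Data.List.Relation.Unary.Unique.Propositional.Properties as UP
  open import Data.Product using (Σ; ∃; _×_; _,_; proj₁; proj₂)
  open import Data.Sum using (inj₁; inj₂)
  open import Data.Empty using (⊥-elim)
  open import Relation.Nullary using (yes; no)
  open import Relation.Binary.PropositionalEquality
  open import Function using (_∘_)
  open Sums
  open Expectation
  open Events
  open LargeDeviations
  open RandomHost
  open TwoLevels

  private
    variable
      A B : Set

  ∏ₗ-map : (g : A → B) (xs : List A) (f : B → ℕ) → ∏ₗ (map g xs) f ≡ ∏ₗ xs (f ∘ g)
  ∏ₗ-map g []       f = refl
  ∏ₗ-map g (x ∷ xs) f = cong (f (g x) *_) (∏ₗ-map g xs f)

  filt-cong : {p q : A → Bool} → (∀ x → p x ≡ q x) → (xs : List A) → filt p xs ≡ filt q xs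
  filt-cong e []       = refl
  filt-cong {p = p} {q} e (x ∷ xs) rewrite e x with q x
  ... | true  = cong (x ∷_) (filt-cong e xs)
  ... | false = filt-cong e xs

  Unique-map∈ : (f : A → B) {xs : List A} → Unique xs → (∀ {x y} → x ∈ xs → y ∈ xs → f x ≡ f y → x ≡ y) → Unique (map f xs)
  Unique-map∈ f {[]}     u inj = []
  Unique-map∈ f {x ∷ xs} u@(_ ∷ u′) inj =
    All.tabulate (λ {z} z∈ e → let (y , y∈ , z≡) = ∈-map⁻ f z∈ in
      Unique-head u (subst (_∈ xs) (sym (inj (here refl) (there y∈) (trans e z≡))) y∈))
    ∷ Unique-map∈ f u′ (λ i j → inj (there i) (there j))

  ∑-mem≤ : ∀ {m} (X : List (Fin m)) → ∑[ w ∈ fins m ] (𝟙 (mem w X)) ≤ length X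
  ∑-mem≤ {m} []      = ≤-reflexive (∑-zero (fins m))
  ∑-mem≤ {m} (x ∷ X) = begin
    ∑[ w ∈ fins m ] (𝟙 ((w == x) ∨ mem w X))                 ≤⟨ ∑-mono (fins m) (λ w → 𝟙-∨ (w == x) (mem w X)) ⟩
    ∑[ w ∈ fins m ] (𝟙 (w == x) + 𝟙 (mem w X))               ≡⟨ ∑-+ (fins m) _ _ ⟩
    ∑[ w ∈ fins m ] (𝟙 (w == x)) + ∑[ w ∈ fins m ] (𝟙 (mem w X))
      ≤⟨ +-mono-≤ (≤-trans (≤-reflexive (∑-cong (fins m) (λ w → sym (*-identityʳ _)))) (∑-δ≤ (fins-Unique m) x (λ _ → 1))) (∑-mem≤ X) ⟩
    suc (length X) ∎
    where open ≤-Reasoning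

  -- Every further element failing `p` only enlarges the product, since d₁ ≤ d₁ + 1; hence exactly M
  -- of them may be counted.
  ∏ₗ-mixed : (d₁ : ℕ) (p : A → Bool) (xs : List A) (M : ℕ) → M ≤ ∑[ x ∈ xs ] (𝟙 (not (p x))) →
             d₁ ^ length xs * suc d₁ ^ M ≤ ∏ₗ xs (λ x → if p x then d₁ else suc d₁) * d₁ ^ M
  ∏ₗ-mixed d₁ p []       zero le = ≤-refl
  ∏ₗ-mixed d₁ p (x ∷ xs) M le with p x
  ... | true  = begin
      d₁ * d₁ ^ length xs * suc d₁ ^ M     ≡⟨ *-assoc d₁ _ _ ⟩
      d₁ * (d₁ ^ length xs * suc d₁ ^ M)   ≤⟨ *-monoʳ-≤ d₁ (∏ₗ-mixed d₁ p xs M le) ⟩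
      d₁ * (∏ₗ xs _ * d₁ ^ M)              ≡⟨ *-assoc d₁ _ _ ⟨
      d₁ * ∏ₗ xs _ * d₁ ^ M ∎
    where open ≤-Reasoning
  ∏ₗ-mixed d₁ p (x ∷ xs) zero le | false = begin
      d₁ * d₁ ^ length xs * 1              ≡⟨ *-assoc d₁ _ _ ⟩
      d₁ * (d₁ ^ length xs * 1)            ≤⟨ *-mono-≤ (n≤1+n d₁) (∏ₗ-mixed d₁ p xs 0 z≤n) ⟩
      suc d₁ * (∏ₗ xs _ * 1)               ≡⟨ *-assoc (suc d₁) (∏ₗ xs (λ x → if p x then d₁ else suc d₁)) 1 ⟨
      suc d₁ * ∏ₗ xs _ * 1 ∎
    where open ≤-Reasoning
  ∏ₗ-mixed d₁ p (x ∷ xs) (suc M) (s≤s le) | false = begin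
      d₁ * d₁ ^ length xs * (suc d₁ * suc d₁ ^ M)   ≡⟨ q d₁ (d₁ ^ length xs) (suc d₁) (suc d₁ ^ M) ⟩
      suc d₁ * d₁ * (d₁ ^ length xs * suc d₁ ^ M)   ≤⟨ *-monoʳ-≤ (suc d₁ * d₁) (∏ₗ-mixed d₁ p xs M le) ⟩
      suc d₁ * d₁ * (∏ₗ xs _ * d₁ ^ M)              ≡⟨ q′ (suc d₁) d₁ (∏ₗ xs _) (d₁ ^ M) ⟩
      suc d₁ * ∏ₗ xs _ * (d₁ * d₁ ^ M) ∎
    where open ≤-Reasoning
          q : ∀ a b c d → a * b * (c * d) ≡ c * a * (b * d)
          q = solve-∀
          q′ : ∀ a b c d → a * b * (c * d) ≡ a * c * (b * d)
          q′ = solve-∀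

  -- `v₀` is a default value; for a point in the image of the list the result is a preimage from the
  -- list.
  findRep : ∀ {m n} → Fin n → (Fin 2 → Fin n → Fin m) → Fin 2 → Fin m → List (Fin n) → Fin n
  findRep v₀ b c x []       = v₀
  findRep v₀ b c x (v ∷ vs) = if b c v == x then v else findRep v₀ b c x vs

  findRep-spec : ∀ {m n} (v₀ : Fin n) (b : Fin 2 → Fin n → Fin m) c x J → x ∈ map (b c) J →
                 findRep v₀ b c x J ∈ J × b c (findRep v₀ b c x J) ≡ x
  findRep-spec v₀ b c x (v ∷ J) i with b c v == x in eq
  ... | true  = here refl , ==⇒≡ eq
  findRep-spec v₀ b c x (v ∷ J) (here e)  | false = ⊥-elim (true≢false (trans (cong (b c v ==_) e) (==-refl (b c v))) eq)
  findRep-spec v₀ b c x (v ∷ J) (there i) | false = let (p , q) = findRep-spec v₀ b c x J i in there p , q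

  module Construction {m n : ℕ} (b : Fin 2 → Fin n → Fin m) where

    open Keys m

    colours = fins 2
    N = fins m
    Ω = Vec Bool KK

    closed linked adjacent : Ω → Fin n → Fin n → Bool
    closed ω u v = 1 ≤ᵇ ∑[ c ∈ colours ] (∑[ z ∈ N ] (𝟙 (edge ω c z (b c u)) * 𝟙 (edge ω c z (b c v))))
    linked ω u v = 1 ≤ᵇ ∑[ c ∈ colours ] (𝟙 (edge ω c (b c u) (b c v)))
    adjacent ω u v = linked ω u v ∧ not (closed ω u v)

    closed-intro : ∀ ω u v c z → edge ω c z (b c u) ≡ true → edge ω c z (b c v) ≡ true → closed ω u v ≡ true
    closed-intro ω u v c z p q = ≤ᵇ-intro (≤-trans (≤-reflexive (sym (cong₂ (λ s t → 𝟙 s * 𝟙 t) p q)))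
      (≤-trans (∈⇒≤∑ (λ z → 𝟙 (edge ω c z (b c u)) * 𝟙 (edge ω c z (b c v))) (∈-fins z))
               (∈⇒≤∑ (λ c → ∑[ z ∈ N ] (𝟙 (edge ω c z (b c u)) * 𝟙 (edge ω c z (b c v)))) (∈-fins c))))

    linked-intro : ∀ ω u v c → edge ω c (b c u) (b c v) ≡ true → linked ω u v ≡ true
    linked-intro ω u v c p = ≤ᵇ-intro (≤-trans (≤-reflexive (sym (cong 𝟙 p))) (∈⇒≤∑ (λ c → 𝟙 (edge ω c (b c u) (b c v))) (∈-fins c)))

    linked-elim : ∀ ω u v → linked ω u v ≡ true → ∃ λ c → edge ω c (b c u) (b c v) ≡ true
    linked-elim ω u v e = let (c , _ , p) = ∑-pos colours _ (≤ᵇ-true 1 _ e) in c , 𝟙-pos p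

    closed-elim : ∀ ω u v → closed ω u v ≡ true → Σ (Fin 2) λ c → Σ (Fin m) λ z → edge ω c z (b c u) ≡ true × edge ω c z (b c v) ≡ true
    closed-elim ω u v e =
      let (c , _ , p) = ∑-pos colours _ (≤ᵇ-true 1 _ e)
          (z , _ , q) = ∑-pos N _ p
          (q₁ , q₂)   = *-pos (𝟙 (edge ω c z (b c u))) _ q
      in c , z , 𝟙-pos q₁ , 𝟙-pos q₂

    module Ind (d₁ : ℕ) .{{_ : NonZero d₁}} (v₀ : Fin n) (I : List (Fin n)) where

      open ≤-Reasoning

      d = suc d₁
      vs = bits d₁

      im : Fin 2 → List (Fin m)
      im c = map (b c) I

      inA : Fin 2 → Fin m → Bool
      inA c x = mem x (im c)

      Aᵢ : Fin 2 → List (Fin m)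
      Aᵢ c = filt (inA c) N

      rep : Fin 2 → Fin m → Fin n
      rep c x = findRep v₀ b c x I

      rep-spec : ∀ {c x} → x ∈ Aᵢ c → rep c x ∈ I × b c (rep c x) ≡ x
      rep-spec {c} {x} x∈ = findRep-spec v₀ b c x I (mem⇒∈ (im c) (proj₂ (∈-filt⁻ (inA c) N x∈)))

      ∈A : ∀ {c v} → v ∈ I → b c v ∈ Aᵢ c
      ∈A {c} v∈ = ∈-filt⁺ (inA c) (∈-fins _) (∈⇒mem (∈-map⁺ (b c) v∈))

      ∈A⇒inA : ∀ {c x} → x ∈ Aᵢ c → inA c x ≡ true
      ∈A⇒inA {c} x∈ = proj₂ (∈-filt⁻ (inA c) N x∈)

      -- A coordinate inside an image: a colour and two points of Aᵢ in increasing order. It stands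
      -- for the pair of vertices of I that represent the two points.
      Slot = Fin 2 × Fin m × Fin m

      ltᵇ : Fin m × Fin m → Bool
      ltᵇ (x , y) = toℕ x <ᵇ toℕ y

      row : Fin 2 → List Slot
      row c = map (c ,_) (filt ltᵇ (cartesianProduct (Aᵢ c) (Aᵢ c)))

      slots : List Slot
      slots = concatMap row colours

      slots⁻ : ∀ {c x y} → (c , x , y) ∈ slots → x ∈ Aᵢ c × y ∈ Aᵢ c × toℕ x < toℕ y
      slots⁻ {c} {x} {y} s∈ with ∈-concatMap⁻ row {colours} s∈
      ... | c′ , _ , i with ∈-map⁻ (c′ ,_) i
      ...   | (x′ , y′) , j , refl =
              let (k , l) = ∈-filt⁻ ltᵇ (cartesianProduct (Aᵢ c) (Aᵢ c)) j
                  (p , q) = ∈-cartesianProduct⁻ (Aᵢ c) (Aᵢ c) k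
              in p , q , ≤ᵇ-true (suc (toℕ x)) (toℕ y) l

      slots⁺ : ∀ {c x y} → x ∈ Aᵢ c → y ∈ Aᵢ c → toℕ x < toℕ y → (c , x , y) ∈ slots
      slots⁺ {c} p q l = ∈-concatMap⁺ row (∈-fins c) (∈-map⁺ (c ,_) (∈-filt⁺ ltᵇ (∈-cartesianProduct⁺ p q) (≤ᵇ-intro l)))

      A-Unique : ∀ c → Unique (Aᵢ c)
      A-Unique c = ⊆⇒Unique (filt-⊆ (inA c) N) (fins-Unique m)

      slots-Unique : Unique slots
      slots-Unique = Unique-concatMap row (fins-Unique 2)
        (λ {c} _ → UP.map⁺ (λ { refl → refl }) (⊆⇒Unique (filt-⊆ ltᵇ _) (UP.cartesianProduct⁺ (A-Unique c) (A-Unique c))))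
        (λ {c} {c′} {y} _ _ i j → let (_ , _ , e) = ∈-map⁻ (c ,_) i ; (_ , _ , e′) = ∈-map⁻ (c′ ,_) j in trans (sym (cong proj₁ e)) (cong proj₁ e′))

      slotKey : Slot → Fin KK
      slotKey (c , x , y) = key c x y

      SK : List (Fin KK)
      SK = map slotKey slots

      SK-Unique : Unique SK
      SK-Unique = Unique-map∈ slotKey slots-Unique inj
        where
        inj : ∀ {s t} → s ∈ slots → t ∈ slots → slotKey s ≡ slotKey t → s ≡ t
        inj {c , x , y} {c′ , x′ , y′} s∈ t∈ e with key-inj {c} {c′} {x} {x′} {y} {y′} e
        ... | refl , inj₁ (refl , refl) = refl
        ... | refl , inj₂ (refl , refl) = ⊥-elim (<-asym (proj₂ (proj₂ (slots⁻ s∈))) (proj₂ (proj₂ (slots⁻ t∈))))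

      inside⁺ : ∀ {c x y} → x ∈ Aᵢ c → y ∈ Aᵢ c → x ≢ y → key c x y ∈ SK
      inside⁺ {c} {x} {y} p q ne with toℕ x <? toℕ y
      ... | yes l = ∈-map⁺ slotKey (slots⁺ p q l)
      ... | no ¬l = subst (_∈ SK) (key-sym c y x) (∈-map⁺ slotKey (slots⁺ q p (≤∧≢⇒< (≮⇒≥ ¬l) (λ e → ne (FP.toℕ-injective (sym e))))))

      inside⁻ : ∀ {c x y} → key c x y ∈ SK → x ∈ Aᵢ c
      inside⁻ {c} {x} {y} i with ∈-map⁻ slotKey i
      ... | (c′ , x′ , y′) , s∈ , e with key-inj {c} {c′} {x} {x′} {y} {y′} e
      ...   | refl , inj₁ (refl , _) = proj₁ (slots⁻ s∈)
      ...   | refl , inj₂ (refl , _) = proj₁ (proj₂ (slots⁻ s∈))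

      lhs rhs : Slot → Fin n
      lhs (c , x , y) = rep c x
      rhs (c , x , y) = rep c y

      -- Slots whose representatives coincide in some colour are written off as closed: there the
      -- two edges from a closing point z would be one and the same coordinate.
      same : Slot → Bool
      same s = 1 ≤ᵇ ∑[ c ∈ colours ] (𝟙 (b c (lhs s) == b c (rhs s)))

      -- Reads no coordinate in `SK`, because z lies outside Aᵢ; it is determined before the slots
      -- are exposed.
      outᵇ : Ω → Slot → Bool
      outᵇ ω s = 1 ≤ᵇ ∑[ c ∈ colours ] (∑[ z ∈ N ] (𝟙 (not (inA c z)) * (𝟙 (edge ω c z (b c (lhs s))) * 𝟙 (edge ω c z (b c (rhs s))))))

      ok : Slot → Fin 2 → Fin m → Bool
      ok s c z = not (z == b c (lhs s)) ∧ not (z == b c (rhs s))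

      inᵇ : List (Fin KK) → Slot → Bool
      inᵇ E s = 1 ≤ᵇ ∑[ c ∈ colours ] (∑[ z ∈ Aᵢ c ] (𝟙 (ok s c z) * (𝟙 (mem (key c z (b c (lhs s))) E) * 𝟙 (mem (key c z (b c (rhs s))) E))))

      -- The slots not seen to be closed from the outside coordinates and the certificate alone. If
      -- I is independent they have to be absent, unless they belong to the certificate.
      Uᵇ : Ω → List (Fin KK) → Slot → Bool
      Uᵇ ω E s = not (same s) ∧ (not (outᵇ ω s) ∧ not (inᵇ E s))

      slotClosed : Ω → Slot → Bool
      slotClosed ω s = same s ∨ closed ω (lhs s) (rhs s)

      fine : Ω → List (Fin KK) → Slot → Bool
      fine ω E s = mem (slotKey s) E ∨ (not (Uᵇ ω E s) ∨ not (lookup ω (slotKey s)))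

      -- What a certificate asserts: its coordinates are present, every slot of `Uᵇ` outside it is
      -- absent, and at least `M` slots are open in reality.
      χ : List (Fin KK) → ℕ → Ω → Bool
      χ E M ω = allᵇ (lookup ω) E ∧ (allᵇ (fine ω E) slots ∧ (M ≤ᵇ ∑[ s ∈ slots ] (𝟙 (not (slotClosed ω s)))))

      module _ (E′ : List (Fin KK)) (E-Unique : Unique E′) (E-inside : ∀ {i} → i ∈ E′ → i ∈ SK) where

        UK : Ω → List (Fin KK)
        UK ω = map slotKey (filt (Uᵇ ω E′) slots)

        -- A change of measure. Summed over the d values of the coordinate each of the three weights
        -- gives d₁ d, so the product has a known mean although the outside coordinates decide which
        -- weight is used where.
        g : Ω → Fin KK → Bool → ℕ
        g ω j v = if mem j E′ then d * d₁ * 𝟙 v else (if mem j (UK ω) then d * 𝟙 (not v) else d₁)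

        h : Fin KK → Ω → ℕ
        h j ω = if mem j SK then g ω j (lookup ω j) else 1

        outᵇ-inv : ∀ i v ω → mem i SK ≡ true → ∀ s → outᵇ (ω [ i ]≔ v) s ≡ outᵇ ω s
        outᵇ-inv i v ω i∈ s = cong (1 ≤ᵇ_) (∑-cong colours (λ c → ∑-cong N (λ z → pt c z)))
          where
          e-inv : ∀ c z y → inA c z ≡ false → edge (ω [ i ]≔ v) c z y ≡ edge ω c z y
          e-inv c z y nz = cong (not (z == y) ∧_) (VP.lookup∘updateAt′ (key c z y) i
            (λ e → true≢false (∈A⇒inA (inside⁻ {c} {z} {y} (subst (_∈ SK) (sym e) (mem⇒∈ SK i∈)))) nz) ω)
          pt : ∀ c z → 𝟙 (not (inA c z)) * (𝟙 (edge (ω [ i ]≔ v) c z (b c (lhs s))) * 𝟙 (edge (ω [ i ]≔ v) c z (b c (rhs s)))) ≡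
                       𝟙 (not (inA c z)) * (𝟙 (edge ω c z (b c (lhs s))) * 𝟙 (edge ω c z (b c (rhs s))))
          pt c z with inA c z in eq
          ... | true  = refl
          ... | false = cong (1 *_) (cong₂ (λ p q → 𝟙 p * 𝟙 q) (e-inv c z (b c (lhs s)) eq) (e-inv c z (b c (rhs s)) eq))

        UK-inv : ∀ i v ω → mem i SK ≡ true → UK (ω [ i ]≔ v) ≡ UK ω
        UK-inv i v ω i∈ = cong (map slotKey) (filt-cong (λ s → cong (λ t → not (same s) ∧ (not t ∧ not (inᵇ E′ s))) (outᵇ-inv i v ω i∈ s)) slots)

        h-inv : ∀ i j v ω → mem i SK ≡ true → i ≢ j → h j (ω [ i ]≔ v) ≡ h j ω
        h-inv i j v ω i∈ ne = cong₂ (λ t v → if mem j SK then (if mem j E′ then d * d₁ * 𝟙 v else (if mem j t then d * 𝟙 (not v) else d₁)) else 1)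
          (UK-inv i v ω i∈) (VP.lookup∘updateAt′ j i (λ e → ne (sym e)) ω)

        Bd : Fin KK → ℕ
        Bd i = (if mem i SK then d₁ else 1) * d

        g-mean : ∀ ω i → ∑ vs (g ω i) ≤ d₁ * d
        g-mean ω i with mem i E′ | mem i (UK ω)
        ... | true  | _     = ≤-reflexive (trans (cong (d * d₁ * 1 +_) (zs d₁)) (p d₁ d))
          where zs : ∀ k → ∑ (replicate k false) (λ v → d * d₁ * 𝟙 v) ≡ 0
                zs zero    = refl
                zs (suc k) = trans (cong (_+ ∑ (replicate k false) (λ v → d * d₁ * 𝟙 v)) (*-zeroʳ (d * d₁))) (zs k)
                p : ∀ a b → b * a * 1 + 0 ≡ a * b
                p = solve-∀
        ... | false | true  = ≤-reflexive (trans (cong (_+ ∑ (replicate d₁ false) (λ v → d * 𝟙 (not v))) (*-zeroʳ d)) (zs d₁))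
          where zs : ∀ k → ∑ (replicate k false) (λ v → d * 𝟙 (not v)) ≡ k * d
                zs zero    = refl
                zs (suc k) = cong₂ _+_ (*-identityʳ d) (zs k)
        ... | false | false = ≤-reflexive (trans (∑-const vs d₁) (trans (cong (_* d₁) (length-bits d₁)) (*-comm d d₁)))

        h-mean : ∀ i ω → mem i SK ≡ true → ∑[ v ∈ vs ] (h i (ω [ i ]≔ v)) ≤ Bd i
        h-mean i ω i∈ = ≤-trans (≤-reflexive (∑-cong vs eq)) (≤-trans (g-mean ω i) (≤-reflexive (cong (λ t → (if t then d₁ else 1) * d) (sym i∈))))
          where
          eq : ∀ v → h i (ω [ i ]≔ v) ≡ g ω i v
          eq v rewrite i∈ = cong₂ (λ t v → if mem i E′ then d * d₁ * 𝟙 v else (if mem i t then d * 𝟙 (not v) else d₁)) (UK-inv i v ω i∈) (VP.lookup∘updateAt i ω)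

        h-out : ∀ i ω → mem i SK ≡ false → h i ω ≤ 1 × length vs ≤ Bd i
        h-out i ω i∉ rewrite i∉ = ≤-refl , ≤-reflexive (trans (length-bits d₁) (sym (*-identityˡ d)))

        ∏Bd : ∏ Bd ≡ d₁ ^ length slots * total vs KK
        ∏Bd = trans (∏-* (λ i → if mem i SK then d₁ else 1) (λ _ → d))
          (cong₂ _*_ (trans (∏-mem SK-Unique (λ _ → d₁)) (trans (∏ₗ-const SK d₁) (cong (d₁ ^_) (LP.length-map slotKey slots))))
                     (trans (∏-const KK d) (cong (_^ KK) (sym (length-bits d₁)))))

        E∏h≤ : E vs (λ ω → ∏ (λ i → h i ω)) ≤ d₁ ^ length slots * total vs KK
        E∏h≤ = ≤-trans (E-∏≤ vs (λ i → mem i SK) h Bd h-inv h-mean h-out) (≤-reflexive ∏Bd)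

        cl : Ω → Slot → ℕ
        cl ω s = if slotClosed ω s then d₁ else d

        ex : Fin KK → ℕ
        ex i = if mem i E′ then d₁ else 1

        ∏ex : ∏ₗ slots (ex ∘ slotKey) ≡ d₁ ^ length E′
        ∏ex = trans (sym (∏ₗ-map slotKey slots ex)) (trans (sym (∏-mem SK-Unique ex))
          (trans (∏-cong eq) (trans (∏-mem E-Unique (λ _ → d₁)) (∏ₗ-const E′ d₁))))
          where eq : ∀ i → (if mem i SK then ex i else 1) ≡ (if mem i E′ then d₁ else 1)
                eq i with mem i SK in e₁ | mem i E′ in e₂
                ... | true  | _     = refl
                ... | false | false = refl
                ... | false | true  = ⊥-elim (true≢false (∈⇒mem (E-inside (mem⇒∈ E′ e₂))) e₁)

        module _ (M : ℕ) (ω : Ω) (χω : χ E′ M ω ≡ true) where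

          pres : ∀ {i} → i ∈ E′ → lookup ω i ≡ true
          pres = allᵇ-true (lookup ω) E′ (proj₁ (∧-true {allᵇ (lookup ω) E′} χω))

          χ₂ = ∧-true {allᵇ (fine ω E′) slots} (proj₂ (∧-true {allᵇ (lookup ω) E′} χω))

          opens : M ≤ ∑[ s ∈ slots ] (𝟙 (not (slotClosed ω s)))
          opens = ≤ᵇ-true M _ (proj₂ χ₂)

          out⇒closed : ∀ s → outᵇ ω s ≡ true → closed ω (lhs s) (rhs s) ≡ true
          out⇒closed s e =
            let (c , _ , p) = ∑-pos colours _ (≤ᵇ-true 1 _ e)
                (z , _ , q) = ∑-pos N _ p
                (_ , r)     = *-pos (𝟙 (not (inA c z))) _ q
                (r₁ , r₂)   = *-pos (𝟙 (edge ω c z (b c (lhs s)))) _ r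
            in closed-intro ω (lhs s) (rhs s) c z (𝟙-pos r₁) (𝟙-pos r₂)

          in⇒closed : ∀ s → inᵇ E′ s ≡ true → closed ω (lhs s) (rhs s) ≡ true
          in⇒closed s e =
            let (c , _ , p) = ∑-pos colours _ (≤ᵇ-true 1 _ e)
                (z , _ , q) = ∑-pos (Aᵢ c) _ p
                (o , r)     = *-pos (𝟙 (ok s c z)) _ q
                (o₁ , o₂)   = ∧-true {not (z == b c (lhs s))} (𝟙-pos o)
                (r₁ , r₂)   = *-pos (𝟙 (mem (key c z (b c (lhs s))) E′)) _ r
            in closed-intro ω (lhs s) (rhs s) c z (∧-intro o₁ (pres (mem⇒∈ E′ (𝟙-pos r₁)))) (∧-intro o₂ (pres (mem⇒∈ E′ (𝟙-pos r₂))))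

          -- A slot of the certificate is present and has weight d d₁; one of `Uᵇ` is absent and has
          -- weight d; any other is closed and has weight d₁. In each case an open slot has its
          -- factor d.
          factor : ∀ {s} → s ∈ slots → cl ω s * ex (slotKey s) ≤ g ω (slotKey s) (lookup ω (slotKey s))
          factor {s} s∈ with mem (slotKey s) E′ in eE
          ... | true rewrite pres (mem⇒∈ E′ eE) = ≤-trans (*-monoˡ-≤ d₁ (cl≤ (slotClosed ω s))) (≤-reflexive (sym (*-identityʳ (d * d₁))))
            where cl≤ : ∀ t → (if t then d₁ else d) ≤ d
                  cl≤ true  = n≤1+n d₁
                  cl≤ false = ≤-refl
          ... | false with mem (slotKey s) (UK ω) in eU
          ...   | true = ≤-trans (≤-reflexive (*-identityʳ (cl ω s))) (≤-trans (cl≤ (slotClosed ω s)) (≤-reflexive (trans (sym (*-identityʳ d)) (cong (λ t → d * 𝟙 (not t)) (sym absent)))))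
            where
            cl≤ : ∀ t → (if t then d₁ else d) ≤ d
            cl≤ true  = n≤1+n d₁
            cl≤ false = ≤-refl
            Us : Uᵇ ω E′ s ≡ true
            Us with ∈-map⁻ slotKey (mem⇒∈ (UK ω) eU)
            ... | t , t∈ , e with slotKey-inj s∈ (proj₁ (∈-filt⁻ (Uᵇ ω E′) slots t∈)) e
              where slotKey-inj : ∀ {s t} → s ∈ slots → t ∈ slots → slotKey s ≡ slotKey t → s ≡ t
                    slotKey-inj {c , x , y} {c′ , x′ , y′} s∈ t∈ e with key-inj {c} {c′} {x} {x′} {y} {y′} e
                    ... | refl , inj₁ (refl , refl) = refl
                    ... | refl , inj₂ (refl , refl) = ⊥-elim (<-asym (proj₂ (proj₂ (slots⁻ s∈))) (proj₂ (proj₂ (slots⁻ t∈))))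
            ...   | refl = proj₂ (∈-filt⁻ (Uᵇ ω E′) slots t∈)
            absent : lookup ω (slotKey s) ≡ false
            absent with allᵇ-true (fine ω E′) slots (proj₁ χ₂) s∈
            ... | f rewrite eE | Us = not-true f
          ...   | false = ≤-trans (≤-reflexive (trans (*-identityʳ (cl ω s)) (cong (λ t → if t then d₁ else d) isClosed))) ≤-refl
            where
            nU : Uᵇ ω E′ s ≡ false
            nU with Uᵇ ω E′ s in e
            ... | false = refl
            ... | true  = ⊥-elim (true≢false (∈⇒mem (∈-map⁺ slotKey (∈-filt⁺ (Uᵇ ω E′) s∈ e))) eU)
            isClosed : slotClosed ω s ≡ true
            isClosed with same s | outᵇ ω s in e₁ | inᵇ E′ s in e₂ | nU
            ... | true  | _     | _     | _ = refl
            ... | false | true  | _     | _ = out⇒closed s e₁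
            ... | false | false | true  | _ = in⇒closed s e₂

          ∏h≥ : d₁ ^ length slots * d ^ M * d₁ ^ length E′ ≤ ∏ (λ i → h i ω) * d₁ ^ M
          ∏h≥ = begin
            d₁ ^ length slots * d ^ M * d₁ ^ length E′                 ≤⟨ *-monoˡ-≤ _ (∏ₗ-mixed d₁ (slotClosed ω) slots M opens) ⟩
            ∏ₗ slots (cl ω) * d₁ ^ M * d₁ ^ length E′                  ≡⟨ cong (∏ₗ slots (cl ω) * d₁ ^ M *_) ∏ex ⟨
            ∏ₗ slots (cl ω) * d₁ ^ M * ∏ₗ slots (ex ∘ slotKey)         ≡⟨ p (∏ₗ slots (cl ω)) (d₁ ^ M) _ ⟩
            ∏ₗ slots (cl ω) * ∏ₗ slots (ex ∘ slotKey) * d₁ ^ M         ≡⟨ cong (_* d₁ ^ M) (∏ₗ-* slots (cl ω) (ex ∘ slotKey)) ⟨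
            ∏ₗ slots (λ s → cl ω s * ex (slotKey s)) * d₁ ^ M          ≤⟨ *-monoˡ-≤ (d₁ ^ M) (∏ₗ-mono∈ slots factor) ⟩
            ∏ₗ slots (λ s → g ω (slotKey s) (lookup ω (slotKey s))) * d₁ ^ M ≡⟨ cong (_* d₁ ^ M) (trans (sym (∏ₗ-map slotKey slots (λ i → g ω i (lookup ω i)))) (sym (∏-mem SK-Unique (λ i → g ω i (lookup ω i))))) ⟩
            ∏ (λ i → h i ω) * d₁ ^ M ∎
            where p : ∀ a b c → a * b * c ≡ a * c * b
                  p = solve-∀

        -- With N slots, the product of the weights is at least d₁^(N - M) d^M d₁^|E′| on the event,
        -- while its mean is d₁^N. The result is (1 - 1/d)^M d₁^(-|E′|), and nothing was conditioned
        -- on the number of open slots.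
        E-χ : ∀ M → E vs (λ ω → 𝟙 (χ E′ M ω)) * (d ^ M * d₁ ^ length E′) ≤ d₁ ^ M * total vs KK
        E-χ M = *-cancelˡ-≤ (d₁ ^ length slots) {{m^n≢0 d₁ (length slots)}} (begin
            σ * (E vs X * (d ^ M * d₁ ^ length E′))            ≡⟨ p σ (E vs X) (d ^ M) (d₁ ^ length E′) ⟩
            E vs X * (σ * d ^ M * d₁ ^ length E′)              ≡⟨ E-*ʳ vs X _ ⟨
            E vs (λ ω → X ω * (σ * d ^ M * d₁ ^ length E′))    ≤⟨ E-mono vs pt ⟩
            E vs (λ ω → ∏ (λ i → h i ω) * d₁ ^ M)              ≡⟨ E-*ʳ vs (λ ω → ∏ (λ i → h i ω)) (d₁ ^ M) ⟩
            E vs (λ ω → ∏ (λ i → h i ω)) * d₁ ^ M              ≤⟨ *-monoˡ-≤ (d₁ ^ M) E∏h≤ ⟩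
            σ * total vs KK * d₁ ^ M                           ≡⟨ q σ (total vs KK) (d₁ ^ M) ⟩
            σ * (d₁ ^ M * total vs KK) ∎)
          where
          σ = d₁ ^ length slots
          X : Ω → ℕ
          X ω = 𝟙 (χ E′ M ω)
          p : ∀ a b c d → a * (b * (c * d)) ≡ b * (a * c * d)
          p = solve-∀
          q : ∀ a b c → a * b * c ≡ a * (c * b)
          q = solve-∀
          pt : ∀ ω → X ω * (σ * d ^ M * d₁ ^ length E′) ≤ ∏ (λ i → h i ω) * d₁ ^ M
          pt ω with χ E′ M ω in eq
          ... | true  = ≤-trans (≤-reflexive (*-identityˡ _)) (∏h≥ M ω eq)
          ... | false = z≤n

-- Present slots closed from inside, and the union bound over certificates

module ClosingTriples where

  open import Data.Nat
  open import Data.Nat.Properties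
  open import Data.Nat.Tactic.RingSolver using (solve-∀)
  open import Data.Bool using (Bool; true; false; _∧_; _∨_; not)
  open import Data.Fin using (Fin; suc; toℕ)
  import Data.Fin.Properties as FP
  open import Data.Vec using (lookup)
  open import Data.List using (List; []; _∷_; length; map; _++_; concat; concatMap; cartesianProduct)
  import Data.List.Properties as LP
  open import Data.List.Membership.Propositional using (_∈_; _∉_)
  open import Data.List.Membership.Propositional.Properties using (∈-map⁺; ∈-map⁻)
  open import Data.List.Relation.Unary.Any using (here; there)
  open import Data.List.Relation.Unary.All using ([]; _∷_)
  open import Data.List.Relation.Unary.AllPairs using ([]; _∷_)
  open import Data.List.Relation.Unary.Unique.Propositional using (Unique)
  open import Data.List.Relation.Binary.Sublist.Propositional using (_⊆_)
  open import Data.Product using (Σ; _×_; _,_; proj₁; proj₂)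
  open import Data.Sum using (_⊎_; inj₁; inj₂)
  open import Data.Empty using (⊥; ⊥-elim)
  open import Relation.Nullary using (yes; no; does)
  open import Relation.Binary.PropositionalEquality
  open import Function using (_∘_)
  open import Data.List.Relation.Unary.Unique.DecPropositional using (unique?)
  open Sums
  open Expectation
  open Events
  open LargeDeviations
  open RandomHost
  open TwoLevels
  open Colours
  open WeightedPairs

  private
    variable
      A B : Set

  length-concatMap : (g : A → List B) (xs : List A) → length (concatMap g xs) ≡ ∑[ x ∈ xs ] (length (g x))
  length-concatMap g []       = refl
  length-concatMap g (x ∷ xs) = trans (LP.length-++ (g x)) (cong (length (g x) +_) (length-concatMap g xs))

  levels-< : ∀ {i n} → i ∈ levels n → i < n
  levels-< {n = suc n} (here refl) = ≤-refl
  levels-< {n = suc n} (there i∈)  = m≤n⇒m≤1+n (levels-< i∈)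

  ∈-levels : ∀ {i n} → i < n → i ∈ levels n
  ∈-levels {i} {suc n} lt with i ≟ n
  ... | yes refl = here refl
  ... | no ne    = there (∈-levels (≤∧≢⇒< (≤-pred lt) ne))

  ∑-fins≤ : ∀ n {f : Fin n → ℕ} (c : ℕ) → (∀ i → f i ≤ c) → ∑ (fins n) f ≤ n * c
  ∑-fins≤ n c h = ≤-trans (∑-≤const (fins n) c (λ {i} _ → h i)) (≤-reflexive (cong (_* c) (length-fins n)))

  module Triples {m n : ℕ} (b : Fin 2 → Fin n → Fin m) (d₁ : ℕ) .{{_ : NonZero d₁}} (v₀ : Fin n) (I : List (Fin n)) where

    open Keys m
    open Construction b
    open Ind d₁ v₀ I
    open TwoLevel {KK}
    open ≤-Reasoning

    tbits : Slot → Fin 2 → Fin m → List (Fin KK)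
    tbits s c z = slotKey s ∷ key c z (b c (lhs s)) ∷ key c z (b c (rhs s)) ∷ []

    T₂ : Slot → Fin 2 → List (List (Fin KK))
    T₂ s c = map (tbits s c) (filt (ok s c) (Aᵢ c))

    T₁ : Slot → List (List (Fin KK))
    T₁ s = concatMap (T₂ s) colours

    slots′ : List Slot
    slots′ = filt (not ∘ same) slots

    -- One triple for each way in which a present slot can be closed by a point of an image: the
    -- slot and the two closing edges. All three coordinates lie in `SK`.
    𝒯 : List (List (Fin KK))
    𝒯 = concatMap T₁ slots′

    Shape : List (Fin KK) → Set
    Shape t = Σ Slot λ s → Σ (Fin 2) λ c → Σ (Fin m) λ z →
      (t ≡ tbits s c z) × s ∈ slots × same s ≡ false × z ∈ Aᵢ c × z ≢ b c (lhs s) × z ≢ b c (rhs s)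

    shape : ∀ {t} → t ∈ 𝒯 → Shape t
    shape t∈ with ∈-concatMap⁻ T₁ {slots′} t∈
    ... | s , s∈ , i with ∈-concatMap⁻ (T₂ s) {colours} i
    ...   | c , _ , j with ∈-map⁻ (tbits s c) j
    ...     | z , z∈ , e =
          let (s∈′ , ns) = ∈-filt⁻ (not ∘ same) slots s∈
              (z∈′ , o)  = ∈-filt⁻ (ok s c) (Aᵢ c) z∈
              (o₁ , o₂)  = ∧-true {not (z == b c (lhs s))} o
          in s , c , z , e , s∈′ , not-true ns , z∈′ , ne (not-true o₁) , ne (not-true o₂)
      where ne : ∀ {x y : Fin m} → (x == y) ≡ false → x ≢ y
            ne {x} f refl = true≢false (==-refl x) f

    ∈𝒯 : ∀ {s c z} → s ∈ slots → same s ≡ false → z ∈ Aᵢ c → z ≢ b c (lhs s) → z ≢ b c (rhs s) → tbits s c z ∈ 𝒯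
    ∈𝒯 {s} {c} {z} s∈ ns z∈ n₁ n₂ = ∈-concatMap⁺ T₁ (∈-filt⁺ (not ∘ same) s∈ (cong not ns))
      (∈-concatMap⁺ (T₂ s) (∈-fins c) (∈-map⁺ (tbits s c) (∈-filt⁺ (ok s c) z∈ (∧-intro (cong not (≢⇒== n₁)) (cong not (≢⇒== n₂))))))

    blobs : ∀ {s} → s ∈ slots → (∀ c → b c (lhs s) ∈ Aᵢ c × b c (rhs s) ∈ Aᵢ c) ×
            b (proj₁ s) (lhs s) ≡ proj₁ (proj₂ s) × b (proj₁ s) (rhs s) ≡ proj₂ (proj₂ s)
    blobs {c₀ , x , y} s∈ =
      let (x∈ , y∈ , _) = slots⁻ s∈
          (p , q)   = rep-spec x∈
          (p′ , q′) = rep-spec y∈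
      in (λ c → ∈A p , ∈A p′) , q , q′

    same-false : ∀ {s} → same s ≡ false → ∀ c → b c (lhs s) ≢ b c (rhs s)
    same-false {s} ns c e = true≢false (≤ᵇ-intro (≤-trans (≤-reflexive (sym (cong 𝟙 (trans (cong (_== b c (rhs s)) e) (==-refl (b c (rhs s)))))))
      (∈⇒≤∑ (λ c → 𝟙 (b c (lhs s) == b c (rhs s))) (∈-fins c)))) ns

    -- A common coordinate would have the colour of the slot, and z would be an end of the slot,
    -- that is, the image of one of its representatives.
    key≢slotKey : ∀ {s c z t} → s ∈ slots → z ≢ b c (lhs s) → z ≢ b c (rhs s) → slotKey s ≢ key c z t
    key≢slotKey {c₀ , x , y} {c} {z} {t} s∈ n₁ n₂ e with key-inj {c₀} {c} {x} {z} {y} {t} e | blobs s∈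
    ... | refl , inj₁ (p , _) | _ , q , _  = n₁ (trans (sym p) (sym q))
    ... | refl , inj₂ (_ , p) | _ , _ , q′ = n₂ (trans (sym p) (sym q′))

    Shape-wf : ∀ {t} → Shape t → Unique t × length t ≡ 3
    Shape-wf (s , c , z , refl , s∈ , ns , z∈ , n₁ , n₂) =
      (key≢slotKey s∈ n₁ n₂ ∷ key≢slotKey s∈ n₁ n₂ ∷ []) ∷
      ((λ e → same-false ns c (key-injʳ {c} {z} e)) ∷ []) ∷ [] ∷ [] , refl

    𝒯-wf : ∀ {t} → t ∈ 𝒯 → Unique t × length t ≡ 3
    𝒯-wf t∈ = Shape-wf (shape t∈)

    Shape-inside : ∀ {t i} → Shape t → i ∈ t → i ∈ SK
    Shape-inside (s , c , z , refl , s∈ , ns , z∈ , n₁ , n₂) (here refl)                 = ∈-map⁺ slotKey s∈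
    Shape-inside (s , c , z , refl , s∈ , ns , z∈ , n₁ , n₂) (there (here refl))         = inside⁺ z∈ (proj₁ (proj₁ (blobs s∈) c)) n₁
    Shape-inside (s , c , z , refl , s∈ , ns , z∈ , n₁ , n₂) (there (there (here refl))) = inside⁺ z∈ (proj₂ (proj₁ (blobs s∈) c)) n₂

    𝒯-inside : ∀ {t i} → t ∈ 𝒯 → i ∈ t → i ∈ SK
    𝒯-inside t∈ i∈ = Shape-inside (shape t∈) i∈

    tot = total vs KK

    valid : ℕ → ℕ → List (Fin KK) → Bool
    valid j₀ j₁ E = does (unique? FP._≟_ E) ∧ (allᵇ (λ i → mem i SK) E ∧ (length E ≡ᵇ 3 * j₀ + 2 * j₁))

    term : ℕ → ℕ → ℕ → List (List (Fin KK)) → List (List (Fin KK)) → Ω → ℕ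
    term M j₀ j₁ 𝓕₀ 𝓕₁ ω = 𝟙 (valid j₀ j₁ (concat 𝓕₀ ++ concat 𝓕₁)) * 𝟙 (χ (concat 𝓕₀ ++ concat 𝓕₁) M ω)

    -- The number of certificates whose assertion holds, sorted by the sizes of their two levels. It
    -- is positive as soon as I is independent with `M` open slots.
    φ : ℕ → ℕ → Ω → ℕ
    φ M J ω = ∑[ j₀ ∈ levels J ] (∑[ j₁ ∈ levels J ] (∑[ 𝓕₀ ∈ subs j₀ 𝒯 ] (∑[ 𝓕₁ ∈ subs j₁ (𝒫 (concat 𝓕₀) 𝒯) ] (term M j₀ j₁ 𝓕₀ 𝓕₁ ω))))

    E-term : ∀ M j₀ j₁ 𝓕₀ 𝓕₁ → E vs (term M j₀ j₁ 𝓕₀ 𝓕₁) * (d ^ M * d₁ ^ (3 * j₀ + 2 * j₁)) ≤ d₁ ^ M * tot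
    E-term M j₀ j₁ 𝓕₀ 𝓕₁ = ≤-trans (≤-reflexive (cong (_* (d ^ M * d₁ ^ (3 * j₀ + 2 * j₁))) (E-*ˡ vs (𝟙 (valid j₀ j₁ E₁)) (λ ω → 𝟙 (χ E₁ M ω))))) (go (valid j₀ j₁ E₁) refl)
      where
      E₁ = concat 𝓕₀ ++ concat 𝓕₁
      go : ∀ v → valid j₀ j₁ E₁ ≡ v → 𝟙 v * E vs (λ ω → 𝟙 (χ E₁ M ω)) * (d ^ M * d₁ ^ (3 * j₀ + 2 * j₁)) ≤ d₁ ^ M * tot
      go false _ = z≤n
      go true  e =
        let (u , e′) = ∧-true {does (unique? FP._≟_ E₁)} e
            (ins , l) = ∧-true {allᵇ (λ i → mem i SK) E₁} e′
        in ≤-trans (≤-reflexive (cong₂ (λ s t → s * (d ^ M * d₁ ^ t)) (*-identityˡ (E vs (λ ω → 𝟙 (χ E₁ M ω)))) (sym (≡ᵇ⇒≡ (length E₁) (3 * j₀ + 2 * j₁) (subst Data.Bool.T (sym l) _)))))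
             (E-χ E₁ (does-true (unique? FP._≟_ E₁) u) (λ i∈ → mem⇒∈ SK (allᵇ-true (λ i → mem i SK) E₁ ins i∈)) M)

    module Bounds (k : ℕ) (|I|≤k : length I ≤ k) where

      length-A : ∀ c → length (Aᵢ c) ≤ k
      length-A c = begin
        length (Aᵢ c)               ≡⟨ length-filt (inA c) N ⟩
        ∑[ x ∈ N ] (𝟙 (mem x (im c))) ≤⟨ ∑-mem≤ (im c) ⟩
        length (im c)               ≡⟨ LP.length-map (b c) I ⟩
        length I                    ≤⟨ |I|≤k ⟩
        k ∎

      length-slots : length slots ≤ 2 * (k * k)
      length-slots = ≤-trans (≤-reflexive (length-concatMap row colours)) (∑-fins≤ 2 (k * k) (λ c → begin
        length (row c)                                  ≡⟨ LP.length-map (c ,_) (filt ltᵇ (cartesianProduct (Aᵢ c) (Aᵢ c))) ⟩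
        length (filt ltᵇ (cartesianProduct (Aᵢ c) (Aᵢ c))) ≤⟨ ⊆⇒length (filt-⊆ ltᵇ (cartesianProduct (Aᵢ c) (Aᵢ c))) ⟩
        length (cartesianProduct (Aᵢ c) (Aᵢ c))         ≡⟨ length-cartesianProduct (Aᵢ c) (Aᵢ c) ⟩
        length (Aᵢ c) * length (Aᵢ c)                   ≤⟨ *-mono-≤ (length-A c) (length-A c) ⟩
        k * k ∎))

      length-𝒯 : length 𝒯 ≤ 2 * (k * k) * (2 * k)
      length-𝒯 = begin
        length 𝒯                                      ≡⟨ length-concatMap T₁ slots′ ⟩
        ∑[ s ∈ slots′ ] (length (T₁ s))               ≤⟨ ∑-≤const slots′ (2 * k) (λ {s} _ → one s) ⟩
        length slots′ * (2 * k)                       ≤⟨ *-monoˡ-≤ (2 * k) (≤-trans (⊆⇒length (filt-⊆ (not ∘ same) slots)) length-slots) ⟩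
        2 * (k * k) * (2 * k) ∎
        where
        one : ∀ s → length (T₁ s) ≤ 2 * k
        one s = ≤-trans (≤-reflexive (length-concatMap (T₂ s) colours)) (∑-fins≤ 2 k (λ c →
          ≤-trans (≤-reflexive (LP.length-map (tbits s c) (filt (ok s c) (Aᵢ c)))) (≤-trans (⊆⇒length (filt-⊆ (ok s c) (Aᵢ c))) (length-A c))))

      module _ (ρ : ℕ) (load : ∀ c x → ∑[ v ∈ fins n ] (𝟙 (b c v == x)) ≤ ρ) where

        -- The number of triples through one coordinate: 2k in which it is the slot, and twice 8kρ
        -- in which it is one or the other closing edge.
        R : ℕ
        R = 2 * k + (k * (2 * (2 * (ρ + ρ))) + k * (2 * (2 * (ρ + ρ))))

        f : Fin KK → Fin n → ℕ
        f β v = ∑[ c ∈ colours ] (∑[ z ∈ Aᵢ c ] (𝟙 (β == key c z (b c v))))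

        -- The coordinate determines the pair of points z and b c v up to order; for each colour and
        -- each order v lies in one fibre, of size at most ρ.
        ∑f : ∀ β → ∑ (fins n) (f β) ≤ 2 * (ρ + ρ)
        ∑f β = ≤-trans (≤-reflexive (∑-swap (fins n) colours _)) (∑-fins≤ 2 (ρ + ρ) each)
          where
          p = proj₁ (ends β)
          q = proj₂ (ends β)
          pt : ∀ c z v → 𝟙 (β == key c z (b c v)) ≤ 𝟙 (z == p) * 𝟙 (b c v == q) + 𝟙 (z == q) * 𝟙 (b c v == p)
          pt c z v with β == key c z (b c v) in eq
          ... | false = z≤n
          ... | true with subst (λ κ → (z ≡ proj₁ (ends κ) × b c v ≡ proj₂ (ends κ)) ⊎ (z ≡ proj₂ (ends κ) × b c v ≡ proj₁ (ends κ))) (sym (==⇒≡ eq)) (ends-key c z (b c v))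
          ...   | inj₁ (r , r′) rewrite trans (cong (_== p) r) (==-refl p) | trans (cong (_== q) r′) (==-refl q) = s≤s z≤n
          ...   | inj₂ (r , r′) rewrite trans (cong (_== q) r) (==-refl q) | trans (cong (_== p) r′) (==-refl p) = m≤n+m 1 (𝟙 (z == p) * 𝟙 (b c v == q))
          half : ∀ c r t → ∑[ z ∈ N ] (∑[ v ∈ fins n ] (𝟙 (z == r) * 𝟙 (b c v == t))) ≤ ρ
          half c r t = begin
            ∑[ z ∈ N ] (∑[ v ∈ fins n ] (𝟙 (z == r) * 𝟙 (b c v == t)))   ≡⟨ ∑-cong N (λ z → ∑-*ˡ (fins n) (𝟙 (z == r)) _) ⟩
            ∑[ z ∈ N ] (𝟙 (z == r) * ∑[ v ∈ fins n ] (𝟙 (b c v == t)))   ≤⟨ ∑-δ≤ (fins-Unique m) r (λ _ → ∑[ v ∈ fins n ] (𝟙 (b c v == t))) ⟩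
            ∑[ v ∈ fins n ] (𝟙 (b c v == t))                             ≤⟨ load c t ⟩
            ρ ∎
          each : ∀ c → ∑[ v ∈ fins n ] (∑[ z ∈ Aᵢ c ] (𝟙 (β == key c z (b c v)))) ≤ ρ + ρ
          each c = begin
            ∑[ v ∈ fins n ] (∑[ z ∈ Aᵢ c ] (𝟙 (β == key c z (b c v))))   ≤⟨ ∑-mono (fins n) (λ v → ∑-filt≤ (inA c) N _) ⟩
            ∑[ v ∈ fins n ] (∑[ z ∈ N ] (𝟙 (β == key c z (b c v))))      ≡⟨ ∑-swap (fins n) N _ ⟩
            ∑[ z ∈ N ] (∑[ v ∈ fins n ] (𝟙 (β == key c z (b c v))))      ≤⟨ ∑-mono N (λ z → ∑-mono (fins n) (λ v → pt c z v)) ⟩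
            ∑[ z ∈ N ] (∑[ v ∈ fins n ] (𝟙 (z == p) * 𝟙 (b c v == q) + 𝟙 (z == q) * 𝟙 (b c v == p)))
              ≡⟨ trans (∑-cong N (λ z → ∑-+ (fins n) _ _)) (∑-+ N _ _) ⟩
            ∑[ z ∈ N ] (∑[ v ∈ fins n ] (𝟙 (z == p) * 𝟙 (b c v == q))) + ∑[ z ∈ N ] (∑[ v ∈ fins n ] (𝟙 (z == q) * 𝟙 (b c v == p)))
              ≤⟨ +-mono-≤ (half c p q) (half c q p) ⟩
            ρ + ρ ∎

        ∑rep : ∀ c (g : Fin n → ℕ) → ∑[ x ∈ Aᵢ c ] (g (rep c x)) ≤ ∑ (fins n) g
        ∑rep c g = ≤-trans (≤-reflexive (sym (∑-map (rep c) (Aᵢ c) g)))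
          (∑-Unique≤ (Unique-map∈ (rep c) (A-Unique c) (λ i j e → trans (sym (proj₂ (rep-spec i))) (trans (cong (b c) e) (proj₂ (rep-spec j))))) g)

        ∑slots : ∀ (g : Slot → ℕ) → ∑ slots g ≤ ∑[ c ∈ colours ] (∑[ x ∈ Aᵢ c ] (∑[ y ∈ Aᵢ c ] (g (c , x , y))))
        ∑slots g = ≤-trans (≤-reflexive (∑-concatMap row colours g)) (∑-mono colours (λ c → begin
          ∑ (row c) g                                                         ≡⟨ ∑-map (c ,_) (filt ltᵇ (cartesianProduct (Aᵢ c) (Aᵢ c))) g ⟩
          ∑ (filt ltᵇ (cartesianProduct (Aᵢ c) (Aᵢ c))) (λ p → g (c , p))     ≤⟨ ∑-filt≤ ltᵇ (cartesianProduct (Aᵢ c) (Aᵢ c)) _ ⟩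
          ∑ (cartesianProduct (Aᵢ c) (Aᵢ c)) (λ p → g (c , p))                ≡⟨ ∑-cartesianProduct (Aᵢ c) (Aᵢ c) _ ⟩
          ∑[ x ∈ Aᵢ c ] (∑[ y ∈ Aᵢ c ] (g (c , x , y))) ∎))

        ∑lhs : ∀ β → ∑[ s ∈ slots ] (f β (lhs s)) ≤ k * (2 * (2 * (ρ + ρ)))
        ∑lhs β = begin
          ∑[ s ∈ slots ] (f β (lhs s))                                              ≤⟨ ∑slots (λ s → f β (lhs s)) ⟩
          ∑[ c ∈ colours ] (∑[ x ∈ Aᵢ c ] (∑[ y ∈ Aᵢ c ] (f β (rep c x))))          ≤⟨ ∑-fins≤ 2 (k * (2 * (ρ + ρ))) each ⟩
          2 * (k * (2 * (ρ + ρ)))                                                   ≡⟨ q k (2 * (ρ + ρ)) ⟩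
          k * (2 * (2 * (ρ + ρ))) ∎
          where
          q : ∀ a b → 2 * (a * b) ≡ a * (2 * b)
          q = solve-∀
          each : ∀ c → ∑[ x ∈ Aᵢ c ] (∑[ y ∈ Aᵢ c ] (f β (rep c x))) ≤ k * (2 * (ρ + ρ))
          each c = begin
            ∑[ x ∈ Aᵢ c ] (∑[ y ∈ Aᵢ c ] (f β (rep c x)))   ≡⟨ trans (∑-cong (Aᵢ c) (λ x → ∑-const (Aᵢ c) (f β (rep c x)))) (∑-*ˡ (Aᵢ c) (length (Aᵢ c)) _) ⟩
            length (Aᵢ c) * ∑[ x ∈ Aᵢ c ] (f β (rep c x))   ≤⟨ *-mono-≤ (length-A c) (≤-trans (∑rep c (f β)) (∑f β)) ⟩
            k * (2 * (ρ + ρ)) ∎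

        ∑rhs : ∀ β → ∑[ s ∈ slots ] (f β (rhs s)) ≤ k * (2 * (2 * (ρ + ρ)))
        ∑rhs β = begin
          ∑[ s ∈ slots ] (f β (rhs s))                                              ≤⟨ ∑slots (λ s → f β (rhs s)) ⟩
          ∑[ c ∈ colours ] (∑[ x ∈ Aᵢ c ] (∑[ y ∈ Aᵢ c ] (f β (rep c y))))          ≤⟨ ∑-fins≤ 2 (k * (2 * (ρ + ρ))) each ⟩
          2 * (k * (2 * (ρ + ρ)))                                                   ≡⟨ q k (2 * (ρ + ρ)) ⟩
          k * (2 * (2 * (ρ + ρ))) ∎
          where
          q : ∀ a b → 2 * (a * b) ≡ a * (2 * b)
          q = solve-∀
          each : ∀ c → ∑[ x ∈ Aᵢ c ] (∑[ y ∈ Aᵢ c ] (f β (rep c y))) ≤ k * (2 * (ρ + ρ))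
          each c = ≤-trans (≤-reflexive (∑-const (Aᵢ c) _)) (*-mono-≤ (length-A c) (≤-trans (∑rep c (f β)) (∑f β)))

        𝒯-load : ∀ β → ∑[ t ∈ 𝒯 ] (𝟙 (mem β t)) ≤ R
        𝒯-load β = begin
          ∑[ t ∈ 𝒯 ] (𝟙 (mem β t))                                         ≡⟨ ∑-concatMap T₁ slots′ _ ⟩
          ∑[ s ∈ slots′ ] (∑ (T₁ s) (λ t → 𝟙 (mem β t)))                   ≤⟨ ∑-filt≤ (not ∘ same) slots _ ⟩
          ∑[ s ∈ slots ] (∑ (T₁ s) (λ t → 𝟙 (mem β t)))                    ≤⟨ ∑-mono slots one ⟩
          ∑[ s ∈ slots ] (𝟙 (slotKey s == β) * (2 * k) + (f β (lhs s) + f β (rhs s)))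
            ≡⟨ trans (∑-+ slots _ _) (cong₂ _+_ (∑-*ʳ slots (2 * k) _) (∑-+ slots _ _)) ⟩
          ∑[ s ∈ slots ] (𝟙 (slotKey s == β)) * (2 * k) + (∑[ s ∈ slots ] (f β (lhs s)) + ∑[ s ∈ slots ] (f β (rhs s)))
            ≤⟨ +-mono-≤ (*-monoˡ-≤ (2 * k) once) (+-mono-≤ (∑lhs β) (∑rhs β)) ⟩
          1 * (2 * k) + (k * (2 * (2 * (ρ + ρ))) + k * (2 * (2 * (ρ + ρ)))) ≡⟨ cong (_+ (k * (2 * (2 * (ρ + ρ))) + k * (2 * (2 * (ρ + ρ))))) (*-identityˡ (2 * k)) ⟩
          R ∎
          where
          once : ∑[ s ∈ slots ] (𝟙 (slotKey s == β)) ≤ 1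
          once = ≤-trans (≤-reflexive (trans (sym (∑-map slotKey slots (λ i → 𝟙 (i == β)))) (∑-cong SK (λ i → sym (*-identityʳ _))))) (∑-δ≤ SK-Unique β (λ _ → 1))
          three : ∀ e f g → 𝟙 (e ∨ (f ∨ (g ∨ false))) ≤ 𝟙 e + (𝟙 f + 𝟙 g)
          three e f g = ≤-trans (𝟙-∨ e _) (+-monoʳ-≤ (𝟙 e) (≤-trans (𝟙-∨ f _) (+-monoʳ-≤ (𝟙 f) (≤-trans (𝟙-∨ g false) (≤-reflexive (+-identityʳ (𝟙 g)))))))
          one : ∀ s → ∑ (T₁ s) (λ t → 𝟙 (mem β t)) ≤ 𝟙 (slotKey s == β) * (2 * k) + (f β (lhs s) + f β (rhs s))
          one s = begin
            ∑ (T₁ s) (λ t → 𝟙 (mem β t))                                   ≡⟨ ∑-concatMap (T₂ s) colours _ ⟩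
            ∑[ c ∈ colours ] (∑ (T₂ s c) (λ t → 𝟙 (mem β t)))              ≤⟨ ∑-mono colours (λ c → ≤-trans (≤-reflexive (∑-map (tbits s c) (filt (ok s c) (Aᵢ c)) _)) (≤-trans (∑-filt≤ (ok s c) (Aᵢ c) _) (∑-mono (Aᵢ c) (λ z → three (β == slotKey s) (β == key c z (b c (lhs s))) (β == key c z (b c (rhs s))))))) ⟩
            ∑[ c ∈ colours ] (∑[ z ∈ Aᵢ c ] (𝟙 (β == slotKey s) + (𝟙 (β == key c z (b c (lhs s))) + 𝟙 (β == key c z (b c (rhs s))))))
              ≡⟨ trans (∑-cong colours (λ c → trans (∑-+ (Aᵢ c) _ _) (cong (∑[ z ∈ Aᵢ c ] (𝟙 (β == slotKey s)) +_) (∑-+ (Aᵢ c) _ _)))) (trans (∑-+ colours _ _) (cong (∑[ c ∈ colours ] (∑[ z ∈ Aᵢ c ] (𝟙 (β == slotKey s))) +_) (∑-+ colours _ _))) ⟩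
            ∑[ c ∈ colours ] (∑[ z ∈ Aᵢ c ] (𝟙 (β == slotKey s))) + (f β (lhs s) + f β (rhs s))
              ≤⟨ +-monoˡ-≤ _ (∑-fins≤ 2 (k * 𝟙 (β == slotKey s)) (λ c → ≤-trans (≤-reflexive (∑-const (Aᵢ c) _)) (*-monoˡ-≤ _ (length-A c)))) ⟩
            2 * (k * 𝟙 (β == slotKey s)) + (f β (lhs s) + f β (rhs s))      ≡⟨ cong (_+ (f β (lhs s) + f β (rhs s))) (trans (q k (𝟙 (β == slotKey s))) (cong (λ t → 𝟙 t * (2 * k)) (==-sym β (slotKey s)))) ⟩
            𝟙 (slotKey s == β) * (2 * k) + (f β (lhs s) + f β (rhs s)) ∎
            where q : ∀ a b → 2 * (a * b) ≡ b * (2 * a)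
                  q = solve-∀

        module _ (D₃ D₂ c₀ : ℕ) .{{_ : NonZero D₃}} .{{_ : NonZero D₂}} (𝒯≤ : length 𝒯 ≤ c₀ * D₃) (8D₃≤ : 8 * D₃ ≤ d₁ ^ 3)
                 (3R≤ : 3 * R ≤ D₂) (D₂≤ : D₂ ≤ d₁ ^ 2) where

          -- There are at most 8^c₀ D₃^j₀ first levels and then 8^j₀ D₂^j₁ second levels, each pair
          -- of probability at most d₁^(-3j₀ - 2j₁) (1 - 1/d)^M. The factor 8^j₀ disappears in 8 D₃
          -- ≤ d₁³, so the price of all certificates is 8^c₀.
          inner : ∀ M j₀ j₁ → ∑[ 𝓕₀ ∈ subs j₀ 𝒯 ] (∑[ 𝓕₁ ∈ subs j₁ (𝒫 (concat 𝓕₀) 𝒯) ] (E vs (term M j₀ j₁ 𝓕₀ 𝓕₁) * d ^ M)) ≤ 8 ^ c₀ * (d₁ ^ M * tot)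
          inner M j₀ j₁ = *-cancelʳ-≤ _ _ P {{m^n≢0 d₁ (3 * j₀ + 2 * j₁)}} (begin
            ∑[ 𝓕₀ ∈ subs j₀ 𝒯 ] (∑[ 𝓕₁ ∈ subs j₁ (𝒫 (concat 𝓕₀) 𝒯) ] (E vs (term M j₀ j₁ 𝓕₀ 𝓕₁) * d ^ M)) * P
              ≡⟨ trans (sym (∑-*ʳ (subs j₀ 𝒯) P _)) (∑-cong (subs j₀ 𝒯) (λ 𝓕₀ → sym (∑-*ʳ (subs j₁ (𝒫 (concat 𝓕₀) 𝒯)) P _))) ⟩
            ∑[ 𝓕₀ ∈ subs j₀ 𝒯 ] (∑[ 𝓕₁ ∈ subs j₁ (𝒫 (concat 𝓕₀) 𝒯) ] (E vs (term M j₀ j₁ 𝓕₀ 𝓕₁) * d ^ M * P))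
              ≤⟨ ∑-≤const (subs j₀ 𝒯) (8 ^ j₀ * D₂ ^ j₁ * X) (λ {𝓕₀} 𝓕₀∈ → ≤-trans (∑-≤const (subs j₁ (𝒫 (concat 𝓕₀) 𝒯)) X
                   (λ {𝓕₁} _ → ≤-trans (≤-reflexive (*-assoc (E vs (term M j₀ j₁ 𝓕₀ 𝓕₁)) (d ^ M) P)) (E-term M j₀ j₁ 𝓕₀ 𝓕₁)))
                   (*-monoˡ-≤ X (length-subs≤ D₂ j₀ j₁ (𝒫 (concat 𝓕₀) 𝒯) (len𝒫 𝓕₀∈)))) ⟩
            length (subs j₀ 𝒯) * (8 ^ j₀ * D₂ ^ j₁ * X)     ≤⟨ *-monoˡ-≤ _ (length-subs≤ D₃ c₀ j₀ 𝒯 𝒯≤) ⟩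
            8 ^ c₀ * D₃ ^ j₀ * (8 ^ j₀ * D₂ ^ j₁ * X)       ≡⟨ q (8 ^ c₀) (D₃ ^ j₀) (8 ^ j₀) (D₂ ^ j₁) X ⟩
            8 ^ c₀ * X * (8 ^ j₀ * D₃ ^ j₀ * D₂ ^ j₁)       ≤⟨ *-monoʳ-≤ (8 ^ c₀ * X) (*-mono-≤ (≤-trans (≤-reflexive (sym (^-distribʳ-* 8 D₃ j₀))) (^-monoˡ-≤ j₀ 8D₃≤)) (^-monoˡ-≤ j₁ D₂≤)) ⟩
            8 ^ c₀ * X * ((d₁ ^ 3) ^ j₀ * (d₁ ^ 2) ^ j₁)    ≡⟨ cong (8 ^ c₀ * X *_) (trans (cong₂ _*_ (^-*-assoc d₁ 3 j₀) (^-*-assoc d₁ 2 j₁)) (sym (^-distribˡ-+-* d₁ (3 * j₀) (2 * j₁)))) ⟩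
            8 ^ c₀ * X * P ∎)
            where
            P = d₁ ^ (3 * j₀ + 2 * j₁)
            X = d₁ ^ M * tot
            q : ∀ a b c e x → a * b * (c * e * x) ≡ a * x * (c * b * e)
            q = solve-∀
            len𝒫 : ∀ {𝓕₀} → 𝓕₀ ∈ subs j₀ 𝒯 → length (𝒫 (concat 𝓕₀) 𝒯) ≤ j₀ * D₂
            len𝒫 {𝓕₀} i = let (s , l) = subs⇒⊆ j₀ 𝒯 i in begin
              length (𝒫 (concat 𝓕₀) 𝒯)    ≤⟨ length-𝒫 (concat 𝓕₀) 𝒯 R (λ t∈ → proj₂ (𝒯-wf t∈)) 𝒯-load ⟩
              length (concat 𝓕₀) * R      ≡⟨ cong (_* R) (length-concat 3 𝓕₀ (λ t∈ → proj₂ (𝒯-wf (⊆⇒∈ s t∈)))) ⟩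
              3 * length 𝓕₀ * R           ≤⟨ *-monoˡ-≤ R (*-monoʳ-≤ 3 l) ⟩
              3 * j₀ * R                  ≡⟨ q′ j₀ R ⟩
              j₀ * (3 * R)                ≤⟨ *-monoʳ-≤ j₀ 3R≤ ⟩
              j₀ * D₂ ∎
              where q′ : ∀ a b → 3 * a * b ≡ a * (3 * b)
                    q′ = solve-∀

          E-φ : ∀ M J → E vs (φ M J) * d ^ M ≤ J * (J * (8 ^ c₀ * (d₁ ^ M * tot)))
          E-φ M J = begin
            E vs (φ M J) * d ^ M
              ≡⟨ cong (_* d ^ M) (trans (E-∑ vs {K = KK} (levels J) _) (∑-cong (levels J) (λ j₀ → trans (E-∑ vs {K = KK} (levels J) _) (∑-cong (levels J) (λ j₁ →
                   trans (E-∑ vs {K = KK} (subs j₀ 𝒯) _) (∑-cong (subs j₀ 𝒯) (λ 𝓕₀ → E-∑ vs {K = KK} (subs j₁ (𝒫 (concat 𝓕₀) 𝒯)) (term M j₀ j₁ 𝓕₀)))))))) ⟩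
            ∑[ j₀ ∈ levels J ] (∑[ j₁ ∈ levels J ] (∑[ 𝓕₀ ∈ subs j₀ 𝒯 ] (∑[ 𝓕₁ ∈ subs j₁ (𝒫 (concat 𝓕₀) 𝒯) ] (E vs (term M j₀ j₁ 𝓕₀ 𝓕₁))))) * d ^ M
              ≡⟨ trans (sym (∑-*ʳ (levels J) (d ^ M) _)) (∑-cong (levels J) (λ j₀ → trans (sym (∑-*ʳ (levels J) (d ^ M) _)) (∑-cong (levels J) (λ j₁ →
                   trans (sym (∑-*ʳ (subs j₀ 𝒯) (d ^ M) _)) (∑-cong (subs j₀ 𝒯) (λ 𝓕₀ → sym (∑-*ʳ (subs j₁ (𝒫 (concat 𝓕₀) 𝒯)) (d ^ M) _))))))) ⟩
            ∑[ j₀ ∈ levels J ] (∑[ j₁ ∈ levels J ] (∑[ 𝓕₀ ∈ subs j₀ 𝒯 ] (∑[ 𝓕₁ ∈ subs j₁ (𝒫 (concat 𝓕₀) 𝒯) ] (E vs (term M j₀ j₁ 𝓕₀ 𝓕₁) * d ^ M))))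
              ≤⟨ ∑-≤const (levels J) _ (λ {j₀} _ → ∑-≤const (levels J) _ (λ {j₁} _ → inner M j₀ j₁)) ⟩
            length (levels J) * (length (levels J) * (8 ^ c₀ * (d₁ ^ M * tot)))   ≡⟨ cong (λ t → t * (t * (8 ^ c₀ * (d₁ ^ M * tot)))) (length-levels J) ⟩
            J * (J * (8 ^ c₀ * (d₁ ^ M * tot))) ∎

    module _ (ω : Ω) (E₁ : List (Fin KK))
             (ind : ∀ {u v} → u ∈ I → v ∈ I → u ≢ v → adjacent ω u v ≡ false)
             (two : ∀ {e f g} → (e ∷ f ∷ g ∷ []) ∈ 𝒯 → lookup ω e ≡ true → lookup ω f ≡ true → lookup ω g ≡ true →
                    e ∉ E₁ → f ∈ E₁ × g ∈ E₁) where

      outᵇ-intro : ∀ s c z → inA c z ≡ false → edge ω c z (b c (lhs s)) ≡ true → edge ω c z (b c (rhs s)) ≡ true → outᵇ ω s ≡ true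
      outᵇ-intro s c z zA e₁ e₂ = ≤ᵇ-intro (≤-trans (≤-reflexive (sym one)) (≤-trans (∈⇒≤∑ (G c) (∈-fins z)) (∈⇒≤∑ (λ c → ∑ N (G c)) (∈-fins c))))
        where G : Fin 2 → Fin m → ℕ
              G c z = 𝟙 (not (inA c z)) * (𝟙 (edge ω c z (b c (lhs s))) * 𝟙 (edge ω c z (b c (rhs s))))
              one : G c z ≡ 1
              one = trans (cong (λ t → 𝟙 (not t) * (𝟙 (edge ω c z (b c (lhs s))) * 𝟙 (edge ω c z (b c (rhs s))))) zA) (cong₂ (λ s t → 1 * (𝟙 s * 𝟙 t)) e₁ e₂)

      inᵇ-intro : ∀ s c z → z ∈ Aᵢ c → ok s c z ≡ true → key c z (b c (lhs s)) ∈ E₁ → key c z (b c (rhs s)) ∈ E₁ → inᵇ E₁ s ≡ true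
      inᵇ-intro s c z z∈ okz e₁ e₂ = ≤ᵇ-intro (≤-trans (≤-reflexive (sym one)) (≤-trans (∈⇒≤∑ (G c) z∈) (∈⇒≤∑ (λ c → ∑ (Aᵢ c) (G c)) (∈-fins c))))
        where G : Fin 2 → Fin m → ℕ
              G c z = 𝟙 (ok s c z) * (𝟙 (mem (key c z (b c (lhs s))) E₁) * 𝟙 (mem (key c z (b c (rhs s))) E₁))
              one : G c z ≡ 1
              one = trans (cong (λ t → 𝟙 t * (𝟙 (mem (key c z (b c (lhs s))) E₁) * 𝟙 (mem (key c z (b c (rhs s))) E₁))) okz) (cong₂ (λ s t → 1 * (𝟙 s * 𝟙 t)) (∈⇒mem e₁) (∈⇒mem e₂))

      -- The representatives are linked by the present edge, and two linked vertices of an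
      -- independent set can only be non-adjacent by being closed.
      present⇒closed : ∀ {c₀ x y} → (c₀ , x , y) ∈ slots → lookup ω (key c₀ x y) ≡ true → closed ω (rep c₀ x) (rep c₀ y) ≡ true
      present⇒closed {c₀} {x} {y} s∈ present = go (closed ω u v) refl
        where
        u v : Fin n
        u = rep c₀ x
        v = rep c₀ y
        s⁻ : x ∈ Aᵢ c₀ × y ∈ Aᵢ c₀ × toℕ x < toℕ y
        s⁻ = slots⁻ {c₀} {x} {y} s∈
        ux : u ∈ I × b c₀ u ≡ x
        ux = rep-spec {c₀} {x} (proj₁ s⁻)
        vy : v ∈ I × b c₀ v ≡ y
        vy = rep-spec {c₀} {y} (proj₁ (proj₂ s⁻))
        x≢y : x ≢ y
        x≢y e = <-irrefl (cong toℕ e) (proj₂ (proj₂ s⁻))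
        edge-xy : edge ω c₀ x y ≡ true
        edge-xy = ∧-intro {not (x == y)} {lookup ω (key c₀ x y)} (cong not (≢⇒== x≢y)) present
        edge-uv : edge ω c₀ (b c₀ u) (b c₀ v) ≡ true
        edge-uv = subst₂ (λ p q → edge ω c₀ p q ≡ true) (sym (proj₂ ux)) (sym (proj₂ vy)) edge-xy
        u≢v : u ≢ v
        u≢v e = x≢y (trans (sym (proj₂ ux)) (trans (cong (b c₀) e) (proj₂ vy)))
        lnk : linked ω u v ≡ true
        lnk = linked-intro ω u v c₀ edge-uv
        go : ∀ t → closed ω u v ≡ t → t ≡ true
        go true  _ = refl
        go false e = ⊥-elim (true≢false {adjacent ω u v} (∧-intro {linked ω u v} {not (closed ω u v)} lnk (cong not e)) (ind {u} {v} (proj₁ ux) (proj₁ vy) u≢v))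

      -- A present slot is closed by some z. If z is outside Aᵢ, this contradicts `outᵇ`; if it is
      -- inside, the triple is present, so `two` puts both closing edges into E₁ and contradicts
      -- `inᵇ`.
      absent : ∀ s → s ∈ slots → slotKey s ∉ E₁ → Uᵇ ω E₁ s ≡ true → lookup ω (slotKey s) ≡ true → ⊥
      absent s s∈ ∉E Us present = go (inA c z) refl
        where
        U₁ : not (same s) ≡ true × (not (outᵇ ω s) ∧ not (inᵇ E₁ s)) ≡ true
        U₁ = ∧-true {not (same s)} {not (outᵇ ω s) ∧ not (inᵇ E₁ s)} Us
        U₂ : not (outᵇ ω s) ≡ true × not (inᵇ E₁ s) ≡ true
        U₂ = ∧-true {not (outᵇ ω s)} {not (inᵇ E₁ s)} (proj₂ U₁)
        cl≡ : closed ω (lhs s) (rhs s) ≡ true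
        cl≡ = present⇒closed {proj₁ s} {proj₁ (proj₂ s)} {proj₂ (proj₂ s)} s∈ present
        cz : Σ (Fin 2) λ c → Σ (Fin m) λ z → edge ω c z (b c (lhs s)) ≡ true × edge ω c z (b c (rhs s)) ≡ true
        cz = closed-elim ω (lhs s) (rhs s) cl≡
        c : Fin 2
        c = proj₁ cz
        z : Fin m
        z = proj₁ (proj₂ cz)
        e₁ : edge ω c z (b c (lhs s)) ≡ true
        e₁ = proj₁ (proj₂ (proj₂ cz))
        e₂ : edge ω c z (b c (rhs s)) ≡ true
        e₂ = proj₂ (proj₂ (proj₂ cz))
        n₁ : z ≢ b c (lhs s)
        n₁ = edge⇒≢ ω c {z} {b c (lhs s)} e₁
        n₂ : z ≢ b c (rhs s)
        n₂ = edge⇒≢ ω c {z} {b c (rhs s)} e₂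
        go : ∀ t → inA c z ≡ t → ⊥
        go false zA = true≢false {outᵇ ω s} (outᵇ-intro s c z zA e₁ e₂) (not-true (proj₁ U₂))
        go true  zA = true≢false {inᵇ E₁ s} (inᵇ-intro s c z z∈ (∧-intro {not (z == b c (lhs s))} (cong not (≢⇒== n₁)) (cong not (≢⇒== n₂))) (proj₁ both) (proj₂ both)) (not-true (proj₂ U₂))
          where
          z∈ : z ∈ Aᵢ c
          z∈ = ∈-filt⁺ (inA c) (∈-fins z) zA
          t∈ : tbits s c z ∈ 𝒯
          t∈ = ∈𝒯 {s} {c} {z} s∈ (not-true (proj₁ U₁)) z∈ n₁ n₂
          both : key c z (b c (lhs s)) ∈ E₁ × key c z (b c (rhs s)) ∈ E₁
          both = two {slotKey s} {key c z (b c (lhs s))} {key c z (b c (rhs s))} t∈ present (edge⇒bit ω c {z} {b c (lhs s)} e₁) (edge⇒bit ω c {z} {b c (rhs s)} e₂) ∉E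

      fine-all : ∀ {s} → s ∈ slots → fine ω E₁ s ≡ true
      fine-all {s} s∈ = go (mem (slotKey s) E₁) (Uᵇ ω E₁ s) (lookup ω (slotKey s)) refl refl refl
        where
        go : ∀ p q r → mem (slotKey s) E₁ ≡ p → Uᵇ ω E₁ s ≡ q → lookup ω (slotKey s) ≡ r → (p ∨ (not q ∨ not r)) ≡ true
        go true  _     _     _  _  _  = refl
        go false false _     _  _  _  = refl
        go false true  false _  _  _  = refl
        go false true  true  e₁ e₂ e₃ = ⊥-elim (absent s s∈ (λ i → true≢false (∈⇒mem i) e₁) e₂ e₃)

    ≡ᵇ-intro : ∀ a b → a ≡ b → (a ≡ᵇ b) ≡ true
    ≡ᵇ-intro a b e with a ≡ᵇ b | ≡⇒≡ᵇ a b e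
    ... | true | _ = refl

    -- In an independent set every present slot is closed; by maximality of the two families a slot
    -- outside E₁ that is closed from inside is closed by two elements of E₁.
    φ-pos : ∀ M J ω → length 𝒯 < J → (∀ {u v} → u ∈ I → v ∈ I → u ≢ v → adjacent ω u v ≡ false) →
            M ≤ ∑[ s ∈ slots ] (𝟙 (not (slotClosed ω s))) → 1 ≤ φ M J ω
    φ-pos M J ω |𝒯|<J ind opens =
      let (𝓕₀ , 𝓕₁ , s₀ , s₁ , uniq , l , pr , two) = two-level 𝒯 (lookup ω) 𝒯-wf
      in concl 𝓕₀ 𝓕₁ s₀ s₁
           (∧-intro (does-intro (unique? FP._≟_ (concat 𝓕₀ ++ concat 𝓕₁)) uniq) (∧-intro
             (allᵇ-intro (λ i → mem i SK) (concat 𝓕₀ ++ concat 𝓕₁) (λ i∈ → let (_ , t , t∈ , i∈t) = pr i∈ in ∈⇒mem (𝒯-inside t∈ i∈t)))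
             (≡ᵇ-intro (length (concat 𝓕₀ ++ concat 𝓕₁)) (3 * length 𝓕₀ + 2 * length 𝓕₁) l)))
           (∧-intro (allᵇ-intro (lookup ω) (concat 𝓕₀ ++ concat 𝓕₁) (λ i∈ → proj₁ (pr i∈)))
             (∧-intro (allᵇ-intro (fine ω (concat 𝓕₀ ++ concat 𝓕₁)) slots (fine-all ω (concat 𝓕₀ ++ concat 𝓕₁) ind two)) (≤ᵇ-intro opens)))
      where
      concl : ∀ 𝓕₀ 𝓕₁ → 𝓕₀ ⊆ 𝒯 → 𝓕₁ ⊆ 𝒫 (concat 𝓕₀) 𝒯 →
              valid (length 𝓕₀) (length 𝓕₁) (concat 𝓕₀ ++ concat 𝓕₁) ≡ true →
              χ (concat 𝓕₀ ++ concat 𝓕₁) M ω ≡ true → 1 ≤ φ M J ω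
      concl 𝓕₀ 𝓕₁ s₀ s₁ v≡ χ≡ = begin
        1                                   ≡⟨ cong₂ (λ s t → 𝟙 s * 𝟙 t) (sym v≡) (sym χ≡) ⟩
        term M j₀ j₁ 𝓕₀ 𝓕₁ ω                ≤⟨ ∈⇒≤∑ (λ 𝓕₁ → term M j₀ j₁ 𝓕₀ 𝓕₁ ω) (∈-subs {j = j₁} s₁ ≤-refl) ⟩
        F₃ j₀ j₁ 𝓕₀                         ≤⟨ ∈⇒≤∑ (F₃ j₀ j₁) (∈-subs {j = j₀} s₀ ≤-refl) ⟩
        F₂ j₀ j₁                            ≤⟨ ∈⇒≤∑ (F₂ j₀) (∈-levels (≤-<-trans l₁ |𝒯|<J)) ⟩
        F₁ j₀                               ≤⟨ ∈⇒≤∑ F₁ (∈-levels (≤-<-trans (⊆⇒length s₀) |𝒯|<J)) ⟩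
        φ M J ω ∎
        where
        j₀ = length 𝓕₀
        j₁ = length 𝓕₁
        F₃ : ℕ → ℕ → List (List (Fin KK)) → ℕ
        F₃ j₀ j₁ 𝓕₀ = ∑[ 𝓕₁ ∈ subs j₁ (𝒫 (concat 𝓕₀) 𝒯) ] (term M j₀ j₁ 𝓕₀ 𝓕₁ ω)
        F₂ : ℕ → ℕ → ℕ
        F₂ j₀ j₁ = ∑[ 𝓕₀ ∈ subs j₀ 𝒯 ] (F₃ j₀ j₁ 𝓕₀)
        F₁ : ℕ → ℕ
        F₁ j₀ = ∑[ j₁ ∈ levels J ] (F₂ j₀ j₁)
        l₁ : j₁ ≤ length 𝒯
        l₁ = ≤-trans (⊆⇒length s₁) (≤-trans (⊆⇒length (filt-⊆ (λ t → length t ≡ᵇ 2) (map (rest (concat 𝓕₀)) 𝒯))) (≤-reflexive (LP.length-map (rest (concat 𝓕₀)) 𝒯)))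

-- A lower bound for the number of open slots

module OpenPairs where

  open import Data.Nat
  open import Data.Nat.Properties
  open import Data.Nat.Tactic.RingSolver using (solve-∀)
  open import Data.Bool using (Bool; true; false; _∨_; not)
  open import Data.Fin using (Fin; zero; suc; toℕ)
  import Data.Fin.Properties as FP
  open import Data.Vec using (Vec)
  open import Data.List using (List; []; _∷_; length; map; cartesianProduct)
  open import Data.List.Membership.Propositional using (_∈_)
  open import Data.List.Relation.Unary.All using ([]; _∷_)
  open import Data.List.Relation.Unary.AllPairs using ([]; _∷_)
  open import Data.List.Relation.Unary.Unique.Propositional using (Unique)
  open import Data.Product using (_,_; proj₂)
  open import Relation.Nullary using (yes; no)
  open import Relation.Binary.PropositionalEquality
  open Sums
  open Expectation
  open Events
  open LargeDeviations
  open RandomHost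
  open TwoLevels
  open Colours
  open ClosingTriples
  open WeightedPairs

  private
    variable
      A B : Set

  ∑-δ-by : ∀ {m} (x : Fin m) (f : Fin m → ℕ) → ∑[ y ∈ fins m ] (𝟙 (x == y) * f y) ≡ f x
  ∑-δ-by {m} x f = trans (∑-cong (fins m) (λ y → cong (λ t → 𝟙 t * f y) (==-sym x y))) (∑-δ (fins-Unique m) (∈-fins x) f)

  module OpenSlots {m n : ℕ} (b : Fin 2 → Fin n → Fin m) (d₁ : ℕ) .{{_ : NonZero d₁}} (v₀ : Fin n) (I : List (Fin n))
    (I-Unique : Unique I) (ω : Vec Bool (Keys.KK m))
    (k Δ L₁ cd α β γ : ℕ) (|I|≡k : length I ≡ k)
    (deg : ∀ c w → ∑[ x ∈ fins m ] (𝟙 (Keys.edge m ω c w x)) ≤ Δ)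
    (sparse : ∀ c {W X} → W ∈ subs k (fins m) → X ∈ subs k (fins m) → ∑[ w ∈ W ] (∑[ x ∈ X ] (𝟙 (Keys.edge m ω c w x))) ≤ L₁)
    (codeg : ∀ c {w w′} → w ≢ w′ → ∑[ x ∈ fins m ] (𝟙 (Keys.edge m ω c w x) * 𝟙 (Keys.edge m ω c w′ x)) ≤ cd)
    (joint : ∀ c {X Y} → X ∈ subs k (fins m) → Y ∈ subs k (fins m) →
       β * ∑[ w ∈ fins m ] (𝟙 (1 ≤ᵇ ∑[ x ∈ X ] (∑[ y ∈ Y ] (𝟙 (not (x == y)) * (𝟙 (Keys.edge m ω c w x) * 𝟙 (Keys.edge m ω c w y)))))) ≤ α * (length X * length Y) + γ)
    (t₀ t₁ j : ℕ) (L₁<kt₀ : L₁ < k * t₀)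
    (ρ : ℕ) (1≤ρ : 1 ≤ ρ) (few : k + j * j * (cd * ρ) < j * t₁)
    (load : ∀ c x → ∑[ v ∈ fins n ] (𝟙 (b c v == x)) ≤ ρ)
    where

    open Keys m
    open Construction b
    open Ind d₁ v₀ I

    open ≤-Reasoning

    a : Fin 2 → ℕ
    a c = length (Aᵢ c)

    -- Fibre size in I and indicator of the image: μ weighs the pairs closed in the colour other
    -- than that of the slot, ν those closed in its own colour.
    μ ν : Fin 2 → Fin m → ℕ
    μ c x = ∑[ v ∈ I ] (𝟙 (b c v == x))
    ν c x = 𝟙 (inA c x)

    μ≤ρ : ∀ c x → μ c x ≤ ρ
    μ≤ρ c x = ≤-trans (∑-Unique≤ I-Unique _) (load c x)

    ∑μ : ∀ c (f : Fin m → ℕ) → ∑[ x ∈ N ] (μ c x * f x) ≡ ∑[ v ∈ I ] (f (b c v))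
    ∑μ c f = trans (∑-cong N (λ x → sym (∑-*ʳ I (f x) _))) (trans (∑-swap N I _) (∑-cong I (λ v → ∑-δ-by (b c v) f)))

    ∑μ≡k : ∀ c → ∑ N (μ c) ≡ k
    ∑μ≡k c = trans (∑-cong N (λ x → sym (*-identityʳ (μ c x)))) (trans (∑μ c (λ _ → 1)) (trans (∑-1 I) |I|≡k))

    ∑ν≡a : ∀ c → ∑ N (ν c) ≡ a c
    ∑ν≡a c = sym (length-filt (inA c) N)

    ν≡ : ∀ c x → 𝟙 (1 ≤ᵇ μ c x) ≡ ν c x
    ν≡ c x = go I
      where
      go : ∀ J → 𝟙 (1 ≤ᵇ ∑[ v ∈ J ] (𝟙 (b c v == x))) ≡ 𝟙 (mem x (map (b c) J))
      go []      = refl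
      go (v ∷ J) rewrite ==-sym x (b c v) with b c v == x
      ... | true  = refl
      ... | false = go J

    exc+a : ∀ c → ∑[ x ∈ N ] (μ c x ∸ 1) + a c ≡ k
    exc+a c = trans (cong (∑[ x ∈ N ] (μ c x ∸ 1) +_) (trans (sym (∑ν≡a c)) (∑-cong N (λ x → sym (ν≡ c x)))))
      (trans (sym (∑-+ N _ _)) (trans (∑-cong N (λ x → e (μ c x))) (∑μ≡k c)))
      where e : ∀ t → t ∸ 1 + 𝟙 (1 ≤ᵇ t) ≡ t
            e zero    = refl
            e (suc t) = +-comm t 1

    a≤k : ∀ c → a c ≤ k
    a≤k c = ≤-trans (m≤n+m _ _) (≤-reflexive (exc+a c))

    u : Fin 2 → ℕ
    u c = k ∸ a c

    exc≡u : ∀ c → ∑[ x ∈ N ] (μ c x ∸ 1) ≡ u c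
    exc≡u c = sym (trans (cong (_∸ a c) (sym (exc+a c))) (m+n∸n≡m _ (a c)))

    ovl Err Low : ℕ
    ovl = j * j * (cd * ρ)
    Err = 2 * Δ * (k + ovl) + t₁ * (ρ * L₁)
    Low = t₀ * t₀ * (α * (k * k) + ρ * ρ * γ)

    Qw : Fin 2 → (Fin m → ℕ) → Fin m → ℕ
    Qw c κ w = ∑[ x ∈ N ] (∑[ y ∈ N ] (𝟙 (not (x == y)) * ((𝟙 (edge ω c w x) * κ x) * (𝟙 (edge ω c w y) * κ y))))

    -- τ is min(u, ρΔ): a single point sees at most the whole excess u, and at most Δ fibres of size
    -- ρ.
    cross-bound : ∀ c → β * ∑ N (Qw c (μ c)) ≤ β * ((u c ⊓ (ρ * Δ)) * (u c + ovl) + Err) + Low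
    cross-bound c = ≤-trans (C.closers-bound (u c ⊓ (ρ * Δ)) (λ w → ⊓-glb (≤-trans (C.ex≤exc w) (≤-reflexive (exc≡u c))) (C.ex≤ρΔ w)))
      (≤-reflexive (cong (λ t → β * t + Low) (trans (cong (λ t → (u c ⊓ (ρ * Δ)) * (t + ovl) + 2 * Δ * (k + ovl) + t₁ * (ρ * L₁)) (exc≡u c)) (+-assoc ((u c ⊓ (ρ * Δ)) * (u c + ovl)) _ _))))
      where module C = Closers (edge ω c) k Δ L₁ cd α β γ (deg c) (sparse c) (codeg c) (joint c) t₀ t₁ j L₁<kt₀ ρ few (μ c) (μ≤ρ c) (≤-reflexive (∑μ≡k c))

    -- Seen in the colour of the slot, representatives have distinct images; the excess is 0 and
    -- only error terms remain.
    own-bound : ∀ c → β * ∑ N (Qw c (ν c)) ≤ β * Err + Low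
    own-bound c = ≤-trans (C.closers-bound 0 (λ w → ≤-trans (C.ex≤exc w) (≤-reflexive exc≡0)))
      (≤-reflexive refl)
      where
      module C = Closers (edge ω c) k Δ L₁ cd α β γ (deg c) (sparse c) (codeg c) (joint c) t₀ t₁ j L₁<kt₀ ρ few (ν c)
        (λ x → ≤-trans (𝟙≤1 (inA c x)) 1≤ρ) (≤-trans (≤-reflexive (∑ν≡a c)) (a≤k c))
      exc≡0 : C.exc ≡ 0
      exc≡0 = trans (∑-cong N (λ x → z (inA c x))) (∑-zero N)
        where z : ∀ t → 𝟙 t ∸ 1 ≡ 0
              z true  = refl
              z false = refl

    same-sym : ∀ c x y → same (c , x , y) ≡ same (c , y , x)
    same-sym c x y = cong (1 ≤ᵇ_) (∑-cong colours (λ c′ → cong 𝟙 (==-sym (b c′ (rep c x)) (b c′ (rep c y)))))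

    closed-sym : ∀ p q → closed ω p q ≡ closed ω q p
    closed-sym p q = cong (1 ≤ᵇ_) (∑-cong colours (λ c → ∑-cong N (λ z → *-comm (𝟙 (edge ω c z (b c p))) (𝟙 (edge ω c z (b c q))))))

    slotClosed-sym : ∀ c x y → slotClosed ω (c , x , y) ≡ slotClosed ω (c , y , x)
    slotClosed-sym c x y = cong₂ _∨_ (same-sym c x y) (closed-sym (rep c x) (rep c y))

    #open : ℕ
    #open = ∑[ s ∈ slots ] (𝟙 (not (slotClosed ω s)))

    clo : Fin 2 → Fin m → Fin m → ℕ
    clo c x y = 𝟙 (slotClosed ω (c , x , y))

    closedPairs : Fin 2 → ℕ
    closedPairs c = ∑[ x ∈ Aᵢ c ] (∑[ y ∈ Aᵢ c ] (𝟙 (not (x == y)) * clo c x y))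

    openIn : Fin 2 → ℕ
    openIn c = ∑[ x ∈ Aᵢ c ] (∑[ y ∈ Aᵢ c ] (𝟙 (toℕ x <ᵇ toℕ y) * 𝟙 (not (slotClosed ω (c , x , y)))))

    #open≡ : #open ≡ ∑ colours openIn
    #open≡ = trans (∑-concatMap row colours _) (∑-cong colours (λ c → trans (∑-map (c ,_) (filt ltᵇ (cartesianProduct (Aᵢ c) (Aᵢ c))) _)
      (trans (∑-filt ltᵇ (cartesianProduct (Aᵢ c) (Aᵢ c)) _) (∑-cartesianProduct (Aᵢ c) (Aᵢ c) _))))

    -- The ordered pairs of points of Aᵢ: the diagonal, every open slot twice, and the closed pairs.
    square : ∀ c → a c * a c ≤ a c + 2 * openIn c + closedPairs c
    square c = begin
      a c * a c                                    ≡⟨ trans (sym (trans (∑-const (Aᵢ c) _) (cong (a c *_) (∑-1 (Aᵢ c))))) refl ⟩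
      ∑[ x ∈ Aᵢ c ] (∑[ y ∈ Aᵢ c ] 1)               ≤⟨ ∑-mono (Aᵢ c) (λ x → ∑-mono (Aᵢ c) (λ y → pt x y)) ⟩
      ∑[ x ∈ Aᵢ c ] (∑[ y ∈ Aᵢ c ] (𝟙 (y == x) * 1 + (o x y + o y x) + 𝟙 (not (x == y)) * clo c x y))
        ≡⟨ trans (∑-cong (Aᵢ c) (λ x → trans (∑-+ (Aᵢ c) _ _) (cong (_+ ∑[ y ∈ Aᵢ c ] (𝟙 (not (x == y)) * clo c x y)) (trans (∑-+ (Aᵢ c) _ _) (cong (∑[ y ∈ Aᵢ c ] (𝟙 (y == x) * 1) +_) (∑-+ (Aᵢ c) _ _))))))
             (trans (∑-+ (Aᵢ c) _ _) (cong (_+ closedPairs c) (trans (∑-+ (Aᵢ c) _ _) (cong (∑[ x ∈ Aᵢ c ] (∑[ y ∈ Aᵢ c ] (𝟙 (y == x) * 1)) +_) (∑-+ (Aᵢ c) _ _))))) ⟩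
      ∑[ x ∈ Aᵢ c ] (∑[ y ∈ Aᵢ c ] (𝟙 (y == x) * 1)) + (openIn c + ∑[ x ∈ Aᵢ c ] (∑[ y ∈ Aᵢ c ] (o y x))) + closedPairs c
        ≤⟨ +-monoˡ-≤ (closedPairs c) (+-mono-≤ (≤-trans (∑-mono (Aᵢ c) (λ x → ∑-δ≤ (A-Unique c) x (λ _ → 1))) (≤-reflexive (∑-1 (Aᵢ c))))
             (≤-reflexive (trans (cong (openIn c +_) (∑-swap (Aᵢ c) (Aᵢ c) _)) (cong (openIn c +_) (sym (+-identityʳ (openIn c))))))) ⟩
      a c + 2 * openIn c + closedPairs c ∎
      where
      o : Fin m → Fin m → ℕ
      o x y = 𝟙 (toℕ x <ᵇ toℕ y) * 𝟙 (not (slotClosed ω (c , x , y)))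
      pt : ∀ x y → 1 ≤ 𝟙 (y == x) * 1 + (o x y + o y x) + 𝟙 (not (x == y)) * clo c x y
      pt x y = go (<-cmp (toℕ x) (toℕ y))
        where
        open import Relation.Binary.Definitions using (tri<; tri≈; tri>; Tri)
        core : ∀ t → 1 ≤ 𝟙 (not t) + 𝟙 t
        core true  = ≤-refl
        core false = ≤-refl
        fin : ∀ A B {C D} → 1 ≤ C + D → C ≤ B → D ≤ A → 1 ≤ B + A
        fin A B le p q = ≤-trans le (+-mono-≤ p q)
        go : Tri (toℕ x < toℕ y) (toℕ x ≡ toℕ y) (toℕ y < toℕ x) → 1 ≤ 𝟙 (y == x) * 1 + (o x y + o y x) + 𝟙 (not (x == y)) * clo c x y
        go (tri≈ _ e _) rewrite FP.toℕ-injective e | ==-refl y = s≤s z≤n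
        go (tri< l ne _) = fin _ _ (core (slotClosed ω (c , x , y)))
          (≤-trans (≤-trans (≤-reflexive (sym (trans (cong (λ t → 𝟙 t * 𝟙 (not (slotClosed ω (c , x , y)))) (<ᵇ-intro l)) (*-identityˡ _)))) (m≤m+n (o x y) (o y x))) (m≤n+m _ (𝟙 (y == x) * 1)))
          (≤-reflexive (sym (trans (cong (λ t → 𝟙 (not t) * clo c x y) (≢⇒== (λ e → ne (cong toℕ e)))) (*-identityˡ _))))
        go (tri> _ ne l) = fin _ _ (core (slotClosed ω (c , y , x)))
          (≤-trans (≤-trans (≤-reflexive (sym (trans (cong (λ t → 𝟙 t * 𝟙 (not (slotClosed ω (c , y , x)))) (<ᵇ-intro l)) (*-identityˡ _)))) (m≤n+m (o y x) (o x y))) (m≤n+m _ (𝟙 (y == x) * 1)))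
          (≤-reflexive (trans (cong 𝟙 (slotClosed-sym c y x)) (sym (trans (cong (λ t → 𝟙 (not t) * clo c x y) (≢⇒== (λ e → ne (cong toℕ e)))) (*-identityˡ _)))))

    F : Fin 2 → Fin m → Fin m → ℕ
    F c′ p q = 𝟙 (p == q) + 𝟙 (not (p == q)) * ∑[ z ∈ N ] (𝟙 (edge ω c′ z p) * 𝟙 (edge ω c′ z q))

    clo≤F : ∀ c x y → clo c x y ≤ ∑[ c′ ∈ colours ] (F c′ (b c′ (rep c x)) (b c′ (rep c y)))
    clo≤F c x y = go (same (c , x , y)) (closed ω (rep c x) (rep c y)) refl refl
      where
      go : ∀ s t → same (c , x , y) ≡ s → closed ω (rep c x) (rep c y) ≡ t → 𝟙 (s ∨ t) ≤ ∑[ c′ ∈ colours ] (F c′ (b c′ (rep c x)) (b c′ (rep c y)))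
      go true  _     e _ = ≤-trans (≤ᵇ-true 1 _ e) (∑-mono colours (λ c′ → m≤m+n _ _))
      go false false _ _ = z≤n
      go false true  _ e =
        let (c′ , _ , p) = ∑-pos colours _ (≤ᵇ-true 1 _ e)
        in ≤-trans (at (b c′ (rep c x) == b c′ (rep c y)) _ p) (∈⇒≤∑ (λ c′ → F c′ (b c′ (rep c x)) (b c′ (rep c y))) (∈-fins c′))
        where
        at : ∀ t n → 1 ≤ n → 1 ≤ 𝟙 t + 𝟙 (not t) * n
        at true  n le = s≤s z≤n
        at false n le = ≤-trans le (≤-reflexive (sym (*-identityˡ n)))

    G : Fin 2 → Fin 2 → ℕ
    G c c′ = ∑[ x ∈ Aᵢ c ] (∑[ y ∈ Aᵢ c ] (𝟙 (not (x == y)) * F c′ (b c′ (rep c x)) (b c′ (rep c y))))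

    closedPairs≤ : ∀ c → closedPairs c ≤ ∑[ c′ ∈ colours ] (G c c′)
    closedPairs≤ c = begin
      closedPairs c
        ≤⟨ ∑-mono (Aᵢ c) (λ x → ∑-mono (Aᵢ c) (λ y → *-monoʳ-≤ (𝟙 (not (x == y))) (clo≤F c x y))) ⟩
      ∑[ x ∈ Aᵢ c ] (∑[ y ∈ Aᵢ c ] (𝟙 (not (x == y)) * ∑[ c′ ∈ colours ] (F c′ (b c′ (rep c x)) (b c′ (rep c y)))))
        ≡⟨ trans (∑-cong (Aᵢ c) (λ x → trans (∑-cong (Aᵢ c) (λ y → sym (∑-*ˡ colours (𝟙 (not (x == y))) _))) (∑-swap (Aᵢ c) colours _))) (∑-swap (Aᵢ c) colours _) ⟩
      ∑[ c′ ∈ colours ] (G c c′) ∎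

    Qw≡ : ∀ c κ → ∑ N (Qw c κ) ≡ ∑[ x ∈ N ] (κ x * ∑[ y ∈ N ] (κ y * (𝟙 (not (x == y)) * ∑[ z ∈ N ] (𝟙 (edge ω c z x) * 𝟙 (edge ω c z y)))))
    Qw≡ c κ = trans (∑-swap N N _) (∑-cong N (λ x → trans (∑-swap N N _) (trans (∑-cong N (λ y → at x y)) (∑-*ˡ N (κ x) _))))
      where
      p : ∀ a b c d e → a * ((b * c) * (d * e)) ≡ c * (e * a) * (b * d)
      p = solve-∀
      q : ∀ a b c d → a * (b * c) * d ≡ a * (b * (c * d))
      q = solve-∀
      at : ∀ x y → ∑[ w ∈ N ] (𝟙 (not (x == y)) * ((𝟙 (edge ω c w x) * κ x) * (𝟙 (edge ω c w y) * κ y))) ≡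
           κ x * (κ y * (𝟙 (not (x == y)) * ∑[ z ∈ N ] (𝟙 (edge ω c z x) * 𝟙 (edge ω c z y))))
      at x y = trans (∑-cong N (λ w → p (𝟙 (not (x == y))) (𝟙 (edge ω c w x)) (κ x) (𝟙 (edge ω c w y)) (κ y)))
        (trans (∑-*ˡ N (κ x * (κ y * 𝟙 (not (x == y)))) _) (q (κ x) (κ y) (𝟙 (not (x == y))) _))

    own : ∀ c → G c c ≤ ∑ N (Qw c (ν c))
    own c = begin
      G c c
        ≤⟨ ∑-mono∈ (Aᵢ c) (λ {x} x∈ → ∑-mono∈ (Aᵢ c) (λ {y} y∈ → pt x y (proj₂ (rep-spec x∈)) (proj₂ (rep-spec y∈)))) ⟩
      ∑[ x ∈ Aᵢ c ] (∑[ y ∈ Aᵢ c ] (𝟙 (not (x == y)) * ∑[ z ∈ N ] (𝟙 (edge ω c z x) * 𝟙 (edge ω c z y))))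
        ≡⟨ trans (∑-filt (inA c) N _) (∑-cong N (λ x → cong (ν c x *_) (∑-filt (inA c) N _))) ⟩
      ∑[ x ∈ N ] (ν c x * ∑[ y ∈ N ] (ν c y * (𝟙 (not (x == y)) * ∑[ z ∈ N ] (𝟙 (edge ω c z x) * 𝟙 (edge ω c z y)))))
        ≡⟨ Qw≡ c (ν c) ⟨
      ∑ N (Qw c (ν c)) ∎
      where
      drop : ∀ t n → 𝟙 (not t) * (𝟙 t + 𝟙 (not t) * n) ≤ 𝟙 (not t) * n
      drop true  n = z≤n
      drop false n = ≤-reflexive (cong (λ t → 1 * t) (*-identityˡ n))
      pt : ∀ x y → b c (rep c x) ≡ x → b c (rep c y) ≡ y →
           𝟙 (not (x == y)) * F c (b c (rep c x)) (b c (rep c y)) ≤ 𝟙 (not (x == y)) * ∑[ z ∈ N ] (𝟙 (edge ω c z x) * 𝟙 (edge ω c z y))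
      pt x y ex ey = subst₂ (λ p q → 𝟙 (not (x == y)) * F c p q ≤ 𝟙 (not (x == y)) * ∑[ z ∈ N ] (𝟙 (edge ω c z x) * 𝟙 (edge ω c z y))) (sym ex) (sym ey) (drop (x == y) _)

    ∑rep≤∑I : ∀ c (g : Fin n → ℕ) → ∑[ x ∈ Aᵢ c ] (g (rep c x)) ≤ ∑ I g
    ∑rep≤∑I c g = begin
      ∑[ x ∈ Aᵢ c ] (g (rep c x))                                      ≤⟨ ∑-mono∈ (Aᵢ c) pt ⟩
      ∑[ x ∈ Aᵢ c ] (∑[ v ∈ I ] (𝟙 (x == b c v) * g v))                ≡⟨ ∑-swap (Aᵢ c) I _ ⟩
      ∑[ v ∈ I ] (∑[ x ∈ Aᵢ c ] (𝟙 (x == b c v) * g v))                ≤⟨ ∑-mono I (λ v → ∑-δ≤ (A-Unique c) (b c v) (λ _ → g v)) ⟩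
      ∑ I g ∎
      where
      pt : ∀ {x} → x ∈ Aᵢ c → g (rep c x) ≤ ∑[ v ∈ I ] (𝟙 (x == b c v) * g v)
      pt {x} x∈ = let (p , q) = rep-spec x∈ in
        ≤-trans (≤-reflexive (sym (trans (cong (λ t → 𝟙 t * g (rep c x)) (trans (cong (x ==_) q) (==-refl x))) (*-identityˡ _)))) (∈⇒≤∑ (λ v → 𝟙 (x == b c v) * g v) p)

    -- Passing from representatives to all of I only adds pairs, and a sum over I is a μ-weighted
    -- sum over points. Pairs inside one fibre of c′ cost at most ρk.
    cross : ∀ c c′ → G c c′ ≤ ρ * k + ∑ N (Qw c′ (μ c′))
    cross c c′ = begin
      G c c′
        ≤⟨ ∑-mono (Aᵢ c) (λ x → ∑-mono (Aᵢ c) (λ y → drop (not (x == y)) _)) ⟩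
      ∑[ x ∈ Aᵢ c ] (∑[ y ∈ Aᵢ c ] (F c′ (b c′ (rep c x)) (b c′ (rep c y))))
        ≤⟨ ∑-mono (Aᵢ c) (λ x → ∑rep≤∑I c (λ v → F c′ (b c′ (rep c x)) (b c′ v))) ⟩
      ∑[ x ∈ Aᵢ c ] (∑[ v ∈ I ] (F c′ (b c′ (rep c x)) (b c′ v)))
        ≤⟨ ∑rep≤∑I c (λ w → ∑[ v ∈ I ] (F c′ (b c′ w) (b c′ v))) ⟩
      ∑[ w ∈ I ] (∑[ v ∈ I ] (F c′ (b c′ w) (b c′ v)))
        ≡⟨ trans (∑-cong I (λ w → ∑-+ I _ _)) (∑-+ I _ _) ⟩
      ∑[ w ∈ I ] (∑[ v ∈ I ] (𝟙 (b c′ w == b c′ v))) + ∑[ w ∈ I ] (∑[ v ∈ I ] (P (b c′ w) (b c′ v)))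
        ≤⟨ +-mono-≤ (≤-trans (∑-≤const I ρ (λ {w} _ → ≤-trans (≤-reflexive (∑-cong I (λ v → cong 𝟙 (==-sym (b c′ w) (b c′ v))))) (μ≤ρ c′ (b c′ w)))) (≤-reflexive (trans (cong (_* ρ) |I|≡k) (*-comm k ρ)))) (≤-reflexive two) ⟩
      ρ * k + ∑ N (Qw c′ (μ c′)) ∎
      where
      drop : ∀ t n → 𝟙 t * n ≤ n
      drop true  n = ≤-reflexive (*-identityˡ n)
      drop false n = z≤n
      P : Fin m → Fin m → ℕ
      P x y = 𝟙 (not (x == y)) * ∑[ z ∈ N ] (𝟙 (edge ω c′ z x) * 𝟙 (edge ω c′ z y))
      two : ∑[ w ∈ I ] (∑[ v ∈ I ] (P (b c′ w) (b c′ v))) ≡ ∑ N (Qw c′ (μ c′))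
      two = trans (∑-cong I (λ w → sym (∑μ c′ (P (b c′ w))))) (trans (sym (∑μ c′ (λ x → ∑[ y ∈ N ] (μ c′ y * P x y)))) (sym (Qw≡ c′ (μ c′))))

    otherColour : ∀ c′ → ∑[ c ∈ colours ] (𝟙 (not (c == c′))) ≤ 1
    otherColour c′ = +-cancelˡ-≤ (∑[ c ∈ colours ] (𝟙 (c == c′))) _ _ (begin
      ∑[ c ∈ colours ] (𝟙 (c == c′)) + ∑[ c ∈ colours ] (𝟙 (not (c == c′))) ≡⟨ ∑-+ colours _ _ ⟨
      ∑[ c ∈ colours ] (𝟙 (c == c′) + 𝟙 (not (c == c′)))   ≡⟨ ∑-cong colours (λ c → one (c == c′)) ⟩
      ∑[ c ∈ colours ] 1                                   ≡⟨ ∑-fins-const 2 1 ⟩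
      1 + 1                                                ≡⟨ cong (_+ 1) (trans (∑-cong colours (λ c → sym (*-identityʳ _))) (∑-δ (fins-Unique 2) (∈-fins c′) (λ _ → 1))) ⟨
      ∑[ c ∈ colours ] (𝟙 (c == c′)) + 1 ∎)
      where one : ∀ t → 𝟙 t + 𝟙 (not t) ≡ 1
            one true  = refl
            one false = refl

    -- With two colours each c′ is the foreign colour of a single c, so the main loss u min(u, T) of
    -- c′ is charged once.
    ∑G : ∑[ c ∈ colours ] (∑[ c′ ∈ colours ] (G c c′)) ≤ ∑[ c ∈ colours ] (∑ N (Qw c (ν c)) + (ρ * k + ∑ N (Qw c (μ c))))
    ∑G = begin
      ∑[ c ∈ colours ] (∑[ c′ ∈ colours ] (G c c′))    ≤⟨ ∑-mono colours (λ c → ∑-mono colours (λ c′ → pt c c′)) ⟩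
      ∑[ c ∈ colours ] (∑[ c′ ∈ colours ] (𝟙 (c == c′) * O c′ + 𝟙 (not (c == c′)) * X c′)) ≡⟨ ∑-swap colours colours _ ⟩
      ∑[ c′ ∈ colours ] (∑[ c ∈ colours ] (𝟙 (c == c′) * O c′ + 𝟙 (not (c == c′)) * X c′))
        ≤⟨ ∑-mono colours (λ c′ → ≤-trans (≤-reflexive (∑-+ colours _ _)) (+-mono-≤ (∑-δ≤ (fins-Unique 2) c′ (λ _ → O c′))
             (≤-trans (≤-reflexive (∑-*ʳ colours (X c′) _)) (≤-trans (*-monoˡ-≤ (X c′) (otherColour c′)) (≤-reflexive (*-identityˡ (X c′))))))) ⟩
      ∑[ c ∈ colours ] (O c + X c) ∎
      where
      O X : Fin 2 → ℕ
      O c = ∑ N (Qw c (ν c))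
      X c = ρ * k + ∑ N (Qw c (μ c))
      pt : ∀ c c′ → G c c′ ≤ 𝟙 (c == c′) * O c′ + 𝟙 (not (c == c′)) * X c′
      pt c c′ with c FP.≟ c′
      ... | yes refl = ≤-trans (own c) (≤-reflexive (sym (trans (+-identityʳ _) (*-identityˡ (O c)))))
      ... | no _     = ≤-trans (cross c c′) (≤-reflexive (sym (*-identityˡ (X c′))))

    open-bound : β * ∑[ c ∈ colours ] (a c * a c) ≤
                 β * (∑[ c ∈ colours ] (a c) + 2 * #open) +
                 ∑[ c ∈ colours ] (β * ((u c ⊓ (ρ * Δ)) * (u c + ovl) + (2 * Err + ρ * k)) + 2 * Low)
    open-bound = begin
      β * ∑[ c ∈ colours ] (a c * a c)
        ≤⟨ *-monoʳ-≤ β (∑-mono colours square) ⟩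
      β * ∑[ c ∈ colours ] (a c + 2 * openIn c + closedPairs c)
        ≡⟨ cong (β *_) (trans (∑-+ colours _ _) (cong (_+ ∑ colours closedPairs) (trans (∑-+ colours _ _) (cong (∑ colours a +_) (trans (∑-*ˡ colours 2 openIn) (cong (2 *_) (sym #open≡))))))) ⟩
      β * (∑ colours a + 2 * #open + ∑ colours closedPairs)
        ≡⟨ *-distribˡ-+ β (∑ colours a + 2 * #open) _ ⟩
      β * (∑ colours a + 2 * #open) + β * ∑ colours closedPairs
        ≤⟨ +-monoʳ-≤ (β * (∑ colours a + 2 * #open)) (begin
          β * ∑ colours closedPairs
            ≤⟨ *-monoʳ-≤ β (≤-trans (∑-mono colours closedPairs≤) ∑G) ⟩
          β * ∑[ c ∈ colours ] (∑ N (Qw c (ν c)) + (ρ * k + ∑ N (Qw c (μ c))))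
            ≡⟨ ∑-*ˡ colours β _ ⟨
          ∑[ c ∈ colours ] (β * (∑ N (Qw c (ν c)) + (ρ * k + ∑ N (Qw c (μ c)))))
            ≤⟨ ∑-mono colours each ⟩
          ∑[ c ∈ colours ] (β * ((u c ⊓ (ρ * Δ)) * (u c + ovl) + (2 * Err + ρ * k)) + 2 * Low) ∎) ⟩
      β * (∑ colours a + 2 * #open) + ∑[ c ∈ colours ] (β * ((u c ⊓ (ρ * Δ)) * (u c + ovl) + (2 * Err + ρ * k)) + 2 * Low) ∎
      where
      p : ∀ β x y z → β * (x + (y + z)) ≡ β * x + (β * z + β * y)
      p = solve-∀
      q : ∀ β x y e l → β * e + l + ((β * (x + e) + l) + β * y) ≡ β * (x + (2 * e + y)) + 2 * l
      q = solve-∀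
      each : ∀ c → β * (∑ N (Qw c (ν c)) + (ρ * k + ∑ N (Qw c (μ c)))) ≤ β * ((u c ⊓ (ρ * Δ)) * (u c + ovl) + (2 * Err + ρ * k)) + 2 * Low
      each c = begin
        β * (∑ N (Qw c (ν c)) + (ρ * k + ∑ N (Qw c (μ c))))           ≡⟨ p β (∑ N (Qw c (ν c))) (ρ * k) (∑ N (Qw c (μ c))) ⟩
        β * ∑ N (Qw c (ν c)) + (β * ∑ N (Qw c (μ c)) + β * (ρ * k))   ≤⟨ +-mono-≤ (own-bound c) (+-monoˡ-≤ (β * (ρ * k)) (cross-bound c)) ⟩
        β * Err + Low + ((β * ((u c ⊓ (ρ * Δ)) * (u c + ovl) + Err) + Low) + β * (ρ * k)) ≡⟨ q β ((u c ⊓ (ρ * Δ)) * (u c + ovl)) (ρ * k) Err Low ⟩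
        β * ((u c ⊓ (ρ * Δ)) * (u c + ovl) + (2 * Err + ρ * k)) + 2 * Low ∎

-- The random maps: fibres, and the number of sets with given image sizes

module Blowup where

  open import Data.Nat
  open import Data.Nat.Properties
  open import Data.Nat.Tactic.RingSolver using (solve-∀)
  open import Data.Bool using (Bool; true; false; _∧_)
  open import Data.Fin using (Fin; zero; suc; combine; remQuot)
  import Data.Fin.Properties as FP
  open import Data.Vec using (Vec; lookup)
  open import Data.List using (List; []; _∷_; length; map; _++_)
  import Data.List.Properties as LP
  open import Data.List.Membership.Propositional using (_∈_; _∉_)
  open import Data.List.Membership.Propositional.Properties using (∈-map⁺; ∈-map⁻; ∈-++⁻)
  open import Data.List.Relation.Unary.Any using (here; there)
  open import Data.List.Relation.Unary.All using ([]; _∷_)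
  open import Data.List.Relation.Unary.AllPairs using ([]; _∷_)
  open import Data.List.Relation.Unary.Unique.Propositional using (Unique)
  import Data.List.Relation.Unary.Unique.Propositional.Properties as UP
  open import Data.Product using (Σ; _×_; _,_; proj₁; proj₂)
  open import Data.Sum using (inj₁; inj₂)
  open import Data.Empty using (⊥-elim)
  open import Relation.Nullary using (yes; no)
  open import Relation.Binary.PropositionalEquality
  open import Function using (_∘_)
  open Sums
  open Expectation
  open Events
  open LargeDeviations
  open RandomHost
  open Colours
  open ClosingTriples
  open WeightedPairs

  private
    variable
      A B : Set

  ∏ₗ-++ : (xs ys : List A) (f : A → ℕ) → ∏ₗ (xs ++ ys) f ≡ ∏ₗ xs f * ∏ₗ ys f
  ∏ₗ-++ []       ys f = sym (*-identityˡ _)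
  ∏ₗ-++ (x ∷ xs) ys f = trans (cong (f x *_) (∏ₗ-++ xs ys f)) (sym (*-assoc (f x) _ _))

  ∏ₗ≡1 : (xs : List A) (f : A → ℕ) → (∀ {x} → x ∈ xs → f x ≡ 1) → ∏ₗ xs f ≡ 1
  ∏ₗ≡1 []       f h = refl
  ∏ₗ≡1 (x ∷ xs) f h rewrite h (here refl) | ∏ₗ≡1 xs f (λ i → h (there i)) = refl

  ∑∑-*ʳ : (xs : List A) (ys : List B) (c : ℕ) (f : A → B → ℕ) → ∑ xs (λ x → ∑ ys (f x)) * c ≡ ∑ xs (λ x → ∑ ys (λ y → f x y * c))
  ∑∑-*ʳ xs ys c f = trans (sym (∑-*ʳ xs c (λ x → ∑ ys (f x)))) (∑-cong xs (λ x → sym (∑-*ʳ ys c (f x))))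

  module Placement (k r D s D₁ m n : ℕ) .{{_ : NonZero k}} .{{_ : NonZero r}} .{{_ : NonZero D}} .{{_ : NonZero D₁}} .{{_ : NonZero m}}
                   (m≡kD : m ≡ k * D) (n≡rm : n ≡ r * m) (m≡10D₁ : m ≡ 10 * D₁) (r≡170s : r ≡ 170 * s) where

    open ≤-Reasoning

    Ω = Vec (Fin m) (2 * n)
    vs = fins m
    tot = total vs (2 * n)

    place : Ω → Fin 2 → Fin n → Fin m
    place ω c v = lookup ω (combine c v)

    occ : (b : Fin 2 → Fin n → Fin m) → List (Fin n) → Fin 2 → ℕ
    occ b I c = length (filt (λ x → mem x (map (b c) I)) (fins m))

    c₀ c₁ : Fin 2
    c₀ = zero
    c₁ = suc zero

    hit : Fin m → Fin m → Bool
    hit x v = v == x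

    hit≤1 : ∀ x → ∑ vs (𝟙 ∘ hit x) ≤ 1
    hit≤1 x = ≤-trans (≤-reflexive (∑-cong vs (λ v → sym (*-identityʳ _)))) (∑-δ≤ (fins-Unique m) x (λ _ → 1))

    colour : Fin 2 → List (Fin (2 * n))
    colour c = map (combine c) (fins n)

    loadBad : Ω → ℕ
    loadBad ω = ∑[ c ∈ fins 2 ] (∑[ x ∈ vs ] (many vs (hit x) (hit≤1 x) (colour c) (187 * s) ω))

    loadBad-small : E vs loadBad * 2 ^ s ≤ 2 * m * tot
    loadBad-small = begin
      E vs loadBad * 2 ^ s
        ≡⟨ cong (_* 2 ^ s) (trans (E-∑ vs {K = 2 * n} (fins 2) _) (∑-cong (fins 2) (λ c → E-∑ vs {K = 2 * n} vs _))) ⟩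
      ∑[ c ∈ fins 2 ] (∑[ x ∈ vs ] (E vs (f c x))) * 2 ^ s
        ≡⟨ ∑∑-*ʳ (fins 2) vs (2 ^ s) (λ c x → E vs (f c x)) ⟩
      ∑[ c ∈ fins 2 ] (∑[ x ∈ vs ] (E vs (f c x) * 2 ^ s))
        ≤⟨ ∑-fins≤ 2 (m * tot) (λ c → ∑-fins≤ m tot (λ x → one c x)) ⟩
      2 * (m * tot)    ≡⟨ *-assoc 2 m tot ⟨
      2 * m * tot ∎
      where
      f : Fin 2 → Fin m → Ω → ℕ
      f c x = many vs (hit x) (hit≤1 x) (colour c) (187 * s)
      q : ∀ s m → 170 * s * m ≡ 170 * m * s
      q = solve-∀
      one : ∀ c x → E vs (f c x) * 2 ^ s ≤ tot
      one c x = chernoff vs (hit x) (hit≤1 x) (UP.map⁺ (λ {y} {y′} e → FP.combine-injectiveʳ c y c y′ e) (fins-Unique n)) D₁ s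
        (trans (length-fins m) m≡10D₁)
        (≤-reflexive (trans (LP.length-map (combine c) (fins n)) (trans (length-fins n) (trans (trans n≡rm (cong (_* m) r≡170s)) (trans (q s m) (cong (λ t → 170 * t * s) (sym (length-fins m))))))))

    loadBad≡0 : ∀ ω → loadBad ω ≡ 0 → ∀ c x → ∑[ v ∈ fins n ] (𝟙 (place ω c v == x)) ≤ 187 * s
    loadBad≡0 ω z c x with ∑[ v ∈ fins n ] (𝟙 (place ω c v == x)) ≤? 187 * s
    ... | yes le = le
    ... | no ¬le = ⊥-elim (absurd (trans (sym one) (∑≡0⇒ (∑≡0⇒ z (∈-fins c)) (∈-fins x))))
      where
      absurd : 1 ≢ 0
      absurd ()
      one : many vs (hit x) (hit≤1 x) (colour c) (187 * s) ω ≡ 1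
      one = cong 𝟙 (≤ᵇ-intro (≤-trans (<⇒≤ (≰⇒> ¬le)) (≤-reflexive (sym (∑-map (combine c) (fins n) _)))))

    profile : Ω → ℕ → ℕ → List (Fin n) → Bool
    profile ω a₀ a₁ I = (length I ≡ᵇ k) ∧ ((occ (place ω) I c₀ ≡ᵇ a₀) ∧ (occ (place ω) I c₁ ≡ᵇ a₁))

    count : ℕ → ℕ → Ω → ℕ
    count a₀ a₁ ω = ∑[ I ∈ subs k (fins n) ] (𝟙 (profile ω a₀ a₁ I))

    bound : ℕ → ℕ → ℕ
    bound a₀ a₁ = (512 * r) ^ k * D ^ (a₀ + a₁)

    pick : List (Fin m) → List (Fin m) → Fin 2 → List (Fin m)
    pick X Y zero    = X
    pick X Y (suc _) = Y

    sel : List (Fin m) → List (Fin m) → Fin (2 * n) → List (Fin m)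
    sel X Y i = pick X Y (proj₁ (remQuot {2} n i))

    sel-combine : ∀ X Y (c : Fin 2) (v : Fin n) → sel X Y (combine c v) ≡ pick X Y c
    sel-combine X Y c v = cong (pick X Y) (cong proj₁ (FP.remQuot-combine {2} {n} c v))

    coords : List (Fin n) → List (Fin (2 * n))
    coords I = map (combine c₀) I ++ map (combine c₁) I

    coords-Unique : ∀ {I} → Unique I → Unique (coords I)
    coords-Unique {I} u = Unique-++ (UP.map⁺ (λ {y} {y′} e → FP.combine-injectiveʳ c₀ y c₀ y′ e) u)
      (UP.map⁺ (λ {y} {y′} e → FP.combine-injectiveʳ c₁ y c₁ y′ e) u) dj
      where
      dj : ∀ {i} → i ∈ map (combine c₀) I → i ∉ map (combine c₁) I
      dj p q with ∈-map⁻ (combine c₀) p | ∈-map⁻ (combine c₁) q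
      ... | y , _ , e | y′ , _ , e′ with FP.combine-injectiveˡ c₀ y c₁ y′ (trans (sym e) e′)
      ...   | ()

    inside : List (Fin m) → List (Fin m) → List (Fin n) → Ω → ℕ
    inside X Y I ω = ∏ₗ (coords I) (λ i → 𝟙 (mem (lookup ω i) (sel X Y i)))

    inside≡1 : ∀ ω I → inside (filt (λ x → mem x (map (place ω c₀) I)) vs) (filt (λ x → mem x (map (place ω c₁) I)) vs) I ω ≡ 1
    inside≡1 ω I = ∏ₗ≡1 (coords I) _ h
      where
      X = filt (λ x → mem x (map (place ω c₀) I)) vs
      Y = filt (λ x → mem x (map (place ω c₁) I)) vs
      in₀ : ∀ {v} → v ∈ I → mem (place ω c₀ v) X ≡ true
      in₀ v∈ = ∈⇒mem (∈-filt⁺ (λ x → mem x (map (place ω c₀) I)) (∈-fins _) (∈⇒mem (∈-map⁺ (place ω c₀) v∈)))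
      in₁ : ∀ {v} → v ∈ I → mem (place ω c₁ v) Y ≡ true
      in₁ v∈ = ∈⇒mem (∈-filt⁺ (λ x → mem x (map (place ω c₁) I)) (∈-fins _) (∈⇒mem (∈-map⁺ (place ω c₁) v∈)))
      h : ∀ {i} → i ∈ coords I → 𝟙 (mem (lookup ω i) (sel X Y i)) ≡ 1
      h i∈ with ∈-++⁻ (map (combine c₀) I) i∈
      ... | inj₁ p with ∈-map⁻ (combine c₀) p
      ...   | v , v∈ , refl = cong 𝟙 (trans (cong (mem (place ω c₀ v)) (sel-combine X Y c₀ v)) (in₀ v∈))
      h i∈ | inj₂ p with ∈-map⁻ (combine c₁) p
      ...   | v , v∈ , refl = cong 𝟙 (trans (cong (mem (place ω c₁ v)) (sel-combine X Y c₁ v)) (in₁ v∈))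

    E-inside : ∀ X Y {I} → Unique I → length I ≡ k → E vs (inside X Y I) * m ^ (k + k) ≤ length X ^ k * length Y ^ k * tot
    E-inside X Y {I} u l = begin
      E vs (inside X Y I) * m ^ (k + k)                        ≡⟨ cong₂ (λ s t → E vs (inside X Y I) * s ^ t) (sym (length-fins m)) (sym lenc) ⟩
      E vs (inside X Y I) * length vs ^ length (coords I)      ≤⟨ E-∏ₗ≤ vs (coords-Unique u) (λ i v → 𝟙 (mem v (sel X Y i))) (λ i → length (sel X Y i)) (λ i → ∑-mem≤ (sel X Y i)) ⟩
      ∏ₗ (coords I) (λ i → length (sel X Y i)) * tot           ≡⟨ cong (_* tot) (trans (∏ₗ-++ (map (combine c₀) I) _ _) (cong₂ _*_ (pr c₀) (pr c₁))) ⟩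
      length X ^ k * length Y ^ k * tot ∎
      where
      lenc : length (coords I) ≡ k + k
      lenc = trans (LP.length-++ (map (combine c₀) I)) (cong₂ _+_ (trans (LP.length-map (combine c₀) I) l) (trans (LP.length-map (combine c₁) I) l))
      pr : ∀ c → ∏ₗ (map (combine c) I) (λ i → length (sel X Y i)) ≡ length (pick X Y c) ^ k
      pr c = trans (∏ₗ-map (combine c) I _) (trans (go I) (cong (length (pick X Y c) ^_) l))
        where go : ∀ J → ∏ₗ J (λ v → length (sel X Y (combine c v))) ≡ length (pick X Y c) ^ length J
              go []      = refl
              go (v ∷ J) = cong₂ _*_ (cong length (sel-combine X Y c v)) (go J)

    count≤ : ∀ a₀ a₁ ω → count a₀ a₁ ω ≤ ∑[ I ∈ subs k (fins n) ] (𝟙 (length I ≡ᵇ k) * ∑[ X ∈ subs a₀ vs ] (∑[ Y ∈ subs a₁ vs ] (inside X Y I ω)))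
    count≤ a₀ a₁ ω = ∑-mono (subs k (fins n)) pt
      where
      pt : ∀ I → 𝟙 (profile ω a₀ a₁ I) ≤ 𝟙 (length I ≡ᵇ k) * ∑[ X ∈ subs a₀ vs ] (∑[ Y ∈ subs a₁ vs ] (inside X Y I ω))
      pt I with length I ≡ᵇ k | occ (place ω) I c₀ ≡ᵇ a₀ in e₀ | occ (place ω) I c₁ ≡ᵇ a₁ in e₁
      ... | false | _     | _     = z≤n
      ... | true  | false | _     = z≤n
      ... | true  | true  | false = z≤n
      ... | true  | true  | true  = begin
        1                    ≡⟨ inside≡1 ω I ⟨
        inside X Y I ω       ≤⟨ ∈⇒≤∑ (λ Y → inside X Y I ω) (∈-subs {j = a₁} (filt-⊆ _ vs) (≤-reflexive (≡ᵇ⇒≡ _ _ (subst Data.Bool.T (sym e₁) _)))) ⟩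
        ∑[ Y ∈ subs a₁ vs ] (inside X Y I ω) ≤⟨ ∈⇒≤∑ (λ X → ∑[ Y ∈ subs a₁ vs ] (inside X Y I ω)) (∈-subs {j = a₀} (filt-⊆ _ vs) (≤-reflexive (≡ᵇ⇒≡ _ _ (subst Data.Bool.T (sym e₀) _)))) ⟩
        ∑[ X ∈ subs a₀ vs ] (∑[ Y ∈ subs a₁ vs ] (inside X Y I ω)) ≡⟨ *-identityˡ _ ⟨
        1 * ∑[ X ∈ subs a₀ vs ] (∑[ Y ∈ subs a₁ vs ] (inside X Y I ω)) ∎
        where X = filt (λ x → mem x (map (place ω c₀) I)) vs
              Y = filt (λ x → mem x (map (place ω c₁) I)) vs

    -- A union bound over I and over sets X, Y containing its two images: 8^k (r D)^k · 8^k D^a₀ ·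
    -- 8^k D^a₁ choices, each of probability at most (k/m)^(2k) = D^(-2k).
    E-count : ∀ a₀ a₁ → a₀ ≤ k → a₁ ≤ k → E vs (count a₀ a₁) * D ^ k ≤ bound a₀ a₁ * tot
    E-count a₀ a₁ a₀≤ a₁≤ = *-cancelʳ-≤ _ _ (D ^ k * (k ^ k * k ^ k)) {{m*n≢0 (D ^ k) (k ^ k * k ^ k) {{m^n≢0 D k}} {{m*n≢0 (k ^ k) (k ^ k) {{m^n≢0 k k}} {{m^n≢0 k k}}}}}} (begin
      E vs (count a₀ a₁) * D ^ k * (D ^ k * (k ^ k * k ^ k))
        ≡⟨ q₁ (E vs (count a₀ a₁)) (D ^ k) (k ^ k) ⟩
      E vs (count a₀ a₁) * ((k ^ k * D ^ k) * (k ^ k * D ^ k))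
        ≡⟨ cong (E vs (count a₀ a₁) *_) (trans (cong₂ _*_ m^k≡ m^k≡) (sym (^-distribˡ-+-* m k k))) ⟩
      E vs (count a₀ a₁) * m ^ (k + k)
        ≤⟨ *-monoˡ-≤ (m ^ (k + k)) (E-mono vs (count≤ a₀ a₁)) ⟩
      E vs (λ ω → ∑[ I ∈ subs k (fins n) ] (𝟙 (length I ≡ᵇ k) * ∑[ X ∈ subs a₀ vs ] (∑[ Y ∈ subs a₁ vs ] (inside X Y I ω)))) * m ^ (k + k)
        ≡⟨ cong (_* m ^ (k + k)) (trans (E-∑ vs {K = 2 * n} (subs k (fins n)) _) (∑-cong (subs k (fins n)) (λ I → trans (E-*ˡ vs {2 * n} (𝟙 (length I ≡ᵇ k)) _)
             (cong (𝟙 (length I ≡ᵇ k) *_) (trans (E-∑ vs {K = 2 * n} (subs a₀ vs) _) (∑-cong (subs a₀ vs) (λ X → E-∑ vs {K = 2 * n} (subs a₁ vs) (λ Y → inside X Y I)))))))) ⟩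
      ∑[ I ∈ subs k (fins n) ] (𝟙 (length I ≡ᵇ k) * ∑[ X ∈ subs a₀ vs ] (∑[ Y ∈ subs a₁ vs ] (E vs (inside X Y I)))) * m ^ (k + k)
        ≡⟨ ∑-*ʳ (subs k (fins n)) (m ^ (k + k)) _ ⟨
      ∑[ I ∈ subs k (fins n) ] (𝟙 (length I ≡ᵇ k) * ∑[ X ∈ subs a₀ vs ] (∑[ Y ∈ subs a₁ vs ] (E vs (inside X Y I))) * m ^ (k + k))
        ≤⟨ ∑-≤const (subs k (fins n)) (S₀ * (S₁ * Z)) each ⟩
      length (subs k (fins n)) * (S₀ * (S₁ * Z))
        ≤⟨ *-mono-≤ (length-subs≤ (r * D) {{m*n≢0 r D}} k k (fins n) (≤-reflexive (trans (length-fins n) (trans n≡rm (trans (cong (r *_) m≡kD) (q₂ r k D))))))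
             (*-mono-≤ (length-subs≤ D k a₀ vs (≤-reflexive (trans (length-fins m) m≡kD))) (*-monoˡ-≤ Z (length-subs≤ D k a₁ vs (≤-reflexive (trans (length-fins m) m≡kD))))) ⟩
      8 ^ k * (r * D) ^ k * (8 ^ k * D ^ a₀ * (8 ^ k * D ^ a₁ * (k ^ k * k ^ k * tot)))
        ≡⟨ cong₂ (λ p q → 8 ^ k * p * (8 ^ k * D ^ a₀ * (8 ^ k * D ^ a₁ * q))) (^-distribʳ-* r D k) refl ⟩
      8 ^ k * (r ^ k * D ^ k) * (8 ^ k * D ^ a₀ * (8 ^ k * D ^ a₁ * (k ^ k * k ^ k * tot)))
        ≡⟨ q₃ (8 ^ k) (r ^ k) (D ^ k) (D ^ a₀) (D ^ a₁) (k ^ k) tot ⟩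
      8 ^ k * 8 ^ k * 8 ^ k * r ^ k * (D ^ a₀ * D ^ a₁) * tot * (D ^ k * (k ^ k * k ^ k))
        ≡⟨ cong (λ t → t * tot * (D ^ k * (k ^ k * k ^ k))) (cong₂ _*_ (trans (cong (_* r ^ k) (trans (cong (_* 8 ^ k) (sym (^-distribʳ-* 8 8 k))) (sym (^-distribʳ-* 64 8 k)))) (sym (^-distribʳ-* 512 r k))) (sym (^-distribˡ-+-* D a₀ a₁))) ⟩
      bound a₀ a₁ * tot * (D ^ k * (k ^ k * k ^ k)) ∎)
      where
      m^k≡ : k ^ k * D ^ k ≡ m ^ k
      m^k≡ = trans (sym (^-distribʳ-* k D k)) (cong (_^ k) (sym m≡kD))
      S₀ = length (subs a₀ vs)
      S₁ = length (subs a₁ vs)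
      Z = k ^ k * k ^ k * tot
      q₁ : ∀ e d κ → e * d * (d * (κ * κ)) ≡ e * ((κ * d) * (κ * d))
      q₁ = solve-∀
      q₂ : ∀ r k D → r * (k * D) ≡ k * (r * D)
      q₂ = solve-∀
      q₃ : ∀ e r d x y κ t → e * (r * d) * (e * x * (e * y * (κ * κ * t))) ≡ e * e * e * r * (x * y) * t * (d * (κ * κ))
      q₃ = solve-∀
      each : ∀ {I} → I ∈ subs k (fins n) → 𝟙 (length I ≡ᵇ k) * ∑[ X ∈ subs a₀ vs ] (∑[ Y ∈ subs a₁ vs ] (E vs (inside X Y I))) * m ^ (k + k) ≤ S₀ * (S₁ * Z)
      each {I} I∈ with length I ≡ᵇ k in e
      ... | false = z≤n
      ... | true  = begin
        1 * ∑[ X ∈ subs a₀ vs ] (∑[ Y ∈ subs a₁ vs ] (E vs (inside X Y I))) * m ^ (k + k)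
          ≡⟨ trans (cong (_* m ^ (k + k)) (*-identityˡ (∑[ X ∈ subs a₀ vs ] (∑[ Y ∈ subs a₁ vs ] (E vs (inside X Y I)))))) (∑∑-*ʳ (subs a₀ vs) (subs a₁ vs) (m ^ (k + k)) (λ X Y → E vs (inside X Y I))) ⟩
        ∑[ X ∈ subs a₀ vs ] (∑[ Y ∈ subs a₁ vs ] (E vs (inside X Y I) * m ^ (k + k)))
          ≤⟨ ∑-≤const (subs a₀ vs) (S₁ * Z) (λ {X} X∈ → ∑-≤const (subs a₁ vs) Z (λ {Y} Y∈ → ≤-trans
               (E-inside X Y (⊆⇒Unique (proj₁ (subs⇒⊆ k (fins n) I∈)) (fins-Unique n)) (≡ᵇ⇒≡ _ _ (subst Data.Bool.T (sym e) _)))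
               (*-monoˡ-≤ tot (*-mono-≤ (^-monoˡ-≤ k (≤-trans (proj₂ (subs⇒⊆ a₀ vs X∈)) a₀≤)) (^-monoˡ-≤ k (≤-trans (proj₂ (subs⇒⊆ a₁ vs Y∈)) a₁≤)))))) ⟩
        S₀ * (S₁ * Z) ∎

    Y = 4 * (suc k * suc k)

    -- Markov's inequality for each of the (k + 1)² possible pairs of image sizes; the factor `Y` =
    -- 4 (k + 1)² leaves a total failure probability of 1/4.
    countBad : Ω → ℕ
    countBad ω = ∑[ a₀ ∈ levels (suc k) ] (∑[ a₁ ∈ levels (suc k) ] (𝟙 (Y * bound a₀ a₁ <ᵇ count a₀ a₁ ω * D ^ k)))

    countBad-small : E vs countBad * 4 ≤ tot
    countBad-small = *-cancelʳ-≤ _ _ (suc k * suc k) (begin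
      E vs countBad * 4 * (suc k * suc k)     ≡⟨ *-assoc (E vs countBad) 4 _ ⟩
      E vs countBad * Y
        ≡⟨ cong (_* Y) (trans (E-∑ vs {K = 2 * n} (levels (suc k)) _) (∑-cong (levels (suc k)) (λ a₀ → E-∑ vs {K = 2 * n} (levels (suc k)) (f a₀)))) ⟩
      ∑[ a₀ ∈ levels (suc k) ] (∑[ a₁ ∈ levels (suc k) ] (E vs (f a₀ a₁))) * Y
        ≡⟨ ∑∑-*ʳ (levels (suc k)) (levels (suc k)) Y (λ a₀ a₁ → E vs (f a₀ a₁)) ⟩
      ∑[ a₀ ∈ levels (suc k) ] (∑[ a₁ ∈ levels (suc k) ] (E vs (f a₀ a₁) * Y))
        ≤⟨ ∑-≤const (levels (suc k)) _ (λ i → ∑-≤const (levels (suc k)) tot (λ j → each (≤-pred (levels-< i)) (≤-pred (levels-< j)))) ⟩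
      length (levels (suc k)) * (length (levels (suc k)) * tot)  ≡⟨ cong (λ t → t * (t * tot)) (length-levels (suc k)) ⟩
      suc k * (suc k * tot)                   ≡⟨ trans (sym (*-assoc (suc k) (suc k) tot)) (*-comm (suc k * suc k) tot) ⟩
      tot * (suc k * suc k) ∎)
      where
      f : ℕ → ℕ → Ω → ℕ
      f a₀ a₁ ω = 𝟙 (Y * bound a₀ a₁ <ᵇ count a₀ a₁ ω * D ^ k)
      each : ∀ {a₀ a₁} → a₀ ≤ k → a₁ ≤ k → E vs (f a₀ a₁) * Y ≤ tot
      each {a₀} {a₁} p q = *-cancelʳ-≤ _ _ (bound a₀ a₁) {{m*n≢0 ((512 * r) ^ k) (D ^ (a₀ + a₁)) {{m^n≢0 (512 * r) k {{m*n≢0 512 r}}}} {{m^n≢0 D (a₀ + a₁)}}}} (begin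
        E vs (f a₀ a₁) * Y * bound a₀ a₁        ≡⟨ *-assoc (E vs (f a₀ a₁)) Y _ ⟩
        E vs (f a₀ a₁) * (Y * bound a₀ a₁)      ≡⟨ E-*ʳ vs (f a₀ a₁) _ ⟨
        E vs (λ ω → f a₀ a₁ ω * (Y * bound a₀ a₁)) ≤⟨ E-mono vs (λ ω → pt (Y * bound a₀ a₁) (count a₀ a₁ ω * D ^ k)) ⟩
        E vs (λ ω → count a₀ a₁ ω * D ^ k)      ≡⟨ E-*ʳ vs (count a₀ a₁) (D ^ k) ⟩
        E vs (count a₀ a₁) * D ^ k              ≤⟨ E-count a₀ a₁ p q ⟩
        bound a₀ a₁ * tot                       ≡⟨ *-comm (bound a₀ a₁) tot ⟩
        tot * bound a₀ a₁ ∎)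
        where
        pt : ∀ x y → 𝟙 (x <ᵇ y) * x ≤ y
        pt x y with x <ᵇ y in e
        ... | true  = ≤-trans (≤-reflexive (*-identityˡ x)) (<⇒≤ (<ᵇ-true x y e))
        ... | false = z≤n

    countBad≡0 : ∀ ω → countBad ω ≡ 0 → ∀ a₀ a₁ → a₀ ≤ k → a₁ ≤ k → count a₀ a₁ ω * D ^ k ≤ Y * bound a₀ a₁
    countBad≡0 ω z a₀ a₁ p q = ≮⇒≥ (λ l → absurd (trans (sym (cong 𝟙 (<ᵇ-intro l))) (∑≡0⇒ (∑≡0⇒ z (∈-levels (s≤s p))) (∈-levels (s≤s q)))))
      where absurd : 1 ≢ 0
            absurd ()

    placement : 8 * m ≤ 2 ^ s → Σ (Fin 2 → Fin n → Fin m) λ b →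
      (∀ c x → ∑[ v ∈ fins n ] (𝟙 (b c v == x)) ≤ 187 * s) ×
      (∀ a₀ a₁ → a₀ ≤ k → a₁ ≤ k →
         ∑[ I ∈ subs k (fins n) ] (𝟙 ((length I ≡ᵇ k) ∧ ((occ b I c₀ ≡ᵇ a₀) ∧ (occ b I c₁ ≡ᵇ a₁)))) * D ^ k ≤ Y * bound a₀ a₁)
    placement 8m≤ = place ω , loadBad≡0 ω (m+n≡0⇒m≡0 (loadBad ω) z) , countBad≡0 ω (m+n≡0⇒n≡0 (loadBad ω) z)
      where
      instance
        nz2m : NonZero (2 * m)
        nz2m = m*n≢0 2 m
      load4 : E vs loadBad * 4 ≤ tot
      load4 = *-cancelʳ-≤ _ _ (2 * m) (begin
        E vs loadBad * 4 * (2 * m)   ≡⟨ q (E vs loadBad) m ⟩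
        E vs loadBad * (8 * m)       ≤⟨ *-monoʳ-≤ (E vs loadBad) 8m≤ ⟩
        E vs loadBad * 2 ^ s         ≤⟨ loadBad-small ⟩
        2 * m * tot                  ≡⟨ *-comm (2 * m) tot ⟩
        tot * (2 * m) ∎)
        where q : ∀ e m → e * 4 * (2 * m) ≡ e * (8 * m)
              q = solve-∀
      tot>0 : 0 < tot
      tot>0 = subst (λ t → 0 < t ^ (2 * n)) (sym (length-fins m)) (m^n>0 m (2 * n))
      small : E vs (λ ω → loadBad ω + countBad ω) < tot
      small = *-cancelʳ-< 4 _ _ (begin-strict
        E vs (λ ω → loadBad ω + countBad ω) * 4     ≡⟨ trans (cong (_* 4) (E-+ vs loadBad countBad)) (*-distribʳ-+ 4 (E vs loadBad) _) ⟩
        E vs loadBad * 4 + E vs countBad * 4        ≤⟨ +-mono-≤ load4 countBad-small ⟩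
        tot + tot                                   <⟨ m<m+n (tot + tot) (≤-trans tot>0 (m≤m+n tot tot)) ⟩
        tot + tot + (tot + tot)                     ≡⟨ q tot ⟩
        tot * 4 ∎)
        where q : ∀ t → t + t + (t + t) ≡ t * 4
              q = solve-∀
      wit = E-witness vs (λ ω → loadBad ω + countBad ω) small
      ω = proj₁ wit
      z = proj₂ wit

-- A sample of the edges that avoids all bad events

module GoodSample where

  open import Data.Nat
  open import Data.Nat.Properties
  open import Data.Nat.Tactic.RingSolver using (solve-∀)
  open import Data.Bool using (Bool; true; false; _∧_)
  open import Data.Fin using (Fin; zero; suc)
  open import Data.List using (List; length; map)
  open import Data.List.Membership.Propositional using (_∈_)
  open import Data.Product using (∃; _,_; proj₁; proj₂)
  open import Data.Sum using (_⊎_; [_,_]′)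
  open import Relation.Nullary using (¬_)
  open import Relation.Binary.PropositionalEquality
  open Sums
  open Expectation
  open Events
  open LargeDeviations
  open RandomHost
  open Colours
  open ClosingTriples
  open OpenPairs
  open Blowup using (∑∑-*ʳ)
  open WeightedPairs

  private
    variable
      A B : Set

  -- Brings a tail bound to probability 1/16, so that five bad events can be avoided together.
  rare : ∀ {e t x y} .{{_ : NonZero x}} → e * y ≤ x * t → 16 * x ≤ y → e * 16 ≤ t
  rare {e} {t} {x} {y} le xy = *-cancelʳ-≤ _ _ x (begin
    e * 16 * x    ≡⟨ *-assoc e 16 x ⟩
    e * (16 * x)  ≤⟨ *-monoʳ-≤ e xy ⟩
    e * y         ≤⟨ le ⟩
    x * t         ≡⟨ *-comm x t ⟩
    t * x ∎)
    where open ≤-Reasoning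

  occurrences : ∀ {m n} → (Fin 2 → Fin n → Fin m) → List (Fin n) → Fin 2 → ℕ
  occurrences {m} b I c = length (filt (λ x → mem x (map (b c) I)) (fins m))

  hasProfile : ∀ {m n} → (Fin 2 → Fin n → Fin m) → (k a₀ a₁ : ℕ) → List (Fin n) → Bool
  hasProfile b k a₀ a₁ I = (length I ≡ᵇ k) ∧ ((occurrences b I zero ≡ᵇ a₀) ∧ (occurrences b I (suc zero) ≡ᵇ a₁))

  -- The contribution of one colour to the right side of `open-bound`, for L₁ = 2j and α = m, as a
  -- function of its image size `a`.
  loss : (k β ρ Δ ovl t₀ t₁ j m γ a : ℕ) → ℕ
  loss k β ρ Δ ovl t₀ t₁ j m γ a =
    β * (((k ∸ a) ⊓ (ρ * Δ)) * ((k ∸ a) + ovl) + (2 * (2 * Δ * (k + ovl) + t₁ * (ρ * (j + j))) + ρ * k)) + 2 * (t₀ * t₀ * (m * (k * k) + ρ * ρ * γ))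

  -- The numerical conditions under which some sample has no independent k-set. `M a₀ a₁` is the
  -- number of open slots promised for the given image sizes; the alternative 0 in `open-h` serves
  -- strongly collapsed sets, which `count-h` makes rare enough by itself.
  module Existence {m n : ℕ} (b : Fin 2 → Fin n → Fin m) (v₀ : Fin n) .{{_ : NonZero m}} (k : ℕ)
    (ρ : ℕ) (1≤ρ : 1 ≤ ρ) (load : ∀ c x → ∑[ v ∈ fins n ] (𝟙 (b c v == x)) ≤ ρ)
    (d₁ Dq Dt : ℕ) .{{_ : NonZero d₁}} .{{_ : NonZero Dq}} .{{_ : NonZero Dt}} (d≡4Dq : suc d₁ ≡ 4 * Dq) (d≡10Dt : suc d₁ ≡ 10 * Dt)
    (s₂ : ℕ) (m≤ : m ≤ 170 * suc d₁ * suc s₂) (deg-h : 16 * (2 * m) ≤ 2 ^ suc s₂)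
    (c₁ j : ℕ) (k²≤ : k * k ≤ c₁ * Dq) (sparse-h : 16 * (2 * (suc m ^ k * (suc m ^ k * 8 ^ c₁))) ≤ 4 ^ suc j)
    (cd : ℕ) (m≤Dq² : m ≤ Dq * Dq) (codeg-h : 16 * (2 * (m * (m * 8))) ≤ 16 ^ suc cd)
    (J : ℕ) (joint-h : 16 * (2 * (suc m ^ k * suc m ^ k)) ≤ 16 ^ suc J)
    (t₀ t₁ jj : ℕ) (L₁<kt₀ : j + j < k * t₀) (few : k + jj * jj * (cd * ρ) < jj * t₁)
    (D₃ D₂ c₀ : ℕ) .{{_ : NonZero D₃}} .{{_ : NonZero D₂}} (K₃≤ : 2 * (k * k) * (2 * k) ≤ c₀ * D₃) (8D₃≤ : 8 * D₃ ≤ d₁ ^ 3)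
    (3R≤ : 3 * (2 * k + (k * (2 * (2 * (ρ + ρ))) + k * (2 * (2 * (ρ + ρ))))) ≤ D₂) (D₂≤ : D₂ ≤ d₁ ^ 2)
    (M : ℕ → ℕ → ℕ)
    (open-h : ∀ a₀ a₁ → a₀ ≤ k → a₁ ≤ k → M a₀ a₁ ≡ 0 ⊎ Dq * Dq * (a₀ + a₁ + 2 * M a₀ a₁) + (loss k (Dq * Dq) ρ (s₂ + 186 * suc s₂) (jj * jj * (cd * ρ)) t₀ t₁ j m (Dq * Dq * suc (J + (k + k))) a₀ + loss k (Dq * Dq) ρ (s₂ + 186 * suc s₂) (jj * jj * (cd * ρ)) t₀ t₁ j m (Dq * Dq * suc (J + (k + k))) a₁) ≤ Dq * Dq * (a₀ * a₀ + a₁ * a₁))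
    (X : ℕ) .{{_ : NonZero X}} (Bd : ℕ → ℕ → ℕ)
    (count-h : ∀ a₀ a₁ → a₀ ≤ k → a₁ ≤ k → ∑[ I ∈ subs k (fins n) ] (𝟙 (hasProfile b k a₀ a₁ I)) * X ≤ Bd a₀ a₁)
    (final-h : ∀ a₀ a₁ → a₀ ≤ k → a₁ ≤ k →
      16 * (suc k * suc k) * (Bd a₀ a₁ * (suc (2 * (k * k) * (2 * k)) * (suc (2 * (k * k) * (2 * k)) * (8 ^ c₀ * d₁ ^ M a₀ a₁)))) ≤ X * suc d₁ ^ M a₀ a₁)
    where

    open Keys m
    open Construction b

    β γ Δ ovl Jf : ℕ
    β = Dq * Dq
    γ = Dq * Dq * suc (J + (k + k))
    Δ = s₂ + 186 * suc s₂
    ovl = jj * jj * (cd * ρ)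
    Jf = suc (2 * (k * k) * (2 * k))

    W : ℕ → ℕ
    W = loss k β ρ Δ ovl t₀ t₁ j m γ

    occ : List (Fin n) → Fin 2 → ℕ
    occ = occurrences b

    profile : ℕ → ℕ → List (Fin n) → Bool
    profile = hasProfile b k

    open ≤-Reasoning
    private
      module RG = RandomGraph m Dq d₁ d≡4Dq

    vs = bits d₁
    tot = total vs KK
    d = suc d₁

    φᵢ : List (Fin n) → ℕ → Ω → ℕ
    φᵢ I M ω = Triples.φ b d₁ v₀ I M Jf ω

    indBad : Ω → ℕ
    indBad ω = ∑[ a₀ ∈ levels (suc k) ] (∑[ a₁ ∈ levels (suc k) ] (∑[ I ∈ subs k (fins n) ] (𝟙 (profile a₀ a₁ I) * φᵢ I (M a₀ a₁) ω)))

    E-φᵢ : ∀ I M → length I ≤ k → E vs (φᵢ I M) * d ^ M ≤ Jf * (Jf * (8 ^ c₀ * (d₁ ^ M * tot)))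
    E-φᵢ I M l = Triples.Bounds.E-φ b d₁ v₀ I k l ρ load D₃ D₂ c₀ (≤-trans (Triples.Bounds.length-𝒯 b d₁ v₀ I k l) K₃≤) 8D₃≤ 3R≤ D₂≤ M Jf

    indBad-small : E vs indBad * 16 ≤ tot
    indBad-small = *-cancelʳ-≤ _ _ (suc k * suc k) (begin
      E vs indBad * 16 * (suc k * suc k)     ≡⟨ *-assoc (E vs indBad) 16 _ ⟩
      E vs indBad * S
        ≡⟨ cong (_* S) (trans (E-∑ vs {K = KK} (levels (suc k)) _) (∑-cong (levels (suc k)) (λ a₀ → trans (E-∑ vs {K = KK} (levels (suc k)) _) (∑-cong (levels (suc k)) (λ a₁ →
             trans (E-∑ vs {K = KK} (subs k (fins n)) _) (∑-cong (subs k (fins n)) (λ I → E-*ˡ vs {KK} (𝟙 (profile a₀ a₁ I)) (φᵢ I (M a₀ a₁))))))))) ⟩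
      ∑[ a₀ ∈ levels (suc k) ] (∑[ a₁ ∈ levels (suc k) ] (G a₀ a₁)) * S
        ≡⟨ ∑∑-*ʳ (levels (suc k)) (levels (suc k)) S G ⟩
      ∑[ a₀ ∈ levels (suc k) ] (∑[ a₁ ∈ levels (suc k) ] (G a₀ a₁ * S))
        ≤⟨ ∑-≤const (levels (suc k)) _ (λ i → ∑-≤const (levels (suc k)) tot (λ i′ → each (≤-pred (levels-< i)) (≤-pred (levels-< i′)))) ⟩
      length (levels (suc k)) * (length (levels (suc k)) * tot)  ≡⟨ cong (λ t → t * (t * tot)) (length-levels (suc k)) ⟩
      suc k * (suc k * tot)                   ≡⟨ trans (sym (*-assoc (suc k) (suc k) tot)) (*-comm (suc k * suc k) tot) ⟩
      tot * (suc k * suc k) ∎)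
      where
      S = 16 * (suc k * suc k)
      G : ℕ → ℕ → ℕ
      G a₀ a₁ = ∑[ I ∈ subs k (fins n) ] (𝟙 (profile a₀ a₁ I) * E vs (φᵢ I (M a₀ a₁)))
      each : ∀ {a₀ a₁} → a₀ ≤ k → a₁ ≤ k → G a₀ a₁ * S ≤ tot
      each {a₀} {a₁} p q = *-cancelʳ-≤ _ _ (X * d ^ μ) {{m*n≢0 X (d ^ μ) {{it}} {{m^n≢0 d μ}}}} (begin
        G a₀ a₁ * S * (X * d ^ μ)              ≡⟨ q₁ (G a₀ a₁) S X (d ^ μ) ⟩
        G a₀ a₁ * d ^ μ * X * S                ≡⟨ cong (λ t → t * X * S) (sym (∑-*ʳ (subs k (fins n)) (d ^ μ) (λ I → 𝟙 (profile a₀ a₁ I) * E vs (φᵢ I μ)))) ⟩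
        ∑[ I ∈ subs k (fins n) ] (𝟙 (profile a₀ a₁ I) * E vs (φᵢ I μ) * d ^ μ) * X * S
          ≤⟨ *-monoˡ-≤ S (*-monoˡ-≤ X (∑-mono∈ (subs k (fins n)) (λ {I} I∈ → ≤-trans (≤-reflexive (*-assoc (𝟙 (profile a₀ a₁ I)) _ _)) (*-monoʳ-≤ (𝟙 (profile a₀ a₁ I)) (E-φᵢ I μ (proj₂ (subs⇒⊆ k (fins n) I∈))))))) ⟩
        ∑[ I ∈ subs k (fins n) ] (𝟙 (profile a₀ a₁ I) * Z) * X * S ≡⟨ cong (λ t → t * X * S) (∑-*ʳ (subs k (fins n)) Z (λ I → 𝟙 (profile a₀ a₁ I))) ⟩
        C * Z * X * S                           ≡⟨ q₂ C Z X S ⟩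
        C * X * Z * S                           ≤⟨ *-monoˡ-≤ S (*-monoˡ-≤ Z (count-h a₀ a₁ p q)) ⟩
        Bd a₀ a₁ * Z * S                        ≡⟨ q₃ (Bd a₀ a₁) Jf (8 ^ c₀) (d₁ ^ μ) tot S ⟩
        S * (Bd a₀ a₁ * (Jf * (Jf * (8 ^ c₀ * d₁ ^ μ)))) * tot ≤⟨ *-monoˡ-≤ tot (final-h a₀ a₁ p q) ⟩
        X * d ^ μ * tot                         ≡⟨ *-comm (X * d ^ μ) tot ⟩
        tot * (X * d ^ μ) ∎)
        where
        it : ∀ {x} .{{nz : NonZero x}} → NonZero x
        it {suc _} = _
        μ = M a₀ a₁
        C = ∑[ I ∈ subs k (fins n) ] (𝟙 (profile a₀ a₁ I))
        Z = Jf * (Jf * (8 ^ c₀ * (d₁ ^ μ * tot)))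
        q₁ : ∀ g s x e → g * s * (x * e) ≡ g * e * x * s
        q₁ = solve-∀
        q₂ : ∀ c z x s → c * z * x * s ≡ c * x * z * s
        q₂ = solve-∀
        q₃ : ∀ b j e f t s → b * (j * (j * (e * (f * t)))) * s ≡ s * (b * (j * (j * (e * f)))) * t
        q₃ = solve-∀

    bad : Ω → ℕ
    bad ω = RG.degBad (187 * suc s₂) ω + (RG.sparseBad k (suc j) ω + (RG.codegBad (suc cd) ω + (RG.jointBad k (suc J) ω + indBad ω)))

    bad-small : E vs bad < tot
    bad-small = *-cancelʳ-< 16 _ _ (begin-strict
      E vs bad * 16
        ≡⟨ cong (_* 16) (trans (E-+ vs B₁ (λ ω → B₂ ω + (B₃ ω + (B₄ ω + indBad ω)))) (cong (e₁ +_) (trans (E-+ vs B₂ (λ ω → B₃ ω + (B₄ ω + indBad ω))) (cong (e₂ +_) (trans (E-+ vs B₃ (λ ω → B₄ ω + indBad ω)) (cong (e₃ +_) (E-+ vs B₄ indBad))))))) ⟩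
      (e₁ + (e₂ + (e₃ + (e₄ + e₅)))) * 16     ≡⟨ q₁ e₁ e₂ e₃ e₄ e₅ ⟩
      e₁ * 16 + (e₂ * 16 + (e₃ * 16 + (e₄ * 16 + e₅ * 16)))
        ≤⟨ +-mono-≤ h₁ (+-mono-≤ h₂ (+-mono-≤ h₃ (+-mono-≤ h₄ indBad-small))) ⟩
      tot + (tot + (tot + (tot + tot)))       <⟨ m<m+n _ (≤-trans tot>0 (m≤m*n tot 11)) ⟩
      tot + (tot + (tot + (tot + tot))) + tot * 11 ≡⟨ q₂ tot ⟩
      tot * 16 ∎)
      where
      B₁ B₂ B₃ B₄ : Ω → ℕ
      B₁ = RG.degBad (187 * suc s₂)
      B₂ = RG.sparseBad k (suc j)
      B₃ = RG.codegBad (suc cd)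
      B₄ = RG.jointBad k (suc J)
      e₁ = E vs (RG.degBad (187 * suc s₂))
      e₂ = E vs (RG.sparseBad k (suc j))
      e₃ = E vs (RG.codegBad (suc cd))
      e₄ = E vs (RG.jointBad k (suc J))
      e₅ = E vs indBad
      q₁ : ∀ a b c d e → (a + (b + (c + (d + e)))) * 16 ≡ a * 16 + (b * 16 + (c * 16 + (d * 16 + e * 16)))
      q₁ = solve-∀
      q₂ : ∀ t → t + (t + (t + (t + t))) + t * 11 ≡ t * 16
      q₂ = solve-∀
      lenvs : length vs ≡ suc d₁
      lenvs = length-bits d₁
      tot>0 : 0 < tot
      tot>0 = subst (λ t → 0 < t ^ KK) (sym lenvs) (m^n>0 (suc d₁) KK)
      sm^k : NonZero (suc m ^ k)
      sm^k = m^n≢0 (suc m) k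
      nz : NonZero m
      nz = nonZero′ m
        where
        nonZero′ : ∀ x .{{_ : NonZero x}} → NonZero x
        nonZero′ (suc _) = _
      h₁ : e₁ * 16 ≤ tot
      h₁ = rare {e₁} {tot} {2 * m} {2 ^ suc s₂} {{m*n≢0 2 m}} (RG.degBad-small Dt (suc s₂) (trans lenvs d≡10Dt) (subst (λ t → m ≤ 170 * t * suc s₂) (sym lenvs) m≤)) deg-h
      h₂ : e₂ * 16 ≤ tot
      h₂ = rare {e₂} {tot} {2 * (suc m ^ k * (suc m ^ k * 8 ^ c₁))} {4 ^ suc j} {{m*n≢0 2 _ {{_}} {{m*n≢0 (suc m ^ k) _ {{sm^k}} {{m*n≢0 (suc m ^ k) (8 ^ c₁) {{sm^k}} {{m^n≢0 8 c₁}}}}}}}}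
        (≤-trans (RG.sparseBad-small k c₁ (suc j) k²≤) (≤-reflexive (q (suc m ^ k) (8 ^ c₁) tot))) sparse-h
        where q : ∀ a b t → 2 * (a * (a * (b * t))) ≡ 2 * (a * (a * b)) * t
              q = solve-∀
      h₃ : e₃ * 16 ≤ tot
      h₃ = rare {e₃} {tot} {2 * (m * (m * 8))} {16 ^ suc cd} {{m*n≢0 2 _ {{_}} {{m*n≢0 m (m * 8) {{nz}} {{m*n≢0 m 8}}}}}} (≤-trans (RG.codegBad-small (suc cd) m≤Dq²) (≤-reflexive (q m tot))) codeg-h
        where q : ∀ m t → 2 * (m * (m * (8 * t))) ≡ 2 * (m * (m * 8)) * t
              q = solve-∀
      h₄ : e₄ * 16 ≤ tot
      h₄ = rare {e₄} {tot} {2 * (suc m ^ k * suc m ^ k)} {16 ^ suc J} {{m*n≢0 2 _ {{_}} {{m*n≢0 (suc m ^ k) (suc m ^ k) {{sm^k}} {{sm^k}}}}}} (≤-trans (RG.jointBad-small k (suc J)) (≤-reflexive (q (suc m ^ k) tot))) joint-h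
        where q : ∀ a t → 2 * (a * (a * t)) ≡ 2 * (a * a) * t
              q = solve-∀

    Good : Ω → Set
    Good ω = ∀ I → I ∈ subs k (fins n) → length I ≡ k → ¬ (∀ {u v} → u ∈ I → v ∈ I → u ≢ v → adjacent ω u v ≡ false)

    good : ∃ Good
    good = ω , final
      where
      wit = E-witness vs bad bad-small
      ω : Ω
      ω = proj₁ wit
      z₁ = proj₂ wit
      z₂ = m+n≡0⇒n≡0 (RG.degBad (187 * suc s₂) ω) z₁
      z₃ = m+n≡0⇒n≡0 (RG.sparseBad k (suc j) ω) z₂
      z₄ = m+n≡0⇒n≡0 (RG.codegBad (suc cd) ω) z₃
      z₅ = m+n≡0⇒n≡0 (RG.jointBad k (suc J) ω) z₄
      final : Good ω
      final I I∈ l ind = <⇒≱ (Triples.φ-pos b d₁ v₀ I (M a₀ a₁) Jf ω (s≤s (Triples.Bounds.length-𝒯 b d₁ v₀ I k (≤-reflexive l))) ind M≤)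
          (≤-reflexive φ≡0)
        where
        a₀ = occ I zero
        a₁ = occ I (suc zero)
        deg = RG.degBad≡0 Δ ω (m+n≡0⇒m≡0 (RG.degBad (187 * suc s₂) ω) z₁)
        sparse = λ c {W} {X} → RG.sparseBad≡0 k j ω (m+n≡0⇒m≡0 (RG.sparseBad k (suc j) ω) z₂) c {W} {X}
        codeg = λ c {w} {w′} → RG.codegBad≡0 cd ω (m+n≡0⇒m≡0 (RG.codegBad (suc cd) ω) z₃) c {w} {w′}
        joint = λ c {X} {Y} → RG.jointBad≡0 k J ω (m+n≡0⇒m≡0 (RG.jointBad k (suc J) ω) z₄) c {X} {Y}
        a : Fin 2 → ℕ
        a = occ I
        #open : ℕ
        #open = OpenSlots.#open b d₁ v₀ I (⊆⇒Unique (proj₁ (subs⇒⊆ k (fins n) I∈)) (fins-Unique n)) ω k Δ (j + j) cd m β γ l deg sparse codeg joint t₀ t₁ jj L₁<kt₀ ρ 1≤ρ few load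
        open-bound : β * ∑[ c ∈ fins 2 ] (a c * a c) ≤ β * (∑ (fins 2) a + 2 * #open) + ∑ (fins 2) (λ c → W (a c))
        open-bound = OpenSlots.open-bound b d₁ v₀ I (⊆⇒Unique (proj₁ (subs⇒⊆ k (fins n) I∈)) (fins-Unique n)) ω k Δ (j + j) cd m β γ l deg sparse codeg joint t₀ t₁ jj L₁<kt₀ ρ 1≤ρ few load
        a≤k : ∀ c → a c ≤ k
        a≤k = OpenSlots.a≤k b d₁ v₀ I (⊆⇒Unique (proj₁ (subs⇒⊆ k (fins n) I∈)) (fins-Unique n)) ω k Δ (j + j) cd m β γ l deg sparse codeg joint t₀ t₁ jj L₁<kt₀ ρ 1≤ρ few load
        a₀≤ : a₀ ≤ k
        a₀≤ = a≤k zero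
        a₁≤ : a₁ ≤ k
        a₁≤ = a≤k (suc zero)
        -- `fins 2` is opaque, so the two summands are extracted with indicators.
        ∑2 : (f : Fin 2 → ℕ) → ∑ (fins 2) f ≡ f zero + f (suc zero)
        ∑2 f = trans (∑-cong (fins 2) split) (trans (∑-+ (fins 2) _ _) (cong₂ _+_ (pt zero) (pt (suc zero))))
          where
          pt : ∀ c → ∑[ x ∈ fins 2 ] (𝟙 (x == c) * f c) ≡ f c
          pt c = ∑-δ (fins-Unique 2) (∈-fins c) (λ _ → f c)
          split : ∀ x → f x ≡ 𝟙 (x == zero) * f zero + 𝟙 (x == suc zero) * f (suc zero)
          split zero       = sym (trans (+-identityʳ _) (*-identityˡ _))
          split (suc zero) = sym (*-identityˡ _)
        M≤ : M a₀ a₁ ≤ #open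
        M≤ = [ (λ e → subst (_≤ #open) (sym e) z≤n) , M≤-if ]′ (open-h a₀ a₁ a₀≤ a₁≤)
          where
          M≤-if : β * (a₀ + a₁ + 2 * M a₀ a₁) + (W a₀ + W a₁) ≤ β * (a₀ * a₀ + a₁ * a₁) → M a₀ a₁ ≤ #open
          M≤-if le = *-cancelˡ-≤ 2 (*-cancelˡ-≤ β {{m*n≢0 Dq Dq}} (+-cancelʳ-≤ (β * (a₀ + a₁) + (W a₀ + W a₁)) _ _ (begin
            β * (2 * M a₀ a₁) + (β * (a₀ + a₁) + (W a₀ + W a₁))     ≡⟨ q β (a₀ + a₁) (2 * M a₀ a₁) (W a₀ + W a₁) ⟩
            β * (a₀ + a₁ + 2 * M a₀ a₁) + (W a₀ + W a₁)             ≤⟨ le ⟩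
            β * (a₀ * a₀ + a₁ * a₁)                                 ≡⟨ cong (β *_) (sym (∑2 (λ c → a c * a c))) ⟩
            β * ∑[ c ∈ fins 2 ] (a c * a c)                   ≤⟨ open-bound ⟩
            β * (∑ (fins 2) a + 2 * #open) + ∑ (fins 2) (λ c → W (a c)) ≡⟨ cong₂ (λ s t → β * (s + 2 * #open) + t) (∑2 a) (∑2 (λ c → W (a c))) ⟩
            β * (a₀ + a₁ + 2 * #open) + (W a₀ + W a₁)            ≡⟨ q β (a₀ + a₁) (2 * #open) (W a₀ + W a₁) ⟨
            β * (2 * #open) + (β * (a₀ + a₁) + (W a₀ + W a₁)) ∎)))
            where
            q : ∀ β a x w → β * x + (β * a + w) ≡ β * (a + x) + w
            q = solve-∀
        ≡ᵇ-refl : ∀ t → (t ≡ᵇ t) ≡ true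
        ≡ᵇ-refl zero    = refl
        ≡ᵇ-refl (suc t) = ≡ᵇ-refl t
        φ≡0 : φᵢ I (M a₀ a₁) ω ≡ 0
        φ≡0 = trans (sym (trans (cong (λ t → 𝟙 t * φᵢ I (M a₀ a₁) ω) (∧-intro (trans (cong (_≡ᵇ k) l) (≡ᵇ-refl k)) (∧-intro (≡ᵇ-refl a₀) (≡ᵇ-refl a₁)))) (*-identityˡ _)))
          (∑≡0⇒ (∑≡0⇒ (∑≡0⇒ z₅ (∈-levels (s≤s a₀≤))) (∈-levels (s≤s a₁≤))) I∈)

-- The graph belonging to a sample

module Resulting where

  open import Data.Nat
  open import Data.Nat.Properties
  open import Data.Bool using (Bool; true; false; _∧_; not)
  open import Data.Fin using (Fin; zero; suc)
  open import Data.Vec using (Vec)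
  open import Data.List using (List; length; map)
  import Data.List.Properties as LP
  open import Data.List.Membership.Propositional using (_∈_)
  open import Data.List.Membership.Propositional.Properties using (∈-map⁻)
  open import Data.List.Relation.Unary.Unique.Propositional using (Unique)
  import Data.List.Relation.Unary.Unique.Propositional.Properties as UP
  open import Data.Product using (_,_; proj₁; proj₂)
  open import Data.Empty using (⊥; ⊥-elim)
  open import Relation.Nullary using (¬_)
  open import Relation.Binary.PropositionalEquality
  open import Defs using (Graph; TriangleFree; IndependentSetOfSize)
  open Sums
  open Expectation
  open Events
  open LargeDeviations
  open RandomHost
  open TwoLevels
  open Colours
  open ClosingTriples
  open WeightedPairs

  length≤∑-mem : ∀ {n} {xs : List (Fin n)} → Unique xs → length xs ≤ ∑[ v ∈ fins n ] (𝟙 (mem v xs))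
  length≤∑-mem {n} {xs} u = begin
    length xs                        ≡⟨ ∑-1 xs ⟨
    ∑[ x ∈ xs ] 1                    ≤⟨ ∑-mono∈ xs (λ x∈ → ≤-reflexive (sym (cong 𝟙 (∈⇒mem x∈)))) ⟩
    ∑[ x ∈ xs ] (𝟙 (mem x xs))       ≤⟨ ∑-Unique≤ u _ ⟩
    ∑[ v ∈ fins n ] (𝟙 (mem v xs)) ∎
    where open ≤-Reasoning

  module TheGraph {m n : ℕ} (b : Fin 2 → Fin n → Fin m) (ω : Vec Bool (Keys.KK m)) where

    open Keys m
    open Construction b

    linked-sym : ∀ u v → linked ω u v ≡ linked ω v u
    linked-sym u v = cong (1 ≤ᵇ_) (∑-cong colours (λ c → cong 𝟙 (edge-sym ω c (b c u) (b c v))))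

    closed-sym : ∀ u v → closed ω u v ≡ closed ω v u
    closed-sym u v = cong (1 ≤ᵇ_) (∑-cong colours (λ c → ∑-cong N (λ z → *-comm (𝟙 (edge ω c z (b c u))) (𝟙 (edge ω c z (b c v))))))

    linked-irrefl : ∀ u → linked ω u u ≡ false
    linked-irrefl u with linked ω u u in e
    ... | false = refl
    ... | true  = let (c , p) = linked-elim ω u u e in ⊥-elim (edge⇒≢ ω c p refl)

    graph : Graph n
    graph = record
      { adj   = adjacent ω
      ; sym   = λ u v → cong₂ (λ s t → s ∧ not t) (linked-sym u v) (closed-sym u v)
      ; irrfl = λ u → cong (_∧ not (closed ω u u)) (linked-irrefl u)
      }

    -- Among three edges two have the same colour, and these two close the third.
    graph-triangleFree : TriangleFree graph
    graph-triangleFree x y z xy yz xz =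
      let (c₁ , e₁) = linked-elim ω x y (proj₁ (∧-true xy))
          (c₂ , e₂) = linked-elim ω y z (proj₁ (∧-true yz))
          (c₃ , e₃) = linked-elim ω x z (proj₁ (∧-true xz))
      in go c₁ c₂ c₃ e₁ e₂ e₃
      where
      flip : ∀ {c p q} → edge ω c p q ≡ true → edge ω c q p ≡ true
      flip {c} {p} {q} e = trans (edge-sym ω c q p) e
      open′ : ∀ {u v} → adjacent ω u v ≡ true → closed ω u v ≡ false
      open′ {u} {v} e = not-true (proj₂ (∧-true {linked ω u v} e))
      two₁₂ : ∀ c → edge ω c (b c x) (b c y) ≡ true → edge ω c (b c y) (b c z) ≡ true → ⊥
      two₁₂ c e₁ e₂ = true≢false (closed-intro ω x z c (b c y) (flip e₁) e₂) (open′ xz)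
      two₁₃ : ∀ c → edge ω c (b c x) (b c y) ≡ true → edge ω c (b c x) (b c z) ≡ true → ⊥
      two₁₃ c e₁ e₃ = true≢false (closed-intro ω y z c (b c x) e₁ e₃) (open′ yz)
      two₂₃ : ∀ c → edge ω c (b c y) (b c z) ≡ true → edge ω c (b c x) (b c z) ≡ true → ⊥
      two₂₃ c e₂ e₃ = true≢false (closed-intro ω x y c (b c z) (flip e₃) (flip e₂)) (open′ xy)
      go : ∀ c₁ c₂ c₃ → edge ω c₁ (b c₁ x) (b c₁ y) ≡ true → edge ω c₂ (b c₂ y) (b c₂ z) ≡ true → edge ω c₃ (b c₃ x) (b c₃ z) ≡ true → ⊥
      go zero       zero       _          e₁ e₂ e₃ = two₁₂ zero e₁ e₂
      go (suc zero) (suc zero) _          e₁ e₂ e₃ = two₁₂ (suc zero) e₁ e₂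
      go zero       (suc zero) zero       e₁ e₂ e₃ = two₁₃ zero e₁ e₃
      go zero       (suc zero) (suc zero) e₁ e₂ e₃ = two₂₃ (suc zero) e₂ e₃
      go (suc zero) zero       zero       e₁ e₂ e₃ = two₂₃ zero e₂ e₃
      go (suc zero) zero       (suc zero) e₁ e₂ e₃ = two₁₃ (suc zero) e₁ e₃

    graph-independent : ∀ k →
      (∀ I → I ∈ subs k (fins n) → length I ≡ k → ¬ (∀ {u v} → u ∈ I → v ∈ I → u ≢ v → adjacent ω u v ≡ false)) →
      ¬ IndependentSetOfSize graph k
    graph-independent k good (f , inj , ind) = good I (∈-subs (filt-⊆ _ (fins n)) (≤-reflexive len)) len ind′
      where
      image : List (Fin n)
      image = map f (fins k)
      -- The image of f in the order of `fins n`, since members of `subs` are sublists.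
      I : List (Fin n)
      I = filt (λ v → mem v image) (fins n)
      len-image : length image ≡ k
      len-image = trans (LP.length-map f (fins k)) (length-fins k)
      len : length I ≡ k
      len = trans (length-filt _ (fins n)) (≤-antisym (≤-trans (∑-mem≤ image) (≤-reflexive len-image))
        (≤-trans (≤-reflexive (sym len-image)) (length≤∑-mem (UP.map⁺ inj (fins-Unique k)))))
      ind′ : ∀ {u v} → u ∈ I → v ∈ I → u ≢ v → adjacent ω u v ≡ false
      ind′ u∈ v∈ ne with ∈-map⁻ f (mem⇒∈ image (proj₂ (∈-filt⁻ _ (fins n) u∈))) | ∈-map⁻ f (mem⇒∈ image (proj₂ (∈-filt⁻ _ (fins n) v∈)))
      ... | i , _ , refl | j , _ , refl = ind i j (λ e → ne (cong f e))

-- Partial sums of the exponential series, and the comparison with powers of 2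

module Exponential where

  open import Defs using (ℕ→ℚ; expTerm; expPartial; ExpLe)
  open import Data.Nat as ℕ using (ℕ; zero; suc)
  import Data.Nat.Properties as ℕP
  open import Data.Integer as ℤ using (ℤ; +_)
  import Data.Integer.Properties as ℤP
  open import Data.Rational
  open import Data.Rational.Properties
  import Data.Rational.Unnormalised as ℚᵘ
  import Data.Rational.Unnormalised.Properties as ℚᵘP
  open import Data.Rational.Solver using (module +-*-Solver)
  open import Data.Product using (_×_; _,_; proj₂)
  open import Data.Unit using (tt)
  open import Relation.Nullary.Decidable using (toWitness)
  open import Relation.Binary.PropositionalEquality

  open ≤-Reasoning

  mulʳ : ∀ {p q} r → 0ℚ ≤ r → p ≤ q → p * r ≤ q * r
  mulʳ r 0≤r = *-monoʳ-≤-nonNeg r {{nonNegative 0≤r}}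

  mulˡ : ∀ {p q} r → 0ℚ ≤ r → p ≤ q → r * p ≤ r * q
  mulˡ r 0≤r = *-monoˡ-≤-nonNeg r {{nonNegative 0≤r}}

  0≤* : ∀ {p q} → 0ℚ ≤ p → 0ℚ ≤ q → 0ℚ ≤ p * q
  0≤* {p} {q} 0≤p 0≤q = ≤-trans (≤-reflexive (sym (*-zeroˡ q))) (mulʳ q 0≤q 0≤p)

  0≤+ : ∀ {p q} → 0ℚ ≤ p → 0ℚ ≤ q → 0ℚ ≤ p + q
  0≤+ a b = ≤-trans (≤-reflexive (sym (+-identityˡ 0ℚ))) (+-mono-≤ a b)

  toℚᵘ-/ : ∀ a b → toℚᵘ (a / suc b) ℚᵘ.≃ ℚᵘ.mkℚᵘ a b
  toℚᵘ-/ a b = toℚᵘ-fromℚᵘ (ℚᵘ.mkℚᵘ a b)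

  ℕ→ℚ-mono : ∀ {a b} → a ℕ.≤ b → ℕ→ℚ a ≤ ℕ→ℚ b
  ℕ→ℚ-mono {a} {b} le = toℚᵘ-cancel-≤ (ℚᵘP.≤-trans (ℚᵘP.≤-reflexive (toℚᵘ-/ (+ a) 0))
    (ℚᵘP.≤-trans (ℚᵘ.*≤* (ℤP.*-monoʳ-≤-nonNeg (+ 1) (ℤ.+≤+ le))) (ℚᵘP.≤-reflexive (ℚᵘP.≃-sym (toℚᵘ-/ (+ b) 0)))))

  ℕ→ℚ-* : ∀ a b → ℕ→ℚ (a ℕ.* b) ≡ ℕ→ℚ a * ℕ→ℚ b
  ℕ→ℚ-* a b = toℚᵘ-injective (ℚᵘP.≃-trans (toℚᵘ-/ (+ (a ℕ.* b)) 0) (ℚᵘP.≃-trans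
    (ℚᵘ.*≡* (cong (ℤ._* + 1) (ℤP.pos-* a b)))
    (ℚᵘP.≃-sym (ℚᵘP.≃-trans (toℚᵘ-homo-* (ℕ→ℚ a) (ℕ→ℚ b)) (ℚᵘP.*-cong (toℚᵘ-/ (+ a) 0) (toℚᵘ-/ (+ b) 0))))))

  ℕ→ℚ-suc : ∀ a → ℕ→ℚ (suc a) ≡ ℕ→ℚ a + 1ℚ
  ℕ→ℚ-suc a = toℚᵘ-injective (ℚᵘP.≃-trans (toℚᵘ-/ (+ suc a) 0) (ℚᵘP.≃-trans
    (ℚᵘ.*≡* (cong (ℤ._* + 1) (trans (cong +_ (ℕP.+-comm 1 a)) (cong (ℤ._+ + 1) (sym (ℤP.*-identityʳ (+ a)))))))
    (ℚᵘP.≃-sym (ℚᵘP.≃-trans (toℚᵘ-homo-+ (ℕ→ℚ a) 1ℚ) (ℚᵘP.+-cong (toℚᵘ-/ (+ a) 0) ℚᵘP.≃-refl)))))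

  inv : ∀ n .{{_ : ℕ.NonZero n}} → ℚ
  inv n = + 1 / n

  inv-law : ∀ n .{{_ : ℕ.NonZero n}} → ℕ→ℚ n * inv n ≡ 1ℚ
  inv-law (suc j) = toℚᵘ-injective (ℚᵘP.≃-trans (toℚᵘ-homo-* (ℕ→ℚ (suc j)) (inv (suc j))) (ℚᵘP.≃-trans
    (ℚᵘP.*-cong (toℚᵘ-/ (+ suc j) 0) (toℚᵘ-/ (+ 1) j))
    (ℚᵘ.*≡* (trans (ℤP.*-identityʳ _) (trans (ℤP.*-identityʳ (+ suc j)) (trans (cong +_ (sym (ℕP.+-identityʳ (suc j)))) (sym (ℤP.*-identityˡ _))))))))

  0≤inv : ∀ n .{{_ : ℕ.NonZero n}} → 0ℚ ≤ inv n
  0≤inv n = nonNegative⁻¹ (inv n) {{normalize-nonNeg 1 n}}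

  0≤ℕ→ℚ : ∀ a → 0ℚ ≤ ℕ→ℚ a
  0≤ℕ→ℚ a = nonNegative⁻¹ (ℕ→ℚ a) {{normalize-nonNeg a 1}}

  0≤T : ∀ {q} → 0ℚ ≤ q → ∀ j → 0ℚ ≤ expTerm q j
  0≤T 0≤q zero    = nonNegative⁻¹ 1ℚ
  0≤T 0≤q (suc j) = 0≤* (0≤* (0≤T 0≤q j) 0≤q) (0≤inv (suc j))

  T-mono : ∀ {x y} → 0ℚ ≤ x → x ≤ y → ∀ j → expTerm x j ≤ expTerm y j
  T-mono 0≤x x≤y zero    = ≤-refl
  T-mono {x} {y} 0≤x x≤y (suc j) = mulʳ (inv (suc j)) (0≤inv (suc j))
    (≤-trans (mulʳ x 0≤x (T-mono 0≤x x≤y j)) (mulˡ (expTerm y j) (0≤T (≤-trans 0≤x x≤y) j) x≤y))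

  S-mono : ∀ {x y} → 0ℚ ≤ x → x ≤ y → ∀ N → expPartial x N ≤ expPartial y N
  S-mono 0≤x x≤y zero    = ≤-refl
  S-mono 0≤x x≤y (suc N) = +-mono-≤ (S-mono 0≤x x≤y N) (T-mono 0≤x x≤y (suc N))

  -- y^{j+1}/(j+1)! ≤ x^{j+1}/(j+1)! + h y^j/j! for y = x + h: convexity of the power function.
  T-shift : ∀ x h → 0ℚ ≤ x → 0ℚ ≤ h → ∀ j → expTerm (x + h) (suc j) ≤ expTerm x (suc j) + h * expTerm (x + h) j
  T-shift x h 0≤x 0≤h zero = ≤-reflexive (solve 2 (λ x h → con 1ℚ :* (x :+ h) :* con 1ℚ := con 1ℚ :* x :* con 1ℚ :+ h :* con 1ℚ) refl x h)
    where open +-*-Solver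
  T-shift x h 0≤x 0≤h (suc j) = begin
    T₁ * (x + h) * i                         ≡⟨ solve 4 (λ T x h i → T :* (x :+ h) :* i := (T :* x :+ h :* T) :* i) refl T₁ x h i ⟩
    (T₁ * x + h * T₁) * i                    ≤⟨ mulʳ i (0≤inv (2 ℕ.+ j)) (+-monoˡ-≤ (h * T₁) (mulʳ x 0≤x (T-shift x h 0≤x 0≤h j))) ⟩
    ((X₁ + h * T₀) * x + h * T₁) * i         ≡⟨ solve 6 (λ X h T₀ T₁ x i → ((X :+ h :* T₀) :* x :+ h :* T₁) :* i := X :* x :* i :+ h :* ((T₀ :* x :+ T₁) :* i)) refl X₁ h T₀ T₁ x i ⟩
    X₁ * x * i + h * ((T₀ * x + T₁) * i)     ≤⟨ +-monoʳ-≤ (X₁ * x * i) (mulˡ h 0≤h key) ⟩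
    X₁ * x * i + h * T₁ ∎
    where
    open +-*-Solver
    y = x + h
    0≤y : 0ℚ ≤ y
    0≤y = 0≤+ 0≤x 0≤h
    T₀ = expTerm y j
    T₁ = expTerm y (suc j)
    X₁ = expTerm x (suc j)
    i = inv (2 ℕ.+ j)
    s = ℕ→ℚ (suc j)
    x≤y : x ≤ y
    x≤y = ≤-trans (≤-reflexive (sym (+-identityʳ x))) (+-monoʳ-≤ x 0≤h)
    sT₁ : s * T₁ ≡ T₀ * y
    sT₁ = trans (solve 4 (λ s T y i → s :* (T :* y :* i) := T :* y :* (s :* i)) refl s T₀ y (inv (suc j)))
      (trans (cong (T₀ * y *_) (inv-law (suc j))) (*-identityʳ (T₀ * y)))
    key : (T₀ * x + T₁) * i ≤ T₁
    key = begin
      (T₀ * x + T₁) * i     ≤⟨ mulʳ i (0≤inv (2 ℕ.+ j)) (+-monoˡ-≤ T₁ (mulˡ T₀ (0≤T 0≤y j) x≤y)) ⟩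
      (T₀ * y + T₁) * i     ≡⟨ cong (λ t → (t + T₁) * i) (sym sT₁) ⟩
      (s * T₁ + T₁) * i     ≡⟨ solve 3 (λ s T i → (s :* T :+ T) :* i := T :* ((s :+ con 1ℚ) :* i)) refl s T₁ i ⟩
      T₁ * ((s + 1ℚ) * i)   ≡⟨ cong (λ t → T₁ * (t * i)) (sym (ℕ→ℚ-suc (suc j))) ⟩
      T₁ * (ℕ→ℚ (2 ℕ.+ j) * i) ≡⟨ trans (cong (T₁ *_) (inv-law (2 ℕ.+ j))) (*-identityʳ T₁) ⟩
      T₁ ∎

  -- The sum of `T-shift` over all terms. It yields S(x + h) ≤ S(x) + h S(x + h), that is exp h ≤
  -- 1/(1 - h), for the partial sums themselves; the last term stays on the left to make the
  -- induction work.
  S-shift : ∀ x h → 0ℚ ≤ x → 0ℚ ≤ h → ∀ N →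
            expPartial (x + h) N + h * expTerm (x + h) N ≤ expPartial x N + h * expPartial (x + h) N
  S-shift x h 0≤x 0≤h zero    = ≤-refl
  S-shift x h 0≤x 0≤h (suc N) = begin
    S + T₁ + h * T₁              ≤⟨ +-monoˡ-≤ (h * T₁) (+-monoʳ-≤ S (T-shift x h 0≤x 0≤h N)) ⟩
    S + (X₁ + h * T₀) + h * T₁   ≡⟨ solve 5 (λ S X h T₀ T₁ → S :+ (X :+ h :* T₀) :+ h :* T₁ := (S :+ h :* T₀) :+ (X :+ h :* T₁)) refl S X₁ h T₀ T₁ ⟩
    (S + h * T₀) + (X₁ + h * T₁) ≤⟨ +-monoˡ-≤ (X₁ + h * T₁) (S-shift x h 0≤x 0≤h N) ⟩
    (Sx + h * S) + (X₁ + h * T₁) ≡⟨ solve 5 (λ Sx h S X T₁ → (Sx :+ h :* S) :+ (X :+ h :* T₁) := Sx :+ X :+ h :* (S :+ T₁)) refl Sx h S X₁ T₁ ⟩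
    Sx + X₁ + h * (S + T₁) ∎
    where
    open +-*-Solver
    S  = expPartial (x + h) N
    Sx = expPartial x N
    T₀ = expTerm (x + h) N
    T₁ = expTerm (x + h) (suc N)
    X₁ = expTerm x (suc N)

  h₀ ρ₀ : ℚ
  h₀ = + 1 / 20
  ρ₀ = + 20 / 19

  -- 1/(1 - h) at h = 1/20 is 20/19.
  S-step : ∀ x → 0ℚ ≤ x → ∀ N → expPartial (x + h₀) N ≤ ρ₀ * expPartial x N
  S-step x 0≤x N = begin
    S                              ≡⟨ solve 1 (λ S → S := con ρ₀ :* ((S :+ (:- (con h₀ :* S))))) refl S ⟩
    ρ₀ * (S + - (h₀ * S))          ≤⟨ mulˡ ρ₀ (nonNegative⁻¹ ρ₀) (≤-trans (+-monoˡ-≤ (- (h₀ * S)) le) (≤-reflexive (solve 2 (λ a b → a :+ b :+ (:- b) := a) refl Sx (h₀ * S)))) ⟩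
    ρ₀ * Sx ∎
    where
    open +-*-Solver
    S  = expPartial (x + h₀) N
    Sx = expPartial x N
    0≤h : 0ℚ ≤ h₀
    0≤h = nonNegative⁻¹ h₀
    le : S ≤ Sx + h₀ * S
    le = ≤-trans (≤-trans (≤-reflexive (sym (+-identityʳ S))) (+-monoʳ-≤ S (0≤* 0≤h (0≤T (0≤+ 0≤x 0≤h) N)))) (S-shift x h₀ 0≤x 0≤h N)

  iter : ℕ → (ℚ → ℚ) → ℚ → ℚ
  iter zero    f x = x
  iter (suc n) f x = f (iter n f x)

  S-steps : ∀ t x → 0ℚ ≤ x → ∀ N → 0ℚ ≤ iter t (_+ h₀) x × expPartial (iter t (_+ h₀) x) N ≤ iter t (ρ₀ *_) (expPartial x N)
  S-steps zero    x 0≤x N = 0≤x , ≤-refl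
  S-steps (suc t) x 0≤x N = let (p , q) = S-steps t x 0≤x N in
    0≤+ p (nonNegative⁻¹ h₀) , ≤-trans (S-step _ p N) (mulˡ ρ₀ (nonNegative⁻¹ ρ₀) q)

  c₁₃ : ℚ
  c₁₃ = + 13 / 20

  0≤S : ∀ {x} → 0ℚ ≤ x → ∀ N → 0ℚ ≤ expPartial x N
  0≤S 0≤x zero    = nonNegative⁻¹ 1ℚ
  0≤S 0≤x (suc N) = 0≤+ (0≤S 0≤x N) (0≤T 0≤x (suc N))

  -- exp (13/20) ≤ (20/19)^13 ≤ 2
  S-block : ∀ x → 0ℚ ≤ x → ∀ N → expPartial (x + c₁₃) N ≤ ℕ→ℚ 2 * expPartial x N
  S-block x 0≤x N = begin
    expPartial (x + c₁₃) N                      ≡⟨ cong (λ t → expPartial t N) (solve 1 (λ x → x :+ con c₁₃ := ((((((((((((x :+ con h₀) :+ con h₀) :+ con h₀) :+ con h₀) :+ con h₀) :+ con h₀) :+ con h₀) :+ con h₀) :+ con h₀) :+ con h₀) :+ con h₀) :+ con h₀) :+ con h₀) refl x) ⟩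
    expPartial (iter 13 (_+ h₀) x) N            ≤⟨ proj₂ (S-steps 13 x 0≤x N) ⟩
    iter 13 (ρ₀ *_) (expPartial x N)            ≡⟨ solve 1 (λ s → (con ρ₀ :* (con ρ₀ :* (con ρ₀ :* (con ρ₀ :* (con ρ₀ :* (con ρ₀ :* (con ρ₀ :* (con ρ₀ :* (con ρ₀ :* (con ρ₀ :* (con ρ₀ :* (con ρ₀ :* (con ρ₀ :* s))))))))))))) := con (iter 13 (ρ₀ *_) 1ℚ) :* s) refl (expPartial x N) ⟩
    iter 13 (ρ₀ *_) 1ℚ * expPartial x N         ≤⟨ mulʳ (expPartial x N) (0≤S 0≤x N) (toWitness {a? = iter 13 (ρ₀ *_) 1ℚ ≤? ℕ→ℚ 2} tt) ⟩
    ℕ→ℚ 2 * expPartial x N ∎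
    where open +-*-Solver

  S-pow2 : ∀ L N → expPartial (ℕ→ℚ L * c₁₃) N ≤ ℕ→ℚ (2 ℕ.^ L)
  S-pow2 zero    N = ≤-trans (≤-reflexive (cong (λ t → expPartial t N) (*-zeroˡ c₁₃))) (at0 N)
    where
    T0 : ∀ j → expTerm 0ℚ (suc j) ≡ 0ℚ
    T0 j = trans (cong (_* inv (suc j)) (*-zeroʳ (expTerm 0ℚ j))) (*-zeroˡ (inv (suc j)))
    at0 : ∀ N → expPartial 0ℚ N ≤ ℕ→ℚ 1
    at0 zero    = ≤-refl
    at0 (suc N) = ≤-trans (≤-reflexive (trans (cong (λ t → expPartial 0ℚ N + t) (T0 N)) (+-identityʳ _))) (at0 N)
  S-pow2 (suc L) N = begin
    expPartial (ℕ→ℚ (suc L) * c₁₃) N         ≡⟨ cong (λ t → expPartial t N) (trans (cong (_* c₁₃) (ℕ→ℚ-suc L)) (trans (*-distribʳ-+ c₁₃ (ℕ→ℚ L) 1ℚ) (cong (λ t → ℕ→ℚ L * c₁₃ + t) (*-identityˡ c₁₃)))) ⟩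
    expPartial (ℕ→ℚ L * c₁₃ + c₁₃) N         ≤⟨ S-block (ℕ→ℚ L * c₁₃) (0≤* (0≤ℕ→ℚ L) (nonNegative⁻¹ c₁₃)) N ⟩
    ℕ→ℚ 2 * expPartial (ℕ→ℚ L * c₁₃) N       ≤⟨ mulˡ (ℕ→ℚ 2) (0≤ℕ→ℚ 2) (S-pow2 L N) ⟩
    ℕ→ℚ 2 * ℕ→ℚ (2 ℕ.^ L)                    ≡⟨ ℕ→ℚ-* 2 (2 ℕ.^ L) ⟨
    ℕ→ℚ (2 ℕ.^ suc L) ∎

  -- k²/n is at most 39 L / 20, and a third of it is 13 L / 20, whose exponential is at most 2^L. So
  -- the 39 is 3 · 13, with 13/20 a rational just below log 2.
  expLe : ∀ (c : ℚ) (k n L : ℕ) .{{_ : ℕ.NonZero n}} → 0ℚ ≤ c → c ≤ + 1 / 3 → 2 ℕ.^ L ℕ.≤ k →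
          20 ℕ.* (k ℕ.* k) ℕ.≤ 39 ℕ.* (n ℕ.* L) → ExpLe (c * ℕ→ℚ (k ℕ.* k) * (+ 1 / n)) (ℕ→ℚ k)
  expLe c k n L 0≤c c≤ 2^L≤k le N = begin
    expPartial (c * K * i) N          ≤⟨ S-mono (0≤* (0≤* 0≤c (0≤ℕ→ℚ (k ℕ.* k))) (0≤inv n)) arg N ⟩
    expPartial (ℕ→ℚ L * c₁₃) N        ≤⟨ S-pow2 L N ⟩
    ℕ→ℚ (2 ℕ.^ L)                     ≤⟨ ℕ→ℚ-mono 2^L≤k ⟩
    ℕ→ℚ k ∎
    where
    open +-*-Solver
    K = ℕ→ℚ (k ℕ.* k)
    i = inv n
    t = + 1 / 3
    w = i * (h₀ * t)
    0≤w : 0ℚ ≤ w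
    0≤w = 0≤* (0≤inv n) (0≤* {h₀} {t} (nonNegative⁻¹ h₀) (nonNegative⁻¹ t))
    arg : c * K * i ≤ ℕ→ℚ L * c₁₃
    arg = begin
      c * K * i                                ≤⟨ mulʳ i (0≤inv n) (mulʳ K (0≤ℕ→ℚ (k ℕ.* k)) c≤) ⟩
      t * K * i                                ≡⟨ solve 2 (λ K i → con t :* K :* i := con (ℕ→ℚ 20) :* K :* (i :* (con h₀ :* con t))) refl K i ⟩
      ℕ→ℚ 20 * K * w                           ≡⟨ cong (_* w) (ℕ→ℚ-* 20 (k ℕ.* k)) ⟨
      ℕ→ℚ (20 ℕ.* (k ℕ.* k)) * w               ≤⟨ mulʳ w 0≤w (ℕ→ℚ-mono le) ⟩
      ℕ→ℚ (39 ℕ.* (n ℕ.* L)) * w               ≡⟨ cong (_* w) (trans (ℕ→ℚ-* 39 (n ℕ.* L)) (cong (ℕ→ℚ 39 *_) (ℕ→ℚ-* n L))) ⟩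
      ℕ→ℚ 39 * (ℕ→ℚ n * ℕ→ℚ L) * (i * (h₀ * t)) ≡⟨ solve 3 (λ n L i → con (ℕ→ℚ 39) :* (n :* L) :* (i :* (con h₀ :* con t)) := (n :* i) :* (L :* con c₁₃)) refl (ℕ→ℚ n) (ℕ→ℚ L) i ⟩
      ℕ→ℚ n * i * (ℕ→ℚ L * c₁₃)                ≡⟨ cong (_* (ℕ→ℚ L * c₁₃)) (inv-law n) ⟩
      1ℚ * (ℕ→ℚ L * c₁₃)                       ≡⟨ *-identityˡ _ ⟩
      ℕ→ℚ L * c₁₃ ∎

-- Binary logarithm, products and division

module Arithmetic where

  open import Data.Nat
  open import Data.Nat.Properties
  open import Data.Nat.DivMod
  open import Data.List using (List; []; _∷_; length)
  open import Data.Nat.ListAction using (product)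
  open import Data.List.Relation.Unary.All using (All; []; _∷_)
  open import Data.Product using (∃; _×_; _,_)
  open import Data.Empty using (⊥-elim)
  open import Relation.Nullary using (yes; no)
  open import Relation.Binary.PropositionalEquality hiding (J)
  open Sums using (^-distribʳ-*)

  open ≤-Reasoning

  log₂ : ∀ n → 1 ≤ n → ∃ λ L → 2 ^ L ≤ n × n < 2 ^ suc L
  log₂ (suc zero)    _ = 0 , ≤-refl , ≤-refl
  log₂ (suc (suc n)) _ with log₂ (suc n) (s≤s z≤n)
  ... | L , lo , hi with suc (suc n) <? 2 ^ suc L
  ...   | yes l = L , ≤-trans lo (n≤1+n (suc n)) , l
  ...   | no ¬l = suc L , ≮⇒≥ ¬l , (begin-strict
          suc (suc n)           ≤⟨ hi ⟩
          2 ^ suc L             <⟨ m<m+n (2 ^ suc L) (m^n>0 2 (suc L)) ⟩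
          2 ^ suc L + 2 ^ suc L ≡⟨ cong (2 ^ suc L +_) (sym (+-identityʳ (2 ^ suc L))) ⟩
          2 ^ suc (suc L) ∎)

  2^-cancel-< : ∀ a b → 2 ^ a < 2 ^ b → a < b
  2^-cancel-< a b lt with a <? b
  ... | yes l = l
  ... | no ¬l = ⊥-elim (<⇒≱ lt (^-monoʳ-≤ 2 (≮⇒≥ ¬l)))

  ≤-halves : ∀ {x y z} → 2 * x ≤ z → 2 * y ≤ z → x + y ≤ z
  ≤-halves {x} {y} {z} p q = *-cancelˡ-≤ 2 (begin
    2 * (x + y)     ≡⟨ *-distribˡ-+ 2 x y ⟩
    2 * x + 2 * y   ≤⟨ +-mono-≤ p q ⟩
    z + z           ≡⟨ cong (z +_) (sym (+-identityʳ z)) ⟩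
    2 * z ∎)

  product≤ : ∀ B (xs : List ℕ) → All (_≤ B) xs → product xs ≤ B ^ length xs
  product≤ B []       []       = ≤-refl
  product≤ B (x ∷ xs) (p ∷ ps) = *-mono-≤ p (product≤ B xs ps)

  [m/n]*n≤m′ : ∀ m n .{{_ : NonZero n}} → n * (m / n) ≤ m
  [m/n]*n≤m′ m n = ≤-trans (≤-reflexive (*-comm n (m / n))) (m/n*n≤m m n)

  m<n*[1+m/n] : ∀ m n .{{_ : NonZero n}} → m < n * suc (m / n)
  m<n*[1+m/n] m n = begin-strict
    m                     ≡⟨ m≡m%n+[m/n]*n m n ⟩
    m % n + m / n * n     <⟨ +-monoˡ-< (m / n * n) (m%n<n m n) ⟩
    n + m / n * n         ≡⟨ cong (n +_) (*-comm (m / n) n) ⟩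
    n + n * (m / n)       ≡⟨ *-suc n (m / n) ⟨
    n * suc (m / n) ∎

  ≤-div : ∀ {c m n} .{{_ : NonZero n}} → c * n ≤ m → c ≤ m / n
  ≤-div {c} {m} {n} le = ≤-trans (≤-reflexive (sym (m*n/n≡m c n))) (/-monoˡ-≤ n le)

  mul≤ : ∀ c x y → x ≤ y → c * x ≤ c * y
  mul≤ c x y le = *-monoʳ-≤ c le

  cancel≤ : ∀ c x y .{{_ : NonZero c}} → c * x ≤ c * y → x ≤ y
  cancel≤ c x y le = *-cancelˡ-≤ c le

-- The exponents: open pairs against the number of sets

module Budget where

  open import Data.Nat
  open import Data.Nat.Properties
  open import Data.Nat.Tactic.RingSolver using (solve-∀)
  open import Data.Product using (∃; _×_; _,_)
  open import Data.Sum using (_⊎_; inj₁; inj₂)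
  open import Data.Unit using (tt)
  open import Relation.Nullary using (yes; no)
  open import Relation.Binary.PropositionalEquality

  open ≤-Reasoning

  -- Apart from the main term g u there are six error terms. Multiplied by 10 c each is at most β
  -- k², so six tenths of the allowed β k² are used.
  W-bound : ∀ c k u g β ovl Δ e ρ t m G → 10 * c * ovl ≤ k → ovl ≤ k → 80 * c * Δ ≤ k → 20 * c * e ≤ k * k → 10 * c * ρ ≤ k →
            20 * c * (t * (ρ * ρ * G)) ≤ k * k → 20 * c * (t * m) ≤ β → g ≤ k →
            c * (β * (g * (u + ovl) + (2 * (2 * Δ * (k + ovl) + e) + ρ * k)) + 2 * (t * (m * (k * k) + ρ * ρ * (β * G)))) ≤ β * (c * (g * u) + k * k)
  W-bound c k u g β ovl Δ e ρ t m G h₁ h₁′ h₂ h₃ h₄ h₅ h₆ h₇ = *-cancelˡ-≤ 10 (begin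
    10 * (c * (β * (g * (u + ovl) + (2 * (2 * Δ * (k + ovl) + e) + ρ * k)) + 2 * (t * (m * (k * k) + ρ * ρ * (β * G)))))
      ≡⟨ q₁ c k u g β ovl Δ e ρ t m G ⟩
    10 * (β * (c * (g * u))) + (β * (10 * c * ovl * g + (40 * c * Δ * (k + ovl) + (20 * c * e + (10 * c * ρ * k + 20 * c * (t * (ρ * ρ * G)))))) + 20 * c * (t * m) * (k * k))
      ≤⟨ +-monoʳ-≤ (10 * (β * (c * (g * u)))) (+-mono-≤ (*-monoʳ-≤ β (+-mono-≤ (*-mono-≤ h₁ h₇) (+-mono-≤ p₂ (+-mono-≤ h₃ (+-mono-≤ (*-monoˡ-≤ k h₄) h₅))))) (*-monoˡ-≤ (k * k) h₆)) ⟩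
    10 * (β * (c * (g * u))) + (β * (k * k + (k * k + (k * k + (k * k + k * k)))) + β * (k * k))
      ≤⟨ m≤m+n _ (4 * (β * (k * k))) ⟩
    10 * (β * (c * (g * u))) + (β * (k * k + (k * k + (k * k + (k * k + k * k)))) + β * (k * k)) + 4 * (β * (k * k))
      ≡⟨ q₂ β (c * (g * u)) (k * k) ⟩
    10 * (β * (c * (g * u) + k * k)) ∎)
    where
    q₁ : ∀ c k u g β ovl Δ e ρ t m G →
      10 * (c * (β * (g * (u + ovl) + (2 * (2 * Δ * (k + ovl) + e) + ρ * k)) + 2 * (t * (m * (k * k) + ρ * ρ * (β * G))))) ≡
      10 * (β * (c * (g * u))) + (β * (10 * c * ovl * g + (40 * c * Δ * (k + ovl) + (20 * c * e + (10 * c * ρ * k + 20 * c * (t * (ρ * ρ * G)))))) + 20 * c * (t * m) * (k * k))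
    q₁ = solve-∀
    q₂ : ∀ β x y → 10 * (β * x) + (β * (y + (y + (y + (y + y)))) + β * y) + 4 * (β * y) ≡ 10 * (β * (x + y))
    q₂ = solve-∀
    q₃ : ∀ c Δ k → 40 * c * Δ * (k + k) ≡ 80 * c * Δ * k
    q₃ = solve-∀
    p₂ : 40 * c * Δ * (k + ovl) ≤ k * k
    p₂ = ≤-trans (*-monoʳ-≤ (40 * c * Δ) (+-monoʳ-≤ k h₁′)) (≤-trans (≤-reflexive (q₃ c Δ k)) (*-monoˡ-≤ k h₂))

  square-complement : ∀ a u k → a + u ≡ k → a * a + 2 * k * u ≡ k * k + u * u
  square-complement a u k refl = q a u
    where q : ∀ a u → a * a + 2 * (a + u) * u ≡ (a + u) * (a + u) + u * u
          q = solve-∀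

  -- By a² = k² - 2ku + u² and 75 L d ≤ k the hypothesis becomes, up to errors, e q ≥ c L (2 (k - u₀
  -- - u₁) + (u₀² + u₁² - G)/k): a lower bound for the number q of halvings in terms of the
  -- collapses.
  excess-budget : ∀ c e k L d q a₀ a₁ u₀ u₁ G → a₀ + u₀ ≡ k → a₁ + u₁ ≡ k → 75 * L * d ≤ k →
    c * (a₀ * a₀ + a₁ * a₁) ≤ c * G + (k * k + 2 * c * k) + e * 75 * (d * suc q) →
    c * L * (u₀ * u₀ + u₁ * u₁) + 2 * c * (k * k) * L ≤ c * L * G + (e * k * suc q + (2 * c * k * (u₀ + u₁) * L + (k * k * L + 2 * c * k * L)))
  excess-budget c e k L d q a₀ a₁ u₀ u₁ G p₀ p₁ Ld h = begin
    c * L * (u₀ * u₀ + u₁ * u₁) + 2 * c * (k * k) * L           ≡⟨ q₁ c L (u₀ * u₀) (u₁ * u₁) (k * k) ⟩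
    c * L * ((k * k + u₀ * u₀) + (k * k + u₁ * u₁))             ≡⟨ cong₂ (λ s t → c * L * (s + t)) (square-complement a₀ u₀ k p₀) (square-complement a₁ u₁ k p₁) ⟨
    c * L * ((a₀ * a₀ + 2 * k * u₀) + (a₁ * a₁ + 2 * k * u₁))   ≡⟨ q₂ c L (a₀ * a₀) (a₁ * a₁) k u₀ u₁ ⟩
    L * (c * (a₀ * a₀ + a₁ * a₁)) + 2 * c * k * (u₀ + u₁) * L   ≤⟨ +-monoˡ-≤ (2 * c * k * (u₀ + u₁) * L) (*-monoʳ-≤ L h) ⟩
    L * (c * G + (k * k + 2 * c * k) + e * 75 * (d * suc q)) + 2 * c * k * (u₀ + u₁) * L ≡⟨ q₃ L c G k e d (suc q) (2 * c * k * (u₀ + u₁) * L) 75 ⟩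
    c * L * G + (e * (75 * L * d) * suc q + (2 * c * k * (u₀ + u₁) * L + (k * k * L + 2 * c * k * L)))
      ≤⟨ +-monoʳ-≤ (c * L * G) (+-monoˡ-≤ _ (*-monoˡ-≤ (suc q) (*-monoʳ-≤ e Ld))) ⟩
    c * L * G + (e * k * suc q + (2 * c * k * (u₀ + u₁) * L + (k * k * L + 2 * c * k * L))) ∎
    where
    q₁ : ∀ c L x y z → c * L * (x + y) + 2 * c * z * L ≡ c * L * ((z + x) + (z + y))
    q₁ = solve-∀
    q₂ : ∀ c L x y k u v → c * L * ((x + 2 * k * u) + (y + 2 * k * v)) ≡ L * (c * (x + y)) + 2 * c * k * (u + v) * L
    q₂ = solve-∀
    q₃ : ∀ L c G k e d q y s → L * (c * G + (k * k + 2 * c * k) + e * s * (d * q)) + y ≡ c * L * G + (e * (s * L * d) * q + (y + (k * k * L + 2 * c * k * L)))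
    q₃ = solve-∀

  -- To be used with c = 1500, e = 2800, f = 200. If |A₀| + |A₁| = k + v, about (2c/e) L v = (15/14)
  -- L v halvings are gained; L v of them pay for the D^v sets, and f measures the slack.
  module _ (c e f : ℕ) .{{_ : NonZero e}} (2c≡e+f : 2 * c ≡ e + f) (k L q σ g : ℕ) .{{_ : NonZero k}} (eσ≤L : e * σ ≤ L) (lower : e * k + 2 * c * k * L ≤ k * k * L) where

    private
      instance
        ek≢0 : NonZero (e * k)
        ek≢0 = m*n≢0 e k

    -- The case |A₀| + |A₁| = k + v. Of the slack 3k², one k² pays for kσ, one for the error terms
    -- in the number of open slots, and one for rounding.
    rate-below : ∀ t v → t + v ≡ k → 3 * (k * k) ≤ f * k * v + c * g →
      c * L * g + 2 * c * (k * k) * L ≤ e * k * suc q + (2 * c * k * t * L + (k * k * L + 2 * c * k * L)) → L * v + k * σ ≤ q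
    rate-below t v refl hg h = *-cancelˡ-≤ (e * k) (+-cancelʳ-≤ (2 * (k * k * L)) _ _ (begin
      e * k * (L * v + k * σ) + 2 * (k * k * L)                   ≡⟨ q₁ e k L v σ ⟩
      e * k * L * v + (k * k * (e * σ) + 2 * (k * k * L))         ≤⟨ +-monoʳ-≤ (e * k * L * v) (+-monoˡ-≤ (2 * (k * k * L)) (*-monoʳ-≤ (k * k) eσ≤L)) ⟩
      e * k * L * v + (k * k * L + 2 * (k * k * L))               ≡⟨ q₂ (e * k * L * v) k L ⟩
      e * k * L * v + L * (3 * (k * k))                           ≤⟨ +-monoʳ-≤ (e * k * L * v) (*-monoʳ-≤ L hg) ⟩
      e * k * L * v + L * (f * k * v + c * g)                     ≡⟨ q₃ e f k L v c g ⟩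
      c * L * g + (e + f) * (k * v * L)                           ≡⟨ cong (λ x → c * L * g + x * (k * v * L)) (sym 2c≡e+f) ⟩
      c * L * g + 2 * c * (k * v * L)                             ≤⟨ +-cancelʳ-≤ (2 * c * k * t * L) _ _ (≤-trans (≤-reflexive (q₄ c L g t v)) (≤-trans h (≤-reflexive (q₅ (e * k * suc q) (2 * c * k * t * L) _)))) ⟩
      e * k * suc q + (k * k * L + 2 * c * k * L)                 ≡⟨ q₆ (e * k) q (k * k * L) (2 * c * k * L) ⟩
      e * k * q + (k * k * L + (e * k + 2 * c * k * L))           ≤⟨ +-monoʳ-≤ (e * k * q) (+-monoʳ-≤ (k * k * L) lower) ⟩
      e * k * q + (k * k * L + k * k * L)                         ≡⟨ cong (λ x → e * k * q + (k * k * L + x)) (sym (+-identityʳ (k * k * L))) ⟩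
      e * k * q + 2 * (k * k * L) ∎))
      where
      q₁ : ∀ e k L v σ → e * k * (L * v + k * σ) + 2 * (k * k * L) ≡ e * k * L * v + (k * k * (e * σ) + 2 * (k * k * L))
      q₁ = solve-∀
      q₂ : ∀ x k L → x + (k * k * L + 2 * (k * k * L)) ≡ x + L * (3 * (k * k))
      q₂ = solve-∀
      q₃ : ∀ e f k L v c g → e * k * L * v + L * (f * k * v + c * g) ≡ c * L * g + (e + f) * (k * v * L)
      q₃ = solve-∀
      q₄ : ∀ c L g t v → c * L * g + 2 * c * ((t + v) * v * L) + 2 * c * (t + v) * t * L ≡ c * L * g + 2 * c * ((t + v) * (t + v)) * L
      q₄ = solve-∀
      q₅ : ∀ x y z → x + (y + z) ≡ x + z + y
      q₅ = solve-∀
      q₆ : ∀ a q x y → a * suc q + (x + y) ≡ a * q + (x + (a + y))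
      q₆ = solve-∀

    -- The case |A₀| + |A₁| = k - w. The number of sets has the factor D^(-w) ≤ 2^(-y w), which
    -- makes up for nearly all of the missing halvings because ψ = L - y is small; the excess c g
    -- pays for the rest.
    rate-above : ∀ ψ y w → L ≡ ψ + y → e * ψ * w ≤ k * L → f * w ≤ 4 * k → 14 * (k * k) ≤ c * g →
      c * L * g + 2 * c * (k * k) * L ≤ e * k * suc q + (2 * c * k * (k + w) * L + (k * k * L + 2 * c * k * L)) → k * σ ≤ q + y * w
    rate-above ψ y w L≡ hψ hf hg h = *-cancelˡ-≤ (e * k) (+-cancelʳ-≤ (7 * (k * k * L)) _ _ (begin
      e * k * (k * σ) + 7 * (k * k * L)                           ≡⟨ q₁ e k σ (7 * (k * k * L)) ⟩
      k * k * (e * σ) + 7 * (k * k * L)                           ≤⟨ +-monoˡ-≤ (7 * (k * k * L)) (*-monoʳ-≤ (k * k) eσ≤L) ⟩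
      k * k * L + 7 * (k * k * L)                                 ≤⟨ *-monoˡ-≤ (k * k * L) (≤ᵇ⇒≤ 8 14 tt) ⟩
      14 * (k * k * L)                                            ≡⟨ trans (sym (*-assoc 14 (k * k) L)) (*-comm _ L) ⟩
      L * (14 * (k * k))                                          ≤⟨ *-monoʳ-≤ L hg ⟩
      L * (c * g)                                                 ≡⟨ q₂ L c g ⟩
      c * L * g                                                   ≤⟨ +-cancelʳ-≤ (2 * c * (k * k) * L) _ _ (≤-trans h (≤-reflexive (q₃ (e * k * suc q) c k w L _))) ⟩
      e * k * suc q + (2 * c * (k * w * L) + (k * k * L + 2 * c * k * L)) ≡⟨ cong (λ x → e * k * suc q + (x * (k * w * L) + (k * k * L + 2 * c * k * L))) 2c≡e+f ⟩
      e * k * suc q + ((e + f) * (k * w * L) + (k * k * L + 2 * c * k * L)) ≡⟨ q₄ e f k q w L (2 * c * k * L) ⟩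
      e * k * (w * L) + (e * k * q + (k * (f * w) * L + (k * k * L + (e * k + 2 * c * k * L))))
        ≡⟨ cong (λ x → e * k * (w * x) + (e * k * q + (k * (f * w) * L + (k * k * L + (e * k + 2 * c * k * L))))) L≡ ⟩
      e * k * (w * (ψ + y)) + (e * k * q + (k * (f * w) * L + (k * k * L + (e * k + 2 * c * k * L))))
        ≡⟨ q₅ e k w ψ y q _ ⟩
      e * k * (q + y * w) + (k * (e * ψ * w) + (k * (f * w) * L + (k * k * L + (e * k + 2 * c * k * L))))
        ≤⟨ +-monoʳ-≤ (e * k * (q + y * w)) (+-mono-≤ (*-monoʳ-≤ k hψ) (+-mono-≤ (*-monoˡ-≤ L (*-monoʳ-≤ k hf)) (+-monoʳ-≤ (k * k * L) lower))) ⟩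
      e * k * (q + y * w) + (k * (k * L) + (k * (4 * k) * L + (k * k * L + k * k * L)))
        ≡⟨ q₆ (e * k * (q + y * w)) k L ⟩
      e * k * (q + y * w) + 7 * (k * k * L) ∎))
      where
      q₁ : ∀ e k s x → e * k * (k * s) + x ≡ k * k * (e * s) + x
      q₁ = solve-∀
      q₂ : ∀ L c g → L * (c * g) ≡ c * L * g
      q₂ = solve-∀
      q₃ : ∀ x c k w L z → x + (2 * c * k * (k + w) * L + z) ≡ x + (2 * c * (k * w * L) + z) + 2 * c * (k * k) * L
      q₃ = solve-∀
      q₄ : ∀ e f k q w L z → e * k * suc q + ((e + f) * (k * w * L) + (k * k * L + z)) ≡ e * k * (w * L) + (e * k * q + (k * (f * w) * L + (k * k * L + (e * k + z))))
      q₄ = solve-∀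
      q₅ : ∀ e k w p y q z → e * k * (w * (p + y)) + (e * k * q + z) ≡ e * k * (q + y * w) + (k * (e * p * w) + z)
      q₅ = solve-∀
      q₆ : ∀ x k L → x + (k * (k * L) + (k * (4 * k) * L + (k * k * L + k * k * L))) ≡ x + 7 * (k * k * L)
      q₆ = solve-∀

    -- Three ranges of u₀ + u₁. Below 49k/50 one has v ≥ k/50 and f k v ≥ 4k². Above 51k/50 the
    -- factor 2^(-y w) is enough, even with q = 0. In between the excess c g ≥ 14k² is available.
    rate-with : ∀ ψ y d a₀ a₁ u₀ u₁ G → f ≡ 4 * 50 → e ≡ 56 * 50 → 56 * ψ ≤ L → L ≡ ψ + y → 50 * σ ≤ y → 75 * L * d ≤ k → a₀ + u₀ ≡ k → a₁ + u₁ ≡ k →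
      c * (a₀ * a₀ + a₁ * a₁) ≤ c * G + (k * k + 2 * c * k) + e * 75 * (d * suc q) →
      G + g ≡ u₀ * u₀ + u₁ * u₁ → (49 * k ≤ 50 * (u₀ + u₁) → 14 * (k * k) ≤ c * g) →
      (∃ λ v → u₀ + u₁ + v ≡ k × L * v + k * σ ≤ q) ⊎ (∃ λ w → k + w ≡ u₀ + u₁ × k * σ ≤ q + y * w)
    rate-with ψ y d a₀ a₁ u₀ u₁ G f≡ e≡ hψ L≡ h50 Ld p₀ p₁ h G+g ex = cases
      where
      t = u₀ + u₁
      reg : ∀ c x y z → c * x + (c * y + z) ≡ c * (x + y) + z
      reg = solve-∀
      star : c * L * g + 2 * c * (k * k) * L ≤ e * k * suc q + (2 * c * k * t * L + (k * k * L + 2 * c * k * L))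
      star = +-cancelˡ-≤ (c * L * G) _ _ (≤-trans (≤-reflexive (trans (reg (c * L) G g (2 * c * (k * k) * L)) (cong (λ z → c * L * z + 2 * c * (k * k) * L) G+g)))
        (excess-budget c e k L d q a₀ a₁ u₀ u₁ G p₀ p₁ Ld h))
      low : ∀ v → t + v ≡ k → 3 * (k * k) ≤ f * k * v + c * g
      low v eq with 49 * k ≤? 50 * t
      ... | yes le = ≤-trans (*-monoˡ-≤ (k * k) (≤ᵇ⇒≤ 3 14 tt)) (≤-trans (ex le) (m≤n+m _ _))
      ... | no ¬le = ≤-trans (≤-trans (*-monoˡ-≤ (k * k) (n≤1+n 3)) (≤-trans (≤-reflexive (q₁ k)) (≤-trans (*-monoʳ-≤ (4 * k) k≤50v)
                       (≤-reflexive (trans (q₂ 4 50 k v) (cong (λ z → z * k * v) (sym f≡))))))) (m≤m+n _ _)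
        where
        k≤50v : k ≤ 50 * v
        k≤50v = +-cancelˡ-≤ (49 * k) _ _ (begin
          49 * k + k          ≡⟨ trans (+-comm (49 * k) k) (cong (50 *_) (sym eq)) ⟩
          50 * (t + v)        ≡⟨ *-distribˡ-+ 50 t v ⟩
          50 * t + 50 * v     ≤⟨ +-monoˡ-≤ (50 * v) (<⇒≤ (≰⇒> ¬le)) ⟩
          49 * k + 50 * v ∎)
        q₁ : ∀ k → 4 * (k * k) ≡ 4 * k * k
        q₁ = solve-∀
        q₂ : ∀ a b k v → a * k * (b * v) ≡ a * b * k * v
        q₂ = solve-∀
      above : ∀ w → k + w ≡ t → k * σ ≤ q + y * w
      above w eq with 50 * w ≤? k
      ... | no ¬le = *-cancelˡ-≤ 50 (begin
          50 * (k * σ)     ≡⟨ q₁ 50 k σ ⟩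
          k * (50 * σ)     ≤⟨ *-mono-≤ (<⇒≤ (≰⇒> ¬le)) h50 ⟩
          50 * w * y       ≡⟨ q₂ 50 w y ⟩
          50 * (y * w)     ≤⟨ *-monoʳ-≤ 50 (m≤n+m (y * w) q) ⟩
          50 * (q + y * w) ∎)
          where
          q₁ : ∀ a k s → a * (k * s) ≡ k * (a * s)
          q₁ = solve-∀
          q₂ : ∀ a w y → a * w * y ≡ a * (y * w)
          q₂ = solve-∀
      ... | yes le = rate-above ψ y w L≡ eψ (≤-trans (≤-reflexive (trans (cong (_* w) f≡) (*-assoc 4 50 w))) (*-monoʳ-≤ 4 le))
          (ex (begin
            49 * k         ≤⟨ *-monoˡ-≤ k (n≤1+n 49) ⟩
            50 * k         ≤⟨ *-monoʳ-≤ 50 (m≤m+n k w) ⟩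
            50 * (k + w)   ≡⟨ cong (50 *_) eq ⟩
            50 * t ∎))
          (subst (λ z → c * L * g + 2 * c * (k * k) * L ≤ e * k * suc q + (2 * c * k * z * L + (k * k * L + 2 * c * k * L))) (sym eq) star)
          where
          q₀ : ∀ a b p w → a * b * p * w ≡ b * w * (a * p)
          q₀ = solve-∀
          eψ : e * ψ * w ≤ k * L
          eψ = ≤-trans (≤-reflexive (trans (cong (λ z → z * ψ * w) e≡) (q₀ 56 50 ψ w))) (*-mono-≤ le hψ)
      cases : (∃ λ v → t + v ≡ k × L * v + k * σ ≤ q) ⊎ (∃ λ w → k + w ≡ t × k * σ ≤ q + y * w)
      cases with t ≤? k
      ... | yes le = inj₁ (k ∸ t , m+[n∸m]≡n le , rate-below t (k ∸ t) (m+[n∸m]≡n le) (low (k ∸ t) (m+[n∸m]≡n le)) star)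
      ... | no ¬le = inj₂ (t ∸ k , m+[n∸m]≡n (<⇒≤ (≰⇒> ¬le)) , above (t ∸ k) (m+[n∸m]≡n (<⇒≤ (≰⇒> ¬le))))

  -- From T ≤ 0.47 k and u ≥ 0.49 k follows u (u - T) ≥ 0.02 · 0.49 k², and 1500 · 0.0098 = 14.7.
  -- This is where T has to stay away from k/2.
  large-excess : ∀ u T k → 100 * T ≤ 47 * k → 49 * k ≤ 100 * u → 1500 * ((u ⊓ T) * u) + 14 * (k * k) ≤ 1500 * (u * u)
  large-excess u T k hT hu = *-cancelˡ-≤ 20 (begin
    20 * (1500 * ((u ⊓ T) * u) + 14 * (k * k))     ≤⟨ *-monoʳ-≤ 20 (+-monoˡ-≤ (14 * (k * k)) (*-monoʳ-≤ 1500 (*-monoˡ-≤ u (m⊓n≤n u T)))) ⟩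
    20 * (1500 * (T * u) + 14 * (k * k))           ≡⟨ q₁ 20 1500 14 (T * u) (k * k) ⟩
    20 * 1500 * (T * u) + 20 * 14 * (k * k)        ≤⟨ +-monoʳ-≤ (20 * 1500 * (T * u)) (*-monoˡ-≤ (k * k) (≤ᵇ⇒≤ (20 * 14) (3 * (2 * 49)) tt)) ⟩
    3 * (100 * 100) * (T * u) + 3 * (2 * 49) * (k * k) ≡⟨ q₂ 3 100 2 49 T u k ⟩
    3 * (100 * T * (100 * u) + 2 * k * (49 * k))   ≤⟨ *-monoʳ-≤ 3 (+-monoʳ-≤ (100 * T * (100 * u)) (*-monoʳ-≤ (2 * k) hu)) ⟩
    3 * (100 * T * (100 * u) + 2 * k * (100 * u))  ≡⟨ cong (3 *_) (*-distribʳ-+ (100 * u) (100 * T) (2 * k)) ⟨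
    3 * ((100 * T + 2 * k) * (100 * u))            ≤⟨ *-monoʳ-≤ 3 (*-monoˡ-≤ (100 * u) (≤-trans (+-monoˡ-≤ (2 * k) hT) (≤-trans (≤-reflexive (sym (*-distribʳ-+ k 47 2))) hu))) ⟩
    3 * (100 * u * (100 * u))                      ≡⟨ q₃ 3 100 u ⟩
    3 * (100 * 100) * (u * u)                      ≡⟨ *-assoc 20 1500 (u * u) ⟩
    20 * (1500 * (u * u)) ∎)
    where
    q₁ : ∀ a b c x y → a * (b * x + c * y) ≡ a * b * x + a * c * y
    q₁ = solve-∀
    q₂ : ∀ a b c e T u k → a * (b * b) * (T * u) + a * (c * e) * (k * k) ≡ a * (b * T * (b * u) + c * k * (e * k))
    q₂ = solve-∀
    q₃ : ∀ a b u → a * (b * u * (b * u)) ≡ a * (b * b) * (u * u)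
    q₃ = solve-∀

  ⊓*≤sq : ∀ u T → (u ⊓ T) * u ≤ u * u
  ⊓*≤sq u T = *-monoˡ-≤ u (m⊓n≤m u T)

  -- The larger of the two collapses is at least 0.49 k, and the other one loses at most its own
  -- square.
  excess : ∀ u₀ u₁ T k → 100 * T ≤ 47 * k → 49 * k ≤ 50 * (u₀ + u₁) →
    14 * (k * k) ≤ 1500 * ((u₀ * u₀ + u₁ * u₁) ∸ ((u₀ ⊓ T) * u₀ + (u₁ ⊓ T) * u₁))
  excess u₀ u₁ T k hT h = ≤-trans (≤-trans (m+n≤o⇒n≤o∸m (1500 * G) _ tot) ≤-refl) (≤-reflexive (sym (*-distribˡ-∸ 1500 U G)))
    where
    G = (u₀ ⊓ T) * u₀ + (u₁ ⊓ T) * u₁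
    U = u₀ * u₀ + u₁ * u₁
    m+n≤o⇒n≤o∸m : ∀ m {n} o → m + n ≤ o → n ≤ o ∸ m
    m+n≤o⇒n≤o∸m m {n} o le = ≤-trans (≤-reflexive (sym (m+n∸m≡n m n))) (∸-monoˡ-≤ m le)
    q₁ : ∀ c x y z → c * (x + y) + z ≡ c * x + z + c * y
    q₁ = solve-∀
    q₂ : ∀ c x y z → c * (x + y) + z ≡ c * x + (c * y + z)
    q₂ = solve-∀
    half : ∀ x y → 50 * (x + y) ≤ 100 * (x ⊔ y)
    half x y = ≤-trans (*-monoʳ-≤ 50 (+-mono-≤ (m≤m⊔n x y) (m≤n⊔m x y))) (≤-reflexive (q (x ⊔ y)))
      where q : ∀ z → 50 * (z + z) ≡ 100 * z
            q = solve-∀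
    tot : 1500 * G + 14 * (k * k) ≤ 1500 * U
    tot with ≤-total u₀ u₁
    ... | inj₁ le = ≤-trans (≤-reflexive (q₂ 1500 ((u₀ ⊓ T) * u₀) ((u₁ ⊓ T) * u₁) (14 * (k * k))))
          (≤-trans (+-mono-≤ (*-monoʳ-≤ 1500 (⊓*≤sq u₀ T)) (large-excess u₁ T k hT (≤-trans h (≤-trans (half u₀ u₁) (*-monoʳ-≤ 100 (≤-reflexive (m≤n⇒m⊔n≡n le)))))))
            (≤-reflexive (sym (*-distribˡ-+ 1500 (u₀ * u₀) (u₁ * u₁)))))
    ... | inj₂ le = ≤-trans (≤-reflexive (q₁ 1500 ((u₀ ⊓ T) * u₀) ((u₁ ⊓ T) * u₁) (14 * (k * k))))
          (≤-trans (+-mono-≤ (large-excess u₀ T k hT (≤-trans h (≤-trans (half u₀ u₁) (*-monoʳ-≤ 100 (≤-reflexive (m≥n⇒m⊔n≡m le)))))) (*-monoʳ-≤ 1500 (⊓*≤sq u₁ T)))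
            (≤-reflexive (sym (*-distribˡ-+ 1500 (u₀ * u₀) (u₁ * u₁)))))

  rate : ∀ k L d q σ ψ y T a₀ a₁ u₀ u₁ .{{_ : NonZero k}} → 2800 * σ ≤ L → 56 * ψ ≤ L → L ≡ ψ + y → 50 * σ ≤ y →
    2800 * k + 2 * 1500 * k * L ≤ k * k * L → 75 * L * d ≤ k → 100 * T ≤ 47 * k → a₀ + u₀ ≡ k → a₁ + u₁ ≡ k →
    1500 * (a₀ * a₀ + a₁ * a₁) ≤ 1500 * ((u₀ ⊓ T) * u₀ + (u₁ ⊓ T) * u₁) + (k * k + 2 * 1500 * k) + 2800 * 75 * (d * suc q) →
    (∃ λ v → u₀ + u₁ + v ≡ k × L * v + k * σ ≤ q) ⊎ (∃ λ w → k + w ≡ u₀ + u₁ × k * σ ≤ q + y * w)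
  rate k L d q σ ψ y T a₀ a₁ u₀ u₁ hσ hψ L≡ h50 lower Ld hT p₀ p₁ h =
    rate-with 1500 2800 200 refl k L q σ ((u₀ * u₀ + u₁ * u₁) ∸ ((u₀ ⊓ T) * u₀ + (u₁ ⊓ T) * u₁)) hσ lower ψ y d a₀ a₁ u₀ u₁ ((u₀ ⊓ T) * u₀ + (u₁ ⊓ T) * u₁)
      refl refl hψ L≡ h50 Ld p₀ p₁ h (m+[n∸m]≡n (+-mono-≤ (⊓*≤sq u₀ T) (⊓*≤sq u₁ T))) (excess u₀ u₁ T k hT)

-- Halvings of the probability, and rounding

module Rates where

  open import Data.Nat
  open import Data.Nat.Properties
  open import Data.Nat.DivMod
  open import Data.Nat.Tactic.RingSolver using (solve-∀)
  open import Data.Sum using (_⊎_; inj₁; inj₂)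
  open import Data.Unit using (tt)
  open import Relation.Nullary using (yes; no)
  open import Relation.Binary.PropositionalEquality hiding (J)
  open Arithmetic
  open Budget
  open Sums using (^-distribʳ-*)

  open ≤-Reasoning

  bernoulli : ∀ x n → x ^ n * (x + n) ≤ suc x ^ n * x
  bernoulli x zero    = ≤-reflexive (cong (1 *_) (+-identityʳ x))
  bernoulli x (suc n) = begin
    x * x ^ n * (x + suc n)          ≤⟨ m≤m+n _ (x ^ n * n) ⟩
    x * x ^ n * (x + suc n) + x ^ n * n ≡⟨ q x n (x ^ n) ⟩
    suc x * (x ^ n * (x + n))        ≤⟨ *-monoʳ-≤ (suc x) (bernoulli x n) ⟩
    suc x * (suc x ^ n * x)          ≡⟨ *-assoc (suc x) (suc x ^ n) x ⟨
    suc x * suc x ^ n * x ∎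
    where q : ∀ x n y → x * y * (x + suc n) + y * n ≡ suc x * (y * (x + n))
          q = solve-∀

  doubling : ∀ A B a b .{{_ : NonZero b}} → 2 * b ≤ a → A * a ≤ b * B → A * 2 ≤ B
  doubling A B a b h le = *-cancelˡ-≤ b (begin
    b * (A * 2)     ≡⟨ q b A ⟩
    A * (2 * b)     ≤⟨ *-monoʳ-≤ A h ⟩
    A * a           ≤⟨ le ⟩
    b * B ∎)
    where q : ∀ b A → b * (A * 2) ≡ A * (2 * b)
          q = solve-∀

  -- (1 + 1/(d-1))^{d/100} ≥ 101/100 and (101/100)^70 ≥ 2.
  half-life : ∀ x n .{{_ : NonZero x}} → x ≤ 100 * n → x ^ (n * 70) * 2 ≤ suc x ^ (n * 70)
  half-life x n h = doubling (x ^ (n * 70)) (suc x ^ (n * 70)) (101 ^ 70) (100 ^ 70) (≤ᵇ⇒≤ (2 * 100 ^ 70) (101 ^ 70) tt) (begin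
    x ^ (n * 70) * 101 ^ 70      ≡⟨ trans (cong (_* 101 ^ 70) (sym (^-*-assoc x n 70))) (sym (^-distribʳ-* (x ^ n) 101 70)) ⟩
    (x ^ n * 101) ^ 70           ≤⟨ ^-monoˡ-≤ 70 once ⟩
    (100 * suc x ^ n) ^ 70       ≡⟨ trans (^-distribʳ-* 100 (suc x ^ n) 70) (cong (100 ^ 70 *_) (^-*-assoc (suc x) n 70)) ⟩
    100 ^ 70 * suc x ^ (n * 70) ∎)
    where
    q₁ : ∀ a y x → y * suc a * x ≡ y * (a * x + x)
    q₁ = solve-∀
    q₂ : ∀ a y x n → y * (a * x + a * n) ≡ a * (y * (x + n))
    q₂ = solve-∀
    once : x ^ n * 101 ≤ 100 * suc x ^ n
    once = *-cancelʳ-≤ _ _ x (begin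
      x ^ n * 101 * x                ≡⟨ q₁ 100 (x ^ n) x ⟩
      x ^ n * (100 * x + x)          ≤⟨ *-monoʳ-≤ (x ^ n) (+-monoʳ-≤ (100 * x) h) ⟩
      x ^ n * (100 * x + 100 * n)    ≡⟨ q₂ 100 (x ^ n) x n ⟩
      100 * (x ^ n * (x + n))        ≤⟨ *-monoʳ-≤ 100 (bernoulli x n) ⟩
      100 * (suc x ^ n * x)          ≡⟨ *-assoc 100 (suc x ^ n) x ⟨
      100 * suc x ^ n * x ∎)

  open-ineq : ∀ c β W₀ W₁ G₀ G₁ S s M k .{{_ : NonZero c}} → 2 * c * W₀ ≤ β * (2 * c * G₀ + k * k) → 2 * c * W₁ ≤ β * (2 * c * G₁ + k * k) →
    s ≤ 2 * k → 2 * c * M + (c * (G₀ + G₁) + (k * k + 2 * c * k)) ≤ c * S → β * (s + 2 * M) + (W₀ + W₁) ≤ β * S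
  open-ineq c β W₀ W₁ G₀ G₁ S s M k h₀ h₁ hs h = *-cancelˡ-≤ (2 * c) {{m*n≢0 2 c}} (begin
    2 * c * (β * (s + 2 * M) + (W₀ + W₁))                       ≡⟨ q₁ c β s M W₀ W₁ ⟩
    2 * c * (β * (s + 2 * M)) + (2 * c * W₀ + 2 * c * W₁)       ≤⟨ +-mono-≤ (*-monoʳ-≤ (2 * c) (*-monoʳ-≤ β (+-monoˡ-≤ (2 * M) hs))) (+-mono-≤ h₀ h₁) ⟩
    2 * c * (β * (2 * k + 2 * M)) + (β * (2 * c * G₀ + k * k) + β * (2 * c * G₁ + k * k)) ≡⟨ q₂ c β k M G₀ G₁ ⟩
    2 * β * (2 * c * M + (c * (G₀ + G₁) + (k * k + 2 * c * k))) ≤⟨ *-monoʳ-≤ (2 * β) h ⟩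
    2 * β * (c * S)                                             ≡⟨ q₃ c β S ⟩
    2 * c * (β * S) ∎)
    where
    q₁ : ∀ c β s M v w → 2 * c * (β * (s + 2 * M) + (v + w)) ≡ 2 * c * (β * (s + 2 * M)) + (2 * c * v + 2 * c * w)
    q₁ = solve-∀
    q₂ : ∀ c β k M g h → 2 * c * (β * (2 * k + 2 * M)) + (β * (2 * c * g + k * k) + β * (2 * c * h + k * k)) ≡ 2 * β * (2 * c * M + (c * (g + h) + (k * k + 2 * c * k)))
    q₂ = solve-∀
    q₃ : ∀ c β S → 2 * β * (c * S) ≡ 2 * c * (β * S)
    q₃ = solve-∀

  -- All factors of size exp(O(k log log k)) are gathered in 2^c. What remains is the balance of
  -- D^(a₀ + a₁ - k) against 2^(-q).
  final-ineq : ∀ S R A J E F X Y c q → F * 2 ^ q ≤ Y → 16 * S * (4 * S) * (R * (J * (J * E))) ≤ 2 ^ c → 2 ^ c * A ≤ X * 2 ^ q →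
    16 * S * (4 * S * (R * A) * (J * (J * (E * F)))) ≤ X * Y
  final-ineq S R A J E F X Y c q h₁ h₂ h₃ = begin
    16 * S * (4 * S * (R * A) * (J * (J * (E * F))))       ≡⟨ q₁ S R A J E F ⟩
    16 * S * (4 * S) * (R * (J * (J * E))) * A * F         ≤⟨ *-monoˡ-≤ F (≤-trans (*-monoˡ-≤ A h₂) h₃) ⟩
    X * 2 ^ q * F                                          ≡⟨ q₂ X (2 ^ q) F ⟩
    X * (F * 2 ^ q)                                        ≤⟨ *-monoʳ-≤ X h₁ ⟩
    X * Y ∎
    where
    q₁ : ∀ S R A J E F → 16 * S * (4 * S * (R * A) * (J * (J * (E * F)))) ≡ 16 * S * (4 * S) * (R * (J * (J * E))) * A * F
    q₁ = solve-∀
    q₂ : ∀ X p F → X * p * F ≡ X * (F * p)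
    q₂ = solve-∀

  comb : ∀ a b {x y} → x ≤ 2 ^ a → y ≤ 2 ^ b → x * y ≤ 2 ^ (a + b)
  comb a b p q = ≤-trans (*-mono-≤ p q) (≤-reflexive (sym (^-distribˡ-+-* 2 a b)))

  raise-exponent : ∀ a b {x} → x ≤ 2 ^ a → a ≤ b → x ≤ 2 ^ b
  raise-exponent a b h le = ≤-trans h (^-monoʳ-≤ 2 le)

  bundle : ∀ s R J E a b e c → s ≤ 2 ^ a → R ≤ 2 ^ e → J ≤ 2 ^ b → E ≤ 2 ^ c →
    16 * (s * s) * (4 * (s * s)) * (R * (J * (J * E))) ≤ 2 ^ ((4 + (a + a)) + (2 + (a + a)) + (e + (b + (b + c))))
  bundle s R J E a b e c hs hR hJ hE =
    comb ((4 + (a + a)) + (2 + (a + a))) (e + (b + (b + c)))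
      (comb (4 + (a + a)) (2 + (a + a)) (comb 4 (a + a) {16} (≤ᵇ⇒≤ 16 (2 ^ 4) tt) (comb a a hs hs)) (comb 2 (a + a) {4} (≤ᵇ⇒≤ 4 (2 ^ 2) tt) (comb a a hs hs)))
      (comb e (b + (b + c)) hR (comb b (b + c) hJ (comb b c hJ hE)))

  -- If the subtraction truncates, the quotient is 0; this is the alternative that `open-h` leaves.
  round-down : ∀ A B N .{{_ : NonZero N}} → (A ∸ B) / N ≡ 0 ⊎ N * ((A ∸ B) / N) + B ≤ A
  round-down A B N with B ≤? A
  ... | yes le = inj₂ (≤-trans (+-monoˡ-≤ B ([m/n]*n≤m′ (A ∸ B) N)) (≤-reflexive (m∸n+n≡m le)))
  ... | no ¬le = inj₁ (trans (cong (_/ N) (m≤n⇒m∸n≡0 (<⇒≤ (≰⇒> ¬le)))) (0/n≡0 N))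

  round-up : ∀ A B N .{{_ : NonZero N}} → A ≤ B + N * suc ((A ∸ B) / N)
  round-up A B N = ≤-trans (m≤n+m∸n A B) (+-monoʳ-≤ B (<⇒≤ (m<n*[1+m/n] (A ∸ B) N)))

-- The choice of parameters and the asymptotic statement

module Assembly where

  open import Data.Nat.Properties
  open import Data.Nat.DivMod
  open import Relation.Binary.PropositionalEquality hiding (J)
  open import Data.Nat
  open import Data.Rational as ℚ using (ℚ; 0ℚ)
  import Data.Rational.Properties as ℚP
  open import Data.Nat.Tactic.RingSolver using (solve-∀)
  open import Data.List using (List; []; _∷_; length)
  open import Data.Nat.ListAction using (product)
  open import Data.List.Relation.Unary.All using (All; []; _∷_)
  open import Data.Product using (Σ; ∃; _×_; _,_; proj₁; proj₂)
  open import Data.Sum using (_⊎_; inj₁; inj₂; [_,_]′)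
  open import Data.Unit using (tt)
  open import Relation.Nullary using (¬_)
  open import Defs using (Graph; TriangleFree; IndependentSetOfSize; LowerBoundOverLog)
  open import Data.Fin using (Fin; zero; suc; fromℕ<)
  import Data.Integer as ℤ
  open Arithmetic
  open Rates
  open Budget
  open Expectation
  open Events
  open RandomHost
  open Sums
  open Colours using (module Construction)
  open Blowup using (module Placement)
  open GoodSample using (module Existence; hasProfile)
  open Resulting using (module TheGraph)
  open Exponential using (expLe)

  open ≤-Reasoning

  -- Free of ε and of exponentials: with L at most log₂ k, 20 k² ≤ 39 n L expresses n ≥ (20/39) k² /
  -- L, a constant above 1/3 in terms of the natural logarithm.
  Witness : ℕ → Set
  Witness k = Σ ℕ λ n → Σ (Graph n) λ G → TriangleFree G × ¬ IndependentSetOfSize G k × NonZero n × ∃ λ L → 2 ^ L ≤ k × 20 * (k * k) ≤ 39 * (n * L)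

  Placed : (k r D load m : ℕ) → Set
  Placed k r D load m = Σ (Fin 2 → Fin (r * m) → Fin m) λ b →
    (∀ c x → ∑[ v ∈ fins (r * m) ] (𝟙 (b c v == x)) ≤ load) ×
    (∀ a₀ a₁ → a₀ ≤ k → a₁ ≤ k →
       ∑[ I ∈ subs k (fins (r * m)) ] (𝟙 (hasProfile b k a₀ a₁ I)) * D ^ k
       ≤ 4 * (suc k * suc k) * ((512 * r) ^ k * D ^ (a₀ + a₁)))

  -- L = ⌊log₂ k⌋, and ℓ is a power of two just above L.  Polylogarithmic quantities are bounded by
  -- powers of ℓ, and any product of eight quantities below ℓ^12 is at most k.
  module Params (k L ℓ λ′ : ℕ) (2^L≤k : 2 ^ L ≤ k) (k<2^1+L : k < 2 ^ suc L) (L<ℓ : L < ℓ) (ℓ≤2L : ℓ ≤ 2 * L)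
                (ℓ≡ : ℓ ≡ 2 ^ λ′) (λ-small : 1000000 * λ′ ≤ L) (40≤λ : 40 ≤ λ′) where

    abstract
      C≤ℓ : 1000000000000 ≤ ℓ
      C≤ℓ = ≤-trans (≤ᵇ⇒≤ 1000000000000 (2 ^ 40) tt) (≤-trans (^-monoʳ-≤ 2 40≤λ) (≤-reflexive (sym ℓ≡)))

      const≤ℓ : ∀ c → c ≤ 1000000000000 → c ≤ ℓ
      const≤ℓ c le = ≤-trans le C≤ℓ

      1≤ℓ : 1 ≤ ℓ
      1≤ℓ = const≤ℓ 1 (≤ᵇ⇒≤ 1 1000000000000 tt)

      ℓ^100≤k : ℓ ^ 100 ≤ k
      ℓ^100≤k = begin
        ℓ ^ 100             ≡⟨ cong (_^ 100) ℓ≡ ⟩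
        (2 ^ λ′) ^ 100      ≡⟨ ^-*-assoc 2 λ′ 100 ⟩
        2 ^ (λ′ * 100)      ≤⟨ ^-monoʳ-≤ 2 (≤-trans (≤-reflexive (*-comm λ′ 100)) (≤-trans (*-monoˡ-≤ λ′ (≤ᵇ⇒≤ 100 1000000 tt)) λ-small)) ⟩
        2 ^ L               ≤⟨ 2^L≤k ⟩
        k ∎

    ℓ≢0 : NonZero ℓ
    ℓ≢0 = >-nonZero 1≤ℓ

    B : ℕ
    B = ℓ ^ 12

    abstract
      pow≤B : ∀ e → e ≤ 12 → ℓ ^ e ≤ B
      pow≤B e le = ^-monoʳ-≤ ℓ {{ℓ≢0}} le

      ℓ≤B : ℓ ≤ B
      ℓ≤B = ≤-trans (≤-reflexive (sym (*-identityʳ ℓ))) (pow≤B 1 (s≤s z≤n))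

      const≤B : ∀ c → c ≤ 1000000000000 → c ≤ B
      const≤B c le = ≤-trans (const≤ℓ c le) ℓ≤B

      B^8≤k : B ^ 8 ≤ k
      B^8≤k = begin
        B ^ 8         ≡⟨ ^-*-assoc ℓ 12 8 ⟩
        ℓ ^ 96        ≤⟨ ^-monoʳ-≤ ℓ {{ℓ≢0}} (≤ᵇ⇒≤ 96 100 tt) ⟩
        ℓ ^ 100       ≤⟨ ℓ^100≤k ⟩
        k ∎

      small : (xs : List ℕ) → All (_≤ B) xs → length xs ≤ 8 → product xs ≤ k
      small xs ps le = begin
        product xs         ≤⟨ product≤ B xs ps ⟩
        B ^ length xs      ≤⟨ ^-monoʳ-≤ B {{m^n≢0 ℓ 12 {{ℓ≢0}}}} le ⟩
        B ^ 8              ≤⟨ B^8≤k ⟩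
        k ∎

      1≤L : 1 ≤ L
      1≤L = ≤-trans (≤-trans (≤-trans (s≤s z≤n) 40≤λ) (m≤n*m λ′ 1000000)) λ-small

      L≤B : L ≤ B
      L≤B = ≤-trans (<⇒≤ L<ℓ) ℓ≤B

      1≤k : 1 ≤ k
      1≤k = ≤-trans (m^n>0 2 L) 2^L≤k

    instance
      L≢0 : NonZero L
      L≢0 = >-nonZero 1≤L
      k≢0 : NonZero k
      k≢0 = >-nonZero 1≤k

    abstract
      -- r and ρ are the mean and the maximal size of a fibre. D = 10 D′ is about 20 k / (39 r L),
      -- rounded up to make n = r k D large enough; d = 100 d′ is about 4 k / (3 L), rounded down.
      -- The factor 10 serves `chernoff`, the factor 100 also `half-life` and the splitting d = 4
      -- `Dq`.
      s r ρ P t₁ d′ D′ : ℕ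
      s = ℓ ^ 6
      r = 170 * s
      ρ = 187 * s
      P = ℓ ^ 10

      s≡ : s ≡ ℓ ^ 6
      s≡ = refl
      r≡ : r ≡ 170 * s
      r≡ = refl
      ρ≡ : ρ ≡ 187 * s
      ρ≡ = refl
      P≡ : P ≡ ℓ ^ 10
      P≡ = refl

      instance
        s≢0 : NonZero s
        s≢0 = m^n≢0 ℓ 6 {{ℓ≢0}}
        P≢0 : NonZero P
        P≢0 = m^n≢0 ℓ 10 {{ℓ≢0}}
        r≢0 : NonZero r
        r≢0 = m*n≢0 170 s
        75L≢0 : NonZero (75 * L)
        75L≢0 = m*n≢0 75 L
        39rL≢0 : NonZero (39 * (r * L))
        39rL≢0 = m*n≢0 39 (r * L) {{_}} {{m*n≢0 r L}}

      t₁ = k / P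
      d′ = k / (75 * L)
      D′ = suc (2 * k / (39 * (r * L)))

      Pt₁≤k : P * t₁ ≤ k
      Pt₁≤k = [m/n]*n≤m′ k P
      k<P[1+t₁] : k < P * suc t₁
      k<P[1+t₁] = m<n*[1+m/n] k P
      75Ld′≤k : 75 * L * d′ ≤ k
      75Ld′≤k = [m/n]*n≤m′ k (75 * L)
      k<75L[1+d′] : k < 75 * L * suc d′
      k<75L[1+d′] = m<n*[1+m/n] k (75 * L)
      small-d′ : ∀ c → c * (75 * L) ≤ k → c ≤ d′
      small-d′ c le = ≤-div le
      2k≤39rLD′ : 2 * k ≤ 39 * (r * L) * D′
      2k≤39rLD′ = <⇒≤ (m<n*[1+m/n] (2 * k) (39 * (r * L)))
      39rLD′≤ : 39 * (r * L) * D′ ≤ 39 * (r * L) + 2 * k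
      39rLD′≤ = ≤-trans (≤-reflexive (*-suc (39 * (r * L)) _)) (+-monoʳ-≤ (39 * (r * L)) ([m/n]*n≤m′ (2 * k) (39 * (r * L))))
      instance
        D′≢0 : NonZero D′
        D′≢0 = _

      s≤B : s ≤ B
      s≤B = pow≤B 6 (≤ᵇ⇒≤ 6 12 tt)

      P≤B : P ≤ B
      P≤B = pow≤B 10 (≤ᵇ⇒≤ 10 12 tt)

    abstract
      -- Since P t₁ is about k, 2P points of weight t₁ would weigh about 2k, which is too much. t₀ =
      -- 25 L just exceeds L₁/k = 24 L. The codegree L + 2 makes 16^(cd + 1) beat m², which is at
      -- most 2^(4L + 2).
      jj t₀ d D m D₁ cd : ℕ
      jj = 2 * P
      t₀ = 25 * L
      d  = 100 * d′
      D  = 10 * D′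
      m  = k * D
      D₁ = k * D′
      cd = L + 2
      jj≡ : jj ≡ 2 * P
      jj≡ = refl
      t₀≡ : t₀ ≡ 25 * L
      t₀≡ = refl
      d≡ : d ≡ 100 * d′
      d≡ = refl
      D≡ : D ≡ 10 * D′
      D≡ = refl
      m≡ : m ≡ k * D
      m≡ = refl
      D₁≡ : D₁ ≡ k * D′
      D₁≡ = refl
      cd≡ : cd ≡ L + 2
      cd≡ = refl

    small₂ : ∀ a b → a ≤ B → b ≤ B → a * b ≤ k
    small₂ a b p q = ≤-trans (≤-reflexive (cong (a *_) (sym (*-identityʳ b)))) (small (a ∷ b ∷ []) (p ∷ q ∷ []) (≤ᵇ⇒≤ 2 8 tt))

    small₃ : ∀ a b c → a ≤ B → b ≤ B → c ≤ B → a * b * c ≤ k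
    small₃ a b c p q r = ≤-trans (≤-reflexive (e a b c)) (small (a ∷ b ∷ c ∷ []) (p ∷ q ∷ r ∷ []) (≤ᵇ⇒≤ 3 8 tt))
      where e : ∀ a b c → a * b * c ≡ a * (b * (c * 1))
            e = solve-∀

    abstract
      k≤76Ld′ : k ≤ 76 * L * d′
      k≤76Ld′ = +-cancelʳ-≤ (75 * L) _ _ (begin
        k + 75 * L                      ≤⟨ +-monoˡ-≤ (75 * L) (<⇒≤ k<75L[1+d′]) ⟩
        75 * L * suc d′ + 75 * L        ≡⟨ q₁ L d′ ⟩
        75 * L * d′ + 150 * L           ≤⟨ +-monoʳ-≤ (75 * L * d′) lem ⟩
        75 * L * d′ + (L * d′ + 75 * L) ≡⟨ q₂ L d′ ⟩
        76 * L * d′ + 75 * L ∎)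
        where
        q₁ : ∀ L d → 75 * L * suc d + 75 * L ≡ 75 * L * d + 150 * L
        q₁ = solve-∀
        q₂ : ∀ L d → 75 * L * d + (L * d + 75 * L) ≡ 76 * L * d + 75 * L
        q₂ = solve-∀
        q₃ : ∀ L → 150 * L ≡ L * 75 + 75 * L
        q₃ = solve-∀
        d′≥75 : 75 ≤ d′
        d′≥75 = small-d′ 75 (≤-trans (≤-reflexive (sym (*-assoc 75 75 L))) (small₂ 5625 L (const≤B 5625 (≤ᵇ⇒≤ 5625 1000000000000 tt)) L≤B))
        lem : 150 * L ≤ L * d′ + 75 * L
        lem = ≤-trans (≤-reflexive (q₃ L)) (+-monoˡ-≤ (75 * L) (*-monoʳ-≤ L d′≥75))

      k≤100Ld′ : k ≤ 100 * L * d′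
      k≤100Ld′ = ≤-trans k≤76Ld′ (*-monoˡ-≤ d′ (*-monoˡ-≤ L (≤ᵇ⇒≤ 76 100 tt)))

      1≤d′ : 1 ≤ d′
      1≤d′ = small-d′ 1 (≤-trans (≤-reflexive (*-identityˡ (75 * L))) (small₂ 75 L (const≤B 75 (≤ᵇ⇒≤ 75 1000000000000 tt)) L≤B))

      rL≡ : r * L ≡ 170 * s * L
      rL≡ = cong (_* L) r≡

      19500rL : 19500 * (r * L) ≤ k
      19500rL = ≤-trans (≤-reflexive (trans (cong (19500 *_) rL≡) (q 19500 170 s L))) (small₃ 3315000 s L (const≤B 3315000 (≤ᵇ⇒≤ 3315000 1000000000000 tt)) s≤B L≤B)
        where q : ∀ a b s L → a * (b * s * L) ≡ a * b * s * L
              q = solve-∀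

      20k≤39rLD : 20 * k ≤ 39 * (r * L) * D
      20k≤39rLD = ≤-trans (≤-reflexive (q₁ k)) (≤-trans (*-monoʳ-≤ 10 2k≤39rLD′) (≤-reflexive (trans (q₂ (r * L) D′) (cong (39 * (r * L) *_) (sym D≡)))))
        where q₁ : ∀ k → 20 * k ≡ 10 * (2 * k)
              q₁ = solve-∀
              q₂ : ∀ r D → 10 * (39 * r * D) ≡ 39 * r * (10 * D)
              q₂ = solve-∀

      39rLD≤ : 39 * (r * L) * D ≤ 20 * k + 390 * (r * L)
      39rLD≤ = begin
        39 * (r * L) * D                 ≡⟨ cong (39 * (r * L) *_) D≡ ⟩
        39 * (r * L) * (10 * D′)         ≡⟨ q₁ (r * L) D′ ⟩
        10 * (39 * (r * L) * D′)         ≤⟨ *-monoʳ-≤ 10 39rLD′≤ ⟩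
        10 * (39 * (r * L) + 2 * k)      ≡⟨ q₂ (r * L) k ⟩
        20 * k + 390 * (r * L) ∎
        where q₁ : ∀ r x → 39 * r * (10 * x) ≡ 10 * (39 * r * x)
              q₁ = solve-∀
              q₂ : ∀ r k → 10 * (39 * r + 2 * k) ≡ 20 * k + 390 * r
              q₂ = solve-∀

      rLD≤k : r * L * D ≤ k
      rLD≤k = *-cancelˡ-≤ 39 (begin
        39 * (r * L * D)        ≡⟨ *-assoc 39 (r * L) D ⟨
        39 * (r * L) * D        ≤⟨ 39rLD≤ ⟩
        20 * k + 390 * (r * L)  ≤⟨ +-monoʳ-≤ (20 * k) (≤-trans (*-monoˡ-≤ (r * L) (≤ᵇ⇒≤ 390 19500 tt)) 19500rL) ⟩
        20 * k + k              ≤⟨ ≤-trans (≤-reflexive (+-comm (20 * k) k)) (*-monoˡ-≤ k (≤ᵇ⇒≤ 21 39 tt)) ⟩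
        39 * k ∎)

      k≤2rLD : k ≤ 2 * (r * L) * D
      k≤2rLD = *-cancelˡ-≤ 20 (begin
        20 * k                 ≤⟨ 20k≤39rLD ⟩
        39 * (r * L) * D       ≤⟨ *-monoˡ-≤ D (*-monoˡ-≤ (r * L) (n≤1+n 39)) ⟩
        40 * (r * L) * D       ≡⟨ q (r * L) D ⟩
        20 * (2 * (r * L) * D) ∎)
        where q : ∀ r D → 40 * r * D ≡ 20 * (2 * r * D)
              q = solve-∀

      2≤rL : 2 ≤ r * L
      2≤rL = ≤-trans (*-mono-≤ {2} {170 * s} {1} {L} (≤-trans (≤ᵇ⇒≤ 2 (170 * 1) tt) (*-monoʳ-≤ 170 (>-nonZero⁻¹ s))) 1≤L) (≤-reflexive (sym rL≡))

      D<2^L : D < 2 ^ L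
      D<2^L = *-cancelˡ-< 2 _ _ (begin-strict
        2 * D       ≤⟨ *-monoˡ-≤ D 2≤rL ⟩
        r * L * D   ≤⟨ rLD≤k ⟩
        k           <⟨ k<2^1+L ⟩
        2 ^ suc L ∎)

      1+m≤ : suc m ≤ 2 ^ suc (L + L)
      1+m≤ = begin-strict
        m                     ≡⟨ m≡ ⟩
        k * D                 ≤⟨ *-monoˡ-≤ D (<⇒≤ k<2^1+L) ⟩
        2 ^ suc L * D         <⟨ *-monoʳ-< (2 ^ suc L) {{m^n≢0 2 (suc L)}} D<2^L ⟩
        2 ^ suc L * 2 ^ L     ≡⟨ ^-distribˡ-+-* 2 (suc L) L ⟨
        2 ^ suc (L + L) ∎

      m≤2^ : m ≤ 2 ^ suc (L + L)
      m≤2^ = ≤-trans (n≤1+n m) 1+m≤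

      6ℓ≤s : 6 * ℓ ≤ s
      6ℓ≤s = ≤-trans (*-monoˡ-≤ ℓ (const≤ℓ 6 (≤ᵇ⇒≤ 6 1000000000000 tt))) (≤-trans (≤-reflexive (cong (ℓ *_) (sym (*-identityʳ ℓ)))) (≤-trans (^-monoʳ-≤ ℓ {{ℓ≢0}} (≤ᵇ⇒≤ 2 6 tt)) (≤-reflexive (sym s≡))))

      8m≤2^s : 8 * m ≤ 2 ^ s
      8m≤2^s = begin
        8 * m                       ≤⟨ *-monoʳ-≤ 8 m≤2^ ⟩
        2 ^ 3 * 2 ^ suc (L + L)     ≡⟨ ^-distribˡ-+-* 2 3 (suc (L + L)) ⟨
        2 ^ (3 + suc (L + L))       ≤⟨ ^-monoʳ-≤ 2 (≤-trans (≤-trans (≤-reflexive (q L)) (≤-halves {4} {2 * L} {6 * ℓ} h₁ h₂)) 6ℓ≤s) ⟩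
        2 ^ s ∎
        where
        q : ∀ L → 3 + suc (L + L) ≡ 4 + 2 * L
        q = solve-∀
        h₁ : 2 * 4 ≤ 6 * ℓ
        h₁ = ≤-trans (≤ᵇ⇒≤ 8 12 tt) (*-monoʳ-≤ 6 (const≤ℓ 2 (≤ᵇ⇒≤ 2 1000000000000 tt)))
        h₂ : 2 * (2 * L) ≤ 6 * ℓ
        h₂ = ≤-trans (≤-reflexive (sym (*-assoc 2 2 L))) (*-mono-≤ (≤ᵇ⇒≤ 4 6 tt) (<⇒≤ L<ℓ))

      n-bound : 20 * (k * k) ≤ 39 * (r * m * L)
      n-bound = begin
        20 * (k * k)          ≡⟨ *-assoc 20 k k ⟨
        20 * k * k            ≤⟨ *-monoˡ-≤ k 20k≤39rLD ⟩
        39 * (r * L) * D * k  ≡⟨ q r L D k ⟩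
        39 * (r * (k * D) * L) ≡⟨ cong (λ t → 39 * (r * t * L)) (sym m≡) ⟩
        39 * (r * m * L) ∎
        where q : ∀ r L D k → 39 * (r * L) * D * k ≡ 39 * (r * (k * D) * L)
              q = solve-∀

      instance
        d′≢0 : NonZero d′
        d′≢0 = >-nonZero 1≤d′
        D≢0 : NonZero D
        D≢0 = subst NonZero (sym D≡) (m*n≢0 10 D′)
        m≢0 : NonZero m
        m≢0 = subst NonZero (sym m≡) (m*n≢0 k D)
        d≢0 : NonZero d
        d≢0 = subst NonZero (sym d≡) (m*n≢0 100 d′)
        170d≢0 : NonZero (170 * d)
        170d≢0 = m*n≢0 170 d

      -- The mean degree m/d in units of 170; 187 (s₂ + 1) then bounds all degrees.
      s₂ : ℕ
      s₂ = m / (170 * d)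

      m≤170ds′ : m ≤ 170 * d * suc s₂
      m≤170ds′ = <⇒≤ (m<n*[1+m/n] m (170 * d))

      170ds₂≤m : 170 * d * s₂ ≤ m
      170ds₂≤m = [m/n]*n≤m′ m (170 * d)

    s′ : ℕ
    s′ = suc s₂

    abstract
      d≤3rD : d ≤ 3 * (r * D)
      d≤3rD = *-cancelˡ-≤ (75 * L) (begin
        75 * L * d              ≡⟨ trans (cong (75 * L *_) d≡) (q₁ L d′) ⟩
        100 * (75 * L * d′)     ≤⟨ *-monoʳ-≤ 100 75Ld′≤k ⟩
        100 * k                 ≡⟨ q₂ k ⟩
        5 * (20 * k)            ≤⟨ *-monoʳ-≤ 5 20k≤39rLD ⟩
        5 * (39 * (r * L) * D)       ≡⟨ q₃ r L D ⟩
        195 * (r * L * D)       ≤⟨ *-monoˡ-≤ (r * L * D) (≤ᵇ⇒≤ 195 225 tt) ⟩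
        225 * (r * L * D)       ≡⟨ q₄ r L D ⟩
        75 * L * (3 * (r * D)) ∎)
        where
        q₁ : ∀ L d → 75 * L * (100 * d) ≡ 100 * (75 * L * d)
        q₁ = solve-∀
        q₂ : ∀ k → 100 * k ≡ 5 * (20 * k)
        q₂ = solve-∀
        q₃ : ∀ r L D → 5 * (39 * (r * L) * D) ≡ 195 * (r * L * D)
        q₃ = solve-∀
        q₄ : ∀ r L D → 225 * (r * L * D) ≡ 75 * L * (3 * (r * D))
        q₄ = solve-∀

      k≤510rs′ : k ≤ 510 * r * s′
      k≤510rs′ = *-cancelʳ-≤ k (510 * r * s′) D (begin
        k * D                         ≤⟨ ≤-trans (≤-reflexive (sym m≡)) m≤170ds′ ⟩
        170 * d * s′                  ≤⟨ *-monoˡ-≤ s′ (*-monoʳ-≤ 170 d≤3rD) ⟩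
        170 * (3 * (r * D)) * s′      ≡⟨ q r D s′ ⟩
        510 * r * s′ * D ∎)
        where q : ∀ r D s → 170 * (3 * (r * D)) * s ≡ 510 * r * s * D
              q = solve-∀

      -- s′ is of order k/r at least, hence far above log k, so that 2^s′ outweighs the number of
      -- points in `deg-h`.
      6+2L≤s′ : 6 + 2 * L ≤ s′
      6+2L≤s′ = *-cancelˡ-≤ (510 * r) {{m*n≢0 510 r}} (≤-trans (begin
        510 * r * (6 + 2 * L)             ≡⟨ trans (cong (λ t → 510 * t * (6 + 2 * L)) r≡) (q 510 170 6 2 s L) ⟩
        520200 * s + 173400 * s * L       ≤⟨ ≤-halves {520200 * s} {173400 * s * L}
                                               (≤-trans (≤-reflexive (sym (*-assoc 2 520200 s))) (small₂ 1040400 s (const≤B 1040400 (≤ᵇ⇒≤ 1040400 1000000000000 tt)) s≤B))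
                                               (≤-trans (≤-reflexive (q₂ 2 173400 s L)) (small₃ 346800 s L (const≤B 346800 (≤ᵇ⇒≤ 346800 1000000000000 tt)) s≤B L≤B)) ⟩
        k ∎) k≤510rs′)
        where
        q : ∀ a b c e s L → a * (b * s) * (c + e * L) ≡ a * b * c * s + a * b * e * s * L
        q = solve-∀
        q₂ : ∀ a b s L → a * (b * s * L) ≡ a * b * s * L
        q₂ = solve-∀

      deg-h : 16 * (2 * m) ≤ 2 ^ s′
      deg-h = begin
        16 * (2 * m)                ≡⟨ *-assoc 16 2 m ⟨
        32 * m                      ≤⟨ *-monoʳ-≤ 32 m≤2^ ⟩
        2 ^ 5 * 2 ^ suc (L + L)     ≡⟨ ^-distribˡ-+-* 2 5 (suc (L + L)) ⟨
        2 ^ (5 + suc (L + L))       ≤⟨ ^-monoʳ-≤ 2 (≤-trans (≤-reflexive (q L)) 6+2L≤s′) ⟩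
        2 ^ s′ ∎
        where q : ∀ L → 5 + suc (L + L) ≡ 6 + 2 * L
              q = solve-∀

      -- d is (4/3) k / L up to a factor 0.999 for rounding.
      3996k≤3000Ld : 3996 * k ≤ 3000 * (L * d)
      3996k≤3000Ld = +-cancelʳ-≤ (300000 * L) _ _ (begin
        3996 * k + 300000 * L            ≤⟨ +-monoʳ-≤ (3996 * k) (≤-trans (≤-reflexive (*-assoc 4 75000 L)) (*-monoʳ-≤ 4 (small₂ 75000 L (const≤B 75000 (≤ᵇ⇒≤ 75000 1000000000000 tt)) L≤B))) ⟩
        3996 * k + 4 * k                 ≡⟨ q₂ k ⟩
        4000 * k                         ≤⟨ mul≤ 4000 k (75 * L * suc d′) (<⇒≤ k<75L[1+d′]) ⟩
        4000 * (75 * L * suc d′)         ≡⟨ q₃ L d′ ⟩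
        3000 * (L * (100 * d′)) + 300000 * L ≡⟨ cong (λ t → 3000 * (L * t) + 300000 * L) (sym d≡) ⟩
        3000 * (L * d) + 300000 * L ∎)
        where
        q₂ : ∀ k → 3996 * k + 4 * k ≡ 4000 * k
        q₂ k = sym (*-distribʳ-+ k 3996 4)
        q₃′ : ∀ a b L d → a * (b * L * suc d) ≡ a * b * (L * d) + a * b * L
        q₃′ = solve-∀
        q₃″ : ∀ a b L d → a * b * (L * d) ≡ a * (L * (b * d))
        q₃″ = solve-∀
        q₃ : ∀ L d → 4000 * (75 * L * suc d) ≡ 3000 * (L * (100 * d)) + 300000 * L
        q₃ L d = trans (q₃′ 4000 75 L d) (cong (_+ 300000 * L) (q₃″ 3000 100 L d))

      -- Without rounding the constant would be 170² · (39/20) · (4/3) = 75140; the factors 0.999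
      -- and 1/1.001 for rounding d and D leave 74989.
      74989v≤k : 74989 * (s * s₂) ≤ k
      74989v≤k = cancel≤ 3003000 (74989 * (s * s₂)) k (*-cancelʳ-≤ (3003000 * (74989 * (s * s₂))) (3003000 * k) k (begin
        3003000 * (74989 * (s * s₂)) * k                 ≡⟨ cong (_* k) (q₀ (s * s₂)) ⟩
        225191967000 * (s * s₂) * k                      ≤⟨ *-monoˡ-≤ k (*-monoˡ-≤ (s * s₂) (≤ᵇ⇒≤ 225191967000 225194580000 tt)) ⟩
        225194580000 * (s * s₂) * k                      ≡⟨ q₁ (s * s₂) k ⟩
        56355000 * (s * s₂) * (3996 * k)                 ≤⟨ *-monoʳ-≤ (56355000 * (s * s₂)) 3996k≤3000Ld ⟩
        56355000 * (s * s₂) * (3000 * (L * d))           ≡⟨ q₂ s s₂ L d ⟩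
        5850000 * L * (170 * s) * (170 * d * s₂)         ≤⟨ *-monoʳ-≤ (5850000 * L * (170 * s)) 170ds₂≤m ⟩
        5850000 * L * (170 * s) * m                      ≡⟨ cong₂ (λ x y → 5850000 * L * x * y) (sym r≡) m≡ ⟩
        5850000 * L * r * (k * D)                        ≡⟨ q₃ r L k D ⟩
        150000 * k * (39 * (r * L) * D)                  ≤⟨ *-monoʳ-≤ (150000 * k) 39rLD≤ ⟩
        150000 * k * (20 * k + 390 * (r * L))            ≡⟨ q₄ k (r * L) ⟩
        3000 * k * (1000 * k + 19500 * (r * L))          ≤⟨ *-monoʳ-≤ (3000 * k) (+-monoʳ-≤ (1000 * k) 19500rL) ⟩
        3000 * k * (1000 * k + k)                        ≡⟨ q₅ k ⟩
        3003000 * k * k ∎))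
        where
        q₀ : ∀ v → 3003000 * (74989 * v) ≡ 225191967000 * v
        q₀ v = sym (*-assoc 3003000 74989 v)
        q₁′ : ∀ a b v k → a * b * v * k ≡ a * v * (b * k)
        q₁′ = solve-∀
        q₁ : ∀ v k → 225194580000 * v * k ≡ 56355000 * v * (3996 * k)
        q₁ = q₁′ 56355000 3996
        q₂′ : ∀ a b s t L d → a * (b * b) * (s * t) * (L * d) ≡ a * L * (b * s) * (b * d * t)
        q₂′ = solve-∀
        q₂″ : ∀ a b s t L d → a * (s * t) * (b * (L * d)) ≡ a * b * (s * t) * (L * d)
        q₂″ = solve-∀
        q₂ : ∀ s t L d → 56355000 * (s * t) * (3000 * (L * d)) ≡ 5850000 * L * (170 * s) * (170 * d * t)
        q₂ s t L d = trans (q₂″ 56355000 3000 s t L d) (q₂′ 5850000 170 s t L d)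
        q₃′ : ∀ a b r L k D → a * b * L * r * (k * D) ≡ a * k * (b * (r * L) * D)
        q₃′ = solve-∀
        q₃ : ∀ r L k D → 5850000 * L * r * (k * D) ≡ 150000 * k * (39 * (r * L) * D)
        q₃ = q₃′ 150000 39
        q₄′ : ∀ a b c e k x → a * b * k * (c * k + e * x) ≡ a * k * (b * c * k + b * e * x)
        q₄′ = solve-∀
        q₄ : ∀ k x → 150000 * k * (20 * k + 390 * x) ≡ 3000 * k * (1000 * k + 19500 * x)
        q₄ = q₄′ 3000 50 20 390
        q₅′ : ∀ a b k → a * k * (b * k + k) ≡ a * (b + 1) * k * k
        q₅′ = solve-∀
        q₅ : ∀ k → 3000 * k * (1000 * k + k) ≡ 3003000 * k * k
        q₅ = q₅′ 3000 1000

      -- 187²/74989 is about 0.4663, and the room up to 0.47 absorbs the one added to `s₂`.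
      100T≤47k : ∀ Δ → Δ ≤ 187 * suc s₂ → 100 * (ρ * Δ) ≤ 47 * k
      100T≤47k Δ Δ≤ = ≤-trans (mul≤ 100 (ρ * Δ) (187 * s * (187 * suc s₂)) (*-mono-≤ (≤-reflexive ρ≡) Δ≤))
        (combine 74989 100 187 s s₂ k 47 74989v≤k (small₂ 262229034100 s (const≤B 262229034100 (≤ᵇ⇒≤ 262229034100 1000000000000 tt)) s≤B) (≤ᵇ⇒≤ 3496901 3524483 tt))
        where
        q : ∀ a b c s t → a * (b * (c * s * (c * suc t))) ≡ b * c * c * (a * (s * t)) + a * (b * c * c) * s
        q = solve-∀
        combine : ∀ a b c s t k e .{{_ : NonZero a}} → a * (s * t) ≤ k → a * (b * c * c) * s ≤ k → suc (b * c * c) ≤ a * e →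
                  b * (c * s * (c * suc t)) ≤ e * k
        combine a b c s t k e h₁ h₂ h₃ = *-cancelˡ-≤ a (begin
          a * (b * (c * s * (c * suc t)))                  ≡⟨ q a b c s t ⟩
          b * c * c * (a * (s * t)) + a * (b * c * c) * s  ≤⟨ +-mono-≤ (*-monoʳ-≤ (b * c * c) h₁) h₂ ⟩
          b * c * c * k + k                                ≡⟨ +-comm (b * c * c * k) k ⟩
          suc (b * c * c) * k                              ≤⟨ *-monoˡ-≤ k h₃ ⟩
          a * e * k                                        ≡⟨ *-assoc a e k ⟩
          a * (e * k) ∎)

      ρ≤B : ρ ≤ B
      ρ≤B = begin
        ρ              ≡⟨ ρ≡ ⟩
        187 * s        ≤⟨ *-mono-≤ (const≤ℓ 187 (≤ᵇ⇒≤ 187 1000000000000 tt)) (≤-reflexive s≡) ⟩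
        ℓ * ℓ ^ 6      ≤⟨ pow≤B 7 (≤ᵇ⇒≤ 7 12 tt) ⟩
        B ∎

      cd≤B : cd ≤ B
      cd≤B = begin
        cd             ≡⟨ cd≡ ⟩
        L + 2          ≤⟨ +-mono-≤ (<⇒≤ L<ℓ) (const≤ℓ 2 (≤ᵇ⇒≤ 2 1000000000000 tt)) ⟩
        ℓ + ℓ          ≡⟨ cong (ℓ +_) (sym (+-identityʳ ℓ)) ⟩
        2 * ℓ          ≤⟨ *-monoˡ-≤ ℓ (const≤ℓ 2 (≤ᵇ⇒≤ 2 1000000000000 tt)) ⟩
        ℓ * ℓ          ≡⟨ cong (ℓ *_) (sym (*-identityʳ ℓ)) ⟩
        ℓ ^ 2          ≤⟨ pow≤B 2 (≤ᵇ⇒≤ 2 12 tt) ⟩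
        B ∎

    abstract
      -- (m + 1)^k is at most 2^(k + 2x), so unions over two k-sets cost an exponent of order x = k
      -- L; c₁, j and J are multiples of x large enough for this.
      x Dq Dt c₁ j J d₁ : ℕ
      x  = k * L
      Dq = 25 * d′
      Dt = 10 * d′
      c₁ = 4 * x
      j  = 12 * x
      J  = 2 * x
      d₁ = pred d
      x≡ : x ≡ k * L
      x≡ = refl
      Dq≡ : Dq ≡ 25 * d′
      Dq≡ = refl
      c₁≡ : c₁ ≡ 4 * x
      c₁≡ = refl
      j≡ : j ≡ 12 * x
      j≡ = refl
      J≡ : J ≡ 2 * x
      J≡ = refl
      1+d₁≡d : suc d₁ ≡ d
      1+d₁≡d = suc-pred d
      d≡4Dq : suc d₁ ≡ 4 * Dq
      d≡4Dq = trans 1+d₁≡d (trans d≡ (*-assoc 4 25 d′))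
      d≡10Dt : suc d₁ ≡ 10 * Dt
      d≡10Dt = trans 1+d₁≡d (trans d≡ (*-assoc 10 10 d′))
      m≡10D₁ : k * D ≡ 10 * D₁
      m≡10D₁ = trans (cong (k *_) D≡) (trans (q k D′) (cong (10 *_) (sym D₁≡)))
        where q : ∀ k D → k * (10 * D) ≡ 10 * (k * D)
              q = solve-∀
      instance
        Dq≢0 : NonZero Dq
        Dq≢0 = m*n≢0 25 d′
        Dt≢0 : NonZero Dt
        Dt≢0 = m*n≢0 10 d′
        D₁≢0 : NonZero D₁
        D₁≢0 = subst NonZero (sym D₁≡) (m*n≢0 k D′)

      k≤x : k ≤ x
      k≤x = m≤m*n k L

      1≤x : 1 ≤ x
      1≤x = ≤-trans 1≤k k≤x

      k²≤c₁Dq : k * k ≤ c₁ * Dq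
      k²≤c₁Dq = begin
        k * k                      ≤⟨ *-monoʳ-≤ k k≤100Ld′ ⟩
        k * (100 * L * d′)         ≡⟨ q k L d′ ⟩
        4 * (k * L) * (25 * d′) ∎
        where q : ∀ k L d → k * (100 * L * d) ≡ 4 * (k * L) * (25 * d)
              q = solve-∀

      M₁ : ℕ
      M₁ = suc (L + L) * k

      M₁≡ : M₁ ≡ k + (x + x)
      M₁≡ = q L k
        where q : ∀ L k → suc (L + L) * k ≡ k + (k * L + k * L)
              q = solve-∀

      1+m^k≤ : suc m ^ k ≤ 2 ^ M₁
      1+m^k≤ = ≤-trans (^-monoˡ-≤ k 1+m≤) (≤-reflexive (^-*-assoc 2 (suc (L + L)) k))

      2^-+ : ∀ a b → 2 ^ a * 2 ^ b ≡ 2 ^ (a + b)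
      2^-+ a b = sym (^-distribˡ-+-* 2 a b)

      32*2^ : ∀ A e → A ≤ 2 ^ e → 16 * (2 * A) ≤ 2 ^ (5 + e)
      32*2^ A e le = ≤-trans (≤-reflexive (sym (*-assoc 16 2 A))) (≤-trans (mul≤ 32 A (2 ^ e) le) (≤-reflexive (2^-+ 5 e)))

      4^≡ : ∀ a → 2 ^ (2 * a) ≡ 4 ^ a
      4^≡ a = sym (^-*-assoc 2 2 a)

      16^≡ : ∀ a → 2 ^ (4 * a) ≡ 16 ^ a
      16^≡ a = sym (^-*-assoc 2 4 a)

      expo₁ : 5 + (M₁ + (M₁ + 3 * c₁)) ≤ 2 * suc j
      expo₁ = begin
        5 + (M₁ + (M₁ + 3 * c₁))             ≡⟨ cong₂ (λ t u → 5 + (t + (t + 3 * u))) M₁≡ c₁≡ ⟩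
        5 + (k + (x + x) + (k + (x + x) + 3 * (4 * x))) ≡⟨ q₁ k x ⟩
        2 + 16 * x + (3 * 1 + 2 * k)         ≤⟨ +-monoʳ-≤ (2 + 16 * x) (+-mono-≤ (*-monoʳ-≤ 3 1≤x) (*-monoʳ-≤ 2 k≤x)) ⟩
        2 + 16 * x + (3 * x + 2 * x)         ≤⟨ m≤m+n _ (3 * x) ⟩
        2 + 16 * x + (3 * x + 2 * x) + 3 * x ≡⟨ q₂ x ⟩
        2 * suc (12 * x)                     ≡⟨ cong (λ t → 2 * suc t) (sym j≡) ⟩
        2 * suc j ∎
        where
        q₁ : ∀ k x → 5 + (k + (x + x) + (k + (x + x) + 3 * (4 * x))) ≡ 2 + 16 * x + (3 * 1 + 2 * k)
        q₁ = solve-∀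
        q₂ : ∀ x → 2 + 16 * x + (3 * x + 2 * x) + 3 * x ≡ 2 * suc (12 * x)
        q₂ = solve-∀

      sparse-h : 16 * (2 * (suc m ^ k * (suc m ^ k * 8 ^ c₁))) ≤ 4 ^ suc j
      sparse-h = ≤-trans (32*2^ (suc m ^ k * (suc m ^ k * 8 ^ c₁)) (M₁ + (M₁ + 3 * c₁)) (≤-trans
        (*-mono-≤ 1+m^k≤ (*-mono-≤ 1+m^k≤ (≤-reflexive (^-*-assoc 2 3 c₁))))
        (≤-reflexive (trans (cong (2 ^ M₁ *_) (2^-+ M₁ (3 * c₁))) (2^-+ M₁ (M₁ + 3 * c₁))))))
        (≤-trans (^-monoʳ-≤ 2 expo₁) (≤-reflexive (4^≡ (suc j))))

      expo₂ : 5 + (suc (L + L) + (suc (L + L) + 3)) ≤ 4 * suc cd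
      expo₂ = ≤-trans (m≤m+n _ 2) (≤-reflexive (trans (q L) (cong (λ t → 4 * suc t) (sym cd≡))))
        where
        q : ∀ L → 5 + (suc (L + L) + (suc (L + L) + 3)) + 2 ≡ 4 * suc (L + 2)
        q = solve-∀

      codeg-h : 16 * (2 * (m * (m * 8))) ≤ 16 ^ suc cd
      codeg-h = ≤-trans (32*2^ (m * (m * 8)) (suc (L + L) + (suc (L + L) + 3)) (≤-trans
        (*-mono-≤ m≤2^ (*-monoˡ-≤ 8 m≤2^))
        (≤-reflexive (trans (cong (2 ^ suc (L + L) *_) (2^-+ (suc (L + L)) 3)) (2^-+ (suc (L + L)) (suc (L + L) + 3))))))
        (≤-trans (^-monoʳ-≤ 2 expo₂) (≤-reflexive (16^≡ (suc cd))))

      expo₃ : 5 + (M₁ + M₁) ≤ 4 * suc J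
      expo₃ = begin
        5 + (M₁ + M₁)                    ≡⟨ trans (cong (λ t → 5 + (t + t)) M₁≡) (q₁ k x) ⟩
        4 + 4 * x + (1 + 2 * k)          ≤⟨ +-monoʳ-≤ (4 + 4 * x) (+-mono-≤ 1≤x (*-monoʳ-≤ 2 k≤x)) ⟩
        4 + 4 * x + (x + 2 * x)          ≤⟨ m≤m+n _ x ⟩
        4 + 4 * x + (x + 2 * x) + x      ≡⟨ q₂ x ⟩
        4 * suc (2 * x)                  ≡⟨ cong (λ t → 4 * suc t) (sym J≡) ⟩
        4 * suc J ∎
        where
        q₁ : ∀ k x → 5 + (k + (x + x) + (k + (x + x))) ≡ 4 + 4 * x + (1 + 2 * k)
        q₁ = solve-∀
        q₂ : ∀ x → 4 + 4 * x + (x + 2 * x) + x ≡ 4 * suc (2 * x)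
        q₂ = solve-∀

      joint-h : 16 * (2 * (suc m ^ k * suc m ^ k)) ≤ 16 ^ suc J
      joint-h = ≤-trans (32*2^ (suc m ^ k * suc m ^ k) (M₁ + M₁) (≤-trans (*-mono-≤ 1+m^k≤ 1+m^k≤) (≤-reflexive (2^-+ M₁ M₁))))
        (≤-trans (^-monoʳ-≤ 2 expo₃) (≤-reflexive (16^≡ (suc J))))

      L₁<kt₀ : j + j < k * t₀
      L₁<kt₀ = begin-strict
        12 * x + 12 * x          <⟨ m<m+n _ 1≤x ⟩
        12 * x + 12 * x + x      ≡⟨ q k L ⟩
        k * (25 * L)             ≡⟨ cong (k *_) (sym t₀≡) ⟩
        k * t₀ ∎
        where q : ∀ k L → 12 * (k * L) + 12 * (k * L) + k * L ≡ k * (25 * L)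
              q = solve-∀

      s≤r : s ≤ r
      s≤r = ≤-trans (m≤n*m s 170) (≤-reflexive (sym r≡))

      L⁴≤rL : ∀ c → c ≤ 1000000000000 → c * (L * L * L * L) ≤ r * L
      L⁴≤rL c le = begin
        c * (L * L * L * L)            ≡⟨ *-assoc c (L * L * L) L ⟨
        c * (L * L * L) * L            ≤⟨ *-monoˡ-≤ L (*-mono-≤ (const≤ℓ c le) (*-mono-≤ (*-mono-≤ lℓ lℓ) lℓ)) ⟩
        ℓ * (ℓ * ℓ * ℓ) * L            ≡⟨ cong (_* L) (q ℓ) ⟩
        ℓ ^ 4 * L                      ≤⟨ *-monoˡ-≤ L (≤-trans (^-monoʳ-≤ ℓ {{ℓ≢0}} (≤ᵇ⇒≤ 4 6 tt)) (≤-trans (≤-reflexive (sym s≡)) s≤r)) ⟩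
        r * L ∎
        where
        lℓ : L ≤ ℓ
        lℓ = <⇒≤ L<ℓ
        q : ∀ l → l * (l * l * l) ≡ l * (l * (l * (l * 1)))
        q = solve-∀

      -- m/d′² is of order L/r, and r exceeds ℓ⁶. So two points rarely have a common neighbour, even
      -- after multiplication by L².
      L²m≤ : ∀ c → c * 5776 ≤ 1000000000000 → c * (L * L * m) ≤ d′ * d′
      L²m≤ c le = *-cancelʳ-≤ (c * (L * L * m)) (d′ * d′) (76 * 76 * (L * L)) {{m*n≢0 (76 * 76) (L * L) {{_}} {{m*n≢0 L L}}}} (begin
        c * (L * L * m) * (76 * 76 * (L * L))      ≡⟨ q₁ c (76 * 76) L m ⟩
        m * (c * (76 * 76) * (L * L * L * L))      ≤⟨ *-monoʳ-≤ m (L⁴≤rL (c * (76 * 76)) le) ⟩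
        m * (r * L)                                ≡⟨ trans (cong (_* (r * L)) m≡) (q₂ k D (r * L)) ⟩
        k * (r * L * D)                            ≤⟨ *-monoʳ-≤ k rLD≤k ⟩
        k * k                                      ≤⟨ *-mono-≤ k≤76Ld′ k≤76Ld′ ⟩
        76 * L * d′ * (76 * L * d′)                ≡⟨ q₃ L d′ 76 ⟩
        d′ * d′ * (76 * 76 * (L * L)) ∎)
        where
        q₁ : ∀ a b L m → a * (L * L * m) * (b * (L * L)) ≡ m * (a * b * (L * L * L * L))
        q₁ = solve-∀
        q₂ : ∀ k D y → k * D * y ≡ k * (y * D)
        q₂ = solve-∀
        q₃ : ∀ L d c → c * L * d * (c * L * d) ≡ d * d * (c * c * (L * L))
        q₃ = solve-∀

      m≤Dq² : m ≤ Dq * Dq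
      m≤Dq² = begin
        m                           ≤⟨ m≤n*m m (L * L) {{m*n≢0 L L}} ⟩
        L * L * m                   ≡⟨ *-identityˡ (L * L * m) ⟨
        1 * (L * L * m)             ≤⟨ L²m≤ 1 (≤ᵇ⇒≤ 5776 1000000000000 tt) ⟩
        d′ * d′                     ≤⟨ *-mono-≤ (m≤n*m d′ 25) (m≤n*m d′ 25) ⟩
        25 * d′ * (25 * d′) ∎

      ovl₅ : ∀ c → c ≤ 1000000000000 → c * (P * P * (cd * ρ)) ≤ k
      ovl₅ c le = ≤-trans (≤-reflexive (q c P cd ρ)) (small (c ∷ P ∷ P ∷ cd ∷ ρ ∷ []) (const≤B c le ∷ P≤B ∷ P≤B ∷ cd≤B ∷ ρ≤B ∷ []) (≤ᵇ⇒≤ 5 8 tt))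
        where q : ∀ c P d r → c * (P * P * (d * r)) ≡ c * (P * (P * (d * (r * 1))))
              q = solve-∀

      few : k + jj * jj * (cd * ρ) < jj * t₁
      few = +-cancelʳ-< jj _ _ (begin-strict
        k + jj * jj * (cd * ρ) + jj                 ≡⟨ trans (cong (λ t → k + t * t * (cd * ρ) + t) jj≡) (q₁ k P (cd * ρ)) ⟩
        k + (4 * (P * P * (cd * ρ)) + 2 * P)        ≤⟨ +-monoʳ-≤ k (≤-halves {4 * (P * P * (cd * ρ))} {2 * P} (≤-trans (≤-reflexive (sym (*-assoc 2 4 (P * P * (cd * ρ))))) (ovl₅ 8 (≤ᵇ⇒≤ 8 1000000000000 tt)))
                                                        (≤-trans (≤-reflexive (sym (*-assoc 2 2 P))) (small₂ 4 P (const≤B 4 (≤ᵇ⇒≤ 4 1000000000000 tt)) P≤B))) ⟩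
        k + k                                       <⟨ +-mono-< k<P[1+t₁] k<P[1+t₁] ⟩
        P * suc t₁ + P * suc t₁                     ≡⟨ trans (q₂ P t₁) (cong (λ t → t * t₁ + t) (sym jj≡)) ⟩
        jj * t₁ + jj ∎)
        where
        q₁ : ∀ k P c → k + 2 * P * (2 * P) * c + 2 * P ≡ k + (4 * (P * P * c) + 2 * P)
        q₁ = solve-∀
        q₂ : ∀ P t → P * suc t + P * suc t ≡ 2 * P * t + 2 * P
        q₂ = solve-∀

      2d′≤d₁ : 2 * d′ ≤ d₁
      2d′≤d₁ = ≤-pred (begin
        suc (2 * d′)      ≤⟨ +-monoˡ-≤ (2 * d′) 1≤d′ ⟩
        d′ + 2 * d′       ≤⟨ *-monoˡ-≤ d′ (≤ᵇ⇒≤ 3 100 tt) ⟩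
        100 * d′          ≡⟨ trans (sym d≡) (sym 1+d₁≡d) ⟩
        suc d₁ ∎)

      d₁≢0 : NonZero d₁
      d₁≢0 = >-nonZero (≤-trans 1≤d′ (≤-trans (m≤n*m d′ 2) 2d′≤d₁))

      D₃ D₂ c₀ : ℕ
      D₃ = d′ * d′ * d′
      D₂ = d′ * d′
      c₀ = 4 * (100 * 100 * 100) * (L * L * L)
      c₀≡ : c₀ ≡ 4 * (100 * 100 * 100) * (L * L * L)
      c₀≡ = refl

      instance
        D₂≢0 : NonZero D₂
        D₂≢0 = m*n≢0 d′ d′
        D₃≢0 : NonZero D₃
        D₃≢0 = m*n≢0 (d′ * d′) d′ {{m*n≢0 d′ d′}}

      K₃≤ : 2 * (k * k) * (2 * k) ≤ c₀ * D₃
      K₃≤ = begin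
        2 * (k * k) * (2 * k)       ≡⟨ q₁ k ⟩
        4 * (k * k * k)             ≤⟨ *-monoʳ-≤ 4 (*-mono-≤ (*-mono-≤ k≤100Ld′ k≤100Ld′) k≤100Ld′) ⟩
        4 * (100 * L * d′ * (100 * L * d′) * (100 * L * d′)) ≡⟨ q₂ 4 100 L d′ ⟩
        4 * (100 * 100 * 100) * (L * L * L) * (d′ * d′ * d′) ∎
        where
        q₁ : ∀ k → 2 * (k * k) * (2 * k) ≡ 4 * (k * k * k)
        q₁ = solve-∀
        q₂ : ∀ a c L d → a * (c * L * d * (c * L * d) * (c * L * d)) ≡ a * (c * c * c) * (L * L * L) * (d * d * d)
        q₂ = solve-∀

      8D₃≤ : 8 * D₃ ≤ d₁ ^ 3
      8D₃≤ = ≤-trans (≤-reflexive (q d′)) (^-monoˡ-≤ 3 2d′≤d₁)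
        where q : ∀ d → 8 * (d * d * d) ≡ 2 * d * (2 * d * (2 * d * 1))
              q = solve-∀

      D₂≤ : D₂ ≤ d₁ ^ 2
      D₂≤ = ≤-trans (≤-by′ (3 * (d′ * d′)) (q d′)) (^-monoˡ-≤ 2 2d′≤d₁)
        where q : ∀ d → 2 * d * (2 * d * 1) ≡ d * d + 3 * (d * d)
              q = solve-∀
              ≤-by′ : ∀ {a b} c → b ≡ a + c → a ≤ b
              ≤-by′ c refl = m≤m+n _ c

      1≤ρ : 1 ≤ ρ
      1≤ρ = ≤-trans (>-nonZero⁻¹ s) (≤-trans (m≤n*m s 187) (≤-reflexive (sym ρ≡)))

      absorb : ∀ e → e * 75 ≤ 1000000000000 → e * (ρ * L) * d′ ≤ d′ * d′
      absorb e le = *-monoˡ-≤ d′ (small-d′ (e * (ρ * L)) (≤-trans (≤-reflexive (q e 75 ρ L))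
        (small (e * 75 ∷ ρ ∷ L ∷ L ∷ []) (const≤B (e * 75) le ∷ ρ≤B ∷ L≤B ∷ L≤B ∷ []) (≤ᵇ⇒≤ 4 8 tt))))
        where q : ∀ a b ρ L → a * (ρ * L) * (b * L) ≡ a * b * (ρ * (L * (L * 1)))
              q = solve-∀

      3R≤ : 3 * (2 * k + (k * (2 * (2 * (ρ + ρ))) + k * (2 * (2 * (ρ + ρ))))) ≤ D₂
      3R≤ = begin
        3 * (2 * k + (k * (2 * (2 * (ρ + ρ))) + k * (2 * (2 * (ρ + ρ))))) ≡⟨ q₁ k ρ ⟩
        6 * 1 * k + 48 * ρ * k             ≤⟨ +-monoˡ-≤ (48 * ρ * k) (*-monoˡ-≤ k (*-monoʳ-≤ 6 1≤ρ)) ⟩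
        6 * ρ * k + 48 * ρ * k             ≡⟨ q₂ ρ k ⟩
        54 * ρ * k                         ≤⟨ *-monoʳ-≤ (54 * ρ) k≤76Ld′ ⟩
        54 * ρ * (76 * L * d′)             ≡⟨ q₃ 54 76 ρ L d′ ⟩
        54 * 76 * (ρ * L) * d′             ≤⟨ absorb (54 * 76) (≤ᵇ⇒≤ (54 * 76 * 75) 1000000000000 tt) ⟩
        d′ * d′ ∎
        where
        q₁ : ∀ k ρ → 3 * (2 * k + (k * (2 * (2 * (ρ + ρ))) + k * (2 * (2 * (ρ + ρ))))) ≡ 6 * 1 * k + 48 * ρ * k
        q₁ = solve-∀
        q₂ : ∀ ρ k → 6 * ρ * k + 48 * ρ * k ≡ 54 * ρ * k
        q₂ = solve-∀
        q₃ : ∀ a b ρ L d → a * ρ * (b * L * d) ≡ a * b * (ρ * L) * d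
        q₃ = solve-∀

    private
      lift-λ : ∀ c → c ≤ 1000000 → c * λ′ ≤ L
      lift-λ c le = ≤-trans (*-monoˡ-≤ λ′ le) λ-small
      q-x : ∀ a c λ′ → a * (c * λ′) ≡ a * c * λ′
      q-x a c λ′ = sym (*-assoc a c λ′)

    -- 2^(σ - 1) bounds 512 r, and the spare factor 2 per element of I, 2^k in all, takes the
    -- remaining constants. 2^ψ bounds 2 r L, so that 2^y ≤ D.
    σ ψ y : ℕ
    σ = 18 + 6 * λ′
    ψ = 9 + 7 * λ′
    y = L ∸ ψ

    σ≤ : σ ≤ 7 * λ′
    σ≤ = ≤-trans (+-monoˡ-≤ (6 * λ′) (≤-trans (≤ᵇ⇒≤ 18 40 tt) 40≤λ)) ≤-refl
    ψ≤ : ψ ≤ 8 * λ′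
    ψ≤ = +-monoˡ-≤ (7 * λ′) (≤-trans (≤ᵇ⇒≤ 9 40 tt) 40≤λ)

    abstract
      hσ : 2800 * σ ≤ L
      hσ = ≤-trans (mul≤ 2800 σ (7 * λ′) σ≤) (≤-trans (≤-reflexive (q-x 2800 7 λ′)) (lift-λ (2800 * 7) (≤ᵇ⇒≤ (2800 * 7) 1000000 tt)))

      hψ : 56 * ψ ≤ L
      hψ = ≤-trans (mul≤ 56 ψ (8 * λ′) ψ≤) (≤-trans (≤-reflexive (q-x 56 8 λ′)) (lift-λ (56 * 8) (≤ᵇ⇒≤ (56 * 8) 1000000 tt)))

      L≡ : L ≡ ψ + y
      L≡ = sym (m+[n∸m]≡n (≤-trans (m≤n*m ψ 56) hψ))

      h50 : 50 * σ ≤ y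
      h50 = +-cancelˡ-≤ ψ _ _ (begin
        ψ + 50 * σ                    ≤⟨ +-mono-≤ ψ≤ (≤-trans (mul≤ 50 σ (7 * λ′) σ≤) (≤-reflexive (q-x 50 7 λ′))) ⟩
        8 * λ′ + 50 * 7 * λ′          ≡⟨ *-distribʳ-+ λ′ 8 (50 * 7) ⟨
        (8 + 50 * 7) * λ′             ≤⟨ lift-λ (8 + 50 * 7) (≤ᵇ⇒≤ (8 + 50 * 7) 1000000 tt) ⟩
        L                             ≡⟨ L≡ ⟩
        ψ + y ∎)

      const≤k : ∀ c → c ≤ 1000000000000 → c ≤ k
      const≤k c le = ≤-trans (≤-reflexive (sym (*-identityʳ c))) (small₂ c 1 (const≤B c le) (const≤B 1 (≤ᵇ⇒≤ 1 1000000000000 tt)))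

      lower : 2800 * k + 2 * 1500 * k * L ≤ k * k * L
      lower = begin
        2800 * k + 2 * 1500 * k * L     ≤⟨ +-monoˡ-≤ (2 * 1500 * k * L) (m≤m*n (2800 * k) L) ⟩
        2800 * k * L + 2 * 1500 * k * L ≡⟨ q 2800 (2 * 1500) k L ⟩
        (2800 + 2 * 1500) * k * L       ≤⟨ *-monoˡ-≤ L (*-monoˡ-≤ k (const≤k (2800 + 2 * 1500) (≤ᵇ⇒≤ (2800 + 2 * 1500) 1000000000000 tt))) ⟩
        k * k * L ∎
        where q : ∀ a b k L → a * k * L + b * k * L ≡ (a + b) * k * L
              q = solve-∀

      2^y≤D : 2 ^ y ≤ D
      2^y≤D = *-cancelˡ-≤ (2 ^ ψ) {{m^n≢0 2 ψ}} (begin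
        2 ^ ψ * 2 ^ y               ≡⟨ ^-distribˡ-+-* 2 ψ y ⟨
        2 ^ (ψ + y)                 ≡⟨ cong (2 ^_) L≡ ⟨
        2 ^ L                       ≤⟨ 2^L≤k ⟩
        k                           ≤⟨ k≤2rLD ⟩
        2 * (r * L) * D             ≤⟨ *-monoˡ-≤ D 2rL≤ ⟩
        2 ^ ψ * D ∎)
        where
        q : ∀ a b z l → a * (b * z * l) ≡ a * b * (l * z)
        q = solve-∀
        2rL≤ : 2 * (r * L) ≤ 2 ^ ψ
        2rL≤ = begin
          2 * (r * L)             ≡⟨ cong (λ z → 2 * (z * L)) (trans r≡ (cong (170 *_) s≡)) ⟩
          2 * (170 * ℓ ^ 6 * L)   ≤⟨ mul≤ 2 _ _ (*-monoʳ-≤ (170 * ℓ ^ 6) (<⇒≤ L<ℓ)) ⟩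
          2 * (170 * ℓ ^ 6 * ℓ)   ≡⟨ q 2 170 (ℓ ^ 6) ℓ ⟩
          2 * 170 * ℓ ^ 7         ≤⟨ *-monoˡ-≤ (ℓ ^ 7) (≤ᵇ⇒≤ (2 * 170) (2 ^ 9) tt) ⟩
          2 ^ 9 * ℓ ^ 7           ≡⟨ cong (λ z → 2 ^ 9 * z) (trans (cong (_^ 7) ℓ≡) (trans (^-*-assoc 2 λ′ 7) (cong (2 ^_) (*-comm λ′ 7)))) ⟩
          2 ^ 9 * 2 ^ (7 * λ′)    ≡⟨ ^-distribˡ-+-* 2 9 (7 * λ′) ⟨
          2 ^ ψ ∎

      512r≤ : 512 * r ≤ 2 ^ (17 + 6 * λ′)
      512r≤ = begin
        512 * r                   ≡⟨ trans (cong (512 *_) (trans r≡ (cong (170 *_) s≡))) (sym (*-assoc 512 170 (ℓ ^ 6))) ⟩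
        512 * 170 * ℓ ^ 6         ≤⟨ *-monoˡ-≤ (ℓ ^ 6) (≤ᵇ⇒≤ (512 * 170) (2 ^ 17) tt) ⟩
        2 ^ 17 * ℓ ^ 6            ≡⟨ cong (λ z → 2 ^ 17 * z) (trans (cong (_^ 6) ℓ≡) (trans (^-*-assoc 2 λ′ 6) (cong (2 ^_) (*-comm λ′ 6)))) ⟩
        2 ^ 17 * 2 ^ (6 * λ′)     ≡⟨ ^-distribˡ-+-* 2 17 (6 * λ′) ⟨
        2 ^ (17 + 6 * λ′) ∎

      Jf e₁ e₂ : ℕ
      Jf = suc (2 * (k * k) * (2 * k))
      e₁ = suc L
      e₂ = 2 + (suc L + (suc L + suc L))
      Jf≤ : Jf ≤ 2 ^ e₂
      Jf≤ = begin-strict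
        2 * (k * k) * (2 * k)             ≡⟨ r₁ k ⟩
        4 * (k * (k * k))                 <⟨ *-monoʳ-< 4 (*-mono-< k<2^1+L (*-mono-< k<2^1+L k<2^1+L)) ⟩
        2 ^ 2 * (2 ^ e₁ * (2 ^ e₁ * 2 ^ e₁)) ≡⟨ trans (cong (λ z → 2 ^ 2 * (2 ^ e₁ * z)) (2^-+ e₁ e₁)) (trans (cong (2 ^ 2 *_) (2^-+ e₁ (e₁ + e₁))) (2^-+ 2 (e₁ + (e₁ + e₁)))) ⟩
        2 ^ e₂ ∎
        where r₁ : ∀ k → 2 * (k * k) * (2 * k) ≡ 4 * (k * (k * k))
              r₁ = solve-∀
      r₂ : ∀ L v z → (4 + (suc L + suc L)) + (2 + (suc L + suc L)) + (v + ((2 + (suc L + (suc L + suc L))) + ((2 + (suc L + (suc L + suc L))) + z))) ≡ v + (20 + 10 * L + z)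
      r₂ = solve-∀
      r₃ : ∀ k l → (17 + l) * k + k ≡ k * (18 + l)
      r₃ = solve-∀
      r₄ : ∀ L → 20 * L + 10 * L ≡ 30 * L
      r₄ = solve-∀
      r₅ : ∀ a b c L → a * (b * (c * (L * L * L))) ≡ a * b * c * (L * (L * (L * 1)))
      r₅ = solve-∀
      3c₀-with : ∀ e → c₀ ≡ e * (L * L * L) → 2 * 3 * e ≤ 1000000000000 → 2 * (3 * c₀) ≤ k
      3c₀-with e e≡ le = ≤-trans (≤-reflexive (trans (cong (λ z → 2 * (3 * z)) e≡) (r₅ 2 3 e L)))
        (small (2 * 3 * e ∷ L ∷ L ∷ L ∷ []) (const≤B (2 * 3 * e) le ∷ L≤B ∷ L≤B ∷ L≤B ∷ []) (≤ᵇ⇒≤ 4 8 tt))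
      3c₀ : 2 * (3 * c₀) ≤ k
      3c₀ = 3c₀-with (4 * (100 * 100 * 100)) c₀≡ (≤ᵇ⇒≤ (2 * 3 * (4 * (100 * 100 * 100))) 1000000000000 tt)
      20+10L : 2 * (20 + 10 * L) ≤ k
      20+10L = begin
        2 * (20 + 10 * L)    ≤⟨ *-monoʳ-≤ 2 (≤-trans (+-monoˡ-≤ (10 * L) (m≤m*n 20 L)) (≤-reflexive (r₄ L))) ⟩
        2 * (30 * L)         ≡⟨ *-assoc 2 30 L ⟨
        60 * L               ≤⟨ small₂ 60 L (const≤B 60 (≤ᵇ⇒≤ 60 1000000000000 tt)) L≤B ⟩
        k ∎
      expo : (4 + (e₁ + e₁)) + (2 + (e₁ + e₁)) + ((17 + 6 * λ′) * k + (e₂ + (e₂ + 3 * c₀))) ≤ k * σ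
      expo = begin
        (4 + (e₁ + e₁)) + (2 + (e₁ + e₁)) + ((17 + 6 * λ′) * k + (e₂ + (e₂ + 3 * c₀)))  ≡⟨ r₂ L ((17 + 6 * λ′) * k) (3 * c₀) ⟩
        (17 + 6 * λ′) * k + (20 + 10 * L + 3 * c₀) ≤⟨ +-monoʳ-≤ ((17 + 6 * λ′) * k) (≤-halves {20 + 10 * L} {3 * c₀} 20+10L 3c₀) ⟩
        (17 + 6 * λ′) * k + k                      ≡⟨ r₃ k (6 * λ′) ⟩
        k * σ ∎

      consts≤ : 16 * (suc k * suc k) * (4 * (suc k * suc k)) * ((512 * r) ^ k * (suc (2 * (k * k) * (2 * k)) * (suc (2 * (k * k) * (2 * k)) * 8 ^ c₀))) ≤ 2 ^ (k * σ)
      consts≤ = raise-exponent ((4 + (e₁ + e₁)) + (2 + (e₁ + e₁)) + ((17 + 6 * λ′) * k + (e₂ + (e₂ + 3 * c₀)))) (k * σ)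
        (bundle (suc k) ((512 * r) ^ k) Jf (8 ^ c₀) e₁ e₂ ((17 + 6 * λ′) * k) (3 * c₀) k<2^1+L
          (≤-trans (^-monoˡ-≤ k 512r≤) (≤-reflexive (^-*-assoc 2 (17 + 6 * λ′) k))) Jf≤ (≤-reflexive (^-*-assoc 2 3 c₀))) expo

    Δ T : ℕ
    Δ = s₂ + 186 * suc s₂
    T = ρ * Δ

    abstract
      Δ≤ : Δ ≤ 187 * suc s₂
      Δ≤ = +-monoˡ-≤ (186 * suc s₂) (n≤1+n s₂)

      hT : 100 * T ≤ 47 * k
      hT = 100T≤47k Δ Δ≤

    β G# ovl : ℕ
    β = Dq * Dq
    G# = suc (J + (k + k))
    ovl = jj * jj * (cd * ρ)

    W : ℕ → ℕ
    W a = β * (((k ∸ a) ⊓ (ρ * Δ)) * ((k ∸ a) + ovl) + (2 * (2 * Δ * (k + ovl) + t₁ * (ρ * (j + j))) + ρ * k)) + 2 * (t₀ * t₀ * (m * (k * k) + ρ * ρ * (Dq * Dq * G#)))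

    abstract
      -- Powers of ℓ make every error small: `ovl` is polylogarithmic, Δ is at most k/ρ, medium
      -- degrees enter through t₁ ≤ k/ℓ^10, and low degrees through L² m, small against `Dq`².
      wb-with : ∀ c → 1 ≤ c → 10 * c * 4 ≤ 1000000000000 → 80 * c ≤ 1000000000000 → 20 * c * (2 * 12) ≤ 1000000000000 → 20 * c * (25 * 25) * 5 ≤ 1000000000000 → 20 * c * 5776 ≤ 1000000000000 → 10 * c ≤ 1000000000000 →
        ∀ u → u ≤ k → c * (β * ((u ⊓ T) * (u + ovl) + (2 * (2 * Δ * (k + ovl) + t₁ * (ρ * (j + j))) + ρ * k)) + 2 * (t₀ * t₀ * (m * (k * k) + ρ * ρ * (Dq * Dq * G#))))
           ≤ β * (c * ((u ⊓ T) * u) + k * k)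
      wb-with c 1≤c l₁ l₂ l₃ l₅ l₆ l₄ u u≤k = W-bound c k u (u ⊓ T) β ovl Δ (t₁ * (ρ * (j + j))) ρ (t₀ * t₀) m G# h₁ h₁′ h₂ h₃ h₄ h₅ h₆ (≤-trans (m⊓n≤m u T) u≤k)
        where
        w₁ : ∀ a c p o → a * c * (2 * p * (2 * p) * o) ≡ a * c * 4 * (p * p * o)
        w₁ = solve-∀
        h₁ : 10 * c * ovl ≤ k
        h₁ = ≤-trans (≤-reflexive (trans (cong (λ z → 10 * c * (z * z * (cd * ρ))) jj≡) (w₁ 10 c P (cd * ρ)))) (ovl₅ (10 * c * 4) l₁)
        h₁′ : ovl ≤ k
        h₁′ = ≤-trans (m≤n*m ovl (10 * c) {{m*n≢0 10 c {{_}} {{>-nonZero 1≤c}}}}) h₁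
        sρ : ∀ e → e ≤ 1000000000000 → e ≤ ρ
        sρ e le = ≤-trans (const≤ℓ e le) (≤-trans (≤-trans (≤-reflexive (sym (*-identityʳ ℓ))) (^-monoʳ-≤ ℓ {{ℓ≢0}} {1} {6} (s≤s z≤n))) (≤-trans (≤-reflexive (sym s≡)) (≤-trans (m≤n*m s 187) (≤-reflexive (sym ρ≡)))))
        h₂ : 80 * c * Δ ≤ k
        h₂ = ≤-trans (*-monoˡ-≤ Δ (sρ (80 * c) l₂)) (cancel≤ 100 T k (≤-trans hT (*-monoˡ-≤ k (≤ᵇ⇒≤ 47 100 tt))))
        w₃ : ∀ a b t ρ k L → a * (t * (ρ * (b * (k * L) + b * (k * L)))) ≡ k * (a * (2 * b) * (ρ * L) * t)
        w₃ = solve-∀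
        w₄ : ∀ a b z l → a * (b * z * l) ≡ a * (b * (l * z))
        w₄ = solve-∀
        cρL≤P : 20 * c * (2 * 12) * (ρ * L) ≤ P
        cρL≤P = begin
          20 * c * (2 * 12) * (ρ * L)       ≡⟨ cong (λ z → 20 * c * (2 * 12) * (z * L)) (trans ρ≡ (cong (187 *_) s≡)) ⟩
          20 * c * (2 * 12) * (187 * ℓ ^ 6 * L) ≤⟨ *-mono-≤ (const≤ℓ (20 * c * (2 * 12)) l₃) (*-mono-≤ (*-monoˡ-≤ (ℓ ^ 6) (const≤ℓ 187 (≤ᵇ⇒≤ 187 1000000000000 tt))) (<⇒≤ L<ℓ)) ⟩
          ℓ * (ℓ * ℓ ^ 6 * ℓ)                        ≡⟨ w₄ ℓ ℓ (ℓ ^ 6) ℓ ⟩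
          ℓ ^ 9                                      ≤⟨ ^-monoʳ-≤ ℓ {{ℓ≢0}} (n≤1+n 9) ⟩
          ℓ ^ 10                                     ≡⟨ P≡ ⟨
          P ∎
        h₃ : 20 * c * (t₁ * (ρ * (j + j))) ≤ k * k
        h₃ = begin
          20 * c * (t₁ * (ρ * (j + j)))     ≡⟨ cong (λ z → 20 * c * (t₁ * (ρ * (z + z)))) (trans j≡ (cong (12 *_) x≡)) ⟩
          20 * c * (t₁ * (ρ * (12 * (k * L) + 12 * (k * L)))) ≡⟨ w₃ (20 * c) 12 t₁ ρ k L ⟩
          k * (20 * c * (2 * 12) * (ρ * L) * t₁) ≤⟨ *-monoʳ-≤ k (≤-trans (*-monoˡ-≤ t₁ cρL≤P) Pt₁≤k) ⟩
          k * k ∎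
        h₄ : 10 * c * ρ ≤ k
        h₄ = small₂ (10 * c) ρ (const≤B (10 * c) l₄) ρ≤B
        G#≤ : G# ≤ 5 * (k * L)
        G#≤ = begin
          suc (J + (k + k))            ≡⟨ cong (λ z → suc (z + (k + k))) J≡ ⟩
          1 + (2 * x + (k + k))        ≤⟨ +-mono-≤ 1≤x (+-monoʳ-≤ (2 * x) (+-mono-≤ k≤x k≤x)) ⟩
          x + (2 * x + (x + x))        ≡⟨ w x ⟩
          5 * x                        ≡⟨ cong (5 *_) x≡ ⟩
          5 * (k * L) ∎
          where w : ∀ x → x + (2 * x + (x + x)) ≡ 5 * x
                w = solve-∀
        w₅ : ∀ a b c k L ρ → a * (b * L * (b * L) * (ρ * ρ * (c * (k * L)))) ≡ k * (a * (b * b) * c * (L * (L * (L * (ρ * (ρ * 1))))))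
        w₅ = solve-∀
        h₅ : 20 * c * (t₀ * t₀ * (ρ * ρ * G#)) ≤ k * k
        h₅ = begin
          20 * c * (t₀ * t₀ * (ρ * ρ * G#))  ≡⟨ cong (λ z → 20 * c * (z * z * (ρ * ρ * G#))) t₀≡ ⟩
          20 * c * (25 * L * (25 * L) * (ρ * ρ * G#)) ≤⟨ mul≤ (20 * c) _ _ (*-monoʳ-≤ (25 * L * (25 * L)) (*-monoʳ-≤ (ρ * ρ) G#≤)) ⟩
          20 * c * (25 * L * (25 * L) * (ρ * ρ * (5 * (k * L)))) ≡⟨ w₅ (20 * c) 25 5 k L ρ ⟩
          k * (20 * c * (25 * 25) * 5 * (L * (L * (L * (ρ * (ρ * 1))))))
            ≤⟨ *-monoʳ-≤ k (small (20 * c * (25 * 25) * 5 ∷ L ∷ L ∷ L ∷ ρ ∷ ρ ∷ [])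
                 (const≤B (20 * c * (25 * 25) * 5) l₅ ∷ L≤B ∷ L≤B ∷ L≤B ∷ ρ≤B ∷ ρ≤B ∷ []) (≤ᵇ⇒≤ 6 8 tt)) ⟩
          k * k ∎
        w₆ : ∀ a b L m → a * (b * L * (b * L) * m) ≡ b * b * (a * (L * L * m))
        w₆ = solve-∀
        w₇ : ∀ b d → b * b * (d * d) ≡ b * d * (b * d)
        w₇ = solve-∀
        h₆ : 20 * c * (t₀ * t₀ * m) ≤ β
        h₆ = begin
          20 * c * (t₀ * t₀ * m)             ≡⟨ cong (λ z → 20 * c * (z * z * m)) t₀≡ ⟩
          20 * c * (25 * L * (25 * L) * m)   ≡⟨ w₆ (20 * c) 25 L m ⟩
          25 * 25 * (20 * c * (L * L * m))   ≤⟨ mul≤ (25 * 25) (20 * c * (L * L * m)) (d′ * d′) (L²m≤ (20 * c) l₆) ⟩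
          25 * 25 * (d′ * d′)                         ≡⟨ w₇ 25 d′ ⟩
          25 * d′ * (25 * d′)                         ≡⟨ cong (λ z → z * z) Dq≡ ⟨
          β ∎

    abstract
      -- 70 d′ open slots make one halving, and the budget is scaled by 2 · 1500; the product 210000
      -- d′ is written as 2800 · 75 d′ in order to meet 75 L d′ ≤ k.
      N# : ℕ
      N# = 2800 * 75 * d′
      N#≡ : N# ≡ 2800 * 75 * d′
      N#≡ = refl
      instance
        N#≢0 : NonZero N#
        N#≢0 = m*n≢0 (2800 * 75) d′

      -- The number of halvings: the guaranteed number of open slots in units of 70 d′, and 0 if the
      -- losses exceed a₀² + a₁².
      gain : ℕ → ℕ → ℕ
      gain a₀ a₁ = (1500 * (a₀ * a₀ + a₁ * a₁) ∸ (1500 * (((k ∸ a₀) ⊓ T) * (k ∸ a₀) + ((k ∸ a₁) ⊓ T) * (k ∸ a₁)) + (k * k + 2 * 1500 * k))) / N#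

      gain≡ : ∀ a₀ a₁ → gain a₀ a₁ ≡ (1500 * (a₀ * a₀ + a₁ * a₁) ∸ (1500 * (((k ∸ a₀) ⊓ T) * (k ∸ a₀) + ((k ∸ a₁) ⊓ T) * (k ∸ a₁)) + (k * k + 2 * 1500 * k))) / N#
      gain≡ _ _ = refl

    M : ℕ → ℕ → ℕ
    M a₀ a₁ = d′ * 70 * gain a₀ a₁

    abstract
      open-h-with : ∀ c .{{_ : NonZero c}} → (∀ a → 2 * c * W a ≤ β * (2 * c * (((k ∸ a) ⊓ T) * (k ∸ a)) + k * k)) → ∀ N .{{_ : NonZero N}} → 2 * c * (d′ * 70) ≡ N →
        ∀ a₀ a₁ g → g ≡ (c * (a₀ * a₀ + a₁ * a₁) ∸ (c * (((k ∸ a₀) ⊓ T) * (k ∸ a₀) + ((k ∸ a₁) ⊓ T) * (k ∸ a₁)) + (k * k + 2 * c * k))) / N → a₀ ≤ k → a₁ ≤ k →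
        d′ * 70 * g ≡ 0 ⊎ β * (a₀ + a₁ + 2 * (d′ * 70 * g)) + (W a₀ + W a₁) ≤ β * (a₀ * a₀ + a₁ * a₁)
      open-h-with c wbc N N≡ a₀ a₁ g g≡ p₀ p₁ = [ (λ e → inj₁ (trans (cong (d′ * 70 *_) (trans g≡ e)) (*-zeroʳ (d′ * 70)))) , (λ le → inj₂
          (open-ineq c β (W a₀) (W a₁) (((k ∸ a₀) ⊓ T) * (k ∸ a₀)) (((k ∸ a₁) ⊓ T) * (k ∸ a₁)) (a₀ * a₀ + a₁ * a₁) (a₀ + a₁) (d′ * 70 * g) k
          (wbc a₀) (wbc a₁) (≤-trans (+-mono-≤ p₀ p₁) (≤-reflexive (cong (k +_) (sym (+-identityʳ k)))))
          (≤-trans (+-monoˡ-≤ (c * (((k ∸ a₀) ⊓ T) * (k ∸ a₀) + ((k ∸ a₁) ⊓ T) * (k ∸ a₁)) + (k * k + 2 * c * k)) (≤-reflexive (trans (sym (*-assoc (2 * c) (d′ * 70) g)) (cong₂ _*_ N≡ g≡)))) le))) ]′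
        (round-down (c * (a₀ * a₀ + a₁ * a₁)) (c * (((k ∸ a₀) ⊓ T) * (k ∸ a₀) + ((k ∸ a₁) ⊓ T) * (k ∸ a₁)) + (k * k + 2 * c * k)) N)

      wb-at : ∀ c → 1 ≤ c → 10 * (2 * c) * 4 ≤ 1000000000000 → 80 * (2 * c) ≤ 1000000000000 → 20 * (2 * c) * (2 * 12) ≤ 1000000000000 → 20 * (2 * c) * (25 * 25) * 5 ≤ 1000000000000 →
        20 * (2 * c) * 5776 ≤ 1000000000000 → 10 * (2 * c) ≤ 1000000000000 → ∀ a → 2 * c * W a ≤ β * (2 * c * (((k ∸ a) ⊓ T) * (k ∸ a)) + k * k)
      wb-at c 1≤c l₁ l₂ l₃ l₅ l₆ l₄ a = wb-with (2 * c) (≤-trans 1≤c (m≤n*m c 2)) l₁ l₂ l₃ l₅ l₆ l₄ (k ∸ a) (m∸n≤m k a)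

      wb : ∀ a → 2 * 1500 * W a ≤ β * (2 * 1500 * (((k ∸ a) ⊓ T) * (k ∸ a)) + k * k)
      wb = wb-at 1500 (s≤s z≤n) (≤ᵇ⇒≤ (10 * (2 * 1500) * 4) 1000000000000 tt) (≤ᵇ⇒≤ (80 * (2 * 1500)) 1000000000000 tt) (≤ᵇ⇒≤ (20 * (2 * 1500) * (2 * 12)) 1000000000000 tt)
        (≤ᵇ⇒≤ (20 * (2 * 1500) * (25 * 25) * 5) 1000000000000 tt) (≤ᵇ⇒≤ (20 * (2 * 1500) * 5776) 1000000000000 tt) (≤ᵇ⇒≤ (10 * (2 * 1500)) 1000000000000 tt)

      step≡ : 2 * 1500 * (d′ * 70) ≡ N#
      step≡ = trans (regroup (2 * 1500) 70 (2800 * 75) d′ refl) (sym N#≡)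
        where
        w : ∀ a b d → a * (d * b) ≡ a * b * d
        w = solve-∀
        regroup : ∀ a b c d → a * b ≡ c → a * (d * b) ≡ c * d
        regroup a b c d e = trans (w a b d) (cong (_* d) e)

      open-h : ∀ a₀ a₁ → a₀ ≤ k → a₁ ≤ k → M a₀ a₁ ≡ 0 ⊎ β * (a₀ + a₁ + 2 * M a₀ a₁) + (W a₀ + W a₁) ≤ β * (a₀ * a₀ + a₁ * a₁)
      open-h a₀ a₁ = open-h-with 1500 wb N# step≡ a₀ a₁ (gain a₀ a₁) (gain≡ a₀ a₁)

      budget-with : ∀ c e N .{{_ : NonZero N}} → N ≡ e * d′ → ∀ A G g → g ≡ (c * A ∸ (c * G + (k * k + 2 * c * k))) / N →
        c * A ≤ c * G + (k * k + 2 * c * k) + e * (d′ * suc g)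
      budget-with c e N N≡ A G g g≡ = ≤-trans (round-up (c * A) (c * G + (k * k + 2 * c * k)) N)
        (+-monoʳ-≤ (c * G + (k * k + 2 * c * k)) (≤-reflexive (trans (cong₂ (λ u v → u * suc v) N≡ (sym g≡)) (*-assoc e d′ (suc g)))))

      budget : ∀ a₀ a₁ → 1500 * (a₀ * a₀ + a₁ * a₁) ≤ 1500 * (((k ∸ a₀) ⊓ T) * (k ∸ a₀) + ((k ∸ a₁) ⊓ T) * (k ∸ a₁)) + (k * k + 2 * 1500 * k) + 2800 * 75 * (d′ * suc (gain a₀ a₁))
      budget a₀ a₁ = budget-with 1500 (2800 * 75) N# N#≡ (a₀ * a₀ + a₁ * a₁) (((k ∸ a₀) ⊓ T) * (k ∸ a₀) + ((k ∸ a₁) ⊓ T) * (k ∸ a₁)) (gain a₀ a₁) (gain≡ a₀ a₁)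

      power-gain : ∀ q → d₁ ^ (d′ * 70 * q) * 2 ^ q ≤ suc d₁ ^ (d′ * 70 * q)
      power-gain q = begin
        d₁ ^ (d′ * 70 * q) * 2 ^ q      ≡⟨ trans (cong (_* 2 ^ q) (sym (^-*-assoc d₁ (d′ * 70) q))) (sym (^-distribʳ-* (d₁ ^ (d′ * 70)) 2 q)) ⟩
        (d₁ ^ (d′ * 70) * 2) ^ q        ≤⟨ ^-monoˡ-≤ q (half-life d₁ d′ {{d₁≢0}} (≤-trans (n≤1+n d₁) (≤-reflexive (trans 1+d₁≡d d≡)))) ⟩
        (suc d₁ ^ (d′ * 70)) ^ q        ≡⟨ ^-*-assoc (suc d₁) (d′ * 70) q ⟩
        suc d₁ ^ (d′ * 70 * q) ∎

      gain-cases : ∀ a₀ a₁ → a₀ ≤ k → a₁ ≤ k →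
        (∃ λ v → k ∸ a₀ + (k ∸ a₁) + v ≡ k × L * v + k * σ ≤ gain a₀ a₁) ⊎ (∃ λ w → k + w ≡ k ∸ a₀ + (k ∸ a₁) × k * σ ≤ gain a₀ a₁ + y * w)
      gain-cases a₀ a₁ p₀ p₁ = rate k L d′ (gain a₀ a₁) σ ψ y T a₀ a₁ (k ∸ a₀) (k ∸ a₁) hσ hψ L≡ h50 lower 75Ld′≤k hT (m+[n∸m]≡n p₀) (m+[n∸m]≡n p₁) (budget a₀ a₁)

      -- A surplus of D^v sets is bounded from above through D < 2^L, a deficit D^(-w) through D ≥
      -- 2^y.
      count-gain-with : ∀ a₀ a₁ g → a₀ ≤ k → a₁ ≤ k →
        (∃ λ v → k ∸ a₀ + (k ∸ a₁) + v ≡ k × L * v + k * σ ≤ g) ⊎ (∃ λ w → k + w ≡ k ∸ a₀ + (k ∸ a₁) × k * σ ≤ g + y * w) →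
        2 ^ (k * σ) * D ^ (a₀ + a₁) ≤ D ^ k * 2 ^ g
      count-gain-with a₀ a₁ g p₀ p₁ (inj₁ (v , e , le)) = begin
          2 ^ (k * σ) * D ^ (a₀ + a₁)          ≡⟨ cong (λ z → 2 ^ (k * σ) * D ^ z) a≡ ⟩
          2 ^ (k * σ) * D ^ (k + v)            ≡⟨ cong (2 ^ (k * σ) *_) (^-distribˡ-+-* D k v) ⟩
          2 ^ (k * σ) * (D ^ k * D ^ v)        ≤⟨ *-monoʳ-≤ (2 ^ (k * σ)) (*-monoʳ-≤ (D ^ k) (≤-trans (^-monoˡ-≤ v (<⇒≤ D<2^L)) (≤-reflexive (^-*-assoc 2 L v)))) ⟩
          2 ^ (k * σ) * (D ^ k * 2 ^ (L * v))  ≡⟨ w (2 ^ (k * σ)) (D ^ k) (2 ^ (L * v)) ⟩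
          D ^ k * (2 ^ (L * v) * 2 ^ (k * σ))  ≡⟨ cong (D ^ k *_) (^-distribˡ-+-* 2 (L * v) (k * σ)) ⟨
          D ^ k * 2 ^ (L * v + k * σ)          ≤⟨ *-monoʳ-≤ (D ^ k) (^-monoʳ-≤ 2 le) ⟩
          D ^ k * 2 ^ g ∎
          where
          w : ∀ a b c → a * (b * c) ≡ b * (c * a)
          w = solve-∀
          w′ : ∀ a b u v z → a + b + (u + v + z) ≡ (a + u) + ((b + v) + z)
          w′ = solve-∀
          a≡ : a₀ + a₁ ≡ k + v
          a≡ = +-cancelʳ-≡ k _ _ (trans (cong (a₀ + a₁ +_) (sym e)) (trans (w′ a₀ a₁ (k ∸ a₀) (k ∸ a₁) v) (trans (cong₂ (λ s t → s + (t + v)) (m+[n∸m]≡n p₀) (m+[n∸m]≡n p₁)) (trans (cong (k +_) (+-comm k v)) (sym (+-assoc k v k))))))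
      count-gain-with a₀ a₁ g p₀ p₁ (inj₂ (z , e , le)) = begin
          2 ^ (k * σ) * D ^ (a₀ + a₁)          ≤⟨ *-monoˡ-≤ (D ^ (a₀ + a₁)) (≤-trans (^-monoʳ-≤ 2 le) (≤-reflexive (^-distribˡ-+-* 2 (g) (y * z)))) ⟩
          2 ^ g * 2 ^ (y * z) * D ^ (a₀ + a₁) ≤⟨ *-monoˡ-≤ (D ^ (a₀ + a₁)) (*-monoʳ-≤ (2 ^ g) (≤-trans (≤-reflexive (sym (^-*-assoc 2 y z))) (^-monoˡ-≤ z 2^y≤D))) ⟩
          2 ^ g * D ^ z * D ^ (a₀ + a₁) ≡⟨ w (2 ^ g) (D ^ z) (D ^ (a₀ + a₁)) ⟩
          D ^ (a₀ + a₁) * D ^ z * 2 ^ g ≡⟨ cong (_* 2 ^ g) (trans (sym (^-distribˡ-+-* D (a₀ + a₁) z)) (cong (D ^_) a≡)) ⟩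
          D ^ k * 2 ^ g ∎
          where
          w : ∀ a b c → a * b * c ≡ c * b * a
          w = solve-∀
          w′ : ∀ a b z k → a + b + z + k ≡ a + b + (k + z)
          w′ = solve-∀
          w″ : ∀ a b u v → a + b + (u + v) ≡ (a + u) + (b + v)
          w″ = solve-∀
          a≡ : a₀ + a₁ + z ≡ k
          a≡ = +-cancelʳ-≡ k _ _ (trans (w′ a₀ a₁ z k) (trans (cong (a₀ + a₁ +_) e) (trans (w″ a₀ a₁ (k ∸ a₀) (k ∸ a₁)) (cong₂ _+_ (m+[n∸m]≡n p₀) (m+[n∸m]≡n p₁)))))

      count-gain : ∀ a₀ a₁ → a₀ ≤ k → a₁ ≤ k → 2 ^ (k * σ) * D ^ (a₀ + a₁) ≤ D ^ k * 2 ^ gain a₀ a₁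
      count-gain a₀ a₁ p₀ p₁ = count-gain-with a₀ a₁ (gain a₀ a₁) p₀ p₁ (gain-cases a₀ a₁ p₀ p₁)

      final-h : ∀ a₀ a₁ → a₀ ≤ k → a₁ ≤ k → let Jf = suc (2 * (k * k) * (2 * k)) in
        16 * (suc k * suc k) * (4 * (suc k * suc k) * ((512 * r) ^ k * D ^ (a₀ + a₁)) * (Jf * (Jf * (8 ^ c₀ * d₁ ^ M a₀ a₁)))) ≤ D ^ k * suc d₁ ^ M a₀ a₁
      final-h a₀ a₁ p₀ p₁ = final-ineq (suc k * suc k) ((512 * r) ^ k) (D ^ (a₀ + a₁)) (suc (2 * (k * k) * (2 * k))) (8 ^ c₀) (d₁ ^ M a₀ a₁) (D ^ k) (suc d₁ ^ M a₀ a₁) (k * σ) (gain a₀ a₁)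
        (power-gain (gain a₀ a₁)) consts≤ (count-gain a₀ a₁ p₀ p₁)

    n : ℕ
    n = r * m

    n≢0 : NonZero n
    n≢0 = m*n≢0 r m

    abstract
      placed : Placed k r D ρ m
      placed = subst (λ z → Placed k r D z m) (sym ρ≡) (Placement.placement k r D s D₁ m (r * m) m≡ refl (trans m≡ m≡10D₁) r≡ 8m≤2^s)

    b : Fin 2 → Fin n → Fin m
    b = proj₁ placed

    abstract
      m≤170 : m ≤ 170 * suc d₁ * suc s₂
      m≤170 = subst (λ z → m ≤ 170 * z * suc s₂) (sym 1+d₁≡d) m≤170ds′

    count-bound : ℕ → ℕ → ℕ
    count-bound a₀ a₁ = 4 * (suc k * suc k) * ((512 * r) ^ k * D ^ (a₀ + a₁))

    good = Existence.good {m} {n} b (fromℕ< (>-nonZero⁻¹ n {{n≢0}})) k ρ 1≤ρ (proj₁ (proj₂ placed))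
      d₁ Dq Dt {{d₁≢0}} d≡4Dq d≡10Dt s₂ m≤170 deg-h c₁ j k²≤c₁Dq sparse-h cd m≤Dq² codeg-h J joint-h t₀ t₁ jj L₁<kt₀ few
      D₃ D₂ c₀ K₃≤ 8D₃≤ 3R≤ D₂≤ M open-h (D ^ k) {{m^n≢0 D k}} count-bound
      (proj₂ (proj₂ placed)) final-h

    abstract
      witness : Witness k
      witness = n , TheGraph.graph b (proj₁ good) , TheGraph.graph-triangleFree b (proj₁ good)
        , TheGraph.graph-independent b (proj₁ good) k (proj₂ good) , n≢0 , L , 2^L≤k , n-bound

  -- Holds at 39, where 4 · 10⁷ ≤ 2^39, and doubling the right side outruns adding a million on the
  -- left.
  linear<exponential : ∀ μ → 39 ≤ μ → 1000000 * suc μ ≤ 2 ^ μ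
  linear<exponential μ le = subst (λ z → 1000000 * suc z ≤ 2 ^ z) (m+[n∸m]≡n le) (go 39 (≤ᵇ⇒≤ (1000000 * 40) (2 ^ 39) tt) (μ ∸ 39))
    where
    go : ∀ a → 1000000 * suc a ≤ 2 ^ a → ∀ e → 1000000 * suc (a + e) ≤ 2 ^ (a + e)
    go a h zero    = subst (λ z → 1000000 * suc z ≤ 2 ^ z) (sym (+-identityʳ a)) h
    go a h (suc e) = subst (λ z → 1000000 * suc z ≤ 2 ^ z) (sym (+-suc a e)) (dbl 1000000 (a + e) (go a h e))
      where
      dbl : ∀ c x → c * suc x ≤ 2 ^ x → c * suc (suc x) ≤ 2 ^ suc x
      dbl c x le = ≤-trans (≤-trans (≤-reflexive (*-suc c (suc x))) (+-monoˡ-≤ (c * suc x) (m≤m*n c (suc x)))) (≤-trans (+-mono-≤ le le) (≤-reflexive (cong (λ z → 2 ^ x + z) (sym (+-identityʳ (2 ^ x))))))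

  -- ℓ = 2^(μ + 1) with 2^μ ≤ L < 2^(μ + 1), so L < ℓ ≤ 2 L. L ≥ 2^39 gives ℓ ≥ 2^40, which exceeds
  -- the 10^12 allowed for numerical constants.
  build : ∀ k L → 2 ^ L ≤ k → k < 2 ^ suc L → 2 ^ 39 ≤ L → Witness k
  build k L lo hi big = go (log₂ L (≤-trans (≤ᵇ⇒≤ 1 (2 ^ 39) tt) big))
    where
    go : (∃ λ μ → 2 ^ μ ≤ L × L < 2 ^ suc μ) → Witness k
    go (μ , 2^μ≤L , L<) = Params.witness k L (2 ^ suc μ) (suc μ) lo hi L< (*-monoʳ-≤ 2 2^μ≤L) refl (≤-trans (linear<exponential μ 39≤μ) 2^μ≤L) (s≤s 39≤μ)
      where
      39≤μ : 39 ≤ μ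
      39≤μ = ≤-pred (2^-cancel-< 39 (suc μ) (≤-<-trans big L<))

  eventually : ∀ a → (∀ k L → 2 ^ L ≤ k → k < 2 ^ suc L → a ≤ L → Witness k) → ∃ λ k₀ → ∀ k → k ≥ k₀ → Witness k
  eventually a f = 2 ^ a , λ k le → let (L , lo , hi) = log₂ k (≤-trans (m^n>0 2 a) le) in
    f k L lo hi (≤-pred (2^-cancel-< a (suc L) (≤-<-trans le hi)))

  abstract
    witnesses : ∃ λ k₀ → ∀ k → k ≥ k₀ → Witness k
    witnesses = eventually (2 ^ 39) build

  p-q≤p : ∀ p q → 0ℚ ℚ.< q → p ℚ.- q ℚ.≤ p
  p-q≤p p q 0<q = ℚP.≤-trans (ℚP.+-monoʳ-≤ p (ℚP.neg-antimono-≤ (ℚP.<⇒≤ 0<q))) (ℚP.≤-reflexive (ℚP.+-identityʳ p))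

  -- ε enters through 1/3 - ε ≤ 1/3 only, because `Witness` already holds a constant above 1/3.
  conclusion : ∀ ε → 0ℚ ℚ.< ε → ∀ k → Witness k → Σ ℕ λ n → Σ (Graph n) λ G → TriangleFree G × ¬ IndependentSetOfSize G k × LowerBoundOverLog (ℤ.+ 1 ℚ./ 3 ℚ.- ε) k n
  conclusion ε 0<ε k (n , G , tf , ind , nz , L , 2^L≤k , n-bound) = n , G , tf , ind , bound (ℚP.≤-total (ℤ.+ 1 ℚ./ 3 ℚ.- ε) 0ℚ)
    where
    bound : (ℤ.+ 1 ℚ./ 3 ℚ.- ε) ℚ.≤ 0ℚ ⊎ 0ℚ ℚ.≤ (ℤ.+ 1 ℚ./ 3 ℚ.- ε) → LowerBoundOverLog (ℤ.+ 1 ℚ./ 3 ℚ.- ε) k n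
    bound (inj₁ c≤0) = inj₁ c≤0
    bound (inj₂ 0≤c) = inj₂ (nz , expLe (ℤ.+ 1 ℚ./ 3 ℚ.- ε) k n L {{nz}} 0≤c (p-q≤p (ℤ.+ 1 ℚ./ 3) ε 0<ε) 2^L≤k n-bound)

open import Defs
open import Data.Nat using (ℕ; _≥_)
open import Data.Integer using (+_)
open import Data.Rational using (ℚ; _/_; _-_; _<_; 0ℚ)
open import Data.Product using (Σ; ∃; _×_)
open import Relation.Nullary using (¬_)
open import Data.Product using (_,_; proj₁; proj₂)
open Assembly using (witnesses; conclusion)

theorem1p1 : ∀ (ε : ℚ) → 0ℚ < ε → ∃ λ (k₀ : ℕ) → ∀ (k : ℕ) → k ≥ k₀ → Σ ℕ λ n → Σ (Graph n) λ G → TriangleFree G × ¬ IndependentSetOfSize G k × LowerBoundOverLog (+ 1 / 3 - ε) k n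
-- The threshold k₀ is the same for every ε.
theorem1p1 ε 0<ε = proj₁ witnesses , λ k k≥k₀ → conclusion ε 0<ε k (proj₂ witnesses k k≥k₀)
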